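{- Let $p$ be a prime and $\mathbb{F}_p$ the field with $p$ elements. For $\boldsymbol{x}=(x_1,x_2),\boldsymbol{y}=(y_1,y_2)\in\mathbb{F}_p^2$ let $\|\boldsymbol{x}-\boldsymbol{y}\|=(x_1-y_1)^2+(x_2-y_2)^2\in\mathbb{F}_p$. For $E\subseteq\mathbb{F}_p^2\times\mathbb{F}_p^2$ define \[\Delta_{2,2}(E)=\left\{\left(\|x_1-y_1\|,\|x_2-y_2\|\right) : (x_1,x_2),(y_1,y_2)\in E\right\}\subseteq\mathbb{F}_p\times\mathbb{F}_p.\] If $|E|\gg p^{\frac{13}{4}}$, then $|\Delta_{2,2}(E)|\gg p^2$.
   Context: $X\ll Y$ (equivalently $Y\gg X$) means there is a constant $C>0$, independent of $p$ and of the set $E$, with $X\le CY$. Thus the statement means: there are constants $C,c>0$ (independent of $p$ and $E$) such that $|E|\ge Cp^{13/4}$ implies $|\Delta_{2,2}(E)|\ge cp^2$. -}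

module Defs where

open import Data.Nat using (ℕ; _+_; _*_; _∸_; NonZero)
open import Data.Nat.DivMod using (_%_)
open import Data.Fin using (Fin; toℕ; fromℕ<)
import Data.Fin.Properties
open import Data.Nat.DivMod using (m%n<n)
open import Data.Product using (_×_; _,_)
import Data.Product.Properties
open import Data.List using (List; []; _∷_; map; length; filter; cartesianProduct; allFin)
open import Relation.Binary.PropositionalEquality using (_≡_)
open import Relation.Binary.Definitions using (DecidableEquality)
import Data.List.Membership.DecPropositional as DecMem

𝔽 : ℕ → Set
𝔽 p = Fin p

module Field (p : ℕ) .{{_ : NonZero p}} where

  reduce : ℕ → 𝔽 p
  reduce n = fromℕ< (m%n<n n p)

  _+ₚ_ : 𝔽 p → 𝔽 p → 𝔽 p
  a +ₚ b = reduce (toℕ a + toℕ b)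

  _*ₚ_ : 𝔽 p → 𝔽 p → 𝔽 p
  a *ₚ b = reduce (toℕ a * toℕ b)

  _-ₚ_ : 𝔽 p → 𝔽 p → 𝔽 p
  a -ₚ b = reduce (toℕ a + (p ∸ toℕ b))

  Pt : Set
  Pt = 𝔽 p × 𝔽 p

  dist : Pt → Pt → 𝔽 p
  dist (x₁ , x₂) (y₁ , y₂) =
    ((x₁ -ₚ y₁) *ₚ (x₁ -ₚ y₁)) +ₚ ((x₂ -ₚ y₂) *ₚ (x₂ -ₚ y₂))

  Pair : Set
  Pair = Pt × Pt

  decF : DecidableEquality (𝔽 p)
  decF = Data.Fin.Properties._≟_

  decFF : DecidableEquality (𝔽 p × 𝔽 p)
  decFF = Data.Product.Properties.≡-dec decF decF

  Δ-list : List Pair → List (𝔽 p × 𝔽 p)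
  Δ-list E = map (λ { ((x₁ , x₂) , (y₁ , y₂)) → (dist x₁ y₁ , dist x₂ y₂) })
                 (cartesianProduct E E)

  open DecMem decFF using (_∈?_)

  ∣Δ₂₂∣ : List Pair → ℕ
  ∣Δ₂₂∣ E = length (filter (_∈? Δ-list E) (cartesianProduct (allFin p) (allFin p)))

{-# OPTIONS --safe #-}
-- The product problem reduces to the plane: if |E| is a large multiple of p^{13/4}, then many fibres
-- E_v = {w : (v , w) ∈ E} have at least p^{5/4} elements. Their base points determine a positive
-- proportion of all distances, each attained by some v, v′, and E_v, E_v′ then determine a positive
-- proportion of all distances in the second coordinate.
--
-- For X, Y ⊆ F² of size about p^{5/4}, Cauchy–Schwarz bounds the number of distances between X and Y
-- from below by the number of isosceles triangles with apex in X and base in Y. Apexes lie on bisectors,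
-- so a variance bound reduces these triangles to the bisector energy: the number of pairs of point pairs
-- (a , b), (c , d) of Y with a common bisector. A reflection preserves |c - a| = |d - b|, and the frames
-- (a , c), (b , d) of a fixed length are the lines of two families in projective space, two frames being
-- incident if they have a common bisector. If a block of frames had too many incidences, a polynomial of
-- low degree vanishing on the lines of the first family would, after pruning, vanish on both families,
-- and its curvature in the sections Z = const shows that the lines meeting a given one form a regulus.
-- Such frames lie on circles or lines rich in points of Y, and those were counted separately; isotropic
-- directions are removed at the start by passing to half of Y.
module Submission where

import Defs
open import Data.Nat using (ℕ)

-- The exponent comes from closing a loop. Let T count the isosceles triples of Y, let Q be its
-- bisector energy, and put Λ = n²/p². Up to constants, T ≤ n³/p + Q/Λ. A block of N frames against
-- N frames has at most about N^{3/2} incidences, so cutting the frames of each non-zero length into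
-- blocks gives Q ≤ nT/√N + pN^{3/2}, apart from a small term for frames of length zero. The first
-- summand is absorbed into T if n√N ≥ p², the second is harmless if N^{3/2}p² ≤ Λn³. With N = n²/p,
-- the average number of frames of one length, both conditions read n ≥ p^{5/4}; fibres of that size
-- cost a factor p² in |E|, whence 13/4 = 2 + 5/4. The polynomial has degree about √N, that is
-- p^{3/4}, well below p. This margin is what lets arguments with derivatives work in characteristic
-- p, and lets polynomials be compared as functions. Frames have projective coordinates, the
-- polynomial argument needs affine ones. They are sheared by a parameter θ, and averaging over θ
-- finds a shear for which few neighbours of a typical frame get the same affine coordinate.

module PrimeFields where

  open import Data.Nat as ℕ using (ℕ; zero; suc; NonZero; _∸_)
  import Data.Nat.Properties as ℕₚ
  open import Data.Nat.DivMod using (_%_; m%n<n; %-distribˡ-+; %-distribˡ-*; m<n⇒m%n≡m; n%n≡0; m*n%n≡0)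
  open import Data.Nat.Primality using (Prime; prime⇒nonZero)
  open import Data.Nat.Coprimality using (prime⇒coprime; coprime-Bézout)
  open import Data.Nat.GCD using (module Bézout)
  open import Data.Integer as ℤ using (ℤ; -[1+_]; _⊖_)
  import Data.Integer.Properties as ℤₚ
  open import Data.Fin as Fin using (Fin; toℕ)
  open import Data.Fin.Properties using (toℕ-fromℕ<; fromℕ<-cong; toℕ<n; toℕ-injective)
  open import Data.Product using (Σ; _×_; _,_)
  open import Data.Sum using (inj₁; inj₂)
  open import Data.Bool using (Bool; true; false; T)
  open import Data.Maybe using (Maybe; nothing)
  open import Level using (0ℓ)
  open import Relation.Binary.PropositionalEquality
  open import Algebra.Structures using (IsCommutativeRing)
  open import Algebra.Bundles using (CommutativeRing)
  import Algebra.Properties.Ring as RingProperties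
  open import Tactic.RingSolver.Core.AlmostCommutativeRing using (AlmostCommutativeRing; fromCommutativeRing)
  open import Tactic.RingSolver.Core.Polynomial.Parameters using (Homomorphism)
  open import Tactic.RingSolver.Core.Expression using (Expr; module Eval)

  -- All geometry below is done over an arbitrary inhabitant of this record, so the operations are
  -- opaque and never unfold to remainders. `0#` and `1#` are images of integers by definition,
  -- which lets integer constants of the ring solver denote them by `refl`.
  record PrimeField (p : ℕ) : Set where
    infixl 6 _+_
    infixl 7 _*_
    infix  8 -_
    field
      _+_ _*_ : Fin p → Fin p → Fin p
      -_ : Fin p → Fin p
      fromℤ : ℤ → Fin p
      isCommutativeRing : IsCommutativeRing _≡_ _+_ _*_ -_ (fromℤ (ℤ.+ 0)) (fromℤ (ℤ.+ 1))
      inverse : ∀ x → x ≢ fromℤ (ℤ.+ 0) → Σ (Fin p) λ y → x * y ≡ fromℤ (ℤ.+ 1)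
      fromℤ-+ : ∀ i j → fromℤ (i ℤ.+ j) ≡ fromℤ i + fromℤ j
      fromℤ-* : ∀ i j → fromℤ (i ℤ.* j) ≡ fromℤ i * fromℤ j
      fromℤ-neg : ∀ i → fromℤ (ℤ.- i) ≡ - fromℤ i
      characteristic : ∀ n → 0 ℕ.< n → n ℕ.< p → fromℤ (ℤ.+ n) ≢ fromℤ (ℤ.+ 0)

    0# 1# : Fin p
    0# = fromℤ (ℤ.+ 0)
    1# = fromℤ (ℤ.+ 1)

  module IntegerImage {F : Set} (_+_ _*_ : F → F → F) (-_ : F → F) (0# 1# : F)
    (isCR : IsCommutativeRing _≡_ _+_ _*_ -_ 0# 1#)
    (nat : ℕ → F)
    (nat-+ : ∀ m n → nat m + nat n ≡ nat (m ℕ.+ n))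
    (nat-* : ∀ m n → nat m * nat n ≡ nat (m ℕ.* n))
    (nat-0 : nat 0 ≡ 0#) (nat-1 : nat 1 ≡ 1#) where

    ring : CommutativeRing 0ℓ 0ℓ
    ring = record { isCommutativeRing = isCR }

    open CommutativeRing ring using (+-assoc; +-comm; +-identityˡ; +-identityʳ; *-comm; -‿inverseʳ)
    open RingProperties (CommutativeRing.ring ring)
      using (-‿distribˡ-*; -‿distribʳ-*; -‿involutive; -0#≈0#; -‿+-comm)
    open ≡-Reasoning

    ι : ℤ → F
    ι (ℤ.+ n) = nat n
    ι -[1+ n ] = - nat (suc n)

    ι-neg : ∀ i → ι (ℤ.- i) ≡ (- ι i)
    ι-neg (ℤ.+ zero) = trans nat-0 (trans (sym -0#≈0#) (cong -_ (sym nat-0)))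
    ι-neg (ℤ.+ suc n) = refl
    ι-neg -[1+ n ] = sym (-‿involutive (nat (suc n)))

    cancelʳ : ∀ x y → ((x + y) + (- y)) ≡ x
    cancelʳ x y = trans (+-assoc x y (- y)) (trans (cong (x +_) (-‿inverseʳ y)) (+-identityʳ x))

    ι-⊖ : ∀ m n → ι (m ⊖ n) ≡ (nat m + (- nat n))
    ι-⊖ m n with ℕₚ.≤-total n m
    ... | inj₁ n≤m = begin
      ι (m ⊖ n)                             ≡⟨ cong ι (ℤₚ.⊖-≥ n≤m) ⟩
      nat (m ∸ n)                           ≡⟨ cancelʳ _ _ ⟨
      ((nat (m ∸ n) + nat n) + (- nat n))   ≡⟨ cong (_+ (- nat n)) (nat-+ (m ∸ n) n) ⟩
      (nat (m ∸ n ℕ.+ n) + (- nat n))       ≡⟨ cong (λ k → nat k + (- nat n)) (ℕₚ.m∸n+n≡m n≤m) ⟩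
      (nat m + (- nat n))                   ∎
    ... | inj₂ m≤n = begin
      ι (m ⊖ n)                             ≡⟨ cong ι (ℤₚ.⊖-≤ m≤n) ⟩
      ι (ℤ.- (ℤ.+ (n ∸ m)))                 ≡⟨ ι-neg (ℤ.+ (n ∸ m)) ⟩
      (- nat (n ∸ m))                       ≡⟨ cancelʳ _ _ ⟨
      (((- nat (n ∸ m)) + nat m) + (- nat m)) ≡⟨ cong (_+ (- nat m)) (+-comm _ _) ⟩
      ((nat m + (- nat (n ∸ m))) + (- nat m)) ≡⟨ +-assoc _ _ _ ⟩
      (nat m + ((- nat (n ∸ m)) + (- nat m))) ≡⟨ cong (nat m +_) (-‿+-comm _ _) ⟩
      (nat m + (- (nat (n ∸ m) + nat m)))   ≡⟨ cong (λ k → nat m + (- k)) (nat-+ (n ∸ m) m) ⟩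
      (nat m + (- nat (n ∸ m ℕ.+ m)))       ≡⟨ cong (λ k → nat m + (- nat k)) (ℕₚ.m∸n+n≡m m≤n) ⟩
      (nat m + (- nat n))                   ∎

    ι-+ : ∀ i j → ι (i ℤ.+ j) ≡ (ι i + ι j)
    ι-+ (ℤ.+ m) (ℤ.+ n) = sym (nat-+ m n)
    ι-+ (ℤ.+ m) -[1+ n ] = ι-⊖ m (suc n)
    ι-+ -[1+ m ] (ℤ.+ n) = trans (ι-⊖ n (suc m)) (+-comm _ _)
    ι-+ -[1+ m ] -[1+ n ] = trans (cong (λ k → - nat (suc k)) (sym (ℕₚ.+-suc m n)))
      (trans (cong -_ (sym (nat-+ (suc m) (suc n)))) (sym (-‿+-comm _ _)))

    ι-* : ∀ i j → ι (i ℤ.* j) ≡ (ι i * ι j)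
    ι-* (ℤ.+ m) (ℤ.+ n) = trans (cong ι (sym (ℤₚ.pos-* m n))) (sym (nat-* m n))
    ι-* (ℤ.+ m) -[1+ n ] = trans (cong ι (sym (ℤₚ.neg-distribʳ-* (ℤ.+ m) (ℤ.+ suc n))))
      (trans (ι-neg (ℤ.+ m ℤ.* ℤ.+ suc n)) (trans (cong -_ (ι-* (ℤ.+ m) (ℤ.+ suc n))) (-‿distribʳ-* _ _)))
    ι-* -[1+ m ] (ℤ.+ n) = trans (cong ι (sym (ℤₚ.neg-distribˡ-* (ℤ.+ suc m) (ℤ.+ n))))
      (trans (ι-neg (ℤ.+ suc m ℤ.* ℤ.+ n)) (trans (cong -_ (ι-* (ℤ.+ suc m) (ℤ.+ n))) (-‿distribˡ-* _ _)))
    ι-* -[1+ m ] -[1+ n ] = trans (sym (nat-* (suc m) (suc n)))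
      (trans (sym (-‿involutive _)) (trans (cong -_ (-‿distribˡ-* (nat (suc m)) (nat (suc n)))) (-‿distribʳ-* _ _)))

    -- Bézout's identity n x ± 1 = k q with q = 0 in F gives the inverse of x.
    bézout-inverse : ∀ {q n} → Bézout.Identity 1 q n → (∀ k → nat (k ℕ.* q) ≡ 0#) → Σ F λ y → (nat n * y) ≡ 1#
    bézout-inverse {q} {n} (Bézout.+- a b eq) kq = (- nat b) , (begin
      (nat n * (- nat b))               ≡⟨ -‿distribʳ-* _ _ ⟨
      (- (nat n * nat b))               ≡⟨ cong -_ (trans (*-comm _ _) (nat-* b n)) ⟩
      (- nat (b ℕ.* n))                 ≡⟨ +-identityˡ _ ⟨
      (0# + (- nat (b ℕ.* n)))          ≡⟨ cong (_+ (- nat (b ℕ.* n))) (trans (sym (kq a)) (trans (cong nat (sym eq)) (sym (nat-+ 1 (b ℕ.* n))))) ⟩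
      ((nat 1 + nat (b ℕ.* n)) + (- nat (b ℕ.* n))) ≡⟨ cancelʳ _ _ ⟩
      nat 1                             ≡⟨ nat-1 ⟩
      1#                                ∎)
    bézout-inverse {q} {n} (Bézout.-+ a b eq) kq = nat b , (begin
      (nat n * nat b)                   ≡⟨ trans (*-comm _ _) (nat-* b n) ⟩
      nat (b ℕ.* n)                     ≡⟨ trans (cong nat (sym eq)) (sym (nat-+ 1 (a ℕ.* q))) ⟩
      (nat 1 + nat (a ℕ.* q))           ≡⟨ cong₂ _+_ nat-1 (kq a) ⟩
      (1# + 0#)                         ≡⟨ +-identityʳ _ ⟩
      1#                                ∎)

  module Construction (p : ℕ) (pr : Prime p) where
    instance
      p≢0 : NonZero p
      p≢0 = prime⇒nonZero pr

    open Defs.Field p {{p≢0}} public using (reduce; _+ₚ_; _*ₚ_; _-ₚ_)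

    reduce-cong : ∀ {m n} → m % p ≡ n % p → reduce m ≡ reduce n
    reduce-cong {m} {n} eq = fromℕ<-cong _ _ eq (m%n<n m p) (m%n<n n p)

    toℕ-reduce : ∀ n → toℕ (reduce n) ≡ n % p
    toℕ-reduce n = toℕ-fromℕ< (m%n<n n p)

    reduce-toℕ : ∀ x → reduce (toℕ x) ≡ x
    reduce-toℕ x = toℕ-injective (trans (toℕ-reduce (toℕ x)) (m<n⇒m%n≡m (toℕ<n x)))

    reduce-+ : ∀ m n → reduce m +ₚ reduce n ≡ reduce (m ℕ.+ n)
    reduce-+ m n = reduce-cong (trans (cong₂ (λ a b → (a ℕ.+ b) % p) (toℕ-reduce m) (toℕ-reduce n)) (sym (%-distribˡ-+ m n p)))

    reduce-* : ∀ m n → reduce m *ₚ reduce n ≡ reduce (m ℕ.* n)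
    reduce-* m n = reduce-cong (trans (cong₂ (λ a b → (a ℕ.* b) % p) (toℕ-reduce m) (toℕ-reduce n)) (sym (%-distribˡ-* m n p)))

    neg : Fin p → Fin p
    neg x = reduce (p ∸ toℕ x)

    reduce-surj : ∀ x → Σ ℕ λ n → reduce n ≡ x
    reduce-surj x = toℕ x , reduce-toℕ x

    reduce-p : reduce p ≡ reduce 0
    reduce-p = reduce-cong (trans (n%n≡0 p) (sym (m<n⇒m%n≡m (ℕₚ.≤-<-trans ℕ.z≤n (ℕ.>-nonZero⁻¹ p)))))

    +-assoc : ∀ x y z → (x +ₚ y) +ₚ z ≡ x +ₚ (y +ₚ z)
    +-assoc x y z with reduce-surj x | reduce-surj y | reduce-surj z
    ... | a , refl | b , refl | c , refl
      rewrite reduce-+ a b | reduce-+ b c | reduce-+ (a ℕ.+ b) c | reduce-+ a (b ℕ.+ c) = cong reduce (ℕₚ.+-assoc a b c)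

    *-assoc : ∀ x y z → (x *ₚ y) *ₚ z ≡ x *ₚ (y *ₚ z)
    *-assoc x y z with reduce-surj x | reduce-surj y | reduce-surj z
    ... | a , refl | b , refl | c , refl
      rewrite reduce-* a b | reduce-* b c | reduce-* (a ℕ.* b) c | reduce-* a (b ℕ.* c) = cong reduce (ℕₚ.*-assoc a b c)

    +-comm : ∀ x y → x +ₚ y ≡ y +ₚ x
    +-comm x y = cong reduce (ℕₚ.+-comm (toℕ x) (toℕ y))

    *-comm : ∀ x y → x *ₚ y ≡ y *ₚ x
    *-comm x y = cong reduce (ℕₚ.*-comm (toℕ x) (toℕ y))

    distribˡ : ∀ x y z → x *ₚ (y +ₚ z) ≡ (x *ₚ y) +ₚ (x *ₚ z)
    distribˡ x y z with reduce-surj x | reduce-surj y | reduce-surj z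
    ... | a , refl | b , refl | c , refl
      rewrite reduce-+ b c | reduce-* a (b ℕ.+ c) | reduce-* a b | reduce-* a c | reduce-+ (a ℕ.* b) (a ℕ.* c) = cong reduce (ℕₚ.*-distribˡ-+ a b c)

    distribʳ : ∀ x y z → (y +ₚ z) *ₚ x ≡ (y *ₚ x) +ₚ (z *ₚ x)
    distribʳ x y z = trans (*-comm (y +ₚ z) x) (trans (distribˡ x y z) (cong₂ _+ₚ_ (*-comm x y) (*-comm x z)))

    +-identityˡ : ∀ x → reduce 0 +ₚ x ≡ x
    +-identityˡ x with reduce-surj x
    ... | a , refl = reduce-+ 0 a

    *-identityˡ : ∀ x → reduce 1 *ₚ x ≡ x
    *-identityˡ x with reduce-surj x
    ... | a , refl = trans (reduce-* 1 a) (cong reduce (ℕₚ.*-identityˡ a))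

    neg-inverseʳ : ∀ x → x +ₚ neg x ≡ reduce 0
    neg-inverseʳ x = trans (cong (_+ₚ neg x) (sym (reduce-toℕ x)))
      (trans (reduce-+ (toℕ x) (p ∸ toℕ x)) (trans (cong reduce (ℕₚ.m+[n∸m]≡n (ℕₚ.<⇒≤ (toℕ<n x)))) reduce-p))

    isCR : IsCommutativeRing _≡_ _+ₚ_ _*ₚ_ neg (reduce 0) (reduce 1)
    isCR = record
      { isRing = record
        { +-isAbelianGroup = record
          { isGroup = record
            { isMonoid = record
              { isSemigroup = record
                { isMagma = record { isEquivalence = isEquivalence ; ∙-cong = cong₂ _+ₚ_ }
                ; assoc = +-assoc }
              ; identity = +-identityˡ , λ x → trans (+-comm x _) (+-identityˡ x) }
            ; inverse = (λ x → trans (+-comm (neg x) x) (neg-inverseʳ x)) , neg-inverseʳ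
            ; ⁻¹-cong = cong neg }
          ; comm = +-comm }
        ; *-cong = cong₂ _*ₚ_
        ; *-assoc = *-assoc
        ; *-identity = *-identityˡ , λ x → trans (*-comm x _) (*-identityˡ x)
        ; distrib = distribˡ , distribʳ }
      ; *-comm = *-comm }

    open IntegerImage _+ₚ_ _*ₚ_ neg (reduce 0) (reduce 1) isCR reduce reduce-+ reduce-* refl refl

    reduce≢0 : ∀ n → 0 ℕ.< n → n ℕ.< p → reduce n ≢ reduce 0
    reduce≢0 n 0<n n<p eq = ℕₚ.<⇒≢ 0<n (sym (trans (sym (m<n⇒m%n≡m n<p)) (trans (sym (toℕ-reduce n))
      (trans (cong toℕ eq) (trans (toℕ-reduce 0) (m<n⇒m%n≡m (ℕₚ.<-trans 0<n n<p)))))))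

    inv : ∀ x → x ≢ reduce 0 → Σ (Fin p) λ y → x *ₚ y ≡ reduce 1
    inv x x≢0 with bézout-inverse (coprime-Bézout (prime⇒coprime pr {{ℕ.≢-nonZero tx≢0}} (toℕ<n x))) multiple
      where
      tx≢0 : toℕ x ≢ 0
      tx≢0 eq = x≢0 (trans (sym (reduce-toℕ x)) (cong reduce eq))
      multiple : ∀ k → reduce (k ℕ.* p) ≡ reduce 0
      multiple k = reduce-cong (trans (m*n%n≡0 k p) (sym (m<n⇒m%n≡m (ℕ.>-nonZero⁻¹ p))))
    ... | y , eq = y , trans (cong (_*ₚ y) (sym (reduce-toℕ x))) eq

    primeField : PrimeField p
    primeField = record
      { _+_ = _+ₚ_ ; _*_ = _*ₚ_ ; -_ = neg
      ; fromℤ = ι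
      ; isCommutativeRing = isCR
      ; inverse = inv
      ; fromℤ-+ = ι-+ ; fromℤ-* = ι-* ; fromℤ-neg = ι-neg
      ; characteristic = reduce≢0 }

  module FieldTheory {p : ℕ} (K : PrimeField p) where
    open PrimeField K public

    F : Set
    F = Fin p

    commutativeRing : CommutativeRing 0ℓ 0ℓ
    commutativeRing = record { isCommutativeRing = isCommutativeRing }

    open CommutativeRing commutativeRing public
      using (+-assoc; +-comm; +-identityˡ; +-identityʳ; *-assoc; *-comm; *-identityˡ; *-identityʳ; distribˡ; distribʳ; zeroˡ; zeroʳ; -‿inverseˡ; -‿inverseʳ)

    infixl 6 _-_
    _-_ : F → F → F
    x - y = x + - y

    -- Identities are normalised with coefficients in `ℤ`, where numerals compute and cancellation
    -- is decided, and are then transported along `fromℤ`. The operations of `F` itself do not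
    -- compute, so they could not serve as coefficients.
    module Solver where
      acr : AlmostCommutativeRing 0ℓ 0ℓ
      acr = fromCommutativeRing commutativeRing (λ _ → nothing)

      isZero : ℤ → Bool
      isZero (ℤ.+ zero) = true
      isZero _ = false

      zero-homo : ∀ i → T (isZero i) → 0# ≡ fromℤ i
      zero-homo (ℤ.+ zero) _ = refl

      homo : Homomorphism 0ℓ 0ℓ 0ℓ 0ℓ
      homo = record
        { from = record { rawRing = CommutativeRing.rawRing ℤₚ.+-*-commutativeRing ; isZero = isZero }
        ; to = acr
        ; morphism = record
          { ⟦_⟧ = fromℤ ; +-homo = fromℤ-+ ; *-homo = fromℤ-* ; -‿homo = fromℤ-neg
          ; 0-homo = refl ; 1-homo = refl }
        ; Zero-C⟶Zero-R = zero-homo }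

      open import Tactic.RingSolver.Core.Polynomial.Base (Homomorphism.from homo)
      open import Tactic.RingSolver.Core.Polynomial.Semantics homo renaming (⟦_⟧ to ⟦_⟧ₚ)
      import Tactic.RingSolver.Core.Polynomial.Homomorphism homo as H
      open import Data.Vec using (Vec)
      open Eval (AlmostCommutativeRing.rawRing acr) fromℤ public
      open Expr public
      open import Algebra.Properties.Semiring.Exp.TCOptimised (AlmostCommutativeRing.semiring acr) using (^-congˡ)

      norm : ∀ {n} → Expr ℤ n → Poly n
      norm (Κ x)   = κ x
      norm (Ι x)   = ι x
      norm (x ⊕ y) = norm x ⊞ norm y
      norm (x ⊗ y) = norm x ⊠ norm y
      norm (⊝ x)   = ⊟ norm x
      norm (x ⊛ i) = norm x ⊡ i

      ⟦_⇓⟧ : ∀ {n} → Expr ℤ n → Vec F n → F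
      ⟦ e ⇓⟧ = ⟦ norm e ⟧ₚ

      correct : ∀ {n} (e : Expr ℤ n) ρ → ⟦ e ⇓⟧ ρ ≡ ⟦ e ⟧ ρ
      correct (Κ x) ρ = H.κ-hom x ρ
      correct (Ι x) ρ = H.ι-hom x ρ
      correct (x ⊕ y) ρ = trans (H.⊞-hom (norm x) (norm y) ρ) (cong₂ _+_ (correct x ρ) (correct y ρ))
      correct (x ⊗ y) ρ = trans (H.⊠-hom (norm x) (norm y) ρ) (cong₂ _*_ (correct x ρ) (correct y ρ))
      correct (⊝ x) ρ = trans (H.⊟-hom (norm x) ρ) (cong -_ (correct x ρ))
      correct (x ⊛ i) ρ = trans (H.⊡-hom (norm x) i ρ) (^-congˡ i (correct x ρ))

      open import Relation.Binary.Reflection (setoid F) Ι ⟦_⟧ ⟦_⇓⟧ correct public using (solve)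

      infixl 6 _:+_ _:-_
      infixl 7 _:*_
      infix 4 _:=_
      infix 8 :-_
      _:+_ _:*_ _:-_ : ∀ {n} → Expr ℤ n → Expr ℤ n → Expr ℤ n
      _:+_ = _⊕_
      _:*_ = _⊗_
      x :- y = x ⊕ (⊝ y)
      :-_ : ∀ {n} → Expr ℤ n → Expr ℤ n
      :-_ = ⊝_
      _:=_ : ∀ {n} → Expr ℤ n → Expr ℤ n → Expr ℤ n × Expr ℤ n
      _:=_ = _,_
      con : ∀ {n} → ℤ → Expr ℤ n
      con = Κ

open PrimeFields using (PrimeField; module PrimeField; module Construction; module FieldTheory)

-- Finite sums of natural numbers, indicators and double counting.

module FiniteSums where

  open import Level using (0ℓ)
  open import Data.Nat
  open import Data.Nat.Properties
  open import Data.Nat.Tactic.RingSolver using (solve-∀)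
  open import Data.Product using (Σ; _×_; _,_)
  open import Data.Sum using (inj₁; inj₂)
  open import Data.Empty using (⊥-elim)
  open import Data.Bool using (if_then_else_)
  open import Data.List using (List; []; _∷_; _++_; map; length; filter; cartesianProduct; take; drop)
  open import Data.List.Membership.Propositional using (_∈_)
  open import Data.List.Relation.Unary.Any using (here; there)
  open import Data.List.Relation.Unary.All as All using (All; []; _∷_)
  open import Data.List.Relation.Unary.Unique.Propositional using (Unique; []; _∷_)
  open import Function using (_∘_)
  open import Relation.Binary.Definitions using (DecidableEquality)
  open import Relation.Nullary using (Dec; yes; no; ¬_; does; _×-dec_; contradiction)
  open import Relation.Unary using (Pred; Decidable)
  open import Relation.Binary.PropositionalEquality

  private variable
    A B : Set
    P Q : Set

  ∑ : List A → (A → ℕ) → ℕ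
  ∑ [] f = 0
  ∑ (x ∷ xs) f = f x + ∑ xs f

  𝟙 : Dec P → ℕ
  𝟙 d = if does d then 1 else 0

  𝟙-yes : (d : Dec P) → P → 𝟙 d ≡ 1
  𝟙-yes (yes _) _ = refl
  𝟙-yes (no ¬p) p = ⊥-elim (¬p p)

  𝟙≤1 : (d : Dec P) → 𝟙 d ≤ 1
  𝟙≤1 (yes _) = ≤-refl
  𝟙≤1 (no _) = z≤n

  𝟙-mono : (d : Dec P) (e : Dec Q) → (P → Q) → 𝟙 d ≤ 𝟙 e
  𝟙-mono (yes p) e f = ≤-reflexive (sym (𝟙-yes e (f p)))
  𝟙-mono (no _) e f = z≤n

  𝟙-≤ : (d : Dec P) {n : ℕ} → (P → 1 ≤ n) → 𝟙 d ≤ n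
  𝟙-≤ (yes p) f = f p
  𝟙-≤ (no _) f = z≤n

  𝟙-× : (d : Dec P) (e : Dec Q) → 𝟙 (d ×-dec e) ≡ 𝟙 d * 𝟙 e
  𝟙-× (yes _) (yes _) = refl
  𝟙-× (yes _) (no _) = refl
  𝟙-× (no _) _ = refl

  𝟙-*-≤ : (d : Dec P) {m n : ℕ} → (P → m ≤ n) → 𝟙 d * m ≤ n
  𝟙-*-≤ (yes p) {m} f = ≤-trans (≤-reflexive (*-identityˡ m)) (f p)
  𝟙-*-≤ (no _) f = z≤n

  𝟙-*-yes : (d : Dec P) (m : ℕ) → P → 𝟙 d * m ≡ m
  𝟙-*-yes d m p = trans (cong (_* m) (𝟙-yes d p)) (*-identityˡ m)

  𝟙-idem : (d : Dec P) → 𝟙 d * 𝟙 d ≡ 𝟙 d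
  𝟙-idem (yes _) = refl
  𝟙-idem (no _) = refl

  ∑-mono : ∀ (xs : List A) {f g : A → ℕ} → (∀ {x} → x ∈ xs → f x ≤ g x) → ∑ xs f ≤ ∑ xs g
  ∑-mono [] h = z≤n
  ∑-mono (x ∷ xs) h = +-mono-≤ (h (here refl)) (∑-mono xs (h ∘ there))

  ∑-cong : ∀ (xs : List A) {f g : A → ℕ} → (∀ x → f x ≡ g x) → ∑ xs f ≡ ∑ xs g
  ∑-cong [] h = refl
  ∑-cong (x ∷ xs) h = cong₂ _+_ (h x) (∑-cong xs h)

  ∑-+ : ∀ (xs : List A) (f g : A → ℕ) → ∑ xs (λ x → f x + g x) ≡ ∑ xs f + ∑ xs g
  ∑-+ [] f g = refl
  ∑-+ (x ∷ xs) f g rewrite ∑-+ xs f g = interchange (f x) (g x) (∑ xs f) (∑ xs g)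
    where
    interchange : ∀ a b c d → (a + b) + (c + d) ≡ (a + c) + (b + d)
    interchange = solve-∀

  ∑-*ˡ : ∀ (xs : List A) c (f : A → ℕ) → ∑ xs (λ x → c * f x) ≡ c * ∑ xs f
  ∑-*ˡ [] c f = sym (*-zeroʳ c)
  ∑-*ˡ (x ∷ xs) c f rewrite ∑-*ˡ xs c f = sym (*-distribˡ-+ c (f x) (∑ xs f))

  ∑-*ʳ : ∀ (xs : List A) c (f : A → ℕ) → ∑ xs (λ x → f x * c) ≡ ∑ xs f * c
  ∑-*ʳ xs c f = trans (∑-cong xs (λ x → *-comm (f x) c)) (trans (∑-*ˡ xs c f) (*-comm c _))

  ∑-zero : ∀ (xs : List A) → ∑ xs (λ _ → 0) ≡ 0
  ∑-zero [] = refl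
  ∑-zero (x ∷ xs) = ∑-zero xs

  ∑-const : ∀ (xs : List A) c → ∑ xs (λ _ → c) ≡ length xs * c
  ∑-const [] c = refl
  ∑-const (x ∷ xs) c = cong (c +_) (∑-const xs c)

  ∑-≤const : ∀ (xs : List A) {f : A → ℕ} c → (∀ {x} → x ∈ xs → f x ≤ c) → ∑ xs f ≤ length xs * c
  ∑-≤const xs c h = ≤-trans (∑-mono xs h) (≤-reflexive (∑-const xs c))

  ∑-swap : ∀ (xs : List A) (ys : List B) (f : A → B → ℕ) → ∑ xs (λ x → ∑ ys (f x)) ≡ ∑ ys (λ y → ∑ xs (λ x → f x y))
  ∑-swap [] ys f = sym (∑-zero ys)
  ∑-swap (x ∷ xs) ys f = trans (cong (∑ ys (f x) +_) (∑-swap xs ys f)) (sym (∑-+ ys (f x) _))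

  ∑-++ : ∀ (xs ys : List A) (f : A → ℕ) → ∑ (xs ++ ys) f ≡ ∑ xs f + ∑ ys f
  ∑-++ [] ys f = refl
  ∑-++ (x ∷ xs) ys f = trans (cong (f x +_) (∑-++ xs ys f)) (sym (+-assoc (f x) _ _))

  ∑-map : ∀ (g : A → B) (xs : List A) (f : B → ℕ) → ∑ (map g xs) f ≡ ∑ xs (f ∘ g)
  ∑-map g [] f = refl
  ∑-map g (x ∷ xs) f = cong (f (g x) +_) (∑-map g xs f)

  ∑-× : ∀ (xs : List A) (ys : List B) (f : A × B → ℕ) → ∑ (cartesianProduct xs ys) f ≡ ∑ xs (λ x → ∑ ys (λ y → f (x , y)))
  ∑-× [] ys f = refl
  ∑-× (x ∷ xs) ys f = trans (∑-++ (map (x ,_) ys) _ f) (cong₂ _+_ (∑-map (x ,_) ys f) (∑-× xs ys f))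

  length-∑ : ∀ (xs : List A) → length xs ≡ ∑ xs (λ _ → 1)
  length-∑ xs = sym (trans (∑-const xs 1) (*-identityʳ _))

  length-cartesianProduct : ∀ (xs : List A) (ys : List B) → length (cartesianProduct xs ys) ≡ length xs * length ys
  length-cartesianProduct xs ys = trans (length-∑ (cartesianProduct xs ys)) (trans (∑-× xs ys (λ _ → 1))
    (trans (∑-cong xs (λ _ → sym (length-∑ ys))) (∑-const xs (length ys))))

  ∑-filter : ∀ {R : Pred A 0ℓ} (R? : Decidable R) (xs : List A) (f : A → ℕ) → ∑ (filter R? xs) f ≡ ∑ xs (λ x → 𝟙 (R? x) * f x)
  ∑-filter R? [] f = refl
  ∑-filter R? (x ∷ xs) f with R? x
  ... | yes _ = cong₂ _+_ (sym (*-identityˡ (f x))) (∑-filter R? xs f)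
  ... | no _ = ∑-filter R? xs f

  length-filter-∑ : ∀ {R : Pred A 0ℓ} (R? : Decidable R) (xs : List A) → length (filter R? xs) ≡ ∑ xs (λ x → 𝟙 (R? x))
  length-filter-∑ R? [] = refl
  length-filter-∑ R? (x ∷ xs) with R? x
  ... | yes _ = cong suc (length-filter-∑ R? xs)
  ... | no _ = length-filter-∑ R? xs

  term≤∑ : ∀ {xs : List A} {x} (f : A → ℕ) → x ∈ xs → f x ≤ ∑ xs f
  term≤∑ f (here refl) = m≤m+n _ _
  term≤∑ {xs = y ∷ xs} f (there x∈) = ≤-trans (term≤∑ f x∈) (m≤n+m _ (f y))

  ∑-product : ∀ (xs : List A) (ys : List B) (f : A → ℕ) (g : B → ℕ) → ∑ xs f * ∑ ys g ≡ ∑ xs (λ x → ∑ ys (λ y → f x * g y))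
  ∑-product xs ys f g = trans (sym (∑-*ʳ xs (∑ ys g) f)) (∑-cong xs (λ x → sym (∑-*ˡ ys (f x) g)))

  1≤count : ∀ {R : Pred A 0ℓ} (R? : Decidable R) {xs : List A} {x} → x ∈ xs → R x → 1 ≤ ∑ xs (λ x → 𝟙 (R? x))
  1≤count R? {x = x} x∈ r = ≤-trans (≤-reflexive (sym (𝟙-yes (R? x) r))) (term≤∑ (λ x → 𝟙 (R? x)) x∈)

  ∑-null : ∀ (xs : List A) {f : A → ℕ} → (∀ {x} → x ∈ xs → f x ≡ 0) → ∑ xs f ≡ 0
  ∑-null [] h = refl
  ∑-null (x ∷ xs) h = cong₂ _+_ (h (here refl)) (∑-null xs (h ∘ there))

  ∑-atMostOne : ∀ {R : Pred A 0ℓ} (R? : Decidable R) {xs : List A} → Unique xs →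
    (∀ {x y} → x ∈ xs → y ∈ xs → R x → R y → x ≡ y) → ∀ (f : A → ℕ) c → (∀ {x} → x ∈ xs → R x → f x ≤ c) →
    ∑ xs (λ x → 𝟙 (R? x) * f x) ≤ c
  ∑-atMostOne R? {[]} [] one f c b = z≤n
  ∑-atMostOne {A} {R} R? {x ∷ xs} (x∉ ∷ u) one f c b with R? x
  ... | no _ = ∑-atMostOne R? u (λ p q → one (there p) (there q)) f c (λ p → b (there p))
  ... | yes r = ≤-trans (≤-reflexive (cong₂ _+_ (*-identityˡ (f x)) (∑-null xs others)))
                  (≤-trans (≤-reflexive (+-identityʳ (f x))) (b (here refl) r))
    where
    others : ∀ {y} → y ∈ xs → 𝟙 (R? y) * f y ≡ 0
    others {y} y∈ with R? y
    ... | yes s = ⊥-elim (All.lookup x∉ y∈ (one (here refl) (there y∈) r s))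
    ... | no _ = refl

  -- Each term of the left sum reappears in `ys`. After exchanging the double sum over 𝟙 (x ≟ y),
  -- uniqueness of `xs` means that every entry of `ys` is used at most once; `ys` itself may have
  -- repetitions.
  ∑-subset : DecidableEquality A → ∀ {xs ys : List A} → Unique xs → (∀ {x} → x ∈ xs → x ∈ ys) → ∀ (f : A → ℕ) → ∑ xs f ≤ ∑ ys f
  ∑-subset _≟_ {xs} {ys} u xs⊆ys f = begin
    ∑ xs f                                        ≤⟨ ∑-mono xs (λ {x} x∈ → ≤-trans (≤-reflexive (sym (𝟙-*-yes (x ≟ x) (f x) refl))) (term≤∑ (λ y → 𝟙 (x ≟ y) * f y) (xs⊆ys x∈))) ⟩
    ∑ xs (λ x → ∑ ys (λ y → 𝟙 (x ≟ y) * f y))     ≡⟨ ∑-swap xs ys _ ⟩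
    ∑ ys (λ y → ∑ xs (λ x → 𝟙 (x ≟ y) * f y))     ≤⟨ ∑-mono ys (λ {y} _ → ∑-atMostOne (_≟ y) u (λ _ _ e e′ → trans e (sym e′)) (λ _ → f y) (f y) (λ _ _ → ≤-refl)) ⟩
    ∑ ys f                                        ∎
    where open ≤-Reasoning

  count≤1 : ∀ {R : Pred A 0ℓ} (R? : Decidable R) {xs : List A} → Unique xs →
    (∀ {x y} → x ∈ xs → y ∈ xs → R x → R y → x ≡ y) → ∑ xs (λ x → 𝟙 (R? x)) ≤ 1
  count≤1 R? {xs} u one = ≤-trans (≤-reflexive (∑-cong xs (λ x → sym (*-identityʳ (𝟙 (R? x))))))
    (∑-atMostOne R? u one (λ _ → 1) 1 (λ _ _ → ≤-refl))

  count≤2 : ∀ {R : Pred A 0ℓ} (R? : Decidable R) {xs : List A} → Unique xs →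
    (∀ {x y z} → R x → R y → R z → x ≢ y → x ≢ z → y ≡ z) → ∑ xs (λ x → 𝟙 (R? x)) ≤ 2
  count≤2 R? {[]} [] two = z≤n
  count≤2 R? {x ∷ xs} (x∉ ∷ u) two with R? x
  ... | no _ = count≤2 R? u two
  ... | yes r = s≤s (count≤1 R? u (λ y∈ z∈ ry rz → two r ry rz (All.lookup x∉ y∈) (All.lookup x∉ z∈)))

  ∑-positive : ∀ (xs : List A) {f : A → ℕ} → 0 < ∑ xs f → Σ A λ x → x ∈ xs × 0 < f x
  ∑-positive (x ∷ xs) {f} h with f x in eq
  ... | suc k = x , here refl , subst (0 <_) (sym eq) (s≤s z≤n)
  ... | zero with ∑-positive xs h
  ... | y , y∈ , q = y , there y∈ , q

  average : ∀ (xs : List A) {f : A → ℕ} c → ∑ xs f < length xs * c → Σ A λ x → x ∈ xs × f x < c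
  average [] c ()
  average (x ∷ xs) {f} c h with f x <? c
  ... | yes p = x , here refl , p
  ... | no ¬p with average xs {f} c (+-cancelˡ-< c _ _ (≤-<-trans (+-monoˡ-≤ (∑ xs f) (≮⇒≥ ¬p)) h))
  ... | y , y∈ , q = y , there y∈ , q

  𝟙-positive : (d : Dec P) → 0 < 𝟙 d → P
  𝟙-positive (yes p) _ = p

  square-cancel-≤ : ∀ {m n} → m * m ≤ n * n → m ≤ n
  square-cancel-≤ {m} {n} h with m ≤? n
  ... | yes p = p
  ... | no ¬p = contradiction (*-mono-< (≰⇒> ¬p) (≰⇒> ¬p)) (≤⇒≯ h)

  square-expand : ∀ u d → (u + (u + d)) * (u + (u + d)) ≡ 4 * (u * (u + d)) + d * d
  square-expand = solve-∀

  4uv≤ : ∀ u v → 4 * (u * v) ≤ (u + v) * (u + v)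
  4uv≤ u v with ≤-total u v
  ... | inj₁ u≤v with d , refl ← m≤n⇒∃[o]m+o≡n u≤v = ≤-trans (m≤m+n _ (d * d)) (≤-reflexive (sym (square-expand u d)))
  ... | inj₂ v≤u with d , refl ← m≤n⇒∃[o]m+o≡n v≤u = ≤-trans (≤-reflexive (cong (4 *_) (*-comm (v + d) v)))
         (≤-trans (m≤m+n _ (d * d)) (≤-reflexive (trans (sym (square-expand v d)) (cong₂ _*_ (+-comm v (v + d)) (+-comm v (v + d))))))

  -- Induction without subtraction. The cross term 2abS is compared with a²G + b²H after squaring:
  -- the induction hypothesis S² ≤ HG gives (2abS)² ≤ 4(a²G)(b²H), and `4uv≤` finishes.
  cauchySchwarz : ∀ (xs : List A) (f g : A → ℕ) →
    ∑ xs (λ x → f x * g x) * ∑ xs (λ x → f x * g x) ≤ ∑ xs (λ x → f x * f x) * ∑ xs (λ x → g x * g x)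
  cauchySchwarz [] f g = z≤n
  cauchySchwarz (x ∷ xs) f g = begin
    (a * b + S) * (a * b + S)                   ≡⟨ e₁ a b S ⟩
    a * a * (b * b) + 2 * (a * b * S) + S * S   ≤⟨ +-mono-≤ (+-monoʳ-≤ (a * a * (b * b)) middle) (cauchySchwarz xs f g) ⟩
    a * a * (b * b) + (a * a * G + b * b * H) + H * G ≡⟨ e₂ a b G H ⟩
    (a * a + H) * (b * b + G)                   ∎
    where
    open ≤-Reasoning
    a = f x
    b = g x
    S = ∑ xs (λ x → f x * g x)
    H = ∑ xs (λ x → f x * f x)
    G = ∑ xs (λ x → g x * g x)
    e₁ : ∀ a b S → (a * b + S) * (a * b + S) ≡ a * a * (b * b) + 2 * (a * b * S) + S * S
    e₁ = solve-∀
    e₂ : ∀ a b G H → a * a * (b * b) + (a * a * G + b * b * H) + H * G ≡ (a * a + H) * (b * b + G)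
    e₂ = solve-∀
    e₃ : ∀ a b S → 2 * (a * b * S) * (2 * (a * b * S)) ≡ 4 * (a * a * (b * b) * (S * S))
    e₃ = solve-∀
    e₄ : ∀ a b G H → 4 * (a * a * (b * b) * (H * G)) ≡ 4 * (a * a * G * (b * b * H))
    e₄ = solve-∀
    middle : 2 * (a * b * S) ≤ a * a * G + b * b * H
    middle = square-cancel-≤ (begin
      2 * (a * b * S) * (2 * (a * b * S))  ≡⟨ e₃ a b S ⟩
      4 * (a * a * (b * b) * (S * S))      ≤⟨ *-monoʳ-≤ 4 (*-monoʳ-≤ (a * a * (b * b)) (cauchySchwarz xs f g)) ⟩
      4 * (a * a * (b * b) * (H * G))      ≡⟨ e₄ a b G H ⟩
      4 * (a * a * G * (b * b * H))        ≤⟨ 4uv≤ (a * a * G) (b * b * H) ⟩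
      (a * a * G + b * b * H) * (a * a * G + b * b * H) ∎)

  ∑² : ∀ (xs : List A) (f : A → ℕ) → ∑ xs f * ∑ xs f ≤ length xs * ∑ xs (λ x → f x * f x)
  ∑² xs f = begin
    ∑ xs f * ∑ xs f                                     ≡⟨ cong₂ _*_ e e ⟩
    ∑ xs (λ x → 1 * f x) * ∑ xs (λ x → 1 * f x)         ≤⟨ cauchySchwarz xs (λ _ → 1) f ⟩
    ∑ xs (λ _ → 1) * ∑ xs (λ x → f x * f x)             ≡⟨ cong (_* ∑ xs (λ x → f x * f x)) (trans (∑-const xs 1) (*-identityʳ (length xs))) ⟩
    length xs * ∑ xs (λ x → f x * f x)                  ∎
    where
    open ≤-Reasoning
    e = ∑-cong xs (λ x → sym (*-identityˡ (f x)))

  -- Splitting the list into at most length xs / N + 1 blocks of length at most N.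
  ∑-blocks : ∀ {xs : List A} N → 0 < N → ∀ (f : A → ℕ) W →
    (∀ ys → Unique ys → (∀ {y} → y ∈ ys → y ∈ xs) → length ys ≤ N → ∑ ys f ≤ W) →
    Unique xs → ∑ xs f * N ≤ (length xs + N) * W
  ∑-blocks {A} {xs₀} N 0<N f W block = go (length xs₀) xs₀ ≤-refl (λ y → y)
    where
    open import Data.List.Properties using (take++drop≡id; length-take; length-drop)
    open import Data.List.Relation.Unary.Unique.Propositional.Properties using (take⁺; drop⁺)
    ∈-take : ∀ n (xs : List A) {y} → y ∈ take n xs → y ∈ xs
    ∈-take (suc n) (x ∷ xs) (here e) = here e
    ∈-take (suc n) (x ∷ xs) (there y∈) = there (∈-take n xs y∈)
    ∈-drop : ∀ n (xs : List A) {y} → y ∈ drop n xs → y ∈ xs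
    ∈-drop zero xs y∈ = y∈
    ∈-drop (suc n) (x ∷ xs) y∈ = there (∈-drop n xs y∈)
    open ≤-Reasoning
    go : ∀ k xs → length xs ≤ k → (∀ {y} → y ∈ xs → y ∈ xs₀) → Unique xs → ∑ xs f * N ≤ (length xs + N) * W
    go k xs l≤k sub u with length xs ≤? N
    ... | yes l≤N = ≤-trans (*-monoˡ-≤ N (block xs u sub l≤N)) (≤-trans (≤-reflexive (*-comm W N)) (*-monoˡ-≤ W (m≤n+m N (length xs))))
    go zero [] l≤k sub u | no l≰N = ⊥-elim (l≰N z≤n)
    go (suc k) xs l≤k sub u | no l≰N = begin
      ∑ xs f * N                                   ≡⟨ cong (λ l → ∑ l f * N) (sym (take++drop≡id N xs)) ⟩
      ∑ (take N xs ++ drop N xs) f * N             ≡⟨ cong (_* N) (∑-++ (take N xs) (drop N xs) f) ⟩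
      (∑ (take N xs) f + ∑ (drop N xs) f) * N      ≡⟨ *-distribʳ-+ N (∑ (take N xs) f) _ ⟩
      ∑ (take N xs) f * N + ∑ (drop N xs) f * N    ≤⟨ +-mono-≤ (*-monoˡ-≤ N first) (go k (drop N xs) shorter (sub ∘ ∈-drop N xs) (drop⁺ N u)) ⟩
      W * N + (length (drop N xs) + N) * W         ≡⟨ cong (λ l → W * N + (l + N) * W) (length-drop N xs) ⟩
      W * N + (length xs ∸ N + N) * W              ≡⟨ cong (λ l → W * N + l * W) (m∸n+n≡m (<⇒≤ (≰⇒> l≰N))) ⟩
      W * N + length xs * W                        ≡⟨ e W N (length xs) ⟩
      (length xs + N) * W                          ∎
      where
      e : ∀ W N l → W * N + l * W ≡ (l + N) * W
      e = solve-∀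
      first : ∑ (take N xs) f ≤ W
      first = block (take N xs) (take⁺ N u) (sub ∘ ∈-take N xs) (≤-trans (≤-reflexive (length-take N xs)) (m⊓n≤m N (length xs)))
      shorter : length (drop N xs) ≤ k
      shorter = ≤-trans (≤-reflexive (length-drop N xs)) (≤-trans (∸-monoʳ-≤ (length xs) 0<N) (∸-monoˡ-≤ 1 l≤k))

-- Pruning a bipartite graph, with a random parameter that separates neighbours.

module Pruning where

  open FiniteSums
  open import Data.Nat
  open import Data.Nat.Properties
  open import Data.Nat.DivMod using (_/_; m/n*n≤m; m≡m%n+[m/n]*n; m%n<n)
  open import Data.Nat.Tactic.RingSolver using (solve-∀)
  open import Data.Product using (Σ; _×_; _,_; proj₁; proj₂)
  open import Data.Sum using (_⊎_; inj₁; inj₂)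
  open import Data.Empty using (⊥; ⊥-elim)
  open import Data.List using (List; []; _∷_; length)
  open import Data.List.Membership.Propositional using (_∈_)
  open import Data.List.Relation.Unary.Any using (here; there)
  open import Data.List.Relation.Unary.Unique.Propositional using (Unique)
  open import Function using (_∘_; flip)
  open import Relation.Nullary using (Dec; yes; no; ¬_; _×-dec_; _⊎-dec_; ¬?; contradiction)
  open import Relation.Binary.PropositionalEquality

  private variable
    A B : Set

  remove : ∀ {x : A} {xs} → x ∈ xs → Σ (List A) λ ys → (∀ f → ∑ xs f ≡ f x + ∑ ys f) × (∀ {y} → y ∈ ys → y ∈ xs)
  remove {xs = x ∷ xs} (here refl) = xs , (λ f → refl) , there
  remove {xs = x ∷ xs} (there y∈) with remove y∈
  ... | ys , sum , sub = x ∷ ys , (λ f → trans (cong (f x +_) (sum f)) (swap (f x) (f _) (∑ ys f))) , λ { (here e) → here e ; (there z∈) → there (sub z∈) }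
    where
    swap : ∀ a b c → a + (b + c) ≡ b + (a + c)
    swap = solve-∀

  findSmall : ∀ (f g : A → ℕ) xs → (∀ {x} → x ∈ xs → f x < g x) ⊎ Σ A (λ x → x ∈ xs × g x ≤ f x)
  findSmall f g [] = inj₁ λ ()
  findSmall f g (x ∷ xs) with f x <? g x | findSmall f g xs
  ... | no q | _ = inj₂ (x , here refl , ≮⇒≥ q)
  ... | yes _ | inj₂ (y , y∈ , q) = inj₂ (y , there y∈ , q)
  ... | yes q | inj₁ all = inj₁ λ { (here refl) → q ; (there x∈) → all x∈ }

  -- Being a sublist, reduced to its two consequences used later: membership is inherited, and every
  -- sum of natural numbers can only decrease.
  record _⊑_ (ys xs : List A) : Set where
    field
      member : ∀ {y} → y ∈ ys → y ∈ xs
      ∑-≤ : ∀ f → ∑ ys f ≤ ∑ xs f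
  open _⊑_

  module Pruning (R : A → B → Set) (R? : ∀ i j → Dec (R i j)) (τ₁ : A → ℕ) (τ₂ : B → ℕ) where

    degree₁ : List B → A → ℕ
    degree₁ bs i = ∑ bs (λ j → 𝟙 (R? i j))

    degree₂ : List A → B → ℕ
    degree₂ as j = ∑ as (λ i → 𝟙 (R? i j))

    edges : List A → List B → ℕ
    edges as bs = ∑ as (degree₁ bs)

    edges-swap : ∀ as bs → edges as bs ≡ ∑ bs (degree₂ as)
    edges-swap as bs = ∑-swap as bs (λ i j → 𝟙 (R? i j))

    record Core (as : List A) (bs : List B) : Set where
      field
        as′ : List A
        bs′ : List B
        as′⊑ : as′ ⊑ as
        bs′⊑ : bs′ ⊑ bs
        nonempty : 0 < edges as′ bs′
        large₁ : ∀ {i} → i ∈ as′ → τ₁ i < degree₁ bs′ i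
        large₂ : ∀ {j} → j ∈ bs′ → τ₂ j < degree₂ as′ j

    ⊑-trans : ∀ {C : Set} {xs ys zs : List C} → xs ⊑ ys → ys ⊑ zs → xs ⊑ zs
    ⊑-trans p q = record { member = member q ∘ member p ; ∑-≤ = λ f → ≤-trans (∑-≤ p f) (∑-≤ q f) }

    ⊑-refl : ∀ {C : Set} {xs : List C} → xs ⊑ xs
    ⊑-refl = record { member = λ x → x ; ∑-≤ = λ f → ≤-refl }

    length-removed : ∀ {C : Set} {x : C} {xs ys} → (∀ f → ∑ xs f ≡ f x + ∑ ys f) → length xs ≡ suc (length ys)
    length-removed {xs = xs} {ys} sum = trans (sym (trans (∑-const xs 1) (*-identityʳ _))) (trans (sum (λ _ → 1)) (cong suc (trans (∑-const ys 1) (*-identityʳ _))))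

    ⊑-removed : ∀ {C : Set} {x : C} {xs ys} → (∀ f → ∑ xs f ≡ f x + ∑ ys f) → (∀ {y} → y ∈ ys → y ∈ xs) → ys ⊑ xs
    ⊑-removed {x = x} sum sub = record { member = sub ; ∑-≤ = λ f → ≤-trans (m≤n+m _ (f x)) (≤-reflexive (sym (sum f))) }

    -- Deleting a vertex whose degree is at most its threshold lowers the number of edges by at most
    -- that threshold, so the strict inequality between thresholds and edges survives the deletion.
    -- It forces edges to remain when no such vertex is left. `n` bounds the number of vertices and
    -- makes the recursion structural.
    prune : ∀ n as bs → length as + length bs ≤ n → ∑ as τ₁ + ∑ bs τ₂ < edges as bs → Core as bs
    prune n as bs len many with findSmall τ₁ (degree₁ bs) as | findSmall τ₂ (degree₂ as) bs
    ... | inj₁ l₁ | inj₁ l₂ = record { as′ = as ; bs′ = bs ; as′⊑ = ⊑-refl ; bs′⊑ = ⊑-refl ; nonempty = ≤-<-trans z≤n many ; large₁ = l₁ ; large₂ = l₂ }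
    prune zero as bs len many | inj₂ (i , i∈ , _) | _ = ⊥-elim (case as i∈ len)
      where
      case : ∀ as → i ∈ as → length as + length bs ≤ 0 → ⊥
      case (_ ∷ _) _ ()
    prune (suc n) as bs len many | inj₂ (i , i∈ , small) | _ with remove i∈
    ... | ys , sum , sub = record { as′ = as′ ; bs′ = bs′ ; as′⊑ = ⊑-trans as′⊑ (⊑-removed {xs = as} sum sub) ; bs′⊑ = bs′⊑ ; nonempty = nonempty ; large₁ = large₁ ; large₂ = large₂ }
      where
      open ≤-Reasoning
      rec : Core ys bs
      rec = prune n ys bs (≤-pred (≤-trans (≤-reflexive (cong (_+ length bs) (sym (length-removed {xs = as} {ys} sum)))) len))
        (+-cancelˡ-< (τ₁ i) _ _ (begin-strict
          τ₁ i + (∑ ys τ₁ + ∑ bs τ₂)     ≡⟨ +-assoc (τ₁ i) _ _ ⟨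
          τ₁ i + ∑ ys τ₁ + ∑ bs τ₂       ≡⟨ cong (_+ ∑ bs τ₂) (sum τ₁) ⟨
          ∑ as τ₁ + ∑ bs τ₂              <⟨ many ⟩
          edges as bs                    ≡⟨ sum (degree₁ bs) ⟩
          degree₁ bs i + edges ys bs     ≤⟨ +-monoˡ-≤ (edges ys bs) small ⟩
          τ₁ i + edges ys bs             ∎))
      open Core rec
    prune zero as bs len many | inj₁ _ | inj₂ (j , j∈ , _) = ⊥-elim (case bs j∈ (≤-trans (m≤n+m _ (length as)) len))
      where
      case : ∀ bs → j ∈ bs → length bs ≤ 0 → ⊥
      case (_ ∷ _) _ ()
    prune (suc n) as bs len many | inj₁ _ | inj₂ (j , j∈ , small) with remove j∈
    ... | ys , sum , sub = record { as′ = as′ ; bs′ = bs′ ; as′⊑ = as′⊑ ; bs′⊑ = ⊑-trans bs′⊑ (⊑-removed {xs = bs} sum sub) ; nonempty = nonempty ; large₁ = large₁ ; large₂ = large₂ }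
      where
      open ≤-Reasoning
      rearrange : ∀ a b c → a + (b + c) ≡ b + (a + c)
      rearrange = solve-∀
      rec : Core as ys
      rec = prune n as ys (≤-pred (≤-trans (≤-reflexive (trans (sym (+-suc (length as) (length ys))) (cong (length as +_) (sym (length-removed {xs = bs} {ys} sum))))) len))
        (+-cancelˡ-< (τ₂ j) _ _ (begin-strict
          τ₂ j + (∑ as τ₁ + ∑ ys τ₂)     ≡⟨ rearrange (τ₂ j) (∑ as τ₁) (∑ ys τ₂) ⟩
          ∑ as τ₁ + (τ₂ j + ∑ ys τ₂)     ≡⟨ cong (∑ as τ₁ +_) (sum τ₂) ⟨
          ∑ as τ₁ + ∑ bs τ₂              <⟨ many ⟩
          edges as bs                    ≡⟨ edges-swap as bs ⟩
          ∑ bs (degree₂ as)              ≡⟨ sum (degree₂ as) ⟩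
          degree₂ as j + ∑ ys (degree₂ as) ≤⟨ +-monoˡ-≤ _ small ⟩
          τ₂ j + ∑ ys (degree₂ as)       ≡⟨ cong (τ₂ j +_) (edges-swap as ys) ⟨
          τ₂ j + edges as ys             ∎))
      open Core rec

  -- One side of the bipartite graph: at the parameter θ the neighbours j, j′ of i are indistinguishable
  -- when C θ j j′ holds, and i is unusable when E θ i holds. For most θ, few neighbours are merged.
  module Side {Θ : Set} (Θs : List Θ)
    (R : A → B → Set) (R? : ∀ i j → Dec (R i j)) (bs : List B) (ubs : Unique bs)
    (_≟_ : (j j′ : B) → Dec (j ≡ j′))
    (C : Θ → B → B → Set) (C? : ∀ θ j j′ → Dec (C θ j j′)) (few-C : ∀ {j j′} → j ∈ bs → j′ ∈ bs → j ≢ j′ → ∑ Θs (λ θ → 𝟙 (C? θ j j′)) ≤ 8)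
    (E : Θ → A → Set) (E? : ∀ θ i → Dec (E θ i)) (K : ℕ) (1≤K : 1 ≤ K) where

    δ : A → ℕ
    δ i = ∑ bs (λ j → 𝟙 (R? i j))

    merged : Θ → A → ℕ
    merged θ i = ∑ bs (λ j → ∑ bs (λ j′ → 𝟙 (R? i j) * 𝟙 (R? i j′) * 𝟙 (¬? (j ≟ j′) ×-dec C? θ j j′)))

    Bad : Θ → A → Set
    Bad θ i = E θ i ⊎ δ i * δ i < K * 128 * merged θ i

    abstract
     bad? : ∀ θ i → Dec (Bad θ i)
     bad? θ i = E? θ i ⊎-dec (δ i * δ i <? K * 128 * merged θ i)

    choose : ∀ {P : Set} → Dec P → ℕ → ℕ → ℕ
    choose (yes _) m n = m
    choose (no _) m n = n

    -- A bad vertex gets its full degree as threshold, which no surviving degree can exceed, so bad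
    -- vertices are always deleted. A good vertex survives only with more than 2K + δ/8 neighbours:
    -- more than 2K in number, and a fixed share of the original ones.
    threshold : Θ → A → ℕ
    threshold θ i = choose (bad? θ i) (δ i) (2 * K + δ i / 8)

    threshold-≤ : ∀ θ i → 8 * threshold θ i ≤ 8 * (δ i * 𝟙 (bad? θ i)) + (K * 16 + δ i)
    threshold-≤ θ i = go (bad? θ i)
      where
      open ≤-Reasoning
      e : ∀ K d → 8 * (2 * K + d) ≡ K * 16 + d * 8
      e = solve-∀
      go : ∀ {P : Set} (d : Dec P) → 8 * choose d (δ i) (2 * K + δ i / 8) ≤ 8 * (δ i * 𝟙 d) + (K * 16 + δ i)
      go (yes _) = ≤-trans (≤-reflexive (cong (8 *_) (sym (*-identityʳ (δ i))))) (m≤m+n _ _)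
      go (no _) = begin
        8 * (2 * K + δ i / 8)              ≡⟨ e K (δ i / 8) ⟩
        K * 16 + δ i / 8 * 8               ≤⟨ +-monoʳ-≤ (K * 16) (m/n*n≤m (δ i) 8) ⟩
        K * 16 + δ i                       ≤⟨ m≤n+m _ (8 * (δ i * 0)) ⟩
        8 * (δ i * 0) + (K * 16 + δ i)     ∎

    ∑-merged : ∀ i → ∑ Θs (λ θ → merged θ i) ≤ 8 * (δ i * δ i)
    ∑-merged i = begin
      ∑ Θs (λ θ → merged θ i)
        ≡⟨ ∑-swap Θs bs _ ⟩
      ∑ bs (λ j → ∑ Θs (λ θ → ∑ bs (λ j′ → r j * r j′ * c θ j j′)))
        ≤⟨ ∑-mono bs (λ {j} j∈ → ≤-trans (≤-reflexive (∑-swap Θs bs _)) (∑-mono bs (λ {j′} j′∈ →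
             ≤-trans (≤-reflexive (∑-*ˡ Θs (r j * r j′) _)) (*-monoʳ-≤ (r j * r j′) (pair j∈ j′∈))))) ⟩
      ∑ bs (λ j → ∑ bs (λ j′ → r j * r j′ * 8))
        ≡⟨ ∑-cong bs (λ j → ∑-*ʳ bs 8 _) ⟩
      ∑ bs (λ j → ∑ bs (λ j′ → r j * r j′) * 8)
        ≡⟨ ∑-*ʳ bs 8 _ ⟩
      ∑ bs (λ j → ∑ bs (λ j′ → r j * r j′)) * 8
        ≡⟨ cong (_* 8) (∑-product bs bs r r) ⟨
      δ i * δ i * 8
        ≡⟨ *-comm (δ i * δ i) 8 ⟩
      8 * (δ i * δ i) ∎
      where
      open ≤-Reasoning
      r : B → ℕ
      r j = 𝟙 (R? i j)
      c : Θ → B → B → ℕ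
      c θ j j′ = 𝟙 (¬? (j ≟ j′) ×-dec C? θ j j′)
      pair : ∀ {j j′} → j ∈ bs → j′ ∈ bs → ∑ Θs (λ θ → c θ j j′) ≤ 8
      pair {j} {j′} j∈ j′∈ with j ≟ j′
      ... | yes _ = ≤-trans (≤-reflexive (∑-zero Θs)) z≤n
      ... | no j≢ = ≤-trans (∑-mono Θs (λ {θ} _ → 𝟙-mono (yes j≢ ×-dec C? θ j j′) (C? θ j j′) proj₂)) (few-C j∈ j′∈ j≢)

    -- Markov's inequality: summed over θ, the merged pairs number at most 8δ², so at most 128 · 8 K
    -- = 1024 K parameters give more than δ²/(128 K) of them. The exceptional set `E` adds at most 8
    -- ≤ 8K parameters, hence 1032.
    ∑-bad : ∀ i → ∑ Θs (λ θ → 𝟙 (E? θ i)) ≤ 8 → ∑ Θs (λ θ → δ i * 𝟙 (bad? θ i)) ≤ K * 1032 * δ i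
    ∑-bad i few-E = begin
      ∑ Θs (λ θ → δ i * 𝟙 (bad? θ i))        ≡⟨ ∑-*ˡ Θs (δ i) _ ⟩
      δ i * ∑ Θs (λ θ → 𝟙 (bad? θ i))        ≤⟨ bound (δ i) refl ⟩
      δ i * (K * 1032)                         ≡⟨ *-comm (δ i) _ ⟩
      K * 1032 * δ i                           ∎
      where
      open ≤-Reasoning
      markov : δ i * δ i * ∑ Θs (λ θ → 𝟙 (δ i * δ i <? K * 128 * merged θ i)) ≤ δ i * δ i * (K * 1024)
      markov = begin
        δ i * δ i * ∑ Θs (λ θ → 𝟙 (δ i * δ i <? K * 128 * merged θ i))
          ≡⟨ *-comm (δ i * δ i) _ ⟩
        ∑ Θs (λ θ → 𝟙 (δ i * δ i <? K * 128 * merged θ i)) * (δ i * δ i)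
          ≡⟨ ∑-*ʳ Θs (δ i * δ i) _ ⟨
        ∑ Θs (λ θ → 𝟙 (δ i * δ i <? K * 128 * merged θ i) * (δ i * δ i))
          ≤⟨ ∑-mono Θs (λ {θ} _ → 𝟙-*-≤ (δ i * δ i <? K * 128 * merged θ i) <⇒≤) ⟩
        ∑ Θs (λ θ → K * 128 * merged θ i)
          ≡⟨ ∑-*ˡ Θs (K * 128) _ ⟩
        K * 128 * ∑ Θs (λ θ → merged θ i)
          ≤⟨ *-monoʳ-≤ (K * 128) (∑-merged i) ⟩
        K * 128 * (8 * (δ i * δ i))
          ≡⟨ e K 128 (δ i * δ i) ⟩
        δ i * δ i * (K * 1024) ∎
        where
        e : ∀ K c d → K * c * (8 * d) ≡ d * (K * (c * 8))
        e = solve-∀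
      count : ∀ d → δ i ≡ suc d → ∑ Θs (λ θ → 𝟙 (bad? θ i)) ≤ K * 1032
      count d eq = begin
        ∑ Θs (λ θ → 𝟙 (bad? θ i))
          ≤⟨ ∑-mono Θs (λ {θ} _ → 𝟙-≤ (bad? θ i) (either θ)) ⟩
        ∑ Θs (λ θ → 𝟙 (E? θ i) + 𝟙 (δ i * δ i <? K * 128 * merged θ i))
          ≡⟨ ∑-+ Θs _ _ ⟩
        ∑ Θs (λ θ → 𝟙 (E? θ i)) + ∑ Θs (λ θ → 𝟙 (δ i * δ i <? K * 128 * merged θ i))
          ≤⟨ +-mono-≤ few-E (*-cancelˡ-≤ (δ i * δ i) {{subst (λ n → NonZero (n * n)) (sym eq) _}} markov) ⟩
        8 + K * 1024
          ≤⟨ +-monoˡ-≤ (K * 1024) (*-monoˡ-≤ 8 1≤K) ⟩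
        K * 8 + K * 1024
          ≡⟨ *-distribˡ-+ K 8 1024 ⟨
        K * 1032 ∎
        where
        either : ∀ θ → Bad θ i → 1 ≤ 𝟙 (E? θ i) + 𝟙 (δ i * δ i <? K * 128 * merged θ i)
        either θ (inj₁ e) = ≤-trans (≤-reflexive (sym (𝟙-yes (E? θ i) e))) (m≤m+n _ _)
        either θ (inj₂ lt) = ≤-trans (≤-reflexive (sym (𝟙-yes (δ i * δ i <? K * 128 * merged θ i) lt))) (m≤n+m _ _)
      bound : ∀ d → δ i ≡ d → δ i * ∑ Θs (λ θ → 𝟙 (bad? θ i)) ≤ δ i * (K * 1032)
      bound zero eq = ≤-trans (≤-reflexive (cong (_* ∑ Θs (λ θ → 𝟙 (bad? θ i))) eq)) z≤n
      bound (suc d) eq = *-monoʳ-≤ (δ i) (count d eq)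

    module _ (θ : Θ) (bs′ : List B) (bs′⊑ : bs′ ⊑ bs) (i : A) (survives : threshold θ i < ∑ bs′ (λ j → 𝟙 (R? i j))) where

      δ′ : ℕ
      δ′ = ∑ bs′ (λ j → 𝟙 (R? i j))

      notBad : ¬ Bad θ i × 2 * K + δ i / 8 < δ′
      notBad = go (bad? θ i) survives
        where
        go : ∀ {P : Set} (d : Dec P) → choose d (δ i) (2 * K + δ i / 8) < δ′ → ¬ P × 2 * K + δ i / 8 < δ′
        go (yes _) lt = contradiction lt (≤⇒≯ (∑-≤ bs′⊑ _))
        go (no ¬b) lt = ¬b , lt

      -- Cauchy–Schwarz over the classes of neighbours with equal label ξ.
      manyLabels : ∀ {L : Set} (Ls : List L) (uL : Unique Ls) (all : ∀ l → l ∈ Ls) (_≟L_ : (l l′ : L) → Dec (l ≡ l′)) (ξ : B → L) →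
        (∀ {j j′} → j ∈ bs′ → j′ ∈ bs′ → ξ j ≡ ξ j′ → C θ j j′) →
        ∀ {S : L → Set} (S? : ∀ l → Dec (S l)) → (∀ {j} → j ∈ bs′ → R i j → S (ξ j)) → K ≤ ∑ Ls (λ l → 𝟙 (S? l))
      manyLabels {L} Ls uL all _≟L_ ξ merge {S} S? inS = conclude (δ′ + m) refl
        where
        open ≤-Reasoning
        r : B → ℕ
        r j = 𝟙 (R? i j)
        m = merged θ i
        h : L → ℕ
        h l = ∑ bs′ (λ j → 𝟙 (ξ j ≟L l) * r j)
        single : ∀ j n → ∑ Ls (λ l → 𝟙 (ξ j ≟L l) * n) ≡ n
        single j n = trans (∑-*ʳ Ls n _) (trans (cong (_* n) (≤-antisym
          (count≤1 (ξ j ≟L_) uL (λ _ _ e e′ → trans (sym e) e′)) (1≤count (ξ j ≟L_) (all (ξ j)) refl))) (*-identityˡ n))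
        ∑h : ∑ Ls h ≡ δ′
        ∑h = trans (∑-swap Ls bs′ _) (∑-cong bs′ (λ j → single j (r j)))
        ∑h² : ∑ Ls (λ l → h l * h l) ≤ δ′ + m
        ∑h² = begin
          ∑ Ls (λ l → h l * h l)
            ≡⟨ ∑-cong Ls (λ l → ∑-product bs′ bs′ _ _) ⟩
          ∑ Ls (λ l → ∑ bs′ (λ j → ∑ bs′ (λ j′ → 𝟙 (ξ j ≟L l) * r j * (𝟙 (ξ j′ ≟L l) * r j′))))
            ≡⟨ trans (∑-swap Ls bs′ _) (∑-cong bs′ (λ j → ∑-swap Ls bs′ _)) ⟩
          ∑ bs′ (λ j → ∑ bs′ (λ j′ → ∑ Ls (λ l → 𝟙 (ξ j ≟L l) * r j * (𝟙 (ξ j′ ≟L l) * r j′))))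
            ≤⟨ ∑-mono bs′ (λ {j} j∈ → ∑-mono bs′ (λ {j′} j′∈ → pair j∈ j′∈)) ⟩
          ∑ bs′ (λ j → ∑ bs′ (λ j′ → 𝟙 (j ≟ j′) * r j + r j * r j′ * 𝟙 (¬? (j ≟ j′) ×-dec C? θ j j′)))
            ≡⟨ trans (∑-cong bs′ (λ j → ∑-+ bs′ _ _)) (∑-+ bs′ _ _) ⟩
          ∑ bs′ (λ j → ∑ bs′ (λ j′ → 𝟙 (j ≟ j′) * r j)) + ∑ bs′ (λ j → ∑ bs′ (λ j′ → r j * r j′ * 𝟙 (¬? (j ≟ j′) ×-dec C? θ j j′)))
            ≤⟨ +-mono-≤ (∑-mono bs′ (λ {j} j∈ → ≤-trans (∑-≤ bs′⊑ _) (∑-atMostOne (j ≟_) ubs (λ _ _ e e′ → trans (sym e) e′) (λ _ → r j) (r j) (λ _ _ → ≤-refl))))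
                 (≤-trans (∑-≤ bs′⊑ _) (∑-mono bs (λ _ → ∑-≤ bs′⊑ _))) ⟩
          δ′ + m ∎
          where
          pair : ∀ {j j′} → j ∈ bs′ → j′ ∈ bs′ → ∑ Ls (λ l → 𝟙 (ξ j ≟L l) * r j * (𝟙 (ξ j′ ≟L l) * r j′)) ≤
            𝟙 (j ≟ j′) * r j + r j * r j′ * 𝟙 (¬? (j ≟ j′) ×-dec C? θ j j′)
          pair {j} {j′} j∈ j′∈ with ξ j ≟L ξ j′
          ... | no ξ≢ = ≤-trans (≤-reflexive (∑-null Ls (λ {l} _ → none l))) z≤n
            where
            none : ∀ l → 𝟙 (ξ j ≟L l) * r j * (𝟙 (ξ j′ ≟L l) * r j′) ≡ 0
            none l with ξ j ≟L l | ξ j′ ≟L l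
            ... | yes e | yes e′ = contradiction (trans e (sym e′)) ξ≢
            ... | no _  | _ = refl
            ... | yes _ | no _ = *-zeroʳ (1 * r j)
          ... | yes ξ≡ = begin
            ∑ Ls (λ l → 𝟙 (ξ j ≟L l) * r j * (𝟙 (ξ j′ ≟L l) * r j′))
              ≤⟨ ∑-mono Ls (λ {l} _ → ≤-trans (≤-reflexive (*-assoc (𝟙 (ξ j ≟L l)) (r j) _)) (*-monoʳ-≤ (𝟙 (ξ j ≟L l)) (*-monoʳ-≤ (r j) (*-monoˡ-≤ (r j′) (𝟙≤1 (ξ j′ ≟L l)))))) ⟩
            ∑ Ls (λ l → 𝟙 (ξ j ≟L l) * (r j * (1 * r j′)))
              ≡⟨ single j (r j * (1 * r j′)) ⟩
            r j * (1 * r j′)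
              ≡⟨ cong (r j *_) (*-identityˡ (r j′)) ⟩
            r j * r j′
              ≤⟨ split (j ≟ j′) ⟩
            𝟙 (j ≟ j′) * r j + r j * r j′ * 𝟙 (¬? (j ≟ j′) ×-dec C? θ j j′) ∎
            where
            split : (d : Dec (j ≡ j′)) → r j * r j′ ≤ 𝟙 d * r j + r j * r j′ * 𝟙 (¬? d ×-dec C? θ j j′)
            split (yes refl) = ≤-trans (≤-reflexive (trans (𝟙-idem (R? i j)) (sym (*-identityˡ (r j))))) (m≤m+n _ _)
            split (no j≢) = ≤-reflexive (sym (trans (cong (r j * r j′ *_) (𝟙-yes (yes j≢ ×-dec C? θ j j′) (j≢ , merge j∈ j′∈ ξ≡))) (*-identityʳ _)))
        s = ∑ Ls (λ l → 𝟙 (S? l))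
        supported : ∀ l → h l ≡ 𝟙 (S? l) * h l
        supported l with S? l
        ... | yes _ = sym (*-identityˡ (h l))
        ... | no ¬s = ∑-null bs′ outside
          where
          outside : ∀ {j} → j ∈ bs′ → 𝟙 (ξ j ≟L l) * r j ≡ 0
          outside {j} j∈ with ξ j ≟L l | R? i j
          ... | no _ | _ = refl
          ... | yes _ | no _ = refl
          ... | yes refl | yes rij = contradiction (inS j∈ rij) ¬s
        cs : δ′ * δ′ ≤ s * (δ′ + m)
        cs = begin
          δ′ * δ′                      ≡⟨ cong₂ _*_ eq eq ⟩
          ∑ Ls (λ l → 𝟙 (S? l) * h l) * ∑ Ls (λ l → 𝟙 (S? l) * h l) ≤⟨ cauchySchwarz Ls (λ l → 𝟙 (S? l)) h ⟩
          ∑ Ls (λ l → 𝟙 (S? l) * 𝟙 (S? l)) * ∑ Ls (λ l → h l * h l)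
            ≤⟨ *-mono-≤ (≤-reflexive (∑-cong Ls (λ l → 𝟙-idem (S? l)))) ∑h² ⟩
          s * (δ′ + m) ∎
          where
          eq : δ′ ≡ ∑ Ls (λ l → 𝟙 (S? l) * h l)
          eq = trans (sym ∑h) (∑-cong Ls supported)
        ¬bad = proj₁ notBad
        δ≤8δ′ : δ i ≤ 8 * δ′
        δ≤8δ′ = begin
          δ i                      ≡⟨ m≡m%n+[m/n]*n (δ i) 8 ⟩
          δ i % 8 + δ i / 8 * 8    ≤⟨ +-monoˡ-≤ _ (<⇒≤ (m%n<n (δ i) 8)) ⟩
          suc (δ i / 8) * 8        ≤⟨ *-monoˡ-≤ 8 (≤-trans (s≤s (m≤n+m (δ i / 8) (2 * K))) (proj₂ notBad)) ⟩
          δ′ * 8                   ≡⟨ *-comm δ′ 8 ⟩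
          8 * δ′                   ∎
          where open import Data.Nat.DivMod using (_%_)
        2K≤δ′ : 2 * K ≤ δ′
        2K≤δ′ = ≤-trans (m≤m+n (2 * K) (δ i / 8)) (<⇒≤ (proj₂ notBad))
        -- Half of 128 δ′² pays for 128 K δ′, by 2K ≤ δ′; the other half pays for 128 K m, since
        -- goodness gives 128 K m ≤ δ² and at least an eighth of the neighbours survive.
        key : K * (δ′ + m) ≤ δ′ * δ′
        key = *-cancelˡ-≤ 128 (begin
          128 * (K * (δ′ + m))                       ≡⟨ e₁ K δ′ m ⟩
          64 * (2 * K * δ′) + K * 128 * m            ≤⟨ +-mono-≤ (*-monoʳ-≤ 64 (*-monoˡ-≤ δ′ 2K≤δ′)) (≮⇒≥ (λ lt → ¬bad (inj₂ lt))) ⟩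
          64 * (δ′ * δ′) + δ i * δ i                 ≤⟨ +-monoʳ-≤ (64 * (δ′ * δ′)) (*-mono-≤ δ≤8δ′ δ≤8δ′) ⟩
          64 * (δ′ * δ′) + 8 * δ′ * (8 * δ′)         ≡⟨ e₂ δ′ ⟩
          128 * (δ′ * δ′)                            ∎)
          where
          e₁ : ∀ K d m → 128 * (K * (d + m)) ≡ 64 * (2 * K * d) + K * 128 * m
          e₁ = solve-∀
          e₂ : ∀ d → 64 * (d * d) + 8 * d * (8 * d) ≡ 128 * (d * d)
          e₂ = solve-∀
        conclude : ∀ t → δ′ + m ≡ t → K ≤ s
        conclude zero eq = contradiction (≤-trans (≤-trans 1≤K (m≤m+n K (K + 0))) 2K≤δ′) (<⇒≱ (s≤s (≤-reflexive (m+n≡0⇒m≡0 δ′ eq))))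
        conclude (suc t) eq = *-cancelʳ-≤ K s (δ′ + m) {{subst NonZero (sym eq) _}} (≤-trans key cs)

  module Selection {Θ : Set} (Θs : List Θ)
    (R : A → B → Set) (R? : ∀ i j → Dec (R i j)) (as : List A) (bs : List B) (uas : Unique as) (ubs : Unique bs)
    (_≟A_ : (i i′ : A) → Dec (i ≡ i′)) (_≟B_ : (j j′ : B) → Dec (j ≡ j′))
    (C₁ : Θ → B → B → Set) (C₁? : ∀ θ j j′ → Dec (C₁ θ j j′)) (few-C₁ : ∀ {j j′} → j ∈ bs → j′ ∈ bs → j ≢ j′ → ∑ Θs (λ θ → 𝟙 (C₁? θ j j′)) ≤ 8)
    (C₂ : Θ → A → A → Set) (C₂? : ∀ θ i i′ → Dec (C₂ θ i i′)) (few-C₂ : ∀ {i i′} → i ∈ as → i′ ∈ as → i ≢ i′ → ∑ Θs (λ θ → 𝟙 (C₂? θ i i′)) ≤ 8)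
    (E₁ : Θ → A → Set) (E₁? : ∀ θ i → Dec (E₁ θ i)) (few-E₁ : ∀ {i} → i ∈ as → ∑ Θs (λ θ → 𝟙 (E₁? θ i)) ≤ 8)
    (E₂ : Θ → B → Set) (E₂? : ∀ θ j → Dec (E₂ θ j)) (few-E₂ : ∀ {j} → j ∈ bs → ∑ Θs (λ θ → 𝟙 (E₂? θ j)) ≤ 8)
    (K N : ℕ) (1≤K : 1 ≤ K) (as≤N : length as ≤ N) (bs≤N : length bs ≤ N) (1≤Θ : 1 ≤ length Θs) (K*8256≤ : K * 8256 ≤ length Θs) where

    module S₁ = Side Θs R R? bs ubs _≟B_ C₁ C₁? few-C₁ E₁ E₁? K 1≤K
    module S₂ = Side Θs (flip R) (flip R?) as uas _≟A_ C₂ C₂? few-C₂ E₂ E₂? K 1≤K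

    e : ℕ
    e = ∑ as S₁.δ

    e-swap : e ≡ ∑ bs S₂.δ
    e-swap = ∑-swap as bs (λ i j → 𝟙 (R? i j))

    badEdges : Θ → ℕ
    badEdges θ = ∑ as (λ i → S₁.δ i * 𝟙 (S₁.bad? θ i)) + ∑ bs (λ j → S₂.δ j * 𝟙 (S₂.bad? θ j))

    ∑-badEdges : ∑ Θs badEdges ≤ K * 2064 * e
    ∑-badEdges = begin
      ∑ Θs badEdges
        ≡⟨ trans (∑-+ Θs _ _) (cong₂ _+_ (∑-swap Θs as _) (∑-swap Θs bs _)) ⟩
      ∑ as (λ i → ∑ Θs (λ θ → S₁.δ i * 𝟙 (S₁.bad? θ i))) + ∑ bs (λ j → ∑ Θs (λ θ → S₂.δ j * 𝟙 (S₂.bad? θ j)))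
        ≤⟨ +-mono-≤ (∑-mono as (λ {i} i∈ → S₁.∑-bad i (few-E₁ i∈))) (∑-mono bs (λ {j} j∈ → S₂.∑-bad j (few-E₂ j∈))) ⟩
      ∑ as (λ i → K * 1032 * S₁.δ i) + ∑ bs (λ j → K * 1032 * S₂.δ j)
        ≡⟨ cong₂ _+_ (∑-*ˡ as (K * 1032) S₁.δ) (trans (∑-*ˡ bs (K * 1032) S₂.δ) (cong (K * 1032 *_) (sym e-swap))) ⟩
      K * 1032 * e + K * 1032 * e
        ≡⟨ double K 1032 e ⟩
      K * 2064 * e ∎
      where
      open ≤-Reasoning
      double : ∀ K c e → K * c * e + K * c * e ≡ K * (2 * c) * e
      double = solve-∀

    ∑-badEdges*4 : ∑ Θs (λ θ → badEdges θ * 4) ≤ length Θs * e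
    ∑-badEdges*4 = begin
        ∑ Θs (λ θ → badEdges θ * 4)   ≡⟨ ∑-*ʳ Θs 4 badEdges ⟩
        ∑ Θs badEdges * 4             ≤⟨ *-monoˡ-≤ 4 ∑-badEdges ⟩
        K * 2064 * e * 4              ≡⟨ rotate K 2064 e 4 ⟩
        K * 8256 * e                  ≤⟨ *-monoˡ-≤ e K*8256≤ ⟩
        length Θs * e                 ∎
      where
      open ≤-Reasoning
      rotate : ∀ K c e d → K * c * e * d ≡ K * (c * d) * e
      rotate = solve-∀

    -- Both sides together lose at most 2064 K e edges summed over all parameters. As 4 · 2064 =
    -- 8256 and there are at least 8256 K parameters, some parameter loses at most a quarter of the
    -- edges. `suc e` turns this into the strict inequality that `average` expects.
    goodParameter : Σ Θ λ θ → badEdges θ * 4 ≤ e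
    goodParameter = proj₁ found , ≤-pred (proj₂ (proj₂ found))
      where
      found : Σ Θ λ θ → θ ∈ Θs × badEdges θ * 4 < suc e
      found = average Θs (suc e) (≤-<-trans ∑-badEdges*4 (*-monoʳ-< (length Θs) {{>-nonZero 1≤Θ}} (n<1+n e)))

    θ : Θ
    θ = proj₁ goodParameter

    open Pruning R R? (S₁.threshold θ) (S₂.threshold θ) public

    -- The budget is 8e. Bad vertices cost at most 2e by the choice of `θ`, the shares δ/8 cost e on
    -- each side, and the terms 2K cost 32NK, which is less than 4e by hypothesis; this last term
    -- makes the inequality strict.
    fewRemoved : N * K * 8 < e → ∑ as (S₁.threshold θ) + ∑ bs (S₂.threshold θ) < e
    fewRemoved many = *-cancelˡ-< 8 _ _ (begin-strict
      8 * (∑ as (S₁.threshold θ) + ∑ bs (S₂.threshold θ))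
        ≡⟨ trans (*-distribˡ-+ 8 (∑ as (S₁.threshold θ)) _) (cong₂ _+_ (sym (∑-*ˡ as 8 _)) (sym (∑-*ˡ bs 8 _))) ⟩
      ∑ as (λ i → 8 * S₁.threshold θ i) + ∑ bs (λ j → 8 * S₂.threshold θ j)
        ≤⟨ +-mono-≤ (∑-mono as (λ {i} _ → S₁.threshold-≤ θ i)) (∑-mono bs (λ {j} _ → S₂.threshold-≤ θ j)) ⟩
      ∑ as (λ i → 8 * b₁ i + (K * 16 + S₁.δ i)) + ∑ bs (λ j → 8 * b₂ j + (K * 16 + S₂.δ j))
        ≡⟨ cong₂ _+_ (expand as b₁ S₁.δ) (expand bs b₂ S₂.δ) ⟩
      (8 * ∑ as b₁ + (length as * (K * 16) + e)) + (8 * ∑ bs b₂ + (length bs * (K * 16) + ∑ bs S₂.δ))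
        ≤⟨ +-mono-≤ (+-monoʳ-≤ (8 * ∑ as b₁) (+-monoˡ-≤ e (*-monoˡ-≤ (K * 16) as≤N)))
             (+-monoʳ-≤ (8 * ∑ bs b₂) (+-mono-≤ (*-monoˡ-≤ (K * 16) bs≤N) (≤-reflexive (sym e-swap)))) ⟩
      (8 * ∑ as b₁ + (N * (K * 16) + e)) + (8 * ∑ bs b₂ + (N * (K * 16) + e))
        ≡⟨ regroup (∑ as b₁) (∑ bs b₂) N K e ⟩
      2 * (badEdges θ * 4) + 4 * (N * K * 8) + 2 * e
        ≤⟨ +-monoˡ-≤ (2 * e) (+-monoˡ-≤ (4 * (N * K * 8)) (*-monoʳ-≤ 2 (proj₂ goodParameter))) ⟩
      2 * e + 4 * (N * K * 8) + 2 * e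
        <⟨ +-monoˡ-< (2 * e) (+-monoʳ-< (2 * e) (*-monoʳ-< 4 many)) ⟩
      2 * e + 4 * e + 2 * e
        ≡⟨ total e ⟩
      8 * e ∎)
      where
      open ≤-Reasoning
      b₁ = λ i → S₁.δ i * 𝟙 (S₁.bad? θ i)
      b₂ = λ j → S₂.δ j * 𝟙 (S₂.bad? θ j)
      expand : ∀ {C : Set} (xs : List C) f g → ∑ xs (λ x → 8 * f x + (K * 16 + g x)) ≡ 8 * ∑ xs f + (length xs * (K * 16) + ∑ xs g)
      expand xs f g = trans (∑-+ xs _ _) (cong₂ _+_ (∑-*ˡ xs 8 f) (trans (∑-+ xs _ g) (cong (_+ ∑ xs g) (∑-const xs (K * 16)))))
      regroup : ∀ a b N K e → (8 * a + (N * (K * 16) + e)) + (8 * b + (N * (K * 16) + e)) ≡ 2 * ((a + b) * 4) + 4 * (N * K * 8) + 2 * e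
      regroup = solve-∀
      total : ∀ e → 2 * e + 4 * e + 2 * e ≡ 8 * e
      total = solve-∀

    selection : N * K * 8 < e → Core as bs
    selection many = prune (length as + length bs) as bs ≤-refl (fewRemoved many)

    -- The label counts are stated for any decidable set `S` containing the labels of the
    -- neighbours, because `S` will be the zero set of a polynomial: vanishing at all neighbours
    -- then means at least `K` roots.
    record Outcome : Set₁ where
      field
        parameter : Θ
        as′ : List A
        bs′ : List B
        as′⊑ : as′ ⊑ as
        bs′⊑ : bs′ ⊑ bs
        nonempty : 0 < edges as′ bs′
        regular₁ : ∀ {i} → i ∈ as′ → ¬ E₁ parameter i
        regular₂ : ∀ {j} → j ∈ bs′ → ¬ E₂ parameter j
        manyLabels₁ : ∀ {i} → i ∈ as′ → ∀ {L : Set} (Ls : List L) → Unique Ls → (∀ l → l ∈ Ls) → ((l l′ : L) → Dec (l ≡ l′)) → (ξ : B → L) →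
          (∀ {j j′} → j ∈ bs′ → j′ ∈ bs′ → ξ j ≡ ξ j′ → C₁ parameter j j′) →
          ∀ {S : L → Set} (S? : ∀ l → Dec (S l)) → (∀ {j} → j ∈ bs′ → R i j → S (ξ j)) → K ≤ ∑ Ls (λ l → 𝟙 (S? l))
        manyLabels₂ : ∀ {j} → j ∈ bs′ → ∀ {L : Set} (Ls : List L) → Unique Ls → (∀ l → l ∈ Ls) → ((l l′ : L) → Dec (l ≡ l′)) → (ξ : A → L) →
          (∀ {i i′} → i ∈ as′ → i′ ∈ as′ → ξ i ≡ ξ i′ → C₂ parameter i i′) →
          ∀ {S : L → Set} (S? : ∀ l → Dec (S l)) → (∀ {i} → i ∈ as′ → R i j → S (ξ i)) → K ≤ ∑ Ls (λ l → 𝟙 (S? l))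

    outcome : N * K * 8 < e → Outcome
    outcome many = record
      { parameter = θ
      ; as′ = as′ ; bs′ = bs′ ; as′⊑ = as′⊑ ; bs′⊑ = bs′⊑ ; nonempty = nonempty
      ; regular₁ = λ {i} i∈ q → proj₁ (S₁.notBad θ bs′ bs′⊑ i (large₁ i∈)) (inj₁ q)
      ; regular₂ = λ {j} j∈ q → proj₁ (S₂.notBad θ as′ as′⊑ j (large₂ j∈)) (inj₁ q)
      ; manyLabels₁ = λ {i} i∈ → S₁.manyLabels θ bs′ bs′⊑ i (large₁ i∈)
      ; manyLabels₂ = λ {j} j∈ → S₂.manyLabels θ as′ as′⊑ j (large₂ j∈) }
      where
      core : Core as bs
      core = selection many
      open Core core

-- Numerical bookkeeping: closing the loop and choosing the parameters.

module Arithmetic where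

  open import Data.Nat
  open import Data.Nat.Properties
  open import Data.Nat.Tactic.RingSolver using (solve-∀)
  open import Relation.Binary.PropositionalEquality
  open ≤-Reasoning

  -- The isosceles count T of Y and its bisector energy Q bound each other; with these parameters the loop closes.
  module Bootstrap (p n T G Q N κ W Λ : ℕ) (1≤Λ : 1 ≤ Λ) (1≤N : 1 ≤ N)
    (T≤ : T ≤ (n * n + n * n) + (2 * n * (n + n) + G))
    (G≤ : 2 * Λ * p * G ≤ Λ * Λ * (p * p) * n + 2 * Λ * n * (n * n) + p * Q)
    (Q≤ : Q * N * N ≤ 2 * (n * n * κ) * (N * N) + 2 * W * (n * T + p * (N * N)))
    (n²≡ : n * n ≡ Λ * (p * p)) (12p≤n : 12 * p ≤ n) (2Wn≤ : 2 * W * n ≤ Λ * (N * N)) (2κp≤ : 2 * κ * p ≤ Λ * n)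
    (2Wp²≤ : 2 * W * (p * p) ≤ Λ * (n * (n * n))) where

    private
      n³ = n * (n * n)
      instance
        ΛNN≢0 : NonZero (Λ * (N * N))
        ΛNN≢0 = >-nonZero (*-mono-≤ 1≤Λ (*-mono-≤ 1≤N 1≤N))
        NN≢0 : NonZero (N * N)
        NN≢0 = >-nonZero (*-mono-≤ 1≤N 1≤N)

    G-bound : 2 * Λ * p * G ≤ 3 * (Λ * n³) + p * Q
    G-bound = begin
      2 * Λ * p * G                                            ≤⟨ G≤ ⟩
      Λ * Λ * (p * p) * n + 2 * Λ * n * (n * n) + p * Q        ≡⟨ e₁ Λ p n Q ⟩
      Λ * n * (Λ * (p * p)) + 2 * Λ * n * (n * n) + p * Q      ≡⟨ cong (λ w → Λ * n * w + 2 * Λ * n * (n * n) + p * Q) (sym n²≡) ⟩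
      Λ * n * (n * n) + 2 * Λ * n * (n * n) + p * Q            ≡⟨ e₂ Λ p n Q ⟩
      3 * (Λ * n³) + p * Q                                     ∎
      where
      e₁ : ∀ Λ p n Q → Λ * Λ * (p * p) * n + 2 * Λ * n * (n * n) + p * Q ≡ Λ * n * (Λ * (p * p)) + 2 * Λ * n * (n * n) + p * Q
      e₁ = solve-∀
      e₂ : ∀ Λ p n Q → Λ * n * (n * n) + 2 * Λ * n * (n * n) + p * Q ≡ 3 * (Λ * (n * (n * n))) + p * Q
      e₂ = solve-∀

    loop : 2 * Λ * p * T ≤ 4 * (Λ * n³) + p * Q
    loop = begin
      2 * Λ * p * T                                            ≤⟨ *-monoʳ-≤ (2 * Λ * p) T≤ ⟩
      2 * Λ * p * ((n * n + n * n) + (2 * n * (n + n) + G))    ≡⟨ e₁ Λ p n G ⟩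
      Λ * (n * n) * (12 * p) + 2 * Λ * p * G                   ≤⟨ +-mono-≤ (*-monoʳ-≤ (Λ * (n * n)) 12p≤n) G-bound ⟩
      Λ * (n * n) * n + (3 * (Λ * n³) + p * Q)                 ≡⟨ e₂ Λ n (p * Q) ⟩
      4 * (Λ * n³) + p * Q                                     ∎
      where
      e₁ : ∀ Λ p n G → 2 * Λ * p * ((n * n + n * n) + (2 * n * (n + n) + G)) ≡ Λ * (n * n) * (12 * p) + 2 * Λ * p * G
      e₁ = solve-∀
      e₂ : ∀ Λ n q → Λ * (n * n) * n + (3 * (Λ * (n * (n * n))) + q) ≡ 4 * (Λ * (n * (n * n))) + q
      e₂ = solve-∀

    pQ-bound : p * (Q * N * N) ≤ 2 * (Λ * n³) * (N * N) + Λ * (N * N) * (p * T)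
    pQ-bound = begin
      p * (Q * N * N)
        ≤⟨ *-monoʳ-≤ p Q≤ ⟩
      p * (2 * (n * n * κ) * (N * N) + 2 * W * (n * T + p * (N * N)))
        ≡⟨ e₁ p n κ N W T ⟩
      n * n * (N * N) * (2 * κ * p) + (2 * W * n) * (p * T) + 2 * W * (p * p) * (N * N)
        ≤⟨ +-mono-≤ (+-mono-≤ (*-monoʳ-≤ (n * n * (N * N)) 2κp≤) (*-monoˡ-≤ (p * T) 2Wn≤)) (*-monoˡ-≤ (N * N) 2Wp²≤) ⟩
      n * n * (N * N) * (Λ * n) + Λ * (N * N) * (p * T) + Λ * n³ * (N * N)
        ≡⟨ e₂ n N Λ (p * T) ⟩
      2 * (Λ * n³) * (N * N) + Λ * (N * N) * (p * T) ∎
      where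
      e₁ : ∀ p n κ N W T → p * (2 * (n * n * κ) * (N * N) + 2 * W * (n * T + p * (N * N))) ≡ n * n * (N * N) * (2 * κ * p) + (2 * W * n) * (p * T) + 2 * W * (p * p) * (N * N)
      e₁ = solve-∀
      e₂ : ∀ n N Λ t → n * n * (N * N) * (Λ * n) + Λ * (N * N) * t + Λ * (n * (n * n)) * (N * N) ≡ 2 * (Λ * (n * (n * n))) * (N * N) + Λ * (N * N) * t
      e₂ = solve-∀

    -- `loop` times N² has 2ΛN²pT on the left; substituting `pQ-bound` for pQN² puts ΛN²pT on the
    -- right, exactly half of it. Cancelling leaves T bounded with no reference to Q, and Q is then
    -- bounded in turn.
    pT≤6n³ : p * T ≤ 6 * n³
    pT≤6n³ = *-cancelˡ-≤ (Λ * (N * N)) (+-cancelʳ-≤ (Λ * (N * N) * (p * T)) _ _ (begin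
      Λ * (N * N) * (p * T) + Λ * (N * N) * (p * T)                      ≡⟨ e₁ Λ N p T ⟩
      2 * Λ * p * T * (N * N)                                            ≤⟨ *-monoˡ-≤ (N * N) loop ⟩
      (4 * (Λ * n³) + p * Q) * (N * N)                                   ≡⟨ e₂ (Λ * n³) p Q N ⟩
      4 * (Λ * n³) * (N * N) + p * (Q * N * N)                           ≤⟨ +-monoʳ-≤ (4 * (Λ * n³) * (N * N)) pQ-bound ⟩
      4 * (Λ * n³) * (N * N) + (2 * (Λ * n³) * (N * N) + Λ * (N * N) * (p * T)) ≡⟨ e₃ Λ n³ N (Λ * (N * N) * (p * T)) ⟩
      Λ * (N * N) * (6 * n³) + Λ * (N * N) * (p * T)                     ∎))
      where
      e₁ : ∀ Λ N p T → Λ * (N * N) * (p * T) + Λ * (N * N) * (p * T) ≡ 2 * Λ * p * T * (N * N)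
      e₁ = solve-∀
      e₂ : ∀ a p Q N → (4 * a + p * Q) * (N * N) ≡ 4 * a * (N * N) + p * (Q * N * N)
      e₂ = solve-∀
      e₃ : ∀ Λ n³ N t → 4 * (Λ * n³) * (N * N) + (2 * (Λ * n³) * (N * N) + t) ≡ Λ * (N * N) * (6 * n³) + t
      e₃ = solve-∀

    pQ≤8Λn³ : p * Q ≤ 8 * (Λ * n³)
    pQ≤8Λn³ = *-cancelʳ-≤ _ _ (N * N) (begin
      p * Q * (N * N)                                       ≡⟨ e₁ p Q N ⟩
      p * (Q * N * N)                                       ≤⟨ pQ-bound ⟩
      2 * (Λ * n³) * (N * N) + Λ * (N * N) * (p * T)        ≤⟨ +-monoʳ-≤ (2 * (Λ * n³) * (N * N)) (*-monoʳ-≤ (Λ * (N * N)) pT≤6n³) ⟩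
      2 * (Λ * n³) * (N * N) + Λ * (N * N) * (6 * n³)       ≡⟨ e₂ Λ n³ N ⟩
      8 * (Λ * n³) * (N * N)                                ∎)
      where
      e₁ : ∀ p Q N → p * Q * (N * N) ≡ p * (Q * N * N)
      e₁ = solve-∀
      e₂ : ∀ Λ n³ N → 2 * (Λ * n³) * (N * N) + Λ * (N * N) * (6 * n³) ≡ 8 * (Λ * n³) * (N * N)
      e₂ = solve-∀

    module Pinned (x T′ G′ R : ℕ) (n≤x : n ≤ x) (1≤n : 1 ≤ n)
      (T′≤ : T′ ≤ (x * n + x * n) + (2 * n * (x + n) + G′))
      (G′≤ : 2 * Λ * p * G′ ≤ Λ * Λ * (p * p) * x + 2 * Λ * x * (n * n) + p * Q)
      (R≥ : x * n * (x * n) ≤ 4 * (x * R * T′)) where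

      pG′≤ : 2 * (p * G′) ≤ 11 * (x * (n * n))
      pG′≤ = *-cancelˡ-≤ Λ {{>-nonZero 1≤Λ}} (begin
        Λ * (2 * (p * G′))                                                ≡⟨ e₁ Λ p G′ ⟩
        2 * Λ * p * G′                                                    ≤⟨ G′≤ ⟩
        Λ * Λ * (p * p) * x + 2 * Λ * x * (n * n) + p * Q                 ≤⟨ +-monoʳ-≤ (Λ * Λ * (p * p) * x + 2 * Λ * x * (n * n)) pQ≤8Λn³ ⟩
        Λ * Λ * (p * p) * x + 2 * Λ * x * (n * n) + 8 * (Λ * n³)          ≡⟨ e₂ Λ (p * p) x n ⟩
        Λ * x * (Λ * (p * p)) + 2 * Λ * x * (n * n) + 8 * Λ * (n * n) * n ≡⟨ cong (λ w → Λ * x * w + 2 * Λ * x * (n * n) + 8 * Λ * (n * n) * n) (sym n²≡) ⟩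
        Λ * x * (n * n) + 2 * Λ * x * (n * n) + 8 * Λ * (n * n) * n       ≤⟨ +-monoʳ-≤ (Λ * x * (n * n) + 2 * Λ * x * (n * n)) (*-monoʳ-≤ (8 * Λ * (n * n)) n≤x) ⟩
        Λ * x * (n * n) + 2 * Λ * x * (n * n) + 8 * Λ * (n * n) * x       ≡⟨ e₃ Λ x n ⟩
        Λ * (11 * (x * (n * n)))                                          ∎)
        where
        e₁ : ∀ Λ p G → Λ * (2 * (p * G)) ≡ 2 * Λ * p * G
        e₁ = solve-∀
        e₂ : ∀ Λ q x n → Λ * Λ * q * x + 2 * Λ * x * (n * n) + 8 * (Λ * (n * (n * n))) ≡ Λ * x * (Λ * q) + 2 * Λ * x * (n * n) + 8 * Λ * (n * n) * n
        e₂ = solve-∀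
        e₃ : ∀ Λ x n → Λ * x * (n * n) + 2 * Λ * x * (n * n) + 8 * Λ * (n * n) * x ≡ Λ * (11 * (x * (n * n)))
        e₃ = solve-∀

      pT′≤ : p * T′ ≤ 6 * (x * (n * n))
      pT′≤ = *-cancelˡ-≤ 2 (begin
        2 * (p * T′)                                                      ≤⟨ *-monoʳ-≤ 2 (*-monoʳ-≤ p T′≤) ⟩
        2 * (p * ((x * n + x * n) + (2 * n * (x + n) + G′)))              ≤⟨ *-monoʳ-≤ 2 (*-monoʳ-≤ p (+-monoʳ-≤ (x * n + x * n) (+-monoˡ-≤ G′ (*-monoʳ-≤ (2 * n) (+-monoʳ-≤ x n≤x))))) ⟩
        2 * (p * ((x * n + x * n) + (2 * n * (x + x) + G′)))              ≡⟨ e₁ p x n G′ ⟩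
        x * n * (12 * p) + 2 * (p * G′)                                   ≤⟨ +-mono-≤ (*-monoʳ-≤ (x * n) 12p≤n) pG′≤ ⟩
        x * n * n + 11 * (x * (n * n))                                    ≡⟨ e₂ x n ⟩
        2 * (6 * (x * (n * n)))                                           ∎)
        where
        e₁ : ∀ p x n G → 2 * (p * ((x * n + x * n) + (2 * n * (x + x) + G))) ≡ x * n * (12 * p) + 2 * (p * G)
        e₁ = solve-∀
        e₂ : ∀ x n → x * n * n + 11 * (x * (n * n)) ≡ 2 * (6 * (x * (n * n)))
        e₂ = solve-∀

      p≤24R : p ≤ 24 * R
      p≤24R = *-cancelʳ-≤ p (24 * R) (x * n * (x * n)) {{>-nonZero (*-mono-≤ (*-mono-≤ 1≤x 1≤n) (*-mono-≤ 1≤x 1≤n))}} (begin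
        p * (x * n * (x * n))          ≤⟨ *-monoʳ-≤ p R≥ ⟩
        p * (4 * (x * R * T′))         ≡⟨ e₁ p x R T′ ⟩
        4 * (x * R) * (p * T′)         ≤⟨ *-monoʳ-≤ (4 * (x * R)) pT′≤ ⟩
        4 * (x * R) * (6 * (x * (n * n))) ≡⟨ e₂ x R n ⟩
        24 * R * (x * n * (x * n))     ∎)
        where
        1≤x : 1 ≤ x
        1≤x = ≤-trans 1≤n n≤x
        e₁ : ∀ p x R T → p * (4 * (x * R * T)) ≡ 4 * (x * R) * (p * T)
        e₁ = solve-∀
        e₂ : ∀ x R n → 4 * (x * R) * (6 * (x * (n * n))) ≡ 24 * R * (x * n * (x * n))
        e₂ = solve-∀

  -- m is p^{1/4} up to a constant, so q ~ p^{3/4}, N ~ p^{3/2} and n ~ p^{5/4}. The bound on m is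
  -- 4227072 = 16 · 32 · 8256, which makes 8256 M ≤ p for M = 31 m³.
  module Parameters (p m : ℕ) (p≤m⁴ : p ≤ m * (m * (m * m))) (m⁴≤16p : m * (m * (m * m)) ≤ 16 * p) (1≤p : 1 ≤ p) (large : 4227072 ≤ m) where

    -- 512 = 2 · 8 · 32, the constant in 2W ≤ 512 N q that results from W = 8 N (M + 1) and M + 1 ≤
    -- 32 q.
    c = 512
    q = m * (m * m)
    N = q * q
    s = 2 * q
    -- Written so as to coincide with the degree bound of `cubic`. With s = 2q, the s³ = 8q³
    -- coefficients outnumber the N (d + 1) = q²(6q + 1) conditions.
    d = s + (s + (s + 0))
    -- `M` must dominate 4d = 24q, the degree of `transversal`, and d + κ = 30q, the degree of the
    -- polynomial that rules out reguli, while M + 1 stays below 32q.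
    M = q * 31
    κ = q * 24
    W = N * suc M * 8
    n = c * p * m
    Λ = c * m * (c * m)

    1≤m : 1 ≤ m
    1≤m = ≤-trans (s≤s z≤n) large

    1≤q : 1 ≤ q
    1≤q = *-mono-≤ 1≤m (*-mono-≤ 1≤m 1≤m)

    1≤N : 1 ≤ N
    1≤N = *-mono-≤ 1≤q 1≤q

    1≤Λ : 1 ≤ Λ
    1≤Λ = *-mono-≤ 1≤cm 1≤cm
      where
      1≤cm : 1 ≤ c * m
      1≤cm = *-mono-≤ {1} {c} (s≤s z≤n) 1≤m

    1≤n : 1 ≤ n
    1≤n = *-mono-≤ (*-mono-≤ {1} {c} (s≤s z≤n) 1≤p) 1≤m

    few-lines : N * suc d < s * (s * s)
    few-lines = begin-strict
      N * suc d                ≡⟨ e₁ q ⟩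
      q * q * 1 + q * (q * q) * 6 ≤⟨ +-monoˡ-≤ (q * (q * q) * 6) (≤-trans (*-monoʳ-≤ (q * q) 1≤q) (≤-reflexive (*-assoc q q q))) ⟩
      q * (q * q) + q * (q * q) * 6 ≡⟨ e₂ (q * (q * q)) ⟩
      q * (q * q) * 7          <⟨ *-monoʳ-< (q * (q * q)) {{>-nonZero (*-mono-≤ 1≤q (*-mono-≤ 1≤q 1≤q))}} (n<1+n 7) ⟩
      q * (q * q) * 8          ≡⟨ e₃ q ⟩
      s * (s * s)              ∎
      where
      e₁ : ∀ q → q * q * suc (2 * q + (2 * q + (2 * q + 0))) ≡ q * q * 1 + q * (q * q) * 6
      e₁ = solve-∀
      e₂ : ∀ x → x + x * 6 ≡ x * 7
      e₂ = solve-∀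
      e₃ : ∀ q → q * (q * q) * 8 ≡ 2 * q * (2 * q * (2 * q))
      e₃ = solve-∀

    4d≤M : d + d + (d + d) ≤ M
    4d≤M = ≤-trans (≤-reflexive (e q)) (*-monoʳ-≤ q (m≤m+n 24 7))
      where
      e : ∀ q → let s = 2 * q ; d = s + (s + (s + 0)) in d + d + (d + d) ≡ q * 24
      e = solve-∀

    d+κ≤M : d + κ ≤ M
    d+κ≤M = ≤-trans (≤-reflexive (e q)) (*-monoʳ-≤ q (m≤m+n 30 1))
      where
      e : ∀ q → let s = 2 * q in s + (s + (s + 0)) + q * 24 ≡ q * 30
      e = solve-∀

    sucM≤ : suc M ≤ q * 32
    sucM≤ = ≤-trans (+-monoˡ-≤ M 1≤q) (≤-reflexive (e q))
      where
      e : ∀ q → q + q * 31 ≡ q * 32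
      e = solve-∀

    q*264192≤p : q * 264192 ≤ p
    q*264192≤p = *-cancelˡ-≤ 16 (begin
      16 * (q * 264192)  ≡⟨ e 16 q 264192 ⟩
      q * 4227072        ≤⟨ *-monoʳ-≤ q large ⟩
      q * m              ≡⟨ *-comm q m ⟩
      m * q              ≤⟨ m⁴≤16p ⟩
      16 * p             ∎)
      where
      e : ∀ a q b → a * (q * b) ≡ q * (a * b)
      e = solve-∀

    M*8256≤p : suc M * 8256 ≤ p
    M*8256≤p = begin
      suc M * 8256     ≤⟨ *-monoˡ-≤ 8256 sucM≤ ⟩
      q * 32 * 8256    ≡⟨ *-assoc q 32 8256 ⟩
      q * 264192       ≤⟨ q*264192≤p ⟩
      p                ∎

    M+3<p : M + 3 < p
    M+3<p = begin-strict
      M + 3             ≤⟨ +-monoʳ-≤ M (≤-trans (≤-reflexive (sym (*-identityˡ 3))) (*-monoˡ-≤ 3 1≤q)) ⟩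
      q * 31 + q * 3    ≡⟨ *-distribˡ-+ q 31 3 ⟨
      q * 34            <⟨ *-monoʳ-< q {{>-nonZero 1≤q}} {34} {264192} (m≤m+n 35 264157) ⟩
      q * 264192        ≤⟨ q*264192≤p ⟩
      p                 ∎

    9<p : 9 < p
    9<p = ≤-trans (≤-trans (m≤m+n 10 264182) (≤-trans (≤-reflexive (sym (*-identityˡ 264192))) (*-monoˡ-≤ 264192 1≤q))) q*264192≤p

    12p≤n : 12 * p ≤ n
    12p≤n = ≤-trans (*-monoˡ-≤ p (m≤m+n 12 500)) (≤-trans (≤-reflexive (sym (*-identityʳ (c * p)))) (*-monoʳ-≤ (c * p) 1≤m))

    n²≡ : n * n ≡ Λ * (p * p)
    n²≡ = e c p m
      where
      e : ∀ c p m → c * p * m * (c * p * m) ≡ c * m * (c * m) * (p * p)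
      e = solve-∀

    2W≤ : 2 * W ≤ N * q * c
    2W≤ = begin
      2 * (N * suc M * 8)      ≤⟨ *-monoʳ-≤ 2 (*-monoˡ-≤ 8 (*-monoʳ-≤ N sucM≤)) ⟩
      2 * (N * (q * 32) * 8)   ≡⟨ e N q 32 ⟩
      N * q * (32 * 16)        ≡⟨⟩
      N * q * c                ∎
      where
      e : ∀ N q a → 2 * (N * (q * a) * 8) ≡ N * q * (a * 16)
      e = solve-∀

    2Wn≤ : 2 * W * n ≤ Λ * (N * N)
    2Wn≤ = begin
      2 * W * n                          ≤⟨ *-monoˡ-≤ n 2W≤ ⟩
      N * q * c * (c * p * m)            ≡⟨ e₁ N q c p m ⟩
      N * q * c * c * m * p              ≤⟨ *-monoʳ-≤ (N * q * c * c * m) p≤m⁴ ⟩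
      N * q * c * c * m * (m * q)        ≡⟨ e₂ N q c m ⟩
      c * m * (c * m) * (N * (q * q))    ∎
      where
      e₁ : ∀ N q c p m → N * q * c * (c * p * m) ≡ N * q * c * c * m * p
      e₁ = solve-∀
      e₂ : ∀ N q c m → N * q * c * c * m * (m * q) ≡ c * m * (c * m) * (N * (q * q))
      e₂ = solve-∀

    2κp≤ : 2 * κ * p ≤ Λ * n
    2κp≤ = begin
      2 * (q * 24) * p                   ≡⟨ e₁ q p 24 ⟩
      q * p * 48                         ≤⟨ *-monoʳ-≤ (q * p) {48} {c * (c * c)} (m≤m+n 48 134217680) ⟩
      q * p * (c * (c * c))              ≡⟨ e₂ m p c ⟩
      c * m * (c * m) * (c * p * m)      ∎
      where
      e₁ : ∀ q p a → 2 * (q * a) * p ≡ q * p * (2 * a)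
      e₁ = solve-∀
      e₂ : ∀ m p c → m * (m * m) * p * (c * (c * c)) ≡ c * m * (c * m) * (c * p * m)
      e₂ = solve-∀

    2Wp²≤ : 2 * W * (p * p) ≤ Λ * (n * (n * n))
    2Wp²≤ = begin
      2 * W * (p * p)                            ≤⟨ *-monoˡ-≤ (p * p) 2W≤ ⟩
      q * q * q * c * (p * p)                    ≡⟨ e₁ m q c p ⟩
      q * m * m * c * (p * p) * (m * q)          ≤⟨ *-monoʳ-≤ (q * m * m * c * (p * p)) m⁴≤16p ⟩
      q * m * m * c * (p * p) * (16 * p)         ≡⟨ e₂ m c p 16 ⟩
      m * m * m * m * m * (p * p * p) * c * 16   ≤⟨ *-monoʳ-≤ (m * m * m * m * m * (p * p * p) * c) {16} {c * (c * (c * c))} (m≤m+n 16 68719476720) ⟩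
      m * m * m * m * m * (p * p * p) * c * (c * (c * (c * c))) ≡⟨ e₃ m c p ⟩
      c * m * (c * m) * (c * p * m * (c * p * m * (c * p * m))) ∎
      where
      e₁ : ∀ m q c p → q * (m * (m * m)) * q * c * (p * p) ≡ q * m * m * c * (p * p) * (m * q)
      e₁ = solve-∀
      e₂ : ∀ m c p a → m * (m * m) * m * m * c * (p * p) * (a * p) ≡ m * m * m * m * m * (p * p * p) * c * a
      e₂ = solve-∀
      e₃ : ∀ m c p → m * m * m * m * m * (p * p * p) * c * (c * (c * (c * c))) ≡ c * m * (c * m) * (c * p * m * (c * p * m * (c * p * m)))
      e₃ = solve-∀

    4n≤κ² : 4 * n ≤ κ * κ
    4n≤κ² = begin
      4 * (c * p * m)                    ≡⟨ e₁ c p m ⟩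
      c * 4 * m * p                      ≤⟨ *-monoʳ-≤ (c * 4 * m) p≤m⁴ ⟩
      c * 4 * m * (m * (m * (m * m)))    ≡⟨ e₂ (c * 4) m ⟩
      q * (m * m) * (c * 4)              ≤⟨ *-monoʳ-≤ (q * (m * m)) {c * 4} {m} (≤-trans (m≤m+n 2048 4225024) large) ⟩
      q * (m * m) * m                    ≡⟨ e₃ m ⟩
      q * q * 1                          ≤⟨ *-monoʳ-≤ (q * q) {1} {576} (s≤s z≤n) ⟩
      q * q * (24 * 24)                  ≡⟨ e₄ q 24 ⟩
      κ * κ                              ∎
      where
      e₁ : ∀ c p m → 4 * (c * p * m) ≡ c * 4 * m * p
      e₁ = solve-∀
      e₂ : ∀ a m → a * m * (m * (m * (m * m))) ≡ m * (m * m) * (m * m) * a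
      e₂ = solve-∀
      e₃ : ∀ m → m * (m * m) * (m * m) * m ≡ m * (m * m) * (m * (m * m)) * 1
      e₃ = solve-∀
      e₄ : ∀ q a → q * q * (a * a) ≡ q * a * (q * a)
      e₄ = solve-∀

    2n<κ² : 2 * n < κ * κ
    2n<κ² = <-≤-trans (*-monoˡ-< n {{>-nonZero 1≤n}} {2} {4} (s≤s (s≤s (s≤s z≤n)))) 4n≤κ²

    1<κ : 1 < κ
    1<κ = ≤-trans (m≤m+n 2 22) (≤-trans (≤-reflexive (sym (*-identityˡ 24))) (*-monoˡ-≤ 24 1≤q))

-- An integer substitute for the fourth root of p, and the size of E in terms of it.

module Scales where

  open import Data.Nat
  open import Data.Nat.Properties
  open import Data.Nat.Solver using (module +-*-Solver)
  open import Data.Nat.Tactic.RingSolver using (solve-∀)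
  open import Data.Product using (Σ; _×_; _,_)
  open import Relation.Nullary using (Dec; yes; no)
  open import Relation.Binary.PropositionalEquality
  open +-*-Solver

  -- As p grows, m is kept until p passes m⁴, and then doubled. At that moment m⁴ is the previous
  -- value of p, so the new fourth power is exactly 16 times that value.
  quarticRoot : ∀ p → 1 ≤ p → Σ ℕ λ m → p ≤ m * (m * (m * m)) × m * (m * (m * m)) ≤ 16 * p
  quarticRoot (suc zero) _ = 1 , ≤-refl , s≤s z≤n
  quarticRoot (suc (suc k)) _ = next (quarticRoot (suc k) (s≤s z≤n))
    where
    next : (Σ ℕ λ m → suc k ≤ m * (m * (m * m)) × m * (m * (m * m)) ≤ 16 * suc k) → Σ ℕ λ m → suc (suc k) ≤ m * (m * (m * m)) × m * (m * (m * m)) ≤ 16 * suc (suc k)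
    next (m , lower , upper) = go (suc (suc k) ≤? m * (m * (m * m)))
      where
      go : Dec (suc (suc k) ≤ m * (m * (m * m))) → Σ ℕ λ m → suc (suc k) ≤ m * (m * (m * m)) × m * (m * (m * m)) ≤ 16 * suc (suc k)
      go (yes q) = m , q , ≤-trans upper (*-monoʳ-≤ 16 (n≤1+n (suc k)))
      go (no ¬q) = 2 * m , ≤-trans (≤-trans (s≤s (m≤n+m (suc k) k)) (≤-trans (≤-reflexive (e₂ k)) (*-monoˡ-≤ (suc k) {2} {16} (s≤s (s≤s z≤n))))) (≤-reflexive (sym doubled)) ,
          ≤-trans (≤-reflexive doubled) (*-monoʳ-≤ 16 (n≤1+n (suc k)))
        where
        e₁ : ∀ m → 2 * m * (2 * m * (2 * m * (2 * m))) ≡ 16 * (m * (m * (m * m)))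
        e₁ = solve-∀
        e₂ : ∀ k → suc (k + suc k) ≡ 2 * suc k
        e₂ = solve-∀
        doubled : 2 * m * (2 * m * (2 * m * (2 * m))) ≡ 16 * suc k
        doubled = trans (e₁ m) (cong (16 *_) (≤-antisym (s≤s⁻¹ (≰⇒> ¬q)) lower))

  ^4-cancel-≤ : ∀ {x y} → x ^ 4 ≤ y ^ 4 → x ≤ y
  ^4-cancel-≤ {x} {y} h = ≮⇒≥ (λ y<x → <⇒≱ (^-monoˡ-< 4 y<x) h)

  module Sizes (a p L : ℕ) (4096≤a³ : 4096 ≤ a * (a * a)) (1≤p : 1 ≤ p) (L≤p⁴ : L ≤ p * p * (p * p)) (L-large : suc (a * (a * a)) ^ 4 * p ^ 13 ≤ L ^ 4) (m : ℕ) (p≤m⁴ : p ≤ m * (m * (m * m))) (m⁴≤16p : m * (m * (m * m)) ≤ 16 * p) where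

    -- This is how a large constant excludes small primes. Since |E| ≤ p⁴, the hypothesis gives (a³
    -- + 1)⁴ ≤ p³; but m < a would give p ≤ a⁴ and so p³ ≤ a¹² = (a³)⁴. Hence the constant of the
    -- theorem has the shape a³ + 1.
    root-large : a ≤ m
    root-large = ≮⇒≥ (λ m<a → <⇒≱ (^-monoˡ-< 4 (n<1+n (a * (a * a)))) (begin
      suc (a * (a * a)) ^ 4     ≤⟨ *-cancelʳ-≤ _ _ (p ^ 13) {{m^n≢0 p 13 {{>-nonZero 1≤p}}}} (≤-trans L-large (≤-trans (^-monoˡ-≤ 4 L≤p⁴) (≤-reflexive (e₁ p)))) ⟩
      p ^ 3                     ≤⟨ ^-monoˡ-≤ 3 (≤-trans p≤m⁴ (quartic-mono (<⇒≤ m<a))) ⟩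
      (a * (a * (a * a))) ^ 3   ≡⟨ e₂ a ⟩
      (a * (a * a)) ^ 4         ∎))
      where
      open ≤-Reasoning
      quartic-mono : ∀ {x y} → x ≤ y → x * (x * (x * x)) ≤ y * (y * (y * y))
      quartic-mono q = *-mono-≤ q (*-mono-≤ q (*-mono-≤ q q))
      e₁ : ∀ p → (p * p * (p * p)) ^ 4 ≡ p ^ 3 * p ^ 13
      e₁ = solve 1 (λ p → (p :* p :* (p :* p)) :^ 4 := p :^ 3 :* p :^ 13) refl
      e₂ : ∀ a → (a * (a * (a * a))) ^ 3 ≡ (a * (a * a)) ^ 4
      e₂ = solve 1 (λ a → (a :* (a :* (a :* a))) :^ 3 := (a :* (a :* a)) :^ 4) refl

    -- After taking fourth powers, m⁴ ≤ 16p contributes a factor 2⁴, and 2 · 4 · 512 = 4096 is the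
    -- constant required of a³.
    fibres-large : 2 * (p * p) * (2 * (512 * p * m)) ≤ L
    fibres-large = ^4-cancel-≤ (begin
      (2 * (p * p) * (2 * (512 * p * m))) ^ 4             ≡⟨ e₁ 512 p m ⟩
      (4 * 512) ^ 4 * p ^ 12 * (m * (m * (m * m)))        ≤⟨ *-monoʳ-≤ ((4 * 512) ^ 4 * p ^ 12) m⁴≤16p ⟩
      (4 * 512) ^ 4 * p ^ 12 * (16 * p)                   ≡⟨ e₂ (4 * 512) p ⟩
      (2 * (4 * 512)) ^ 4 * p ^ 13                        ≤⟨ *-monoˡ-≤ (p ^ 13) (^-monoˡ-≤ 4 (≤-trans 4096≤a³ (n≤1+n _))) ⟩
      suc (a * (a * a)) ^ 4 * p ^ 13                      ≤⟨ L-large ⟩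
      L ^ 4                                               ∎)
      where
      open ≤-Reasoning
      e₁ : ∀ c p m → (2 * (p * p) * (2 * (c * p * m))) ^ 4 ≡ (4 * c) ^ 4 * p ^ 12 * (m * (m * (m * m)))
      e₁ = solve 3 (λ c p m → (con 2 :* (p :* p) :* (con 2 :* (c :* p :* m))) :^ 4 := (con 4 :* c) :^ 4 :* p :^ 12 :* (m :* (m :* (m :* m)))) refl
      e₂ : ∀ c p → c ^ 4 * p ^ 12 * (16 * p) ≡ (2 * c) ^ 4 * p ^ 13
      e₂ = solve 2 (λ c p → c :^ 4 :* p :^ 12 :* (con 16 :* p) := (con 2 :* c) :^ 4 :* p :^ 13) refl

module Geometry {p : ℕ} (K : PrimeField p) where

  module 𝔽ₚ = FieldTheory K

  -- Polynomials in one variable as functions on F, their derivatives and Wronskians.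

  module Polynomials where

    open FiniteSums
    open 𝔽ₚ
    open import Data.Nat as ℕ using (ℕ; zero; suc; _≤_; _<_; _⊔_; z≤n; s≤s)
    import Data.Nat.Properties as ℕₚ
    open import Data.Fin as Fin using (Fin)
    import Data.Fin.Properties as Finₚ
    open import Data.Integer as ℤ using (ℤ)
    open import Data.List using (List; []; _∷_; length; allFin)
    open import Data.List.Properties using (length-tabulate)
    open import Data.List.Membership.Propositional using (_∈_)
    open import Data.List.Relation.Unary.Any using (here; there)
    open import Data.List.Relation.Unary.All as All using (All; []; _∷_)
    open import Data.List.Relation.Unary.Unique.Propositional using (Unique; []; _∷_)
    open import Data.List.Relation.Unary.Unique.Propositional.Properties using (allFin⁺)
    open import Data.Product using (Σ; _,_; proj₂)
    open import Relation.Nullary using (Dec; yes; no)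
    open import Relation.Binary.PropositionalEquality

    _≟_ : (x y : F) → Dec (x ≡ y)
    _≟_ = Finₚ._≟_

    open Solver

    *-cancel-0 : ∀ {x y} → x ≢ 0# → x * y ≡ 0# → y ≡ 0#
    *-cancel-0 {x} {y} x≢0 eq with z , xz ← inverse x x≢0 = begin
      y             ≡⟨ *-identityˡ y ⟨
      1# * y        ≡⟨ cong (_* y) xz ⟨
      x * z * y     ≡⟨ solve 3 (λ x y z → x :* z :* y := z :* (x :* y)) refl x y z ⟩
      z * (x * y)   ≡⟨ cong (z *_) eq ⟩
      z * 0#        ≡⟨ zeroʳ z ⟩
      0#            ∎
      where open ≡-Reasoning

    *-nonzero : ∀ {x y} → x ≢ 0# → y ≢ 0# → x * y ≢ 0#
    *-nonzero x≢0 y≢0 eq = y≢0 (*-cancel-0 x≢0 eq)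

    x-y≡0⇒x≡y : ∀ {x y} → x - y ≡ 0# → x ≡ y
    x-y≡0⇒x≡y {x} {y} eq = begin
      x             ≡⟨ solve 2 (λ x y → x := (x :- y) :+ y) refl x y ⟩
      x - y + y     ≡⟨ cong (_+ y) eq ⟩
      0# + y        ≡⟨ +-identityˡ y ⟩
      y             ∎
      where open ≡-Reasoning

    x≢y⇒x-y≢0 : ∀ {x y} → x ≢ y → x - y ≢ 0#
    x≢y⇒x-y≢0 x≢y eq = x≢y (x-y≡0⇒x≡y eq)

    x-x≡0 : ∀ x → x - x ≡ 0#
    x-x≡0 = -‿inverseʳ

    *-cancelˡ : ∀ {x y z} → x ≢ 0# → x * y ≡ x * z → y ≡ z
    *-cancelˡ {x} {y} {z} x≢0 eq = x-y≡0⇒x≡y (*-cancel-0 x≢0 (begin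
      x * (y - z)     ≡⟨ solve 3 (λ x y z → x :* (y :- z) := x :* y :- x :* z) refl x y z ⟩
      x * y - x * z   ≡⟨ cong (_- x * z) eq ⟩
      x * z - x * z   ≡⟨ x-x≡0 _ ⟩
      0#              ∎))
      where open ≡-Reasoning

    allF : List F
    allF = allFin p

    length-allF : length allF ≡ p
    length-allF = length-tabulate {n = p} (λ i → i)

    -- Polynomials in one variable, as expressions: they are compared as functions on F, which is
    -- harmless as long as the degrees stay below p.
    data Poly₁ : Set where
      Con : F → Poly₁
      T : Poly₁
      _⊞_ _⊠_ : Poly₁ → Poly₁ → Poly₁

    infixl 6 _⊞_
    infixl 7 _⊠_

    eval : Poly₁ → F → F
    eval (Con c) t = c
    eval T t = t
    eval (a ⊞ b) t = eval a t + eval b t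
    eval (a ⊠ b) t = eval a t * eval b t

    deg : Poly₁ → ℕ
    deg (Con c) = 0
    deg T = 1
    deg (a ⊞ b) = deg a ⊔ deg b
    deg (a ⊠ b) = deg a ℕ.+ deg b

    D : Poly₁ → Poly₁
    D (Con c) = Con 0#
    D T = Con 1#
    D (a ⊞ b) = D a ⊞ D b
    D (a ⊠ b) = D a ⊠ b ⊞ a ⊠ D b

    deg-D : ∀ a → deg (D a) ≤ deg a
    deg-D (Con c) = z≤n
    deg-D T = z≤n
    deg-D (a ⊞ b) = ℕₚ.⊔-mono-≤ (deg-D a) (deg-D b)
    deg-D (a ⊠ b) = ℕₚ.⊔-lub (ℕₚ.+-monoˡ-≤ (deg b) (deg-D a)) (ℕₚ.+-monoʳ-≤ (deg a) (deg-D b))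

    deg0⇒constant : ∀ a → deg a ≡ 0 → ∀ r t → eval a t ≡ eval a r
    deg0⇒constant (Con c) _ r t = refl
    deg0⇒constant (a ⊞ b) eq r t = cong₂ _+_
      (deg0⇒constant a (ℕₚ.n≤0⇒n≡0 (ℕₚ.≤-trans (ℕₚ.m≤m⊔n (deg a) (deg b)) (ℕₚ.≤-reflexive eq))) r t)
      (deg0⇒constant b (ℕₚ.n≤0⇒n≡0 (ℕₚ.≤-trans (ℕₚ.m≤n⊔m (deg a) (deg b)) (ℕₚ.≤-reflexive eq))) r t)
    deg0⇒constant (a ⊠ b) eq r t = cong₂ _*_
      (deg0⇒constant a (ℕₚ.m+n≡0⇒m≡0 (deg a) eq) r t) (deg0⇒constant b (ℕₚ.m+n≡0⇒n≡0 (deg a) eq) r t)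

    deg0⇒D≡0 : ∀ a → deg a ≡ 0 → ∀ t → eval (D a) t ≡ 0#
    deg0⇒D≡0 (Con c) _ t = refl
    deg0⇒D≡0 (a ⊞ b) eq t = trans (cong₂ _+_
      (deg0⇒D≡0 a (ℕₚ.n≤0⇒n≡0 (ℕₚ.≤-trans (ℕₚ.m≤m⊔n (deg a) (deg b)) (ℕₚ.≤-reflexive eq))) t)
      (deg0⇒D≡0 b (ℕₚ.n≤0⇒n≡0 (ℕₚ.≤-trans (ℕₚ.m≤n⊔m (deg a) (deg b)) (ℕₚ.≤-reflexive eq))) t)) (+-identityˡ 0#)
    deg0⇒D≡0 (a ⊠ b) eq t = trans (cong₂ (λ u v → u * eval b t + eval a t * v)
      (deg0⇒D≡0 a (ℕₚ.m+n≡0⇒m≡0 (deg a) eq) t) (deg0⇒D≡0 b (ℕₚ.m+n≡0⇒n≡0 (deg a) eq) t))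
      (solve 2 (λ x y → con (ℤ.+ 0) :* x :+ y :* con (ℤ.+ 0) := con (ℤ.+ 0)) refl (eval b t) (eval a t))

    -- The divided difference (a(t) - a(r)) / (t - r).
    quot : F → Poly₁ → Poly₁
    quot r (Con c) = Con 0#
    quot r T = Con 1#
    quot r (a ⊞ b) = quot r a ⊞ quot r b
    quot r (a ⊠ b) with deg a ℕ.≟ 0 | deg b ℕ.≟ 0
    ... | yes _ | _     = Con (eval a r) ⊠ quot r b
    ... | no _  | yes _ = quot r a ⊠ b
    ... | no _  | no _  = quot r a ⊠ b ⊞ Con (eval a r) ⊠ quot r b

    -- This bound is the reason for the case distinction in `quot`. If `a` is constant, the term
    -- `quot r a ⊠ b` of the product rule would be zero as a function and yet keep the formal degree
    -- of `b`, one too many.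
    deg-quot : ∀ r a → deg (quot r a) ≤ deg a ℕ.∸ 1
    deg-quot r (Con c) = z≤n
    deg-quot r T = z≤n
    deg-quot r (a ⊞ b) = ℕₚ.≤-trans (ℕₚ.⊔-mono-≤ (deg-quot r a) (deg-quot r b)) (ℕₚ.≤-reflexive (sym (ℕₚ.∸-distribʳ-⊔ 1 (deg a) (deg b))))
    deg-quot r (a ⊠ b) with deg a ℕ.≟ 0 | deg b ℕ.≟ 0
    ... | yes a0 | _     = ℕₚ.≤-trans (deg-quot r b) (ℕₚ.∸-monoˡ-≤ 1 (ℕₚ.m≤n+m (deg b) (deg a)))
    ... | no _   | yes b0 = ℕₚ.≤-trans (ℕₚ.≤-reflexive (trans (cong (deg (quot r a) ℕ.+_) b0) (ℕₚ.+-identityʳ _)))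
                             (ℕₚ.≤-trans (deg-quot r a) (ℕₚ.∸-monoˡ-≤ 1 (ℕₚ.m≤m+n (deg a) (deg b))))
    ... | no a≢0 | no b≢0 = ℕₚ.⊔-lub
        (ℕₚ.≤-trans (ℕₚ.+-monoˡ-≤ (deg b) (deg-quot r a)) (ℕₚ.≤-reflexive (sym (ℕₚ.+-∸-comm (deg b) (ℕₚ.n≢0⇒n>0 a≢0)))))
        (ℕₚ.≤-trans (deg-quot r b) (ℕₚ.∸-monoˡ-≤ 1 (ℕₚ.m≤n+m (deg b) (deg a))))

    eval-quot : ∀ r a t → eval a t ≡ eval a r + (t - r) * eval (quot r a) t
    eval-quot r (Con c) t = solve 3 (λ c t r → c := c :+ (t :- r) :* con (ℤ.+ 0)) refl c t r
    eval-quot r T t = solve 2 (λ t r → t := r :+ (t :- r) :* con (ℤ.+ 1)) refl t r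
    eval-quot r (a ⊞ b) t = trans (cong₂ _+_ (eval-quot r a t) (eval-quot r b t))
      (solve 5 (λ a b d q s → (a :+ d :* q) :+ (b :+ d :* s) := (a :+ b) :+ d :* (q :+ s)) refl
        (eval a r) (eval b r) (t - r) (eval (quot r a) t) (eval (quot r b) t))
    eval-quot r (a ⊠ b) t with deg a ℕ.≟ 0 | deg b ℕ.≟ 0
    ... | yes a0 | _     = trans (cong₂ _*_ (deg0⇒constant a a0 r t) (eval-quot r b t))
        (solve 4 (λ a b d s → a :* (b :+ d :* s) := a :* b :+ d :* (a :* s)) refl
          (eval a r) (eval b r) (t - r) (eval (quot r b) t))
    ... | no _   | yes b0 = trans (cong₂ _*_ (eval-quot r a t) (deg0⇒constant b b0 r t))
        (trans (solve 4 (λ a b d s → (a :+ d :* s) :* b := a :* b :+ d :* (s :* b)) refl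
          (eval a r) (eval b r) (t - r) (eval (quot r a) t))
          (cong (λ z → eval a r * eval b r + (t - r) * (eval (quot r a) t * z)) (sym (deg0⇒constant b b0 r t))))
    ... | no _   | no _ = trans (cong (_* eval b t) (eval-quot r a t)) (trans
        (solve 4 (λ a b d q → (a :+ d :* q) :* b := a :* b :+ d :* (q :* b)) refl
          (eval a r) (eval b t) (t - r) (eval (quot r a) t))
        (trans (cong (λ z → eval a r * z + (t - r) * (eval (quot r a) t * eval b t)) (eval-quot r b t))
          (solve 6 (λ a b d q s c → a :* (b :+ d :* s) :+ d :* (q :* c) := a :* b :+ d :* (q :* c :+ a :* s)) refl
            (eval a r) (eval b r) (t - r) (eval (quot r a) t) (eval (quot r b) t) (eval b t))))

    D-quot : ∀ r a → eval (D a) r ≡ eval (quot r a) r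
    D-quot r (Con c) = refl
    D-quot r T = refl
    D-quot r (a ⊞ b) = cong₂ _+_ (D-quot r a) (D-quot r b)
    D-quot r (a ⊠ b) with deg a ℕ.≟ 0 | deg b ℕ.≟ 0
    ... | yes a0 | _     = trans (cong₂ (λ u v → u * eval b r + eval a r * v) (deg0⇒D≡0 a a0 r) (D-quot r b))
        (solve 3 (λ x y z → con (ℤ.+ 0) :* x :+ y :* z := y :* z) refl (eval b r) (eval a r) (eval (quot r b) r))
    ... | no _   | yes b0 = trans (cong₂ (λ u v → u * eval b r + eval a r * v) (D-quot r a) (deg0⇒D≡0 b b0 r))
        (solve 3 (λ x y z → x :* y :+ z :* con (ℤ.+ 0) := x :* y) refl (eval (quot r a) r) (eval b r) (eval a r))
    ... | no _   | no _ = cong₂ (λ u v → u * eval b r + eval a r * v) (D-quot r a) (D-quot r b)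

    Zero : Poly₁ → Set
    Zero a = ∀ t → eval a t ≡ 0#

    manyRoots : ∀ a {xs} → Unique xs → (∀ {x} → x ∈ xs → eval a x ≡ 0#) → deg a < length xs → Zero a
    manyRoots a {r ∷ rs} (r∉ ∷ u) roots d< t with deg a ℕ.≟ 0
    ... | yes d0 = trans (deg0⇒constant a d0 r t) (roots (here refl))
    ... | no d≢0 = begin
      eval a t                                ≡⟨ eval-quot r a t ⟩
      eval a r + (t - r) * eval (quot r a) t  ≡⟨ cong₂ (λ x y → x + (t - r) * y) (roots (here refl)) (manyRoots (quot r a) u roots′ d<′ t) ⟩
      0# + (t - r) * 0#                       ≡⟨ solve 1 (λ x → con (ℤ.+ 0) :+ x :* con (ℤ.+ 0) := con (ℤ.+ 0)) refl (t - r) ⟩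
      0#                                      ∎
      where
      open ≡-Reasoning
      d<′ : deg (quot r a) < length rs
      d<′ = ℕₚ.≤-<-trans (deg-quot r a) (ℕₚ.<-≤-trans (ℕₚ.∸-monoˡ-< d< (ℕₚ.n≢0⇒n>0 d≢0)) ℕₚ.≤-refl)
      roots′ : ∀ {x} → x ∈ rs → eval (quot r a) x ≡ 0#
      roots′ {x} x∈ = *-cancel-0 (x≢y⇒x-y≢0 (λ e → All.lookup r∉ x∈ (sym e))) (begin
        (x - r) * eval (quot r a) x             ≡⟨ +-identityˡ _ ⟨
        0# + (x - r) * eval (quot r a) x        ≡⟨ cong (_+ (x - r) * eval (quot r a) x) (roots (here refl)) ⟨
        eval a r + (x - r) * eval (quot r a) x  ≡⟨ eval-quot r a x ⟨
        eval a x                                ≡⟨ roots (there x∈) ⟩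
        0#                                      ∎)

    open import Data.List using (filter)
    open import Data.List.Membership.Propositional.Properties using (∈-filter⁻)
    open import Data.List.Relation.Unary.Unique.Propositional.Properties using (filter⁺)

    rootCount : Poly₁ → ℕ
    rootCount a = ∑ allF (λ t → 𝟙 (eval a t ≟ 0#))

    rootCount⇒Zero : ∀ a → deg a < rootCount a → Zero a
    rootCount⇒Zero a d< = manyRoots a {filter root? allF} (filter⁺ root? (allFin⁺ p)) (λ x∈ → proj₂ (∈-filter⁻ root? {xs = allF} x∈))
      (ℕₚ.<-≤-trans d< (ℕₚ.≤-reflexive (sym (length-filter-∑ root? allF))))
      where
      root? : ∀ t → Dec (eval a t ≡ 0#)
      root? t = eval a t ≟ 0#

    rootCount≤deg : ∀ a {t} → eval a t ≢ 0# → rootCount a ≤ deg a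
    rootCount≤deg a {t} a≢0 = ℕₚ.≮⇒≥ (λ d< → a≢0 (rootCount⇒Zero a d< t))

    -- Functions on F have zero divisors; the degree bound excludes them. All p points are roots of
    -- one factor or the other, at most deg a belong to `a`, so `b` has more than deg b.
    Zero-⊠ : ∀ a b {t} → eval a t ≢ 0# → deg a ℕ.+ deg b < p → (∀ s → eval a s * eval b s ≡ 0#) → Zero b
    Zero-⊠ a b a≢0 d< ab≡0 = rootCount⇒Zero b (ℕₚ.+-cancelˡ-< (deg a) _ _ (begin-strict
      deg a ℕ.+ deg b              <⟨ d< ⟩
      p                            ≡⟨ trans (ℕₚ.*-identityʳ _) length-allF ⟨
      length allF ℕ.* 1            ≡⟨ ∑-const allF 1 ⟨
      ∑ allF (λ _ → 1)             ≤⟨ ∑-mono allF (λ {s} _ → root s) ⟩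
      ∑ allF (λ s → 𝟙 (eval a s ≟ 0#) ℕ.+ 𝟙 (eval b s ≟ 0#)) ≡⟨ ∑-+ allF _ _ ⟩
      rootCount a ℕ.+ rootCount b  ≤⟨ ℕₚ.+-monoˡ-≤ _ (rootCount≤deg a a≢0) ⟩
      deg a ℕ.+ rootCount b        ∎))
      where
      open ℕₚ.≤-Reasoning
      root : ∀ s → 1 ≤ 𝟙 (eval a s ≟ 0#) ℕ.+ 𝟙 (eval b s ≟ 0#)
      root s with eval a s ≟ 0#
      ... | yes _ = s≤s z≤n
      ... | no a≢ = ℕₚ.≤-reflexive (sym (𝟙-yes (eval b s ≟ 0#) (*-cancel-0 a≢ (ab≡0 s))))

    T- : F → Poly₁
    T- r = T ⊞ Con (- r)

    ⊖ : Poly₁ → Poly₁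
    ⊖ a = Con (- 1#) ⊠ a

    1≢0 : 2 ≤ p → 1# ≢ 0#
    1≢0 = characteristic 1 (s≤s z≤n)

    shift≢0 : 2 ≤ p → ∀ r → (r + 1#) - r ≢ 0#
    shift≢0 2≤p r eq = 1≢0 2≤p (trans (solve 1 (λ r → con (ℤ.+ 1) := (r :+ con (ℤ.+ 1)) :- r) refl r) eq)

    -- The syntactic derivative descends to functions of degree below p: if `a` vanishes everywhere
    -- then so does its quotient by t - r, and the value of the derivative at r is the value of that
    -- quotient at r.
    Zero-D : ∀ a → deg a < p → Zero a → Zero (D a)
    Zero-D a d< a≡0 r with deg a ℕ.≟ 0
    ... | yes d0 = deg0⇒D≡0 a d0 r
    ... | no d≢0 = trans (D-quot r a) (Zero-⊠ (T- r) (quot r a) (shift≢0 2≤p r) (ℕₚ.≤-<-trans d≤ d<) prod r)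
      where
      open ≡-Reasoning
      2≤p : 2 ≤ p
      2≤p = ℕₚ.≤-trans (s≤s (ℕₚ.n≢0⇒n>0 d≢0)) d<
      d≤ : 1 ℕ.+ deg (quot r a) ≤ deg a
      d≤ = ℕₚ.≤-trans (s≤s (deg-quot r a)) (ℕₚ.≤-reflexive (ℕₚ.m+[n∸m]≡n (ℕₚ.n≢0⇒n>0 d≢0)))
      prod : ∀ s → (s - r) * eval (quot r a) s ≡ 0#
      prod s = begin
        (s - r) * eval (quot r a) s             ≡⟨ +-identityˡ _ ⟨
        0# + (s - r) * eval (quot r a) s        ≡⟨ cong (_+ (s - r) * eval (quot r a) s) (a≡0 r) ⟨
        eval a r + (s - r) * eval (quot r a) s  ≡⟨ eval-quot r a s ⟨
        eval a s                                ≡⟨ a≡0 s ⟩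
        0#                                      ∎

    D-cong : ∀ a b → deg a < p → deg b < p → (∀ t → eval a t ≡ eval b t) → ∀ t → eval (D a) t ≡ eval (D b) t
    D-cong a b da db eq t = x-y≡0⇒x≡y (trans
      (solve 3 (λ x y z → x :- y := x :+ (con (ℤ.+ 0) :* z :+ (:- con (ℤ.+ 1)) :* y)) refl (eval (D a) t) (eval (D b) t) (eval b t))
      (Zero-D (a ⊞ ⊖ b) (ℕₚ.⊔-lub da db) (λ s → trans (cong (_+ - 1# * eval b s) (eq s))
        (solve 1 (λ y → y :+ (:- con (ℤ.+ 1)) :* y := con (ℤ.+ 0)) refl (eval b s))) t))

    -- The order of vanishing of q at t₀ is pinned down by k: comparing values at t₀ in
    -- (t - t₀) q' b + k q b = (t - t₀) q b' forces q(t₀) = 0, and q / (t - t₀) satisfies the relation for k + 1.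
    wronskian-step : ∀ n q b k t₀ → deg q ≤ n → 0 < k → k ℕ.+ n < p → n ℕ.+ deg b ℕ.+ 1 < p → eval b t₀ ≢ 0# →
      (∀ t → (t - t₀) * eval (D q) t * eval b t + fromℤ (ℤ.+ k) * eval q t * eval b t ≡ (t - t₀) * eval q t * eval (D b) t) →
      Zero q
    wronskian-step n q b k t₀ dq 0<k k+n<p nb<p b≢0 rel = go n dq k+n<p nb<p
      where
      open ≡-Reasoning
      κ = fromℤ (ℤ.+ k)
      q₀ : eval q t₀ ≡ 0#
      q₀ = *-cancel-0 (characteristic k 0<k (ℕₚ.≤-<-trans (ℕₚ.m≤m+n k n) k+n<p)) (*-cancel-0 b≢0 (begin
        eval b t₀ * (κ * eval q t₀)
          ≡⟨ solve 5 (λ b k q t d → b :* (k :* q) := (t :- t) :* d :* b :+ k :* q :* b) refl (eval b t₀) κ (eval q t₀) t₀ (eval (D q) t₀) ⟩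
        (t₀ - t₀) * eval (D q) t₀ * eval b t₀ + κ * eval q t₀ * eval b t₀ ≡⟨ rel t₀ ⟩
        (t₀ - t₀) * eval q t₀ * eval (D b) t₀
          ≡⟨ solve 3 (λ q t d → (t :- t) :* q :* d := con (ℤ.+ 0)) refl (eval q t₀) t₀ (eval (D b) t₀) ⟩
        0# ∎))
      q₁ = quot t₀ q
      q≐ : ∀ t → eval q t ≡ (t - t₀) * eval q₁ t
      q≐ t = trans (eval-quot t₀ q t) (trans (cong (_+ (t - t₀) * eval q₁ t) q₀) (+-identityˡ _))
      go : ∀ n → deg q ≤ n → k ℕ.+ n < p → n ℕ.+ deg b ℕ.+ 1 < p → Zero q
      go zero dq _ _ t = trans (deg0⇒constant q (ℕₚ.n≤0⇒n≡0 dq) t₀ t) q₀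
      go (suc n) dq k+n<p nb<p t = trans (q≐ t) (trans (cong ((t - t₀) *_) (q₁≡0 t)) (zeroʳ _))
        where
        dq₁ : deg q₁ ≤ n
        dq₁ = ℕₚ.≤-trans (deg-quot t₀ q) (ℕₚ.∸-monoˡ-≤ 1 dq)
        n<p : suc n < p
        n<p = ℕₚ.≤-<-trans (ℕₚ.m≤n+m (suc n) k) k+n<p
        Dq≐ : ∀ t → eval (D q) t ≡ eval (D (T- t₀ ⊠ q₁)) t
        Dq≐ = D-cong q (T- t₀ ⊠ q₁) (ℕₚ.≤-<-trans dq n<p) (ℕₚ.≤-<-trans (s≤s dq₁) n<p) q≐
        rest : Poly₁
        rest = T- t₀ ⊠ D q₁ ⊠ b ⊞ Con (fromℤ (ℤ.+ suc k)) ⊠ q₁ ⊠ b ⊞ ⊖ (T- t₀ ⊠ q₁ ⊠ D b)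
        deg-rest : deg rest ≤ suc (n ℕ.+ deg b)
        deg-rest = ℕₚ.⊔-lub (ℕₚ.⊔-lub (s≤s (ℕₚ.+-monoˡ-≤ (deg b) (ℕₚ.≤-trans (deg-D q₁) dq₁)))
          (ℕₚ.≤-trans (ℕₚ.+-monoˡ-≤ (deg b) dq₁) (ℕₚ.n≤1+n _))) (s≤s (ℕₚ.+-mono-≤ dq₁ (deg-D b)))
        rest≡0 : Zero rest
        rest≡0 = Zero-⊠ (T- t₀) rest (shift≢0 (ℕₚ.≤-trans (s≤s (s≤s z≤n)) n<p) t₀)
          (ℕₚ.≤-<-trans (s≤s deg-rest) (ℕₚ.≤-<-trans (ℕₚ.≤-reflexive (cong suc (ℕₚ.+-comm 1 _))) nb<p)) (λ s → begin
            (s - t₀) * eval rest s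
              ≡⟨ cong (λ κ′ → (s - t₀) * ((s - t₀) * eval (D q₁) s * eval b s + κ′ * eval q₁ s * eval b s + - 1# * ((s - t₀) * eval q₁ s * eval (D b) s))) (fromℤ-+ (ℤ.+ 1) (ℤ.+ k)) ⟩
            (s - t₀) * ((s - t₀) * eval (D q₁) s * eval b s + (1# + κ) * eval q₁ s * eval b s + - 1# * ((s - t₀) * eval q₁ s * eval (D b) s))
              ≡⟨ solve 6 (λ u d b k q b′ → u :* (u :* d :* b :+ (con (ℤ.+ 1) :+ k) :* q :* b :+ (:- con (ℤ.+ 1)) :* (u :* q :* b′))
                   := (u :* ((con (ℤ.+ 1) :+ con (ℤ.+ 0)) :* q :+ u :* d) :* b :+ k :* (u :* q) :* b) :- u :* (u :* q) :* b′) refl (s - t₀) (eval (D q₁) s) (eval b s) κ (eval q₁ s) (eval (D b) s) ⟩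
            ((s - t₀) * eval (D (T- t₀ ⊠ q₁)) s * eval b s + κ * ((s - t₀) * eval q₁ s) * eval b s) - (s - t₀) * ((s - t₀) * eval q₁ s) * eval (D b) s
              ≡⟨ cong₂ (λ u v → ((s - t₀) * u * eval b s + κ * v * eval b s) - (s - t₀) * v * eval (D b) s) (sym (Dq≐ s)) (sym (q≐ s)) ⟩
            ((s - t₀) * eval (D q) s * eval b s + κ * eval q s * eval b s) - (s - t₀) * eval q s * eval (D b) s
              ≡⟨ cong (_- (s - t₀) * eval q s * eval (D b) s) (rel s) ⟩
            (s - t₀) * eval q s * eval (D b) s - (s - t₀) * eval q s * eval (D b) s
              ≡⟨ x-x≡0 _ ⟩
            0# ∎)
        q₁≡0 : Zero q₁
        q₁≡0 = wronskian-step n q₁ b (suc k) t₀ dq₁ (s≤s z≤n) (ℕₚ.≤-<-trans (ℕₚ.≤-reflexive (sym (ℕₚ.+-suc k n))) k+n<p)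
          (ℕₚ.≤-<-trans (ℕₚ.n≤1+n _) nb<p) b≢0 (λ t → x-y≡0⇒x≡y (trans
            (solve 3 (λ x y z → x :+ y :- z := x :+ y :+ (:- con (ℤ.+ 1)) :* z) refl ((t - t₀) * eval (D q₁) t * eval b t) (fromℤ (ℤ.+ suc k) * eval q₁ t * eval b t) ((t - t₀) * eval q₁ t * eval (D b) t))
            (rest≡0 t)))

    -- In characteristic p the relation a′b = ab′ alone does not force proportionality; the degree
    -- bound does. With c = a(t₀)/b(t₀), write a - cb = (t - t₀) q; the relation for a - cb is then
    -- the one of `wronskian-step` with k = 1, and q vanishes.
    wronskian : ∀ n a b t₀ → deg a ≤ n → deg b ≤ n → n ℕ.+ n ℕ.+ 1 < p → eval b t₀ ≢ 0# →
      (∀ t → eval (D a) t * eval b t ≡ eval a t * eval (D b) t) → Σ F λ c → ∀ t → eval a t ≡ c * eval b t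
    wronskian n a b t₀ da db n<p b≢0 rel with z , bz ← inverse (eval b t₀) b≢0 =
      c , λ t → x-y≡0⇒x≡y (trans (solve 3 (λ a c b → a :- c :* b := a :+ (:- c) :* b) refl (eval a t) c (eval b t))
        (trans (e≐ t) (trans (cong ((t - t₀) *_) (q≡0 t)) (zeroʳ _))))
      where
      open ≡-Reasoning
      c = eval a t₀ * z
      e q : Poly₁
      e = a ⊞ Con (- c) ⊠ b
      q = quot t₀ e
      de : deg e ≤ n
      de = ℕₚ.⊔-lub da db
      n≤ : n ≤ n ℕ.+ n ℕ.+ 1
      n≤ = ℕₚ.≤-trans (ℕₚ.m≤m+n n n) (ℕₚ.m≤m+n _ 1)
      e₀ : eval e t₀ ≡ 0#
      e₀ = begin
        eval a t₀ + - (eval a t₀ * z) * eval b t₀  ≡⟨ solve 3 (λ a z b → a :+ (:- (a :* z)) :* b := a :* (con (ℤ.+ 1) :- b :* z)) refl (eval a t₀) z (eval b t₀) ⟩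
        eval a t₀ * (1# - eval b t₀ * z)           ≡⟨ cong (λ w → eval a t₀ * (1# - w)) bz ⟩
        eval a t₀ * (1# - 1#)                      ≡⟨ solve 1 (λ a → a :* (con (ℤ.+ 1) :- con (ℤ.+ 1)) := con (ℤ.+ 0)) refl (eval a t₀) ⟩
        0#                                         ∎
      e≐ : ∀ t → eval e t ≡ (t - t₀) * eval q t
      e≐ t = trans (eval-quot t₀ e t) (trans (cong (_+ (t - t₀) * eval q t) e₀) (+-identityˡ _))
      dq : deg q ≤ n ℕ.∸ 1
      dq = ℕₚ.≤-trans (deg-quot t₀ e) (ℕₚ.∸-monoˡ-≤ 1 de)
      q≡0 : Zero q
      q≡0 with deg e ℕ.≟ 0
      ... | yes d0 = λ t → case-zero t
        where
        e≡0 : Zero e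
        e≡0 t = trans (deg0⇒constant e d0 t₀ t) e₀
        case-zero : Zero q
        case-zero = Zero-⊠ (T- t₀) q (shift≢0 (ℕₚ.≤-trans (s≤s (ℕₚ.m≤n+m 1 (n ℕ.+ n))) n<p) t₀)
          (ℕₚ.≤-<-trans (s≤s (ℕₚ.≤-trans dq (ℕₚ.m∸n≤m n 1))) (ℕₚ.≤-<-trans (ℕₚ.≤-trans (ℕₚ.≤-reflexive (ℕₚ.+-comm 1 n)) (ℕₚ.+-monoˡ-≤ 1 (ℕₚ.m≤m+n n n))) n<p))
          (λ s → trans (sym (e≐ s)) (e≡0 s))
      ... | no d≢0 = wronskian-step (n ℕ.∸ 1) q b 1 t₀ dq (s≤s z≤n)
          (ℕₚ.≤-<-trans (ℕₚ.≤-trans (ℕₚ.≤-reflexive (ℕₚ.m+[n∸m]≡n 1≤n)) n≤) n<p)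
          (ℕₚ.≤-<-trans (ℕₚ.+-monoˡ-≤ 1 (ℕₚ.+-mono-≤ (ℕₚ.m∸n≤m n 1) db)) n<p) b≢0 (λ t → begin
            (t - t₀) * eval (D q) t * eval b t + 1# * eval q t * eval b t
              ≡⟨ solve 4 (λ u d b q → u :* d :* b :+ con (ℤ.+ 1) :* q :* b := ((con (ℤ.+ 1) :+ con (ℤ.+ 0)) :* q :+ u :* d) :* b) refl (t - t₀) (eval (D q) t) (eval b t) (eval q t) ⟩
            eval (D (T- t₀ ⊠ q)) t * eval b t ≡⟨ cong (_* eval b t) (De≐ t) ⟨
            eval (D e) t * eval b t
              ≡⟨ solve 5 (λ a′ b c b′ z → (a′ :+ (con (ℤ.+ 0) :* b :+ (:- c) :* b′)) :* b := a′ :* b :- c :* b :* b′) refl (eval (D a) t) (eval b t) c (eval (D b) t) z ⟩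
            eval (D a) t * eval b t - c * eval b t * eval (D b) t ≡⟨ cong (_- c * eval b t * eval (D b) t) (rel t) ⟩
            eval a t * eval (D b) t - c * eval b t * eval (D b) t
              ≡⟨ solve 4 (λ a b c b′ → a :* b′ :- c :* b :* b′ := (a :+ (:- c) :* b) :* b′) refl (eval a t) (eval b t) c (eval (D b) t) ⟩
            eval e t * eval (D b) t ≡⟨ cong (_* eval (D b) t) (e≐ t) ⟩
            (t - t₀) * eval q t * eval (D b) t ∎)
        where
        1≤n : 1 ≤ n
        1≤n = ℕₚ.≤-trans (ℕₚ.n≢0⇒n>0 d≢0) de
        De≐ : ∀ t → eval (D e) t ≡ eval (D (T- t₀ ⊠ q)) t
        De≐ = D-cong e (T- t₀ ⊠ q) (ℕₚ.≤-<-trans (ℕₚ.≤-trans de n≤) n<p)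
          (ℕₚ.≤-<-trans (ℕₚ.≤-trans (s≤s dq) (ℕₚ.≤-trans (ℕₚ.≤-reflexive (ℕₚ.m+[n∸m]≡n 1≤n)) n≤)) n<p) e≐

  -- Surfaces containing two families of lines, and the reguli they force.

  module Reguli where

    open FiniteSums
    open 𝔽ₚ
    open Polynomials
    open import Data.Nat as ℕ using (ℕ; zero; suc; _≤_; _<_; _⊔_; z≤n; s≤s)
    import Data.Nat.Properties as ℕₚ
    import Data.Fin.Properties as Finₚ
    open import Data.Integer as ℤ using (ℤ)
    open import Data.List using (List; []; _∷_)
    open import Data.List.Membership.Propositional using (_∈_)
    open import Data.List.Relation.Unary.Any using (here; there)
    open import Data.Product using (Σ; _×_; _,_; proj₁; proj₂)
    open import Data.Sum using (_⊎_; inj₁; inj₂)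
    open import Data.Empty using (⊥-elim)
    open import Relation.Nullary using (yes; no)
    open import Relation.Binary.PropositionalEquality

    open Solver

    D^ : ℕ → Poly₁ → Poly₁
    D^ zero a = a
    D^ (suc k) a = D (D^ k a)

    deg-D^ : ∀ k a → deg (D^ k a) ≤ deg a
    deg-D^ zero a = ℕₚ.≤-refl
    deg-D^ (suc k) a = ℕₚ.≤-trans (deg-D (D^ k a)) (deg-D^ k a)

    D^-cong : ∀ k a b → deg a < p → deg b < p → (∀ t → eval a t ≡ eval b t) → ∀ t → eval (D^ k a) t ≡ eval (D^ k b) t
    D^-cong zero a b da db eq = eq
    D^-cong (suc k) a b da db eq = D-cong (D^ k a) (D^ k b) (ℕₚ.≤-<-trans (deg-D^ k a) da) (ℕₚ.≤-<-trans (deg-D^ k b) db) (D^-cong k a b da db eq)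

    D^-leibniz : ∀ k r a → suc (deg a) < p → ∀ t →
      eval (D^ (suc k) (T- r ⊠ a)) t ≡ (t - r) * eval (D^ (suc k) a) t + fromℤ (ℤ.+ suc k) * eval (D^ k a) t
    D^-leibniz zero r a da t = solve 3 (λ u a a′ → (con (ℤ.+ 1) :+ con (ℤ.+ 0)) :* a :+ u :* a′ := u :* a′ :+ con (ℤ.+ 1) :* a) refl (t - r) (eval a t) (eval (D a) t)
    D^-leibniz (suc k) r a da t = begin
      eval (D (D^ (suc k) (T- r ⊠ a))) t
        ≡⟨ D-cong (D^ (suc k) (T- r ⊠ a)) (T- r ⊠ D^ (suc k) a ⊞ Con (fromℤ (ℤ.+ suc k)) ⊠ D^ k a)
             (ℕₚ.≤-<-trans (deg-D^ (suc k) (T- r ⊠ a)) da)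
             (ℕₚ.≤-<-trans (ℕₚ.⊔-lub (s≤s (deg-D^ (suc k) a)) (ℕₚ.≤-trans (deg-D^ k a) (ℕₚ.n≤1+n _))) da)
             (D^-leibniz k r a da) t ⟩
      (1# + 0#) * a₁ + (t - r) * a₂ + (0# * a₀ + κ * a₁)
        ≡⟨ solve 5 (λ u a₀ a₁ a₂ k → (con (ℤ.+ 1) :+ con (ℤ.+ 0)) :* a₁ :+ u :* a₂ :+ (con (ℤ.+ 0) :* a₀ :+ k :* a₁) := u :* a₂ :+ (con (ℤ.+ 1) :+ k) :* a₁) refl (t - r) a₀ a₁ a₂ κ ⟩
      (t - r) * a₂ + (1# + κ) * a₁
        ≡⟨ cong (λ κ′ → (t - r) * a₂ + κ′ * a₁) (fromℤ-+ (ℤ.+ 1) (ℤ.+ suc k)) ⟨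
      (t - r) * a₂ + fromℤ (ℤ.+ suc (suc k)) * a₁ ∎
      where
      open ≡-Reasoning
      κ = fromℤ (ℤ.+ suc k)
      a₀ = eval (D^ k a) t
      a₁ = eval (D^ (suc k) a) t
      a₂ = eval (D^ (suc (suc k)) a) t

    -- Taylor expansion without division by factorials: with a = (t - r) q, the derivative of order
    -- k + 1 of `a` at r is (k + 1) times that of order k of q, and k + 1 is invertible because it
    -- is below p.
    vanishingJet⇒Zero : ∀ n a r → deg a ≤ n → n < p → (∀ k → k ≤ n → eval (D^ k a) r ≡ 0#) → Zero a
    vanishingJet⇒Zero zero a r da n<p jet t = trans (deg0⇒constant a (ℕₚ.n≤0⇒n≡0 da) r t) (jet 0 z≤n)
    vanishingJet⇒Zero (suc n) a r da n<p jet t = trans (a≐ t) (trans (cong ((t - r) *_) (q≡0 t)) (zeroʳ _))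
      where
      q = quot r a
      dq : deg q ≤ n
      dq = ℕₚ.≤-trans (deg-quot r a) (ℕₚ.∸-monoˡ-≤ 1 da)
      a≐ : ∀ t → eval a t ≡ (t - r) * eval q t
      a≐ t = trans (eval-quot r a t) (trans (cong (_+ (t - r) * eval q t) (jet 0 z≤n)) (+-identityˡ _))
      q≡0 : Zero q
      q≡0 = vanishingJet⇒Zero n q r dq (ℕₚ.<-trans (ℕₚ.n<1+n n) n<p) (λ k k≤n →
        *-cancel-0 (characteristic (suc k) (s≤s z≤n) (ℕₚ.≤-<-trans (s≤s k≤n) n<p)) (begin
          fromℤ (ℤ.+ suc k) * eval (D^ k q) r
            ≡⟨ solve 3 (λ r x y → y := (r :- r) :* x :+ y) refl r (eval (D^ (suc k) q) r) _ ⟩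
          (r - r) * eval (D^ (suc k) q) r + fromℤ (ℤ.+ suc k) * eval (D^ k q) r
            ≡⟨ D^-leibniz k r q (ℕₚ.≤-<-trans (s≤s dq) n<p) r ⟨
          eval (D^ (suc k) (T- r ⊠ q)) r
            ≡⟨ D^-cong (suc k) a (T- r ⊠ q) (ℕₚ.≤-<-trans da n<p) (ℕₚ.≤-<-trans (s≤s dq) n<p) a≐ r ⟨
          eval (D^ (suc k) a) r
            ≡⟨ jet (suc k) (s≤s k≤n) ⟩
          0# ∎))
        where open ≡-Reasoning

    data Var : Set where
      X Y Z : Var

    δ : Var → Var → F
    δ X X = 1#
    δ Y Y = 1#
    δ Z Z = 1#
    δ _ _ = 0#

    data Poly₃ : Set where
      con₃ : F → Poly₃
      var : Var → Poly₃
      _+₃_ _*₃_ : Poly₃ → Poly₃ → Poly₃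

    infixl 6 _+₃_
    infixl 7 _*₃_

    eval₃ : Poly₃ → (Var → F) → F
    eval₃ (con₃ c) ρ = c
    eval₃ (var v) ρ = ρ v
    eval₃ (f +₃ g) ρ = eval₃ f ρ + eval₃ g ρ
    eval₃ (f *₃ g) ρ = eval₃ f ρ * eval₃ g ρ

    deg₃ : Poly₃ → ℕ
    deg₃ (con₃ c) = 0
    deg₃ (var v) = 1
    deg₃ (f +₃ g) = deg₃ f ⊔ deg₃ g
    deg₃ (f *₃ g) = deg₃ f ℕ.+ deg₃ g

    ∂ : Var → Poly₃ → Poly₃
    ∂ v (con₃ c) = con₃ 0#
    ∂ v (var w) = con₃ (δ v w)
    ∂ v (f +₃ g) = ∂ v f +₃ ∂ v g
    ∂ v (f *₃ g) = ∂ v f *₃ g +₃ f *₃ ∂ v g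

    deg-∂ : ∀ v f → deg₃ (∂ v f) ≤ deg₃ f
    deg-∂ v (con₃ c) = z≤n
    deg-∂ v (var w) = z≤n
    deg-∂ v (f +₃ g) = ℕₚ.⊔-mono-≤ (deg-∂ v f) (deg-∂ v g)
    deg-∂ v (f *₃ g) = ℕₚ.⊔-lub (ℕₚ.+-monoˡ-≤ (deg₃ g) (deg-∂ v f)) (ℕₚ.+-monoʳ-≤ (deg₃ f) (deg-∂ v g))

    ∂-comm : ∀ v w f ρ → eval₃ (∂ v (∂ w f)) ρ ≡ eval₃ (∂ w (∂ v f)) ρ
    ∂-comm v w (con₃ c) ρ = refl
    ∂-comm v w (var u) ρ = refl
    ∂-comm v w (f +₃ g) ρ = cong₂ _+_ (∂-comm v w f ρ) (∂-comm v w g ρ)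
    ∂-comm v w (f *₃ g) ρ = trans (cong₂ (λ a b → (a * eval₃ g ρ + eval₃ (∂ w f) ρ * eval₃ (∂ v g) ρ) + (eval₃ (∂ v f) ρ * eval₃ (∂ w g) ρ + eval₃ f ρ * b))
        (∂-comm v w f ρ) (∂-comm v w g ρ))
      (solve 8 (λ a b f g fv fw gv gw → (a :* g :+ fw :* gv) :+ (fv :* gw :+ f :* b) := (a :* g :+ fv :* gw) :+ (fw :* gv :+ f :* b)) refl
        (eval₃ (∂ w (∂ v f)) ρ) (eval₃ (∂ w (∂ v g)) ρ) (eval₃ f ρ) (eval₃ g ρ) (eval₃ (∂ v f) ρ) (eval₃ (∂ w f) ρ) (eval₃ (∂ v g) ρ) (eval₃ (∂ w g) ρ))

    eval₃-cong : ∀ f {ρ ρ′} → (∀ v → ρ v ≡ ρ′ v) → eval₃ f ρ ≡ eval₃ f ρ′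
    eval₃-cong (con₃ c) eq = refl
    eval₃-cong (var v) eq = eq v
    eval₃-cong (f +₃ g) eq = cong₂ _+_ (eval₃-cong f eq) (eval₃-cong g eq)
    eval₃-cong (f *₃ g) eq = cong₂ _*_ (eval₃-cong f eq) (eval₃-cong g eq)

    sub : Poly₃ → (Var → Poly₁) → Poly₁
    sub (con₃ c) σ = Con c
    sub (var v) σ = σ v
    sub (f +₃ g) σ = sub f σ ⊞ sub g σ
    sub (f *₃ g) σ = sub f σ ⊠ sub g σ

    at : (Var → Poly₁) → F → Var → F
    at σ t v = eval (σ v) t

    eval-sub : ∀ f σ t → eval (sub f σ) t ≡ eval₃ f (at σ t)
    eval-sub (con₃ c) σ t = refl
    eval-sub (var v) σ t = refl
    eval-sub (f +₃ g) σ t = cong₂ _+_ (eval-sub f σ t) (eval-sub g σ t)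
    eval-sub (f *₃ g) σ t = cong₂ _*_ (eval-sub f σ t) (eval-sub g σ t)

    deg-sub : ∀ f σ → (∀ v → deg (σ v) ≤ 1) → deg (sub f σ) ≤ deg₃ f
    deg-sub (con₃ c) σ h = z≤n
    deg-sub (var v) σ h = h v
    deg-sub (f +₃ g) σ h = ℕₚ.⊔-mono-≤ (deg-sub f σ h) (deg-sub g σ h)
    deg-sub (f *₃ g) σ h = ℕₚ.+-mono-≤ (deg-sub f σ h) (deg-sub g σ h)

    chain-rule : ∀ f σ t → eval (D (sub f σ)) t ≡
      eval (D (σ X)) t * eval₃ (∂ X f) (at σ t) + eval (D (σ Y)) t * eval₃ (∂ Y f) (at σ t) + eval (D (σ Z)) t * eval₃ (∂ Z f) (at σ t)
    chain-rule (con₃ c) σ t = solve 3 (λ x y z → con (ℤ.+ 0) := x :* con (ℤ.+ 0) :+ y :* con (ℤ.+ 0) :+ z :* con (ℤ.+ 0)) refl (eval (D (σ X)) t) (eval (D (σ Y)) t) (eval (D (σ Z)) t)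
    chain-rule (var X) σ t = solve 3 (λ x y z → x := x :* con (ℤ.+ 1) :+ y :* con (ℤ.+ 0) :+ z :* con (ℤ.+ 0)) refl (eval (D (σ X)) t) (eval (D (σ Y)) t) (eval (D (σ Z)) t)
    chain-rule (var Y) σ t = solve 3 (λ x y z → y := x :* con (ℤ.+ 0) :+ y :* con (ℤ.+ 1) :+ z :* con (ℤ.+ 0)) refl (eval (D (σ X)) t) (eval (D (σ Y)) t) (eval (D (σ Z)) t)
    chain-rule (var Z) σ t = solve 3 (λ x y z → z := x :* con (ℤ.+ 0) :+ y :* con (ℤ.+ 0) :+ z :* con (ℤ.+ 1)) refl (eval (D (σ X)) t) (eval (D (σ Y)) t) (eval (D (σ Z)) t)
    chain-rule (f +₃ g) σ t = trans (cong₂ _+_ (chain-rule f σ t) (chain-rule g σ t))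
      (solve 9 (λ x y z a b c a′ b′ c′ → (x :* a :+ y :* b :+ z :* c) :+ (x :* a′ :+ y :* b′ :+ z :* c′) := x :* (a :+ a′) :+ y :* (b :+ b′) :+ z :* (c :+ c′)) refl
        (eval (D (σ X)) t) (eval (D (σ Y)) t) (eval (D (σ Z)) t) (eval₃ (∂ X f) (at σ t)) (eval₃ (∂ Y f) (at σ t)) (eval₃ (∂ Z f) (at σ t)) (eval₃ (∂ X g) (at σ t)) (eval₃ (∂ Y g) (at σ t)) (eval₃ (∂ Z g) (at σ t)))
    chain-rule (f *₃ g) σ t = trans (cong₂ _+_ (cong₂ _*_ (chain-rule f σ t) (eval-sub g σ t)) (cong₂ _*_ (eval-sub f σ t) (chain-rule g σ t)))
      (solve 11 (λ x y z a b c a′ b′ c′ f g → (x :* a :+ y :* b :+ z :* c) :* g :+ f :* (x :* a′ :+ y :* b′ :+ z :* c′) := x :* (a :* g :+ f :* a′) :+ y :* (b :* g :+ f :* b′) :+ z :* (c :* g :+ f :* c′)) refl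
        (eval (D (σ X)) t) (eval (D (σ Y)) t) (eval (D (σ Z)) t) (eval₃ (∂ X f) (at σ t)) (eval₃ (∂ Y f) (at σ t)) (eval₃ (∂ Z f) (at σ t)) (eval₃ (∂ X g) (at σ t)) (eval₃ (∂ Y g) (at σ t)) (eval₃ (∂ Z g) (at σ t)) (eval₃ f (at σ t)) (eval₃ g (at σ t)))

    -- y = α x + β in the plane Z = z, and y = γ z + δ in the plane X = x.
    line₁ : F → F → F → Var → Poly₁
    line₁ z α β X = T
    line₁ z α β Y = Con α ⊠ T ⊞ Con β
    line₁ z α β Z = Con z

    line₂ : F → F → F → Var → Poly₁
    line₂ x γ δ X = Con x
    line₂ x γ δ Y = Con γ ⊠ T ⊞ Con δ
    line₂ x γ δ Z = T

    lineY : F → F → Var → Poly₁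
    lineY x z X = Con x
    lineY x z Y = T
    lineY x z Z = Con z

    lineZ : F → F → Var → Poly₁
    lineZ x y X = Con x
    lineZ x y Y = Con y
    lineZ x y Z = T

    deg-line₁ : ∀ z α β v → deg (line₁ z α β v) ≤ 1
    deg-line₁ z α β X = s≤s z≤n
    deg-line₁ z α β Y = s≤s z≤n
    deg-line₁ z α β Z = z≤n

    deg-line₂ : ∀ x γ δ v → deg (line₂ x γ δ v) ≤ 1
    deg-line₂ x γ δ X = z≤n
    deg-line₂ x γ δ Y = s≤s z≤n
    deg-line₂ x γ δ Z = s≤s z≤n

    deg-lineY : ∀ x z v → deg (lineY x z v) ≤ 1
    deg-lineY x z X = z≤n
    deg-lineY x z Y = s≤s z≤n
    deg-lineY x z Z = z≤n

    deg-lineZ : ∀ x y v → deg (lineZ x y v) ≤ 1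
    deg-lineZ x y X = z≤n
    deg-lineZ x y Y = z≤n
    deg-lineZ x y Z = s≤s z≤n

    chain₁ : ∀ f z α β t → eval (D (sub f (line₁ z α β))) t ≡ eval₃ (∂ X f) (at (line₁ z α β) t) + α * eval₃ (∂ Y f) (at (line₁ z α β) t)
    chain₁ f z α β t = trans (chain-rule f (line₁ z α β) t)
      (solve 5 (λ a b c α t → con (ℤ.+ 1) :* a :+ (con (ℤ.+ 0) :* t :+ α :* con (ℤ.+ 1) :+ con (ℤ.+ 0)) :* b :+ con (ℤ.+ 0) :* c := a :+ α :* b) refl
        (eval₃ (∂ X f) (at (line₁ z α β) t)) (eval₃ (∂ Y f) (at (line₁ z α β) t)) (eval₃ (∂ Z f) (at (line₁ z α β) t)) α t)

    chain₂ : ∀ f x γ δ t → eval (D (sub f (line₂ x γ δ))) t ≡ eval₃ (∂ Z f) (at (line₂ x γ δ) t) + γ * eval₃ (∂ Y f) (at (line₂ x γ δ) t)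
    chain₂ f x γ δ t = trans (chain-rule f (line₂ x γ δ) t)
      (solve 5 (λ a b c γ t → con (ℤ.+ 0) :* a :+ (con (ℤ.+ 0) :* t :+ γ :* con (ℤ.+ 1) :+ con (ℤ.+ 0)) :* b :+ con (ℤ.+ 1) :* c := c :+ γ :* b) refl
        (eval₃ (∂ X f) (at (line₂ x γ δ) t)) (eval₃ (∂ Y f) (at (line₂ x γ δ) t)) (eval₃ (∂ Z f) (at (line₂ x γ δ) t)) γ t)

    chainY : ∀ f x z t → eval (D (sub f (lineY x z))) t ≡ eval (sub (∂ Y f) (lineY x z)) t
    chainY f x z t = trans (chain-rule f (lineY x z) t) (trans
      (solve 3 (λ a b c → con (ℤ.+ 0) :* a :+ con (ℤ.+ 1) :* b :+ con (ℤ.+ 0) :* c := b) refl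
        (eval₃ (∂ X f) (at (lineY x z) t)) (eval₃ (∂ Y f) (at (lineY x z) t)) (eval₃ (∂ Z f) (at (lineY x z) t)))
      (sym (eval-sub (∂ Y f) (lineY x z) t)))

    ∂Y^ : ℕ → Poly₃ → Poly₃
    ∂Y^ zero f = f
    ∂Y^ (suc k) f = ∂ Y (∂Y^ k f)

    deg-∂Y^ : ∀ k f → deg₃ (∂Y^ k f) ≤ deg₃ f
    deg-∂Y^ zero f = ℕₚ.≤-refl
    deg-∂Y^ (suc k) f = ℕₚ.≤-trans (deg-∂ Y (∂Y^ k f)) (deg-∂Y^ k f)

    chainY^ : ∀ k f x z → deg₃ f < p → ∀ t → eval (D^ k (sub f (lineY x z))) t ≡ eval (sub (∂Y^ k f) (lineY x z)) t
    chainY^ zero f x z d<p t = refl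
    chainY^ (suc k) f x z d<p t = trans
      (D-cong (D^ k h) (sub (∂Y^ k f) (lineY x z)) (ℕₚ.≤-<-trans (ℕₚ.≤-trans (deg-D^ k h) (deg-sub f _ (deg-lineY x z))) d<p)
        (ℕₚ.≤-<-trans (ℕₚ.≤-trans (deg-sub (∂Y^ k f) _ (deg-lineY x z)) (deg-∂Y^ k f)) d<p) (chainY^ k f x z d<p) t)
      (chainY (∂Y^ k f) x z t)
      where h = sub f (lineY x z)

    zero? : ∀ a → Zero a ⊎ Σ F (λ t → eval a t ≢ 0#)
    zero? a with Finₚ.all? (λ t → eval a t ≟ 0#)
    ... | yes z = inj₁ z
    ... | no ¬z = inj₂ (let t , q = Finₚ.¬∀⟶∃¬ p _ (λ t → eval a t ≟ 0#) ¬z in t , q)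

    -- The numerator of the curvature of the level curve f = 0 in the planes Z = const; it vanishes on
    -- every line of the first family that lies on the surface f = 0.
    hessian : Poly₃ → Poly₃
    hessian f = ∂ X (∂ X f) *₃ (∂ Y f *₃ ∂ Y f) +₃ con₃ (- 1#) *₃ (∂ X (∂ Y f) +₃ ∂ Y (∂ X f)) *₃ (∂ X f *₃ ∂ Y f) +₃ ∂ Y (∂ Y f) *₃ (∂ X f *₃ ∂ X f)

    deg-hessian : ∀ f d → deg₃ f ≤ d → deg₃ (hessian f) ≤ d ℕ.+ (d ℕ.+ d)
    deg-hessian f d h = ℕₚ.⊔-lub (ℕₚ.⊔-lub (m3 (d2 X X) (d1 Y) (d1 Y)) (m3 (ℕₚ.⊔-lub (d2 X Y) (d2 Y X)) (d1 X) (d1 Y))) (m3 (d2 Y Y) (d1 X) (d1 X))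
      where
      d1 : ∀ v → deg₃ (∂ v f) ≤ d
      d1 v = ℕₚ.≤-trans (deg-∂ v f) h
      d2 : ∀ v w → deg₃ (∂ v (∂ w f)) ≤ d
      d2 v w = ℕₚ.≤-trans (deg-∂ v (∂ w f)) (d1 w)
      m3 : ∀ {a b c} → a ≤ d → b ≤ d → c ≤ d → a ℕ.+ (b ℕ.+ c) ≤ d ℕ.+ (d ℕ.+ d)
      m3 p q r = ℕₚ.+-mono-≤ p (ℕₚ.+-mono-≤ q r)

    module OnLine (f : Poly₃) (z α β : F) where
      σ = line₁ z α β
      val : Poly₃ → F → F
      val g t = eval₃ g (at σ t)

      module _ (d : ℕ) (d≤ : deg₃ f ≤ d) (d<p : d < p) (f≡0 : Zero (sub f σ)) where

        deg₁ : ∀ v → deg (sub (∂ v f) σ) ≤ d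
        deg₁ v = ℕₚ.≤-trans (deg-sub (∂ v f) σ (deg-line₁ z α β)) (ℕₚ.≤-trans (deg-∂ v f) d≤)

        deg₂ : ∀ v w → deg (sub (∂ v (∂ w f)) σ) ≤ d
        deg₂ v w = ℕₚ.≤-trans (deg-sub (∂ v (∂ w f)) σ (deg-line₁ z α β)) (ℕₚ.≤-trans (deg-∂ v (∂ w f)) (ℕₚ.≤-trans (deg-∂ w f) d≤))

        tangent : ∀ t → val (∂ X f) t ≡ - (α * val (∂ Y f) t)
        tangent t = x-y≡0⇒x≡y (trans (solve 2 (λ a b → a :- (:- b) := a :+ b) refl (val (∂ X f) t) (α * val (∂ Y f) t))
          (trans (sym (chain₁ f z α β t)) (Zero-D (sub f σ) (ℕₚ.≤-<-trans (ℕₚ.≤-trans (deg-sub f σ (deg-line₁ z α β)) d≤) d<p) f≡0 t)))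

        second : ∀ v t → eval (D (sub (∂ v f) σ)) t ≡ val (∂ X (∂ v f)) t + α * val (∂ Y (∂ v f)) t
        second v t = chain₁ (∂ v f) z α β t

        flex : ∀ t → val (∂ X (∂ X f)) t ≡ - (α * val (∂ Y (∂ X f)) t + α * (val (∂ X (∂ Y f)) t + α * val (∂ Y (∂ Y f)) t))
        flex t = x-y≡0⇒x≡y (begin
          fXX - (- (α * fYX + α * (fXY + α * fYY)))
            ≡⟨ solve 6 (λ a b b′ c α s → a :- (:- (α :* b′ :+ α :* (b :+ α :* c))) := (a :+ α :* b′) :+ (con (ℤ.+ 0) :* s :+ α :* (b :+ α :* c))) refl
                 fXX fXY fYX fYY α (eval (sub (∂ Y f) σ) t) ⟩
          (fXX + α * fYX) + (0# * eval (sub (∂ Y f) σ) t + α * (fXY + α * fYY))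
            ≡⟨ cong₂ (λ u w → u + (0# * eval (sub (∂ Y f) σ) t + α * w)) (second X t) (second Y t) ⟨
          eval (D (sub (∂ X f) σ ⊞ Con α ⊠ sub (∂ Y f) σ)) t
            ≡⟨ Zero-D (sub (∂ X f) σ ⊞ Con α ⊠ sub (∂ Y f) σ) (ℕₚ.≤-<-trans (ℕₚ.⊔-lub (deg₁ X) (deg₁ Y)) d<p)
                (λ s → trans (cong₂ (λ u v → u + α * v) (eval-sub (∂ X f) σ s) (eval-sub (∂ Y f) σ s))
                  (trans (cong (_+ α * val (∂ Y f) s) (tangent s)) (-‿inverseˡ _))) t ⟩
          0# ∎)
          where
          open ≡-Reasoning
          fXX = val (∂ X (∂ X f)) t
          fXY = val (∂ X (∂ Y f)) t
          fYX = val (∂ Y (∂ X f)) t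
          fYY = val (∂ Y (∂ Y f)) t

        third : ∀ v t → eval (D (D (sub (∂ v f) σ))) t ≡
          (val (∂ v (∂ X (∂ X f))) t + α * val (∂ v (∂ Y (∂ X f))) t) + α * (val (∂ v (∂ X (∂ Y f))) t + α * val (∂ v (∂ Y (∂ Y f))) t)
        third v t = begin
          eval (D (D (sub (∂ v f) σ))) t
            ≡⟨ D-cong (D (sub (∂ v f) σ)) (sub (∂ v (∂ X f)) σ ⊞ Con α ⊠ sub (∂ v (∂ Y f)) σ)
                 (ℕₚ.≤-<-trans (ℕₚ.≤-trans (deg-D (sub (∂ v f) σ)) (deg₁ v)) d<p) (ℕₚ.≤-<-trans (ℕₚ.⊔-lub (deg₂ v X) (deg₂ v Y)) d<p)
                 (λ s → trans (second v s) (cong₂ (λ u w → u + α * w)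
                   (trans (∂-comm X v f (at σ s)) (sym (eval-sub (∂ v (∂ X f)) σ s))) (trans (∂-comm Y v f (at σ s)) (sym (eval-sub (∂ v (∂ Y f)) σ s))))) t ⟩
          eval (D (sub (∂ v (∂ X f)) σ)) t + (0# * eval (sub (∂ v (∂ Y f)) σ) t + α * eval (D (sub (∂ v (∂ Y f)) σ)) t)
            ≡⟨ cong₂ (λ u w → u + (0# * eval (sub (∂ v (∂ Y f)) σ) t + α * w)) (chain₁ (∂ v (∂ X f)) z α β t) (chain₁ (∂ v (∂ Y f)) z α β t) ⟩
          (val (∂ X (∂ v (∂ X f))) t + α * val (∂ Y (∂ v (∂ X f))) t) + (0# * eval (sub (∂ v (∂ Y f)) σ) t + α * (val (∂ X (∂ v (∂ Y f))) t + α * val (∂ Y (∂ v (∂ Y f))) t))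
            ≡⟨ cong₂ (λ u w → u + (0# * eval (sub (∂ v (∂ Y f)) σ) t + α * w))
                 (cong₂ (λ u w → u + α * w) (∂-comm X v (∂ X f) (at σ t)) (∂-comm Y v (∂ X f) (at σ t)))
                 (cong₂ (λ u w → u + α * w) (∂-comm X v (∂ Y f) (at σ t)) (∂-comm Y v (∂ Y f) (at σ t))) ⟩
          (a + α * b) + (0# * eval (sub (∂ v (∂ Y f)) σ) t + α * (b′ + α * c))
            ≡⟨ solve 3 (λ x s y → x :+ (con (ℤ.+ 0) :* s :+ y) := x :+ y) refl (a + α * b) (eval (sub (∂ v (∂ Y f)) σ) t) (α * (b′ + α * c)) ⟩
          (a + α * b) + α * (b′ + α * c) ∎
          where
          open ≡-Reasoning
          a = val (∂ v (∂ X (∂ X f))) t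
          b = val (∂ v (∂ Y (∂ X f))) t
          b′ = val (∂ v (∂ X (∂ Y f))) t
          c = val (∂ v (∂ Y (∂ Y f))) t

        hessian≡0 : Zero (sub (hessian f) σ)
        hessian≡0 t = trans (eval-sub (hessian f) σ t) (trans
          (cong₂ (λ u v → u * (fY * fY) + - 1# * (fXY + fYX) * (v * fY) + fYY * (v * v)) (flex t) (tangent t))
          (solve 5 (λ α y b b′ c → (:- (α :* b′ :+ α :* (b :+ α :* c))) :* (y :* y) :+ (:- con (ℤ.+ 1)) :* (b :+ b′) :* ((:- (α :* y)) :* y) :+ c :* ((:- (α :* y)) :* (:- (α :* y))) := con (ℤ.+ 0)) refl α fY fXY fYX fYY))
          where
          fY = val (∂ Y f) t
          fXY = val (∂ X (∂ Y f)) t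
          fYX = val (∂ Y (∂ X f)) t
          fYY = val (∂ Y (∂ Y f)) t

        φ ψ N : Poly₁
        φ = sub (∂ Y f) σ
        ψ = sub (∂ Z f) σ
        N = φ ⊠ D ψ ⊞ ⊖ (ψ ⊠ D φ)

        -- `tangent` and `flex` eliminate the X-derivatives of `f` on the line. What remains of the
        -- derivative of the curvature depends only on the restrictions g of ∂ v f and φ of ∂ Y f,
        -- as g″φ² - 2φφ′g′ with derivatives along the line.
        hessian-∂ : ∀ v t → val (∂ v (hessian f)) t ≡
          eval (D (D (sub (∂ v f) σ))) t * (eval φ t * eval φ t) - eval φ t * eval (D (sub (∂ v f) σ)) t * (eval (D φ) t + eval (D φ) t)
        hessian-∂ v t = begin
          val (∂ v (hessian f)) t
            ≡⟨ cong₂ (λ A x → a * (y * y) + A * (yv * y + y * yv) + ((0# * (B + B′) + - 1# * (b′ + b)) * (x * y) + - 1# * (B + B′) * (xv * y + x * yv)) + (c * (x * x) + C * (xv * x + x * xv))) (flex t) (tangent t) ⟩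
          _ ≡⟨ solve 11 (λ a b b′ c B B′ C xv yv y α →
                 a :* (y :* y) :+ (:- (α :* B′ :+ α :* (B :+ α :* C))) :* (yv :* y :+ y :* yv) :+ ((con (ℤ.+ 0) :* (B :+ B′) :+ (:- con (ℤ.+ 1)) :* (b′ :+ b)) :* ((:- (α :* y)) :* y) :+ (:- con (ℤ.+ 1)) :* (B :+ B′) :* (xv :* y :+ (:- (α :* y)) :* yv)) :+ (c :* ((:- (α :* y)) :* (:- (α :* y))) :+ C :* (xv :* (:- (α :* y)) :+ (:- (α :* y)) :* xv))
                 := ((a :+ α :* b) :+ α :* (b′ :+ α :* c)) :* (y :* y) :- y :* (xv :+ α :* yv) :* ((B :+ α :* C) :+ (B′ :+ α :* C))) refl a b b′ c B B′ C xv yv y α ⟩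
          ((a + α * b) + α * (b′ + α * c)) * (y * y) - y * (xv + α * yv) * ((B + α * C) + (B′ + α * C))
            ≡⟨ cong (λ w → ((a + α * b) + α * (b′ + α * c)) * (y * y) - y * (xv + α * yv) * ((B + α * C) + (w + α * C))) (∂-comm Y X f (at σ t)) ⟩
          ((a + α * b) + α * (b′ + α * c)) * (y * y) - y * (xv + α * yv) * ((B + α * C) + (B + α * C))
            ≡⟨ cong₂ (λ u w → u * (y * y) - y * (xv + α * yv) * (w + w)) (sym (third v t)) (sym (second Y t)) ⟩
          eval (D (D (sub (∂ v f) σ))) t * (y * y) - y * (xv + α * yv) * (eval (D φ) t + eval (D φ) t)
            ≡⟨ cong₂ (λ y′ w → eval (D (D (sub (∂ v f) σ))) t * (y′ * y′) - y′ * w * (eval (D φ) t + eval (D φ) t)) (sym (eval-sub (∂ Y f) σ t))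
                 (trans (cong₂ (λ u w → u + α * w) (∂-comm v X f (at σ t)) (∂-comm v Y f (at σ t))) (sym (second v t))) ⟩
          _ ∎
          where
          open ≡-Reasoning
          y = val (∂ Y f) t
          xv = val (∂ v (∂ X f)) t
          yv = val (∂ v (∂ Y f)) t
          B = val (∂ X (∂ Y f)) t
          B′ = val (∂ Y (∂ X f)) t
          C = val (∂ Y (∂ Y f)) t
          a = val (∂ v (∂ X (∂ X f))) t
          b = val (∂ v (∂ Y (∂ X f))) t
          b′ = val (∂ v (∂ X (∂ Y f))) t
          c = val (∂ v (∂ Y (∂ Y f))) t

        -- The derivative of `hessian f` along (0, -∂Z f, ∂Y f), the direction tangent to the
        -- surface inside the plane X = const. It vanishes where a line of the second family
        -- crosses, if both `f` and its curvature vanish on that line.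
        transversal : Poly₃
        transversal = ∂ Y f *₃ ∂ Z (hessian f) +₃ con₃ (- 1#) *₃ (∂ Z f *₃ ∂ Y (hessian f))

        -- The right-hand side is N′φ² - N(φ²)′, the Wronskian of N = φψ′ - ψφ′ and φ²; this is what
        -- `wronskian` can integrate.
        transversal-val : ∀ t → val transversal t ≡ eval (D N) t * (eval φ t * eval φ t) - eval N t * (eval (D φ) t * eval φ t + eval φ t * eval (D φ) t)
        transversal-val t = begin
          val (∂ Y f) t * val (∂ Z (hessian f)) t + - 1# * (val (∂ Z f) t * val (∂ Y (hessian f)) t)
            ≡⟨ cong₂ (λ u w → u * val (∂ Z (hessian f)) t + - 1# * (w * val (∂ Y (hessian f)) t)) (sym (eval-sub (∂ Y f) σ t)) (sym (eval-sub (∂ Z f) σ t)) ⟩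
          y * val (∂ Z (hessian f)) t + - 1# * (s * val (∂ Y (hessian f)) t)
            ≡⟨ cong₂ (λ u w → y * u + - 1# * (s * w)) (hessian-∂ Z t) (hessian-∂ Y t) ⟩
          y * (s₂ * (y * y) - y * s₁ * (y₁ + y₁)) + - 1# * (s * (y₂ * (y * y) - y * y₁ * (y₁ + y₁)))
            ≡⟨ solve 6 (λ y y₁ y₂ s s₁ s₂ → y :* (s₂ :* (y :* y) :- y :* s₁ :* (y₁ :+ y₁)) :+ (:- con (ℤ.+ 1)) :* (s :* (y₂ :* (y :* y) :- y :* y₁ :* (y₁ :+ y₁)))
                 := ((y₁ :* s₁ :+ y :* s₂) :+ (con (ℤ.+ 0) :* (s :* y₁) :+ (:- con (ℤ.+ 1)) :* (s₁ :* y₁ :+ s :* y₂))) :* (y :* y) :- (y :* s₁ :+ (:- con (ℤ.+ 1)) :* (s :* y₁)) :* (y₁ :* y :+ y :* y₁)) refl y y₁ y₂ s s₁ s₂ ⟩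
          _ ∎
          where
          open ≡-Reasoning
          y = eval φ t
          y₁ = eval (D φ) t
          y₂ = eval (D (D φ)) t
          s = eval ψ t
          s₁ = eval (D ψ) t
          s₂ = eval (D (D ψ)) t

        -- Zero transversal says (N / φ²)′ = 0 and N / φ² = (ψ / φ)′, so ψ / φ is a linear function.
        ruling : ∀ {t₀} → eval φ t₀ ≢ 0# → d ℕ.+ d ℕ.+ (d ℕ.+ d) ℕ.+ 3 < p → (∀ t → val transversal t ≡ 0#) →
          Σ F λ c → Σ F λ c′ → ∀ t → eval ψ t ≡ (c * t + c′) * eval φ t
        ruling {t₀} φ≢0 4d<p tr≡0 = c , c′ , λ t → x-y≡0⇒x≡y (trans
            (solve 5 (λ s c t c′ y → s :- (c :* t :+ c′) :* y := (s :+ (:- c) :* t :* y) :- c′ :* y) refl (eval ψ t) c t c′ (eval φ t))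
            (trans (cong (_- c′ * eval φ t) (proj₂ second-step t)) (x-x≡0 _)))
          where
          open ≡-Reasoning
          dN : deg N ≤ d ℕ.+ d
          dN = ℕₚ.⊔-lub (ℕₚ.+-mono-≤ (deg₁ Y) (ℕₚ.≤-trans (deg-D ψ) (deg₁ Z))) (ℕₚ.+-mono-≤ (deg₁ Z) (ℕₚ.≤-trans (deg-D φ) (deg₁ Y)))
          first-step : Σ F λ c → ∀ t → eval N t ≡ c * eval (φ ⊠ φ) t
          first-step = wronskian (d ℕ.+ d) N (φ ⊠ φ) t₀ dN (ℕₚ.+-mono-≤ (deg₁ Y) (deg₁ Y))
            (ℕₚ.≤-<-trans (ℕₚ.+-monoʳ-≤ (d ℕ.+ d ℕ.+ (d ℕ.+ d)) (s≤s z≤n)) 4d<p)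
            (*-nonzero φ≢0 φ≢0) (λ t → x-y≡0⇒x≡y (trans (sym (transversal-val t)) (tr≡0 t)))
          c = proj₁ first-step
          χ : Poly₁
          χ = ψ ⊞ Con (- c) ⊠ T ⊠ φ
          second-step : Σ F λ c′ → ∀ t → eval χ t ≡ c′ * eval φ t
          second-step = wronskian (suc d) χ φ t₀ (ℕₚ.⊔-lub (ℕₚ.≤-trans (deg₁ Z) (ℕₚ.n≤1+n d)) (s≤s (deg₁ Y))) (ℕₚ.≤-trans (deg₁ Y) (ℕₚ.n≤1+n d))
            (ℕₚ.≤-<-trans bound 4d<p)
            φ≢0 (λ t → x-y≡0⇒x≡y (begin
              (eval (D ψ) t + ((0# * t + - c * 1#) * eval φ t + - c * t * eval (D φ) t)) * eval φ t - (eval ψ t + - c * t * eval φ t) * eval (D φ) t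
                ≡⟨ solve 6 (λ s s₁ y y₁ c t → (s₁ :+ ((con (ℤ.+ 0) :* t :+ (:- c) :* con (ℤ.+ 1)) :* y :+ (:- c) :* t :* y₁)) :* y :- (s :+ (:- c) :* t :* y) :* y₁
                     := (y :* s₁ :+ (:- con (ℤ.+ 1)) :* (s :* y₁)) :- c :* (y :* y)) refl (eval ψ t) (eval (D ψ) t) (eval φ t) (eval (D φ) t) c t ⟩
              eval N t - c * (eval φ t * eval φ t) ≡⟨ cong (_- c * (eval φ t * eval φ t)) (proj₂ first-step t) ⟩
              c * (eval φ t * eval φ t) - c * (eval φ t * eval φ t) ≡⟨ x-x≡0 _ ⟩
              0# ∎))
            where
            bound : suc d ℕ.+ suc d ℕ.+ 1 ≤ d ℕ.+ d ℕ.+ (d ℕ.+ d) ℕ.+ 3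
            bound = ℕₚ.≤-trans (ℕₚ.≤-reflexive (trans (cong (ℕ._+ 1) (cong suc (ℕₚ.+-suc d d))) (trans (ℕₚ.+-comm _ 1) (ℕₚ.+-comm 3 (d ℕ.+ d)))))
                      (ℕₚ.+-monoˡ-≤ 3 (ℕₚ.m≤m+n (d ℕ.+ d) (d ℕ.+ d)))
          c′ = proj₁ second-step

    findBad : ∀ {A : Set} {P Q : A → Set} → (∀ x → P x ⊎ Q x) → (xs : List A) → (∀ {x} → x ∈ xs → P x) ⊎ Σ A (λ x → x ∈ xs × Q x)
    findBad dec [] = inj₁ λ ()
    findBad dec (x ∷ xs) with dec x | findBad dec xs
    ... | inj₂ q | _ = inj₂ (x , here refl , q)
    ... | inj₁ p | inj₂ (y , y∈ , q) = inj₂ (y , there y∈ , q)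
    ... | inj₁ p | inj₁ all = inj₁ λ { (here refl) → p ; (there x∈) → all x∈ }

    slope-from : ∀ {y g c x c′ s} → s ≡ (c * x + c′) * y → s + g * y ≡ 0# → y ≡ 0# ⊎ g ≡ - c * x + - c′
    slope-from {y} {g} {c} {x} {c′} {s} e e′ with y ≟ 0#
    ... | yes y≡0 = inj₁ y≡0
    ... | no y≢0 = inj₂ (x-y≡0⇒x≡y (*-cancel-0 y≢0 (begin
      y * (g - (- c * x + - c′))
        ≡⟨ solve 5 (λ y g c x c′ → y :* (g :- ((:- c) :* x :+ (:- c′))) := (c :* x :+ c′) :* y :+ g :* y) refl y g c x c′ ⟩
      (c * x + c′) * y + g * y  ≡⟨ cong (_+ g * y) e ⟨
      s + g * y                 ≡⟨ e′ ⟩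
      0#                        ∎)))
      where open ≡-Reasoning

    -- The richness hypotheses are all that is used of the incidence graph: a polynomial of degree
    -- at most `M` that vanishes at the crossings on a line vanishes on the line. `M` is at least 4d
    -- because `transversal` has degree d + 3d, for a surface of degree d with curvature of degree
    -- 3d.
    module Surface
      {A B : Set} (R : A → B → Set) (as : List A) (bs : List B)
      (z α β : A → F) (x γ δ′ : B → F)
      (incident : ∀ {i j} → i ∈ as → j ∈ bs → R i j → α i * x j + β i ≡ γ j * z i + δ′ j)
      (d M : ℕ) (4d≤M : d ℕ.+ d ℕ.+ (d ℕ.+ d) ≤ M) (M<p : M ℕ.+ 3 < p)
      (rich₁ : ∀ {i} → i ∈ as → ∀ g → deg g ≤ M → (∀ {j} → j ∈ bs → R i j → eval g (x j) ≡ 0#) → Zero g)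
      (rich₂ : ∀ {j} → j ∈ bs → ∀ g → deg g ≤ M → (∀ {i} → i ∈ as → R i j → eval g (z i) ≡ 0#) → Zero g)
      where

      L₁ : A → Var → Poly₁
      L₁ i = line₁ (z i) (α i) (β i)

      L₂ : B → Var → Poly₁
      L₂ j = line₂ (x j) (γ j) (δ′ j)

      OnLines : Poly₃ → Set
      OnLines f = ∀ {i} → i ∈ as → Zero (sub f (L₁ i))

      3d≤M : d ℕ.+ (d ℕ.+ d) ≤ M
      3d≤M = ℕₚ.≤-trans (ℕₚ.≤-trans (ℕₚ.m≤n+m _ d) (ℕₚ.≤-reflexive (sym (ℕₚ.+-assoc d d (d ℕ.+ d))))) 4d≤M

      d≤M : d ≤ M
      d≤M = ℕₚ.≤-trans (ℕₚ.m≤m+n d _) 3d≤M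

      M<p′ : M < p
      M<p′ = ℕₚ.≤-<-trans (ℕₚ.m≤m+n M 3) M<p

      d<p : d < p
      d<p = ℕₚ.≤-<-trans d≤M M<p′

      crossing : ∀ {i j} → i ∈ as → j ∈ bs → R i j → ∀ f → eval₃ f (at (L₂ j) (z i)) ≡ eval₃ f (at (L₁ i) (x j))
      crossing {i} {j} i∈ j∈ r f = eval₃-cong f (λ { X → refl ; Y → sym (incident i∈ j∈ r) ; Z → refl })

      -- A surface through the first family contains the crossings on each line of the second, hence
      -- that line. It is applied to `f` and to its curvature, whose vanishing is automatic only on
      -- the first family.
      onLines₂ : ∀ f → deg₃ f ≤ M → OnLines f → ∀ {j} → j ∈ bs → Zero (sub f (L₂ j))
      onLines₂ f df on {j} j∈ = rich₂ j∈ (sub f (L₂ j)) (ℕₚ.≤-trans (deg-sub f (L₂ j) (deg-line₂ (x j) (γ j) (δ′ j))) df) (λ {i} i∈ r →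
        trans (eval-sub f (L₂ j) (z i)) (trans (crossing i∈ j∈ r f) (trans (sym (eval-sub f (L₁ i) (x j))) (on i∈ (x j)))))

      -- At a crossing, the second line gives ∂Z f + γ ∂Y f = 0 and the same for the curvature, so
      -- `transversal` vanishes there and, by richness, along all of line i. `ruling` then makes ∂Z
      -- f / ∂Y f linear in t. So, away from the zeros of φ = ∂Y f, the slope γ is linear in x, and
      -- the lines meeting line i lie on a quadric.
      conclusion : ∀ f → deg₃ f ≤ d → OnLines f → ∀ {i} → i ∈ as → ∀ {t₀} → eval₃ (∂ Y f) (at (L₁ i) t₀) ≢ 0# →
        Σ F λ c → Σ F λ c′ → Σ Poly₁ λ φ → deg φ ≤ d × (Σ F λ t → eval φ t ≢ 0#) ×
          (∀ {j} → j ∈ bs → R i j → eval φ (x j) ≡ 0# ⊎ γ j ≡ c * x j + c′)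
      conclusion f df on {i} i∈ {t₀} fy≢0 =
        conclude (ruling d df d<p (on i∈) φ≢0 (ℕₚ.≤-<-trans (ℕₚ.+-monoˡ-≤ 3 4d≤M) M<p) tr≡0)
        where
        open OnLine f (z i) (α i) (β i) hiding (φ; ψ; N)
        h = hessian f
        dh : deg₃ h ≤ d ℕ.+ (d ℕ.+ d)
        dh = deg-hessian f d df
        φ = sub (∂ Y f) σ
        ψ = sub (∂ Z f) σ
        φ≢0 : eval φ t₀ ≢ 0#
        φ≢0 eq = fy≢0 (trans (sym (eval-sub (∂ Y f) σ t₀)) eq)
        h-on : OnLines h
        h-on {i′} i′∈ = OnLine.hessian≡0 f (z i′) (α i′) (β i′) d df d<p (on i′∈)
        along₂ : ∀ g → deg₃ g ≤ M → OnLines g → ∀ {j} → j ∈ bs → R i j →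
          eval₃ (∂ Z g) (at (L₁ i) (x j)) + γ j * eval₃ (∂ Y g) (at (L₁ i) (x j)) ≡ 0#
        along₂ g dg g-on {j} j∈ r = trans (cong₂ (λ u w → u + γ j * w) (sym (crossing i∈ j∈ r (∂ Z g))) (sym (crossing i∈ j∈ r (∂ Y g))))
          (trans (sym (chain₂ g (x j) (γ j) (δ′ j) (z i)))
            (Zero-D (sub g (L₂ j)) (ℕₚ.≤-<-trans (ℕₚ.≤-trans (deg-sub g (L₂ j) (deg-line₂ (x j) (γ j) (δ′ j))) dg) M<p′) (onLines₂ g dg g-on j∈) (z i)))
        tr = transversal d df d<p (on i∈)
        dtr : deg₃ tr ≤ M
        dtr = ℕₚ.≤-trans (ℕₚ.⊔-lub (ℕₚ.+-mono-≤ (ℕₚ.≤-trans (deg-∂ Y f) df) (ℕₚ.≤-trans (deg-∂ Z h) dh))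
          (ℕₚ.+-mono-≤ (ℕₚ.≤-trans (deg-∂ Z f) df) (ℕₚ.≤-trans (deg-∂ Y h) dh))) (ℕₚ.≤-trans (ℕₚ.≤-reflexive (sym (ℕₚ.+-assoc d d (d ℕ.+ d)))) 4d≤M)
        tr≡0 : ∀ t → eval₃ tr (at (L₁ i) t) ≡ 0#
        tr≡0 t = trans (sym (eval-sub tr (L₁ i) t)) (rich₁ i∈ (sub tr (L₁ i))
          (ℕₚ.≤-trans (deg-sub tr (L₁ i) (deg-line₁ (z i) (α i) (β i))) dtr)
          (λ {j} j∈ r → trans (eval-sub tr (L₁ i) (x j)) (cancels (along₂ f (ℕₚ.≤-trans df d≤M) on j∈ r) (along₂ h (ℕₚ.≤-trans dh 3d≤M) h-on j∈ r))) t)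
          where
          cancels : ∀ {a b a′ b′ g} → a + g * b ≡ 0# → a′ + g * b′ ≡ 0# → b * a′ + - 1# * (a * b′) ≡ 0#
          cancels {a} {b} {a′} {b′} {g} e e′ = trans
            (solve 5 (λ a b a′ b′ g → b :* a′ :+ (:- con (ℤ.+ 1)) :* (a :* b′) := b :* (a′ :+ g :* b′) :- (a :+ g :* b) :* b′) refl a b a′ b′ g)
            (trans (cong₂ (λ u w → b * u - w * b′) e′ e) (solve 2 (λ b b′ → b :* con (ℤ.+ 0) :- con (ℤ.+ 0) :* b′ := con (ℤ.+ 0)) refl b b′))
        conclude : (Σ F λ c → Σ F λ c′ → ∀ t → eval ψ t ≡ (c * t + c′) * eval φ t) → _
        conclude (c , c′ , ruled) = - c , - c′ , φ , deg₁ d df d<p (on i∈) Y , (t₀ , φ≢0) , λ {j} j∈ r →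
          slope-from (trans (sym (eval-sub (∂ Z f) σ (x j))) (ruled (x j)))
            (trans (cong (λ w → eval₃ (∂ Z f) (at (L₁ i) (x j)) + γ j * w) (eval-sub (∂ Y f) σ (x j))) (along₂ f (ℕₚ.≤-trans df d≤M) on j∈ r))

      onLines? : ∀ f → OnLines f ⊎ Σ A (λ i → i ∈ as × Σ F λ t → eval₃ f (at (L₁ i) t) ≢ 0#)
      onLines? f with findBad (λ i → zero? (sub f (L₁ i))) as
      ... | inj₁ all = inj₁ all
      ... | inj₂ (i , i∈ , t , ≢0) = inj₂ (i , i∈ , t , λ e → ≢0 (trans (eval-sub f (L₁ i) t) e))

      Singular : Poly₃ → Set
      Singular f = Σ ℕ λ k → OnLines (∂Y^ k f) × Σ A λ i → i ∈ as × Σ F λ t → eval₃ (∂ Y (∂Y^ k f)) (at (L₁ i) t) ≢ 0#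

      -- The slope argument needs a surface whose Y-derivative is not identically zero on some line.
      -- Differentiating in Y until this happens replaces a choice of `f` of minimal degree.
      search : ∀ f → OnLines f → ∀ n → (∀ k → k ≤ n → OnLines (∂Y^ k f)) ⊎ Singular f
      search f on zero = inj₁ λ { zero z≤n → on }
      search f on (suc n) with search f on n
      ... | inj₂ s = inj₂ s
      ... | inj₁ upto with onLines? (∂Y^ (suc n) f)
      ...   | inj₂ bad = inj₂ (n , upto n ℕₚ.≤-refl , bad)
      ...   | inj₁ next = inj₁ extend
        where
        extend : ∀ k → k ≤ suc n → OnLines (∂Y^ k f)
        extend k k≤ with ℕₚ.m≤n⇒m<n∨m≡n k≤
        ... | inj₁ (s≤s k≤n) = upto k k≤n
        ... | inj₂ refl = next

      -- If all Y-derivatives vanish on the lines, f vanishes on the planes Z = z i, which are too many.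
      vanishing : ∀ f → deg₃ f ≤ d → ∀ {j} → j ∈ bs → (∀ k → k ≤ d → OnLines (∂Y^ k f)) → ∀ ρ → eval₃ f ρ ≡ 0#
      vanishing f df {j} j∈ all ρ = begin
        eval₃ f ρ                                 ≡⟨ eval₃-cong f (λ { X → refl ; Y → refl ; Z → refl }) ⟩
        eval₃ f (at (lineZ (ρ X) (ρ Y)) (ρ Z))    ≡⟨ eval-sub f (lineZ (ρ X) (ρ Y)) (ρ Z) ⟨
        eval (sub f (lineZ (ρ X) (ρ Y))) (ρ Z)    ≡⟨ rich₂ j∈ (sub f (lineZ (ρ X) (ρ Y))) (ℕₚ.≤-trans (ℕₚ.≤-trans (deg-sub f _ (deg-lineZ (ρ X) (ρ Y))) df) d≤M) (λ i∈ r → planes i∈) (ρ Z) ⟩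
        0#                                        ∎
        where
        open ≡-Reasoning
        planes : ∀ {i} → i ∈ as → eval (sub f (lineZ (ρ X) (ρ Y))) (z i) ≡ 0#
        planes {i} i∈ = begin
          eval (sub f (lineZ (ρ X) (ρ Y))) (z i)   ≡⟨ eval-sub f _ (z i) ⟩
          eval₃ f (at (lineZ (ρ X) (ρ Y)) (z i))   ≡⟨ eval₃-cong f (λ { X → refl ; Y → refl ; Z → refl }) ⟩
          eval₃ f (at (lineY (ρ X) (z i)) (ρ Y))   ≡⟨ eval-sub f _ (ρ Y) ⟨
          eval (sub f (lineY (ρ X) (z i))) (ρ Y)   ≡⟨ vanishingJet⇒Zero d (sub f (lineY (ρ X) (z i))) y₀ (ℕₚ.≤-trans (deg-sub f _ (deg-lineY (ρ X) (z i))) df) d<p jet (ρ Y) ⟩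
          0#                                       ∎
          where
          y₀ = α i * ρ X + β i
          jet : ∀ k → k ≤ d → eval (D^ k (sub f (lineY (ρ X) (z i)))) y₀ ≡ 0#
          jet k k≤d = begin
            eval (D^ k (sub f (lineY (ρ X) (z i)))) y₀       ≡⟨ chainY^ k f (ρ X) (z i) (ℕₚ.≤-<-trans df d<p) y₀ ⟩
            eval (sub (∂Y^ k f) (lineY (ρ X) (z i))) y₀      ≡⟨ eval-sub (∂Y^ k f) _ y₀ ⟩
            eval₃ (∂Y^ k f) (at (lineY (ρ X) (z i)) y₀)      ≡⟨ eval₃-cong (∂Y^ k f) (λ { X → refl ; Y → refl ; Z → refl }) ⟩
            eval₃ (∂Y^ k f) (at (L₁ i) (ρ X))                ≡⟨ eval-sub (∂Y^ k f) (L₁ i) (ρ X) ⟨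
            eval (sub (∂Y^ k f) (L₁ i)) (ρ X)                ≡⟨ all k k≤d i∈ (ρ X) ⟩
            0#                                               ∎

      regulus : ∀ f → deg₃ f ≤ d → OnLines f → ∀ {ρ} → eval₃ f ρ ≢ 0# → ∀ {j} → j ∈ bs →
        Σ A λ i → i ∈ as × Σ F λ c → Σ F λ c′ → Σ Poly₁ λ φ → deg φ ≤ d × (Σ F λ t → eval φ t ≢ 0#) ×
          (∀ {j} → j ∈ bs → R i j → eval φ (x j) ≡ 0# ⊎ γ j ≡ c * x j + c′)
      regulus f df on {ρ} f≢0 j∈ with search f on d
      ... | inj₁ all = ⊥-elim (f≢0 (vanishing f df j∈ all ρ))
      ... | inj₂ (k , onk , i , i∈ , t , ≢0) = i , i∈ , conclusion (∂Y^ k f) (ℕₚ.≤-trans (deg-∂Y^ k f) df) onk i∈ ≢0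

  -- A polynomial of low degree that vanishes on given lines.

  module Interpolation where

    open FiniteSums
    open 𝔽ₚ
    open Polynomials
    open Reguli
    open import Data.Nat as ℕ using (ℕ; zero; suc; _≤_; _<_; z≤n; s≤s)
    import Data.Nat.Properties as ℕₚ
    open import Data.Fin as Fin using (Fin; zero; suc; combine; remQuot; inject≤; funToFin; finToFun)
    import Data.Fin.Properties as Finₚ
    open import Data.Integer as ℤ using (ℤ)
    open import Data.List using (List; length; lookup)
    open import Data.List.Properties using (length-tabulate)
    open import Data.List.Membership.Propositional using (_∈_)
    open import Data.List.Membership.Propositional.Properties using (∈-tabulate⁻)
    open import Data.List.Relation.Unary.Any using (index)
    open import Data.List.Relation.Unary.Any.Properties using (lookup-index)
    open import Data.List.Relation.Unary.Unique.Propositional.Properties using (tabulate⁺)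
    open import Data.Product using (Σ; _×_; _,_; proj₁; proj₂; uncurry)
    open import Data.Empty using (⊥-elim)
    open import Function using (_∘_)
    open import Relation.Nullary using (¬_; yes; no)
    open import Relation.Binary.PropositionalEquality

    open Solver

    horner : ∀ n → (Fin n → F) → F → F
    horner zero g t = 0#
    horner (suc n) g t = g zero + t * horner n (g ∘ suc) t

    horner₁ : ∀ n → (Fin n → F) → Poly₁
    horner₁ zero g = Con 0#
    horner₁ (suc n) g = Con (g zero) ⊞ T ⊠ horner₁ n (g ∘ suc)

    eval-horner₁ : ∀ n g t → eval (horner₁ n g) t ≡ horner n g t
    eval-horner₁ zero g t = refl
    eval-horner₁ (suc n) g t = cong (λ w → g zero + t * w) (eval-horner₁ n (g ∘ suc) t)

    deg-horner₁ : ∀ n g → deg (horner₁ n g) ≤ n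
    deg-horner₁ zero g = z≤n
    deg-horner₁ (suc n) g = s≤s (deg-horner₁ n (g ∘ suc))

    horner-cong : ∀ n {g h} t → (∀ k → g k ≡ h k) → horner n g t ≡ horner n h t
    horner-cong zero t eq = refl
    horner-cong (suc n) t eq = cong₂ (λ u w → u + t * w) (eq zero) (horner-cong n t (eq ∘ suc))

    horner-- : ∀ n g h t → horner n (λ k → g k - h k) t ≡ horner n g t - horner n h t
    horner-- zero g h t = sym (x-x≡0 0#)
    horner-- (suc n) g h t = trans (cong (λ w → (g zero - h zero) + t * w) (horner-- n (g ∘ suc) (h ∘ suc) t))
      (solve 5 (λ a b t x y → (a :- b) :+ t :* (x :- y) := (a :+ t :* x) :- (b :+ t :* y)) refl (g zero) (h zero) t (horner n (g ∘ suc) t) (horner n (h ∘ suc) t))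

    horner≡0⇒coefficients≡0 : ∀ n g → suc n < p → (∀ t → horner n g t ≡ 0#) → ∀ k → g k ≡ 0#
    horner≡0⇒coefficients≡0 (suc n) g n<p h≡0 = λ { zero → g₀ ; (suc k) → rest k }
      where
      open ≡-Reasoning
      g₀ : g zero ≡ 0#
      g₀ = trans (solve 2 (λ a b → a := a :+ con (ℤ.+ 0) :* b) refl (g zero) (horner n (g ∘ suc) 0#)) (h≡0 0#)
      rest : ∀ k → g (suc k) ≡ 0#
      rest = horner≡0⇒coefficients≡0 n (g ∘ suc) (ℕₚ.<-trans (ℕₚ.n<1+n _) n<p) (λ t → trans (sym (eval-horner₁ n (g ∘ suc) t))
        (Zero-⊠ T (horner₁ n (g ∘ suc)) {1#} (1≢0 (ℕₚ.≤-trans (s≤s (s≤s z≤n)) n<p))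
          (ℕₚ.≤-<-trans (s≤s (deg-horner₁ n (g ∘ suc))) (ℕₚ.<-trans (ℕₚ.n<1+n _) n<p))
          (λ s → begin
            s * eval (horner₁ n (g ∘ suc)) s  ≡⟨ cong (s *_) (eval-horner₁ n (g ∘ suc) s) ⟩
            s * horner n (g ∘ suc) s          ≡⟨ trans (sym (+-identityˡ _)) (cong (_+ s * horner n (g ∘ suc) s) (sym g₀)) ⟩
            horner (suc n) g s                ≡⟨ h≡0 s ⟩
            0#                                ∎) t))

    series : Var → ∀ n → (Fin n → Poly₃) → Poly₃
    series v zero g = con₃ 0#
    series v (suc n) g = g zero +₃ var v *₃ series v n (g ∘ suc)

    eval-series : ∀ v n g ρ → eval₃ (series v n g) ρ ≡ horner n (λ k → eval₃ (g k) ρ) (ρ v)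
    eval-series v zero g ρ = refl
    eval-series v (suc n) g ρ = cong (λ w → eval₃ (g zero) ρ + ρ v * w) (eval-series v n (g ∘ suc) ρ)

    deg-series : ∀ v n g d → (∀ k → deg₃ (g k) ≤ d) → deg₃ (series v n g) ≤ n ℕ.+ d
    deg-series v zero g d h = z≤n
    deg-series v (suc n) g d h = ℕₚ.⊔-lub (ℕₚ.≤-trans (h zero) (ℕₚ.m≤n+m d (suc n))) (s≤s (deg-series v n (g ∘ suc) d (h ∘ suc)))

    point : F → F → F → Var → F
    point x y z X = x
    point x y z Y = y
    point x y z Z = z

    module _ (s : ℕ) where
      Coefficients : Set
      Coefficients = Fin (s ℕ.* (s ℕ.* s)) → F

      coefficient : Coefficients → Fin s → Fin s → Fin s → F
      coefficient κ a b c = κ (combine a (combine b c))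

      cubic : Coefficients → Poly₃
      cubic κ = series X s λ a → series Y s λ b → series Z s λ c → con₃ (coefficient κ a b c)

      nested : Coefficients → (Var → F) → F
      nested κ ρ = horner s (λ a → horner s (λ b → horner s (coefficient κ a b) (ρ Z)) (ρ Y)) (ρ X)

      eval-cubic : ∀ κ ρ → eval₃ (cubic κ) ρ ≡ nested κ ρ
      eval-cubic κ ρ = trans (eval-series X s _ ρ) (horner-cong s (ρ X) (λ a → trans (eval-series Y s _ ρ) (horner-cong s (ρ Y) (λ b → eval-series Z s _ ρ))))

      deg-cubic : ∀ κ → deg₃ (cubic κ) ≤ s ℕ.+ (s ℕ.+ (s ℕ.+ 0))
      deg-cubic κ = deg-series X s _ _ (λ a → deg-series Y s _ _ (λ b → deg-series Z s _ _ (λ c → z≤n)))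

      nested-- : ∀ κ λ′ ρ → nested (λ k → κ k - λ′ k) ρ ≡ nested κ ρ - nested λ′ ρ
      nested-- κ λ′ ρ = trans (horner-cong s (ρ X) (λ a → trans (horner-cong s (ρ Y) (λ b → horner-- s _ _ (ρ Z))) (horner-- s _ _ (ρ Y)))) (horner-- s _ _ (ρ X))

      nested≡0⇒coefficients≡0 : suc s < p → ∀ κ → (∀ x y z → nested κ (point x y z) ≡ 0#) → ∀ k → κ k ≡ 0#
      nested≡0⇒coefficients≡0 s<p κ n≡0 k =
        trans (cong κ (sym (trans (cong (combine a) (Finₚ.combine-remQuot {s} s bc)) (Finₚ.combine-remQuot {s} (s ℕ.* s) k)))) (vanish a b c)
        where
        a = proj₁ (remQuot {s} (s ℕ.* s) k)
        bc = proj₂ (remQuot {s} (s ℕ.* s) k)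
        b = proj₁ (remQuot {s} s bc)
        c = proj₂ (remQuot {s} s bc)
        vanish : ∀ a b c → coefficient κ a b c ≡ 0#
        vanish a b c = horner≡0⇒coefficients≡0 s (coefficient κ a b) s<p (λ z →
          horner≡0⇒coefficients≡0 s (λ b → horner s (coefficient κ a b) z) s<p (λ y →
            horner≡0⇒coefficients≡0 s (λ a → horner s (λ b → horner s (coefficient κ a b) z) y) s<p (λ x → n≡0 x y z) a) b) c

      module _ {A : Set} (as : List A) (σ : A → Var → Poly₁) (linear : ∀ i v → deg (σ i v) ≤ 1)
        (d : ℕ) (3s≤d : s ℕ.+ (s ℕ.+ (s ℕ.+ 0)) ≤ d) (d<p : suc d < p)
        (few : length as ℕ.* suc d < s ℕ.* (s ℕ.* s)) where

        private
          M = s ℕ.* (s ℕ.* s)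
          m≤p : suc d ≤ p
          m≤p = ℕₚ.<⇒≤ d<p
          s<p : suc s < p
          s<p = ℕₚ.≤-<-trans (s≤s (ℕₚ.≤-trans (ℕₚ.m≤m+n s _) 3s≤d)) d<p

          node : Fin (length as) → Fin (suc d) → Var → F
          node i k = at (σ (lookup as i)) (inject≤ k m≤p)

          values : Coefficients → Fin (length as ℕ.* suc d) → F
          values κ q = nested κ (uncurry node (remQuot (suc d) q))

          -- Counting replaces linear algebra: there are more coefficient vectors than value vectors
          -- at d + 1 points of each line, so two cubics agree at all these points. Their difference
          -- has degree at most d and therefore vanishes on every line.
          collision = Finₚ.pigeonhole (ℕₚ.^-monoʳ-< p (ℕₚ.≤-trans (s≤s (s≤s z≤n)) s<p) few) (λ e → funToFin (values (finToFun {p} {M} e)))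

          u w : Coefficients
          u = finToFun (proj₁ collision)
          w = finToFun (proj₁ (proj₂ collision))

          κ : Coefficients
          κ k = u k - w k

          same-values : ∀ q → values u q ≡ values w q
          same-values q = trans (sym (Finₚ.finToFun-funToFin (values u) q))
            (trans (cong (λ e → finToFun e q) (proj₂ (proj₂ (proj₂ collision)))) (Finₚ.finToFun-funToFin (values w) q))

          κ≢0 : ¬ (∀ k → κ k ≡ 0#)
          κ≢0 κ≡0 = Finₚ.<⇒≢ (proj₁ (proj₂ (proj₂ collision))) (trans (sym (Finₚ.funToFin-finToFin {M} {p} (proj₁ collision)))
            (trans (funToFin-cong {M} (λ k → x-y≡0⇒x≡y (κ≡0 k))) (Finₚ.funToFin-finToFin {M} {p} (proj₁ (proj₂ collision)))))
            where
            funToFin-cong : ∀ {m} {f g : Fin m → Fin p} → (∀ k → f k ≡ g k) → funToFin f ≡ funToFin g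
            funToFin-cong {zero} eq = refl
            funToFin-cong {suc m} eq = cong₂ combine (eq zero) (funToFin-cong (eq ∘ suc))

          f : Poly₃
          f = cubic κ

          vanish-node : ∀ i k → eval₃ f (node i k) ≡ 0#
          vanish-node i k = trans (eval-cubic κ (node i k)) (trans (nested-- u w (node i k))
            (trans (cong (_- nested w (node i k)) same) (x-x≡0 _)))
            where
            same : nested u (node i k) ≡ nested w (node i k)
            same = subst (λ ik → nested u (uncurry node ik) ≡ nested w (uncurry node ik)) (Finₚ.remQuot-combine i k) (same-values (combine i k))

          vanish-line : ∀ i → Zero (sub f (σ (lookup as i)))
          vanish-line i = manyRoots (sub f (σ (lookup as i))) (tabulate⁺ {f = λ k → inject≤ k m≤p} (Finₚ.inject≤-injective m≤p m≤p _ _))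
            (λ x∈ → let k , e = ∈-tabulate⁻ {f = λ k → inject≤ k m≤p} x∈ in
              trans (cong (eval (sub f (σ (lookup as i)))) e) (trans (eval-sub f (σ (lookup as i)) _) (vanish-node i k)))
            (ℕₚ.≤-<-trans (ℕₚ.≤-trans (deg-sub f (σ (lookup as i)) (linear (lookup as i))) (ℕₚ.≤-trans (deg-cubic κ) 3s≤d))
              (ℕₚ.<-≤-trans (ℕₚ.n<1+n d) (ℕₚ.≤-reflexive (sym (length-tabulate (λ k → inject≤ k m≤p))))))

        interpolation : Σ Poly₃ λ f → deg₃ f ≤ d × (∀ {i} → i ∈ as → Zero (sub f (σ i))) × Σ (Var → F) λ ρ → eval₃ f ρ ≢ 0#
        interpolation = f , ℕₚ.≤-trans (deg-cubic κ) 3s≤d , on , witness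
          where
          on : ∀ {i} → i ∈ as → Zero (sub f (σ i))
          on {i} i∈ = subst (λ j → Zero (sub f (σ j))) (sym (lookup-index i∈)) (vanish-line (index i∈))
          P? = λ x → Finₚ.all? λ y → Finₚ.all? λ z → nested κ (point x y z) ≟ 0#
          witness : Σ (Var → F) λ ρ → eval₃ f ρ ≢ 0#
          witness with Finₚ.all? P?
          ... | yes all = ⊥-elim (κ≢0 (nested≡0⇒coefficients≡0 s<p κ all))
          ... | no ¬all =
            let x , ¬x = Finₚ.¬∀⟶∃¬ p _ P? ¬all
                y , ¬y = Finₚ.¬∀⟶∃¬ p _ (λ y → Finₚ.all? λ z → nested κ (point x y z) ≟ 0#) ¬x
                z , ¬z = Finₚ.¬∀⟶∃¬ p _ (λ z → nested κ (point x y z) ≟ 0#) ¬y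
            in point x y z , λ e → ¬z (trans (sym (eval-cubic κ (point x y z))) e)

  -- Reflections in coordinates, half angles and the incidence of frames.

  module Reflections where

    open 𝔽ₚ
    open Polynomials
    open import Data.Nat as ℕ using (ℕ; z≤n; s≤s)
    open import Data.Integer as ℤ using (ℤ)
    open import Data.Product using (Σ; _×_; _,_; proj₁; proj₂)
    open import Data.Empty using (⊥-elim)
    open import Relation.Nullary using (yes; no; _×-dec_)
    open import Relation.Binary.PropositionalEquality

    open Solver
    open ≡-Reasoning

    V : Set
    V = F × F

    norm² : V → F
    norm² (x , y) = x * x + y * y

    infixl 6 _⊝_
    _⊝_ : V → V → V
    (x , y) ⊝ (x′ , y′) = x - x′ , y - y′

    2# : F
    2# = fromℤ (ℤ.+ 2)

    2≢0 : 2 ℕ.< p → 2# ≢ 0#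
    2≢0 = characteristic 2 (s≤s z≤n)

    inv : F → F
    inv x with x ≟ 0#
    ... | yes _ = 0#
    ... | no x≢0 = proj₁ (inverse x x≢0)

    *-inv : ∀ {x} → x ≢ 0# → x * inv x ≡ 1#
    *-inv {x} x≢0 with x ≟ 0#
    ... | yes x≡0 = ⊥-elim (x≢0 x≡0)
    ... | no q = proj₂ (inverse x q)

    *-inv-cancel : ∀ {x} y → x ≢ 0# → y * inv x * x ≡ y
    *-inv-cancel {x} y x≢0 = trans (solve 3 (λ x y z → y :* z :* x := y :* (x :* z)) refl x y (inv x)) (trans (cong (y *_) (*-inv x≢0)) (*-identityʳ y))

    x*x≡0⇒x≡0 : ∀ {x} → x * x ≡ 0# → x ≡ 0#
    x*x≡0⇒x≡0 {x} e with x ≟ 0#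
    ... | yes q = q
    ... | no q = *-cancel-0 q e

    -- The reflection in the line x₁ + k x₂ = h moves a to b.
    record Reflected (k h : F) (a b : V) : Set where
      field
        moved : proj₁ b - proj₁ a ≢ 0#
        direction : proj₂ b - proj₂ a ≡ k * (proj₁ b - proj₁ a)
        distance : (1# + k * k) * (proj₁ b - proj₁ a) ≡ 2# * (h - proj₁ a - k * proj₂ a)
        nonisotropic : 1# + k * k ≢ 0#
    open Reflected

    -- The bisector |q - a|² = |q - b|² reads 2 (b - a)·q = |b|² - |a|²; dividing by 2 (b₁ - a₁)
    -- brings it to the form q₁ + k q₂ = h.
    slope height : V → V → F
    slope (a₁ , a₂) (b₁ , b₂) = (b₂ - a₂) * inv (b₁ - a₁)
    height a@(a₁ , a₂) b@(b₁ , b₂) = (norm² b - norm² a) * inv (2# * (b₁ - a₁))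

    bisector-reflected : 2# ≢ 0# → ∀ a b → proj₁ b - proj₁ a ≢ 0# → norm² (b ⊝ a) ≢ 0# → Reflected (slope a b) (height a b) a b
    bisector-reflected 2≢0 a@(a₁ , a₂) b@(b₁ , b₂) τ≢0 n≢0 = record
      { moved = τ≢0
      ; direction = dir
      ; distance = *-cancelˡ τ≢0 (begin
          τ * ((1# + k * k) * τ)
            ≡⟨ solve 2 (λ t k → t :* ((con (ℤ.+ 1) :+ k :* k) :* t) := t :* t :+ (k :* t) :* (k :* t)) refl τ k ⟩
          τ * τ + (k * τ) * (k * τ)
            ≡⟨ cong (λ w → τ * τ + w * w) (sym dir) ⟩
          τ * τ + (b₂ - a₂) * (b₂ - a₂)
            ≡⟨ solve 4 (λ a₁ a₂ b₁ b₂ → (b₁ :- a₁) :* (b₁ :- a₁) :+ (b₂ :- a₂) :* (b₂ :- a₂)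
                 := ((b₁ :* b₁ :+ b₂ :* b₂) :- (a₁ :* a₁ :+ a₂ :* a₂)) :- con (ℤ.+ 2) :* (a₁ :* (b₁ :- a₁) :+ a₂ :* (b₂ :- a₂))) refl a₁ a₂ b₁ b₂ ⟩
          (norm² b - norm² a) - 2# * (a₁ * τ + a₂ * (b₂ - a₂))
            ≡⟨ cong₂ (λ u w → u - 2# * (a₁ * τ + a₂ * w)) (sym (*-inv-cancel (norm² b - norm² a) (*-nonzero 2≢0 τ≢0))) dir ⟩
          height a b * (2# * τ) - 2# * (a₁ * τ + a₂ * (k * τ))
            ≡⟨ solve 5 (λ h t a₁ a₂ k → h :* (con (ℤ.+ 2) :* t) :- con (ℤ.+ 2) :* (a₁ :* t :+ a₂ :* (k :* t)) := t :* (con (ℤ.+ 2) :* (h :- a₁ :- k :* a₂))) refl (height a b) τ a₁ a₂ k ⟩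
          τ * (2# * (height a b - a₁ - k * a₂)) ∎)
      ; nonisotropic = λ e → n≢0 (begin
          τ * τ + (b₂ - a₂) * (b₂ - a₂) ≡⟨ cong (λ w → τ * τ + w * w) dir ⟩
          τ * τ + (k * τ) * (k * τ)     ≡⟨ solve 2 (λ t k → t :* t :+ (k :* t) :* (k :* t) := t :* t :* (con (ℤ.+ 1) :+ k :* k)) refl τ k ⟩
          τ * τ * (1# + k * k)          ≡⟨ cong (τ * τ *_) e ⟩
          τ * τ * 0#                    ≡⟨ zeroʳ _ ⟩
          0#                            ∎) }
      where
      τ = b₁ - a₁
      k = slope a b
      dir : b₂ - a₂ ≡ k * τ
      dir = sym (*-inv-cancel (b₂ - a₂) τ≢0)

    V-≡ : ∀ {a b : V} → proj₁ a - proj₁ b ≡ 0# → proj₂ a - proj₂ b ≡ 0# → a ≡ b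
    V-≡ e e′ = cong₂ _,_ (x-y≡0⇒x≡y e) (x-y≡0⇒x≡y e′)

    reflected-unique : ∀ {k h a b b′} → Reflected k h a b → Reflected k h a b′ → b ≡ b′
    reflected-unique {k} {h} {a} {b} {b′} r r′ = V-≡ (trans (shift (proj₁ b) (proj₁ b′) (proj₁ a)) (trans (cong (_- (proj₁ b′ - proj₁ a)) τ≡) (x-x≡0 _)))
      (trans (shift (proj₂ b) (proj₂ b′) (proj₂ a)) (trans (cong₂ _-_ (trans (direction r) (cong (k *_) τ≡)) (direction r′)) (x-x≡0 _)))
      where
      shift : ∀ x y z → x - y ≡ (x - z) - (y - z)
      shift = solve 3 (λ x y z → x :- y := (x :- z) :- (y :- z)) refl
      τ≡ : proj₁ b - proj₁ a ≡ proj₁ b′ - proj₁ a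
      τ≡ = *-cancelˡ (nonisotropic r) (trans (distance r) (sym (distance r′)))

    reflected-sym : ∀ {k h a b} → Reflected k h a b → Reflected k h b a
    reflected-sym {k} {h} {a} {b} r = record
      { moved = λ e → moved r (trans (flip (proj₁ b) (proj₁ a)) (trans (cong -_ e) neg-0))
      ; direction = trans (flip (proj₂ a) (proj₂ b)) (trans (cong -_ (direction r)) (solve 3 (λ k a b → :- (k :* (b :- a)) := k :* (a :- b)) refl k (proj₁ a) (proj₁ b)))
      ; distance = begin
          (1# + k * k) * (proj₁ a - proj₁ b)
            ≡⟨ solve 3 (λ k a b → (con (ℤ.+ 1) :+ k :* k) :* (a :- b) := (con (ℤ.+ 1) :+ k :* k) :* (b :- a) :- con (ℤ.+ 2) :* ((b :- a) :+ k :* (k :* (b :- a)))) refl k (proj₁ a) (proj₁ b) ⟩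
          (1# + k * k) * (proj₁ b - proj₁ a) - 2# * ((proj₁ b - proj₁ a) + k * (k * (proj₁ b - proj₁ a)))
            ≡⟨ cong₂ (λ u w → u - 2# * ((proj₁ b - proj₁ a) + k * w)) (distance r) (sym (direction r)) ⟩
          2# * (h - proj₁ a - k * proj₂ a) - 2# * ((proj₁ b - proj₁ a) + k * (proj₂ b - proj₂ a))
            ≡⟨ solve 6 (λ h k a₁ a₂ b₁ b₂ → con (ℤ.+ 2) :* (h :- a₁ :- k :* a₂) :- con (ℤ.+ 2) :* ((b₁ :- a₁) :+ k :* (b₂ :- a₂)) := con (ℤ.+ 2) :* (h :- b₁ :- k :* b₂)) refl
                 h k (proj₁ a) (proj₂ a) (proj₁ b) (proj₂ b) ⟩
          2# * (h - proj₁ b - k * proj₂ b) ∎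
      ; nonisotropic = nonisotropic r }
      where
      flip : ∀ x y → x - y ≡ - (y - x)
      flip = solve 2 (λ x y → x :- y := :- (y :- x)) refl
      neg-0 : - 0# ≡ 0#
      neg-0 = solve 0 (:- con (ℤ.+ 0) := con (ℤ.+ 0)) refl

    mirror-point : ∀ {k h a b} → 2# ≢ 0# → Reflected k h a b → ∀ q → norm² (b ⊝ q) ≡ norm² (a ⊝ q) → proj₁ q + k * proj₂ q ≡ h
    mirror-point {k} {h} {a₁ , a₂} {b₁ , b₂} 2≢0 r (q₁ , q₂) e = x-y≡0⇒x≡y (*-cancel-0 (*-nonzero 2≢0 (moved r)) (begin
      2# * τ * (q₁ + k * q₂ - h)
        ≡⟨ solve 8 (λ a₁ a₂ b₁ b₂ q₁ q₂ k h → con (ℤ.+ 2) :* (b₁ :- a₁) :* (q₁ :+ k :* q₂ :- h)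
             := (con (ℤ.+ 2) :* ((b₁ :- a₁) :* (q₁ :- a₁) :+ k :* (b₁ :- a₁) :* (q₂ :- a₂)) :- (b₁ :- a₁) :* (con (ℤ.+ 2) :* (h :- a₁ :- k :* a₂)))) refl a₁ a₂ b₁ b₂ q₁ q₂ k h ⟩
      2# * (τ * (q₁ - a₁) + k * τ * (q₂ - a₂)) - τ * (2# * (h - a₁ - k * a₂))
        ≡⟨ cong₂ (λ u w → 2# * (τ * (q₁ - a₁) + u * (q₂ - a₂)) - τ * w) (sym (direction r)) (sym (distance r)) ⟩
      2# * (τ * (q₁ - a₁) + (b₂ - a₂) * (q₂ - a₂)) - τ * ((1# + k * k) * τ)
        ≡⟨ solve 6 (λ t d k a₁ a₂ q → con (ℤ.+ 2) :* (t :* a₁ :+ d :* a₂) :- t :* ((con (ℤ.+ 1) :+ k :* k) :* t) := con (ℤ.+ 2) :* (t :* a₁ :+ d :* a₂) :- (t :* t :+ (k :* t) :* (k :* t))) refl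
             τ (b₂ - a₂) k (q₁ - a₁) (q₂ - a₂) q₁ ⟩
      2# * (τ * (q₁ - a₁) + (b₂ - a₂) * (q₂ - a₂)) - (τ * τ + (k * τ) * (k * τ))
        ≡⟨ cong (λ w → 2# * (τ * (q₁ - a₁) + (b₂ - a₂) * (q₂ - a₂)) - (τ * τ + w * w)) (sym (direction r)) ⟩
      2# * (τ * (q₁ - a₁) + (b₂ - a₂) * (q₂ - a₂)) - (τ * τ + (b₂ - a₂) * (b₂ - a₂))
        ≡⟨ solve 6 (λ a₁ a₂ b₁ b₂ q₁ q₂ → con (ℤ.+ 2) :* ((b₁ :- a₁) :* (q₁ :- a₁) :+ (b₂ :- a₂) :* (q₂ :- a₂)) :- ((b₁ :- a₁) :* (b₁ :- a₁) :+ (b₂ :- a₂) :* (b₂ :- a₂))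
             := ((a₁ :- q₁) :* (a₁ :- q₁) :+ (a₂ :- q₂) :* (a₂ :- q₂)) :- ((b₁ :- q₁) :* (b₁ :- q₁) :+ (b₂ :- q₂) :* (b₂ :- q₂))) refl a₁ a₂ b₁ b₂ q₁ q₂ ⟩
      norm² ((a₁ , a₂) ⊝ (q₁ , q₂)) - norm² ((b₁ , b₂) ⊝ (q₁ , q₂))
        ≡⟨ cong (λ w → norm² ((a₁ , a₂) ⊝ (q₁ , q₂)) - w) e ⟩
      norm² ((a₁ , a₂) ⊝ (q₁ , q₂)) - norm² ((a₁ , a₂) ⊝ (q₁ , q₂))
        ≡⟨ x-x≡0 _ ⟩
      0# ∎))
      where τ = b₁ - a₁

    mirror-equidistant : ∀ {k h c d} → Reflected k h c d → ∀ q → proj₁ q + k * proj₂ q ≡ h → norm² (d ⊝ q) ≡ norm² (c ⊝ q)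
    mirror-equidistant {k} {h} {c₁ , c₂} {d₁ , d₂} r (q₁ , q₂) refl = x-y≡0⇒x≡y (begin
      norm² ((d₁ , d₂) ⊝ (q₁ , q₂)) - norm² ((c₁ , c₂) ⊝ (q₁ , q₂))
        ≡⟨ solve 6 (λ c₁ c₂ d₁ d₂ q₁ q₂ → ((d₁ :- q₁) :* (d₁ :- q₁) :+ (d₂ :- q₂) :* (d₂ :- q₂)) :- ((c₁ :- q₁) :* (c₁ :- q₁) :+ (c₂ :- q₂) :* (c₂ :- q₂))
             := ((d₁ :- c₁) :* (d₁ :- c₁) :+ (d₂ :- c₂) :* (d₂ :- c₂)) :- con (ℤ.+ 2) :* ((d₁ :- c₁) :* (q₁ :- c₁) :+ (d₂ :- c₂) :* (q₂ :- c₂))) refl c₁ c₂ d₁ d₂ q₁ q₂ ⟩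
      (τ * τ + (d₂ - c₂) * (d₂ - c₂)) - 2# * (τ * (q₁ - c₁) + (d₂ - c₂) * (q₂ - c₂))
        ≡⟨ cong (λ w → (τ * τ + w * w) - 2# * (τ * (q₁ - c₁) + w * (q₂ - c₂))) (direction r) ⟩
      (τ * τ + k * τ * (k * τ)) - 2# * (τ * (q₁ - c₁) + k * τ * (q₂ - c₂))
        ≡⟨ solve 6 (λ t k c₁ c₂ q₁ q₂ → (t :* t :+ k :* t :* (k :* t)) :- con (ℤ.+ 2) :* (t :* (q₁ :- c₁) :+ k :* t :* (q₂ :- c₂))
             := t :* ((con (ℤ.+ 1) :+ k :* k) :* t) :- t :* (con (ℤ.+ 2) :* (q₁ :+ k :* q₂ :- c₁ :- k :* c₂))) refl τ k c₁ c₂ q₁ q₂ ⟩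
      τ * ((1# + k * k) * τ) - τ * (2# * (q₁ + k * q₂ - c₁ - k * c₂))
        ≡⟨ cong (λ w → τ * w - τ * (2# * (q₁ + k * q₂ - c₁ - k * c₂))) (distance r) ⟩
      τ * (2# * (q₁ + k * q₂ - c₁ - k * c₂)) - τ * (2# * (q₁ + k * q₂ - c₁ - k * c₂))
        ≡⟨ x-x≡0 _ ⟩
      0# ∎)
      where τ = d₁ - c₁

    -- From here on points of the plane are treated as complex numbers over F, with products written in coordinates.
    infixl 7 _·_
    _·_ : V → V → V
    (x , y) · (x′ , y′) = x * x′ - y * y′ , x * y′ + y * x′

    bar : V → V
    bar (x , y) = x , - y

    -- u = e s² / |s|²: s is a "half angle" of u relative to e.
    record Half (e u s : V) : Set where
      field
        half : u · bar s ≡ e · s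
        unit : norm² s ≢ 0#
    open Half

    -- The witness is s = ē (u + e): then u s̄ = e (|u|² + u ē) = e ē (e + u) = e s, by |u|² = |e|².
    -- It degenerates only for u = -e, where the imaginary unit (0 , 1) serves instead.
    halfAngle : ∀ (e u : V) → 2# ≢ 0# → norm² u ≡ norm² e → norm² e ≢ 0# → Σ V (Half e u)
    halfAngle e@(e₁ , e₂) u@(u₁ , u₂) 2≢0 nu≡ne ne≢0 with ((u₁ + e₁) ≟ 0#) ×-dec ((u₂ + e₂) ≟ 0#)
    ... | yes (z₁ , z₂) = (0# , 1#) , record
      { half = cong₂ _,_ (x-y≡0⇒x≡y (trans (solve 4 (λ u₁ u₂ e₁ e₂ → (u₁ :* con (ℤ.+ 0) :- u₂ :* (:- con (ℤ.+ 1))) :- (e₁ :* con (ℤ.+ 0) :- e₂ :* con (ℤ.+ 1)) := u₂ :+ e₂) refl u₁ u₂ e₁ e₂) z₂))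
          (x-y≡0⇒x≡y (trans (solve 4 (λ u₁ u₂ e₁ e₂ → (u₁ :* (:- con (ℤ.+ 1)) :+ u₂ :* con (ℤ.+ 0)) :- (e₁ :* con (ℤ.+ 1) :+ e₂ :* con (ℤ.+ 0)) := :- (u₁ :+ e₁)) refl u₁ u₂ e₁ e₂) (trans (cong -_ z₁) (solve 0 (:- con (ℤ.+ 0) := con (ℤ.+ 0)) refl))))
      ; unit = λ z → ne≢0 (begin
          e₁ * e₁ + e₂ * e₂ ≡⟨ solve 2 (λ x y → x :* x :+ y :* y := (x :* x :+ y :* y) :* (con (ℤ.+ 0) :* con (ℤ.+ 0) :+ con (ℤ.+ 1) :* con (ℤ.+ 1))) refl e₁ e₂ ⟩
          norm² e * norm² (0# , 1#) ≡⟨ cong (norm² e *_) z ⟩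
          norm² e * 0# ≡⟨ zeroʳ _ ⟩
          0# ∎) }
    ... | no ¬z = s , record
      { half = cong₂ _,_
          (x-y≡0⇒x≡y (trans (solve 4 (λ u₁ u₂ e₁ e₂ → (u₁ :* (e₁ :* (u₁ :+ e₁) :+ e₂ :* (u₂ :+ e₂)) :- u₂ :* (:- (e₁ :* (u₂ :+ e₂) :- e₂ :* (u₁ :+ e₁)))) :- (e₁ :* (e₁ :* (u₁ :+ e₁) :+ e₂ :* (u₂ :+ e₂)) :- e₂ :* (e₁ :* (u₂ :+ e₂) :- e₂ :* (u₁ :+ e₁)))
              := e₁ :* ((u₁ :* u₁ :+ u₂ :* u₂) :- (e₁ :* e₁ :+ e₂ :* e₂))) refl u₁ u₂ e₁ e₂) (null e₁)))
          (x-y≡0⇒x≡y (trans (solve 4 (λ u₁ u₂ e₁ e₂ → (u₁ :* (:- (e₁ :* (u₂ :+ e₂) :- e₂ :* (u₁ :+ e₁))) :+ u₂ :* (e₁ :* (u₁ :+ e₁) :+ e₂ :* (u₂ :+ e₂))) :- (e₁ :* (e₁ :* (u₂ :+ e₂) :- e₂ :* (u₁ :+ e₁)) :+ e₂ :* (e₁ :* (u₁ :+ e₁) :+ e₂ :* (u₂ :+ e₂)))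
              := e₂ :* ((u₁ :* u₁ :+ u₂ :* u₂) :- (e₁ :* e₁ :+ e₂ :* e₂))) refl u₁ u₂ e₁ e₂) (null e₂)))
      ; unit = λ z → ¬z (sums (*-cancel-0 ne≢0 (trans (sym norm-s) z))) }
      where
      s : V
      s = e₁ * (u₁ + e₁) + e₂ * (u₂ + e₂) , e₁ * (u₂ + e₂) - e₂ * (u₁ + e₁)
      null : ∀ x → x * (norm² u - norm² e) ≡ 0#
      null x = trans (cong (λ n → x * (n - norm² e)) nu≡ne) (trans (cong (x *_) (x-x≡0 _)) (zeroʳ x))
      w : V
      w = u₁ + e₁ , u₂ + e₂
      norm-s : norm² s ≡ norm² e * norm² w
      norm-s = solve 4 (λ e₁ e₂ w₁ w₂ → (e₁ :* w₁ :+ e₂ :* w₂) :* (e₁ :* w₁ :+ e₂ :* w₂) :+ (e₁ :* w₂ :- e₂ :* w₁) :* (e₁ :* w₂ :- e₂ :* w₁) := (e₁ :* e₁ :+ e₂ :* e₂) :* (w₁ :* w₁ :+ w₂ :* w₂)) refl e₁ e₂ (u₁ + e₁) (u₂ + e₂)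
      -- If -1 is a square, a non-zero w may have norm zero, so u + e ≠ 0 is not enough by itself.
      -- But |u|² = |e|² and |w|² = 0 make w·e zero, then the cross product zero as well, and a
      -- non-isotropic e leaves only w = 0.
      sums : norm² w ≡ 0# → u₁ + e₁ ≡ 0# × u₂ + e₂ ≡ 0#
      sums nw = *-cancel-0 ne≢0 (trans (solve 4 (λ e₁ e₂ w₁ w₂ → (e₁ :* e₁ :+ e₂ :* e₂) :* w₁ := (w₁ :* e₁ :+ w₂ :* e₂) :* e₁ :+ (w₁ :* e₂ :- w₂ :* e₁) :* e₂) refl e₁ e₂ (u₁ + e₁) (u₂ + e₂)) (zeros e₁ e₂))
               , *-cancel-0 ne≢0 (trans (solve 4 (λ e₁ e₂ w₁ w₂ → (e₁ :* e₁ :+ e₂ :* e₂) :* w₂ := (w₁ :* e₁ :+ w₂ :* e₂) :* e₂ :+ (w₁ :* e₂ :- w₂ :* e₁) :* (:- e₁)) refl e₁ e₂ (u₁ + e₁) (u₂ + e₂)) (zeros e₂ (- e₁)))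
        where
        dot cross : F
        dot = (u₁ + e₁) * e₁ + (u₂ + e₂) * e₂
        cross = (u₁ + e₁) * e₂ - (u₂ + e₂) * e₁
        dot≡0 : dot ≡ 0#
        dot≡0 = *-cancel-0 2≢0 (begin
          2# * dot
            ≡⟨ solve 4 (λ u₁ u₂ e₁ e₂ → con (ℤ.+ 2) :* ((u₁ :+ e₁) :* e₁ :+ (u₂ :+ e₂) :* e₂) := ((u₁ :+ e₁) :* (u₁ :+ e₁) :+ (u₂ :+ e₂) :* (u₂ :+ e₂)) :+ (e₁ :* e₁ :+ e₂ :* e₂) :- (u₁ :* u₁ :+ u₂ :* u₂)) refl u₁ u₂ e₁ e₂ ⟩
          norm² w + norm² e - norm² u ≡⟨ cong₂ (λ x y → x + norm² e - y) nw nu≡ne ⟩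
          0# + norm² e - norm² e ≡⟨ solve 1 (λ x → con (ℤ.+ 0) :+ x :- x := con (ℤ.+ 0)) refl (norm² e) ⟩
          0# ∎)
        cross≡0 : cross ≡ 0#
        cross≡0 = x*x≡0⇒x≡0 (begin
          cross * cross
            ≡⟨ solve 4 (λ w₁ w₂ e₁ e₂ → (w₁ :* e₂ :- w₂ :* e₁) :* (w₁ :* e₂ :- w₂ :* e₁) := (w₁ :* w₁ :+ w₂ :* w₂) :* (e₁ :* e₁ :+ e₂ :* e₂) :- (w₁ :* e₁ :+ w₂ :* e₂) :* (w₁ :* e₁ :+ w₂ :* e₂)) refl (u₁ + e₁) (u₂ + e₂) e₁ e₂ ⟩
          norm² w * norm² e - dot * dot ≡⟨ cong₂ (λ x y → x * norm² e - y * y) nw dot≡0 ⟩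
          0# * norm² e - 0# * 0# ≡⟨ solve 1 (λ x → con (ℤ.+ 0) :* x :- con (ℤ.+ 0) :* con (ℤ.+ 0) := con (ℤ.+ 0)) refl (norm² e) ⟩
          0# ∎)
        zeros : ∀ x y → dot * x + cross * y ≡ 0#
        zeros x y = trans (cong₂ (λ a b → a * x + b * y) dot≡0 cross≡0) (solve 2 (λ x y → con (ℤ.+ 0) :* x :+ con (ℤ.+ 0) :* y := con (ℤ.+ 0)) refl x y)
    zero-+ : ∀ {x y} → x ≡ 0# → y ≡ 0# → x + y ≡ 0#
    zero-+ e e′ = trans (cong₂ _+_ e e′) (+-identityˡ 0#)

    *-zero : ∀ x {y} → y ≡ 0# → x * y ≡ 0#
    *-zero x e = trans (cong (x *_) e) (zeroʳ x)

    -- The linear part of the reflection acting on the chord u = c - a. Both endpoints move along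
    -- the normal (1 , k), and ω is the difference of the two displacements; subtracting the
    -- distance equations eliminates h.
    mirror-linear : ∀ {k h a b c d} → Reflected k h a b → Reflected k h c d →
      Σ F λ ω → (d ⊝ b ≡ (proj₁ (c ⊝ a) + ω , proj₂ (c ⊝ a) + k * ω)) × (1# + k * k) * ω + 2# * (proj₁ (c ⊝ a) + k * proj₂ (c ⊝ a)) ≡ 0#
    mirror-linear {k} {h} {a₁ , a₂} {b₁ , b₂} {c₁ , c₂} {d₁ , d₂} r r′ = ω
      , cong₂ _,_ (solve 4 (λ a b c d → d :- b := (c :- a) :+ ((d :- c) :- (b :- a))) refl a₁ b₁ c₁ d₁) (begin
          d₂ - b₂                             ≡⟨ solve 4 (λ a b c d → d :- b := (c :- a) :+ ((d :- c) :- (b :- a))) refl a₂ b₂ c₂ d₂ ⟩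
          c₂ - a₂ + ((d₂ - c₂) - (b₂ - a₂))   ≡⟨ cong₂ (λ x y → c₂ - a₂ + (x - y)) (direction r′) (direction r) ⟩
          c₂ - a₂ + (k * (d₁ - c₁) - k * (b₁ - a₁)) ≡⟨ solve 4 (λ z k x y → z :+ (k :* x :- k :* y) := z :+ k :* (x :- y)) refl (c₂ - a₂) k (d₁ - c₁) (b₁ - a₁) ⟩
          c₂ - a₂ + k * ω                     ∎)
      , (begin
          (1# + k * k) * ω + 2# * (c₁ - a₁ + k * (c₂ - a₂))
            ≡⟨ solve 4 (λ k x y z → (con (ℤ.+ 1) :+ k :* k) :* (x :- y) :+ z := ((con (ℤ.+ 1) :+ k :* k) :* x :- (con (ℤ.+ 1) :+ k :* k) :* y) :+ z) refl k (d₁ - c₁) (b₁ - a₁) (2# * (c₁ - a₁ + k * (c₂ - a₂))) ⟩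
          ((1# + k * k) * (d₁ - c₁) - (1# + k * k) * (b₁ - a₁)) + 2# * (c₁ - a₁ + k * (c₂ - a₂))
            ≡⟨ cong₂ (λ x y → (x - y) + 2# * (c₁ - a₁ + k * (c₂ - a₂))) (distance r′) (distance r) ⟩
          (2# * (h - c₁ - k * c₂) - 2# * (h - a₁ - k * a₂)) + 2# * (c₁ - a₁ + k * (c₂ - a₂))
            ≡⟨ solve 6 (λ k h a₁ a₂ c₁ c₂ → (con (ℤ.+ 2) :* (h :- c₁ :- k :* c₂) :- con (ℤ.+ 2) :* (h :- a₁ :- k :* a₂)) :+ con (ℤ.+ 2) :* (c₁ :- a₁ :+ k :* (c₂ :- a₂)) := con (ℤ.+ 0)) refl k h a₁ a₂ c₁ c₂ ⟩
          0# ∎)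
      where ω = (d₁ - c₁) - (b₁ - a₁)

    norm-reflected : ∀ {k h a b c d} → Reflected k h a b → Reflected k h c d → norm² (d ⊝ b) ≡ norm² (c ⊝ a)
    norm-reflected {k} {h} {a} {b} {c} {d} r r′ with mirror-linear r r′
    ... | ω , v≡ , rel = x-y≡0⇒x≡y (begin
      norm² (d ⊝ b) - norm² (c ⊝ a) ≡⟨ cong (λ v → norm² v - norm² (c ⊝ a)) v≡ ⟩
      norm² (u₁ + ω , u₂ + k * ω) - norm² (u₁ , u₂)
        ≡⟨ solve 4 (λ u₁ u₂ w k → ((u₁ :+ w) :* (u₁ :+ w) :+ (u₂ :+ k :* w) :* (u₂ :+ k :* w)) :- (u₁ :* u₁ :+ u₂ :* u₂) := w :* ((con (ℤ.+ 1) :+ k :* k) :* w :+ con (ℤ.+ 2) :* (u₁ :+ k :* u₂))) refl u₁ u₂ ω k ⟩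
      ω * ((1# + k * k) * ω + 2# * (u₁ + k * u₂)) ≡⟨ *-zero ω rel ⟩
      0# ∎)
      where
      u₁ = proj₁ (c ⊝ a)
      u₂ = proj₂ (c ⊝ a)

    -- The reflection conjugates: v = - n ū n / |n|² for n = 1 + i k; multiplying by s̄ t̄ and inserting the
    -- half angles gives |e|² · 2 Re (t s n̄) = 0.
    halfAngles-mirror : ∀ {e u v s t k ω} → 2# ≢ 0# → norm² u ≡ norm² e → norm² e ≢ 0# → Half e u s → Half (bar e) v t →
      v ≡ (proj₁ u + ω , proj₂ u + k * ω) → (1# + k * k) * ω + 2# * (proj₁ u + k * proj₂ u) ≡ 0# →
      proj₁ (t · s · (1# , - k)) ≡ 0#
    halfAngles-mirror {e₁ , e₂} {u₁ , u₂} {_} {s₁ , s₂} {t₁ , t₂} {k} {ω} 2≢0 nu≡ne ne≢0 hs ht refl rel = *-cancel-0 2≢0 (*-cancel-0 ne≢0 (begin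
      norm² e * (2# * proj₁ (t · s · n̄))
        ≡⟨ solve 7 (λ e₁ e₂ s₁ s₂ t₁ t₂ k →
             let x = e₁ :* t₁ :- (:- e₂) :* t₂ ; y = e₁ :* t₂ :+ (:- e₂) :* t₁ ; x′ = e₁ :* s₁ :- e₂ :* s₂ ; y′ = e₁ :* s₂ :+ e₂ :* s₁ in
             (e₁ :* e₁ :+ e₂ :* e₂) :* (con (ℤ.+ 2) :* ((t₁ :* s₁ :- t₂ :* s₂) :* con (ℤ.+ 1) :- (t₁ :* s₂ :+ t₂ :* s₁) :* (:- k)))
             := ((x :* x′ :- y :* y′) :* con (ℤ.+ 1) :- (x :* y′ :+ y :* x′) :* (:- k))
                :+ (e₁ :* e₁ :+ e₂ :* e₂) :* (con (ℤ.+ 1) :* (s₁ :* t₁ :- (:- s₂) :* (:- t₂)) :- k :* (s₁ :* (:- t₂) :+ (:- s₂) :* t₁))) refl e₁ e₂ s₁ s₂ t₁ t₂ k ⟩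
      proj₁ ((bar e · t) · (e · s) · n̄) + norm² e * proj₁ (n · (bar s · bar t))
        ≡⟨ cong₂ _+_ (cong₂ (λ x y → proj₁ (x · y · n̄)) (sym (half ht)) (sym (half hs))) (cong (_* proj₁ (n · (bar s · bar t))) (sym nu≡ne)) ⟩
      proj₁ ((v · bar t) · (u · bar s) · n̄) + norm² u * proj₁ (n · (bar s · bar t))
        ≡⟨ solve 8 (λ u₁ u₂ s₁ s₂ t₁ t₂ k w →
             let v₁ = u₁ :+ w ; v₂ = u₂ :+ k :* w
                 x = v₁ :* t₁ :- v₂ :* (:- t₂) ; y = v₁ :* (:- t₂) :+ v₂ :* t₁ ; x′ = u₁ :* s₁ :- u₂ :* (:- s₂) ; y′ = u₁ :* (:- s₂) :+ u₂ :* s₁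
                 st₁ = s₁ :* t₁ :- (:- s₂) :* (:- t₂) ; st₂ = s₁ :* (:- t₂) :+ (:- s₂) :* t₁
                 Δ = (con (ℤ.+ 1) :+ k :* k) :* w :+ con (ℤ.+ 2) :* (u₁ :+ k :* u₂) in
             ((x :* x′ :- y :* y′) :* con (ℤ.+ 1) :- (x :* y′ :+ y :* x′) :* (:- k)) :+ (u₁ :* u₁ :+ u₂ :* u₂) :* (con (ℤ.+ 1) :* st₁ :- k :* st₂)
             := (u₁ :* st₁ :- u₂ :* st₂) :* Δ) refl u₁ u₂ s₁ s₂ t₁ t₂ k ω ⟩
      (u₁ * proj₁ (bar s · bar t) - u₂ * proj₂ (bar s · bar t)) * ((1# + k * k) * ω + 2# * (u₁ + k * u₂))
        ≡⟨ *-zero _ rel ⟩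
      0# ∎))
      where
      e u s t v n n̄ : V
      e = e₁ , e₂
      u = u₁ , u₂
      s = s₁ , s₂
      t = t₁ , t₂
      v = u₁ + ω , u₂ + k * ω
      n = 1# , k
      n̄ = 1# , - k

    -- The real part of t s conj(b - a) = s (t b̄) - t (s ā) is bilinear in the vectors (s ā , s)
    -- and (t b̄ , t). Having a common mirror is thus an incidence between a point attached to one
    -- frame and a plane attached to the other.
    frames-incident : ∀ {e k h a b c d s t} → 2# ≢ 0# → norm² (c ⊝ a) ≡ norm² e → norm² e ≢ 0# → Half e (c ⊝ a) s → Half (bar e) (d ⊝ b) t →
      Reflected k h a b → Reflected k h c d → proj₁ (t · (s · bar (b ⊝ a))) ≡ 0#
    frames-incident {e} {k} {h} {a@(a₁ , a₂)} {b@(b₁ , b₂)} {c} {d} {s@(s₁ , s₂)} {t@(t₁ , t₂)} 2≢0 nu ne≢0 hs ht r r′ with mirror-linear r r′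
    ... | ω , v≡ , rel = begin
      proj₁ (t · (s · bar (b ⊝ a))) ≡⟨ cong (λ w → proj₁ (t · (s · (b₁ - a₁ , - w)))) (direction r) ⟩
      proj₁ (t · (s · (b₁ - a₁ , - (k * (b₁ - a₁)))))
        ≡⟨ solve 6 (λ s₁ s₂ t₁ t₂ k x → t₁ :* (s₁ :* x :- s₂ :* (:- (k :* x))) :- t₂ :* (s₁ :* (:- (k :* x)) :+ s₂ :* x)
             := x :* ((t₁ :* s₁ :- t₂ :* s₂) :* con (ℤ.+ 1) :- (t₁ :* s₂ :+ t₂ :* s₁) :* (:- k))) refl s₁ s₂ t₁ t₂ k (b₁ - a₁) ⟩
      (b₁ - a₁) * proj₁ (t · s · (1# , - k)) ≡⟨ *-zero (b₁ - a₁) (halfAngles-mirror 2≢0 nu ne≢0 hs ht v≡ rel) ⟩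
      0# ∎

    Half-norm : ∀ {e u s} → Half e u s → norm² s * proj₁ u ≡ proj₁ (e · s · s) × norm² s * proj₂ u ≡ proj₂ (e · s · s)
    Half-norm {e₁ , e₂} {u₁ , u₂} {s₁ , s₂} h =
      trans (solve 4 (λ u₁ u₂ s₁ s₂ → (s₁ :* s₁ :+ s₂ :* s₂) :* u₁ := (u₁ :* s₁ :- u₂ :* (:- s₂)) :* s₁ :- (u₁ :* (:- s₂) :+ u₂ :* s₁) :* s₂) refl u₁ u₂ s₁ s₂)
        (cong (λ z → proj₁ (z · (s₁ , s₂))) (half h)) ,
      trans (solve 4 (λ u₁ u₂ s₁ s₂ → (s₁ :* s₁ :+ s₂ :* s₂) :* u₂ := (u₁ :* s₁ :- u₂ :* (:- s₂)) :* s₂ :+ (u₁ :* (:- s₂) :+ u₂ :* s₁) :* s₁) refl u₁ u₂ s₁ s₂)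
        (cong (λ z → proj₂ (z · (s₁ , s₂))) (half h))

    -- A frame (a , u) is determined by the projective point (s ā , s).
    frame-injective : ∀ {e u u′ s s′} (a a′ : V) → Half e u s → Half e u′ s′ →
      let E = s · bar a ; E′ = s′ · bar a′ in
      proj₁ s * proj₂ s′ - proj₂ s * proj₁ s′ ≡ 0# →
      proj₁ E * proj₁ s′ - proj₁ s * proj₁ E′ ≡ 0# → proj₁ E * proj₂ s′ - proj₂ s * proj₁ E′ ≡ 0# →
      proj₂ E * proj₁ s′ - proj₁ s * proj₂ E′ ≡ 0# → proj₂ E * proj₂ s′ - proj₂ s * proj₂ E′ ≡ 0# →
      a ≡ a′ × u ≡ u′
    frame-injective {e₁ , e₂} {u₁ , u₂} {u₁′ , u₂′} {s₁ , s₂} {s₁′ , s₂′} (a₁ , a₂) (a₁′ , a₂′) hs hs′ m m₁₁ m₁₂ m₂₁ m₂₂ =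
      V-≡ (*-cancel-0 nn≢0 (begin
            n * n′ * (a₁ - a₁′)
              ≡⟨ solve 8 (λ s₁ s₂ r₁ r₂ a₁ a₂ b₁ b₂ →
                   let E₁ = s₁ :* a₁ :- s₂ :* (:- a₂) ; E₂ = s₁ :* (:- a₂) :+ s₂ :* a₁ ; G₁ = r₁ :* b₁ :- r₂ :* (:- b₂) ; G₂ = r₁ :* (:- b₂) :+ r₂ :* b₁ in
                   (s₁ :* s₁ :+ s₂ :* s₂) :* (r₁ :* r₁ :+ r₂ :* r₂) :* (a₁ :- b₁)
                   := (r₁ :* s₁ :* (E₁ :* r₁ :- s₁ :* G₁) :+ r₂ :* s₁ :* (E₁ :* r₂ :- s₂ :* G₁)) :+ (r₁ :* s₂ :* (E₂ :* r₁ :- s₁ :* G₂) :+ r₂ :* s₂ :* (E₂ :* r₂ :- s₂ :* G₂))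
                      :+ (s₂ :* G₁ :- s₁ :* G₂) :* (s₁ :* r₂ :- s₂ :* r₁)) refl s₁ s₂ s₁′ s₂′ a₁ a₂ a₁′ a₂′ ⟩
            _ ≡⟨ zero-+ (zero-+ (zero-+ (*-zero _ m₁₁) (*-zero _ m₁₂)) (zero-+ (*-zero _ m₂₁) (*-zero _ m₂₂))) (*-zero _ m) ⟩
            0# ∎))
          (*-cancel-0 nn≢0 (begin
            n * n′ * (a₂ - a₂′)
              ≡⟨ solve 8 (λ s₁ s₂ r₁ r₂ a₁ a₂ b₁ b₂ →
                   let E₁ = s₁ :* a₁ :- s₂ :* (:- a₂) ; E₂ = s₁ :* (:- a₂) :+ s₂ :* a₁ ; G₁ = r₁ :* b₁ :- r₂ :* (:- b₂) ; G₂ = r₁ :* (:- b₂) :+ r₂ :* b₁ in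
                   (s₁ :* s₁ :+ s₂ :* s₂) :* (r₁ :* r₁ :+ r₂ :* r₂) :* (a₂ :- b₂)
                   := (r₁ :* s₂ :* (E₁ :* r₁ :- s₁ :* G₁) :+ r₂ :* s₂ :* (E₁ :* r₂ :- s₂ :* G₁)) :+ ((:- r₁) :* s₁ :* (E₂ :* r₁ :- s₁ :* G₂) :+ (:- r₂) :* s₁ :* (E₂ :* r₂ :- s₂ :* G₂))
                      :+ (:- (s₁ :* G₁ :+ s₂ :* G₂)) :* (s₁ :* r₂ :- s₂ :* r₁)) refl s₁ s₂ s₁′ s₂′ a₁ a₂ a₁′ a₂′ ⟩
            _ ≡⟨ zero-+ (zero-+ (zero-+ (*-zero _ m₁₁) (*-zero _ m₁₂)) (zero-+ (*-zero _ m₂₁) (*-zero _ m₂₂))) (*-zero _ m) ⟩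
            0# ∎)) ,
      V-≡ (*-cancel-0 nn≢0 (begin
            n * n′ * (u₁ - u₁′) ≡⟨ solve 4 (λ n n′ u u′ → n :* n′ :* (u :- u′) := n′ :* (n :* u) :- n :* (n′ :* u′)) refl n n′ u₁ u₁′ ⟩
            n′ * (n * u₁) - n * (n′ * u₁′) ≡⟨ cong₂ (λ x y → n′ * x - n * y) (proj₁ (Half-norm hs)) (proj₁ (Half-norm hs′)) ⟩
            n′ * proj₁ (e · s · s) - n * proj₁ (e · s′ · s′)
              ≡⟨ solve 6 (λ e₁ e₂ s₁ s₂ r₁ r₂ →
                   let x = e₁ :* s₁ :- e₂ :* s₂ ; y = e₁ :* s₂ :+ e₂ :* s₁ ; x′ = e₁ :* r₁ :- e₂ :* r₂ ; y′ = e₁ :* r₂ :+ e₂ :* r₁ in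
                   (r₁ :* r₁ :+ r₂ :* r₂) :* (x :* s₁ :- y :* s₂) :- (s₁ :* s₁ :+ s₂ :* s₂) :* (x′ :* r₁ :- y′ :* r₂)
                   := con (ℤ.+ 2) :* (x :* r₂ :+ y :* r₁) :* (s₁ :* r₂ :- s₂ :* r₁)) refl e₁ e₂ s₁ s₂ s₁′ s₂′ ⟩
            _ ≡⟨ *-zero _ m ⟩
            0# ∎))
          (*-cancel-0 nn≢0 (begin
            n * n′ * (u₂ - u₂′) ≡⟨ solve 4 (λ n n′ u u′ → n :* n′ :* (u :- u′) := n′ :* (n :* u) :- n :* (n′ :* u′)) refl n n′ u₂ u₂′ ⟩
            n′ * (n * u₂) - n * (n′ * u₂′) ≡⟨ cong₂ (λ x y → n′ * x - n * y) (proj₂ (Half-norm hs)) (proj₂ (Half-norm hs′)) ⟩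
            n′ * proj₂ (e · s · s) - n * proj₂ (e · s′ · s′)
              ≡⟨ solve 6 (λ e₁ e₂ s₁ s₂ r₁ r₂ →
                   let x = e₁ :* s₁ :- e₂ :* s₂ ; y = e₁ :* s₂ :+ e₂ :* s₁ ; x′ = e₁ :* r₁ :- e₂ :* r₂ ; y′ = e₁ :* r₂ :+ e₂ :* r₁ in
                   (r₁ :* r₁ :+ r₂ :* r₂) :* (x :* s₂ :+ y :* s₁) :- (s₁ :* s₁ :+ s₂ :* s₂) :* (x′ :* r₂ :+ y′ :* r₁)
                   := (:- con (ℤ.+ 2)) :* (x :* r₁ :- y :* r₂) :* (s₁ :* r₂ :- s₂ :* r₁)) refl e₁ e₂ s₁ s₂ s₁′ s₂′ ⟩
            _ ≡⟨ *-zero _ m ⟩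
            0# ∎))
      where
      e s s′ : V
      e = e₁ , e₂
      s = s₁ , s₂
      s′ = s₁′ , s₂′
      n = norm² s
      n′ = norm² s′
      nn≢0 : n * n′ ≢ 0#
      nn≢0 = *-nonzero (unit hs) (unit hs′)

    -- If the pencil of planes through the frame (a , s) contains Re (t (s° b̄ - E°)) = 0, then b lies on this conic through a.
    module Pencil (a s s° E° : V) where
      η : V
      η = E° ⊝ s° · bar a
      lam : F
      lam = proj₁ s * proj₂ s° - proj₂ s * proj₁ s°
      μ : V
      μ = - (proj₁ s * proj₂ η - proj₂ s * proj₁ η) , - (proj₁ s * proj₁ η + proj₂ s * proj₂ η)

      conic : ∀ (b t : V) → norm² t ≢ 0# → proj₁ (t · (s · bar (b ⊝ a))) ≡ 0# → proj₁ (t · (s° · bar b ⊝ E°)) ≡ 0# →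
        lam * norm² (b ⊝ a) + (proj₁ μ * proj₁ (b ⊝ a) + proj₂ μ * proj₂ (b ⊝ a)) ≡ 0#
      conic b t@(t₁ , t₂) t≢0 e₁ e₂ = trans
        (solve 10 (λ s₁ s₂ r₁ r₂ a₁ a₂ b₁ b₂ E₁ E₂ →
           let h₁ = b₁ :- a₁ ; h₂ = b₂ :- a₂
               η₁ = E₁ :- (r₁ :* a₁ :- r₂ :* (:- a₂)) ; η₂ = E₂ :- (r₁ :* (:- a₂) :+ r₂ :* a₁)
               X₁ = s₁ :* h₁ :- s₂ :* (:- h₂) ; X₂ = s₁ :* (:- h₂) :+ s₂ :* h₁
               Y₁ = (r₁ :* b₁ :- r₂ :* (:- b₂)) :- E₁ ; Y₂ = (r₁ :* (:- b₂) :+ r₂ :* b₁) :- E₂ in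
           (s₁ :* r₂ :- s₂ :* r₁) :* (h₁ :* h₁ :+ h₂ :* h₂) :+ ((:- (s₁ :* η₂ :- s₂ :* η₁)) :* h₁ :+ (:- (s₁ :* η₁ :+ s₂ :* η₂)) :* h₂)
           := X₁ :* Y₂ :- X₂ :* Y₁) refl (proj₁ s) (proj₂ s) (proj₁ s°) (proj₂ s°) (proj₁ a) (proj₂ a) (proj₁ b) (proj₂ b) (proj₁ E°) (proj₂ E°))
        (*-cancel-0 t≢0 (begin
          norm² t * (X₁ * Y₂ - X₂ * Y₁)
            ≡⟨ solve 6 (λ t₁ t₂ X₁ X₂ Y₁ Y₂ → (t₁ :* t₁ :+ t₂ :* t₂) :* (X₁ :* Y₂ :- X₂ :* Y₁)
                 := (t₁ :* Y₂ :+ t₂ :* Y₁) :* (t₁ :* X₁ :- t₂ :* X₂) :+ (:- (t₁ :* X₂ :+ t₂ :* X₁)) :* (t₁ :* Y₁ :- t₂ :* Y₂)) refl t₁ t₂ X₁ X₂ Y₁ Y₂ ⟩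
          _ ≡⟨ zero-+ (*-zero _ e₁) (*-zero _ e₂) ⟩
          0# ∎))
        where
        X₁ = proj₁ (s · bar (b ⊝ a))
        X₂ = proj₂ (s · bar (b ⊝ a))
        Y₁ = proj₁ (s° · bar b ⊝ E°)
        Y₂ = proj₂ (s° · bar b ⊝ E°)

      -- If the conic is everything, (E° , s°) is a multiple of (s ā , s).
      degenerate : lam ≡ 0# → proj₁ μ ≡ 0# → proj₂ μ ≡ 0# → norm² s ≢ 0# →
        let ρ = proj₁ s * proj₁ s° + proj₂ s * proj₂ s° ; E = s · bar a in
        (norm² s * proj₁ s° ≡ ρ * proj₁ s × norm² s * proj₂ s° ≡ ρ * proj₂ s) ×
        (norm² s * proj₁ E° ≡ ρ * proj₁ E × norm² s * proj₂ E° ≡ ρ * proj₂ E)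
      degenerate l≡0 μ₁≡0 μ₂≡0 s≢0 =
        (x-y≡0⇒x≡y (trans (solve 4 (λ s₁ s₂ r₁ r₂ → (s₁ :* s₁ :+ s₂ :* s₂) :* r₁ :- (s₁ :* r₁ :+ s₂ :* r₂) :* s₁ := (:- s₂) :* (s₁ :* r₂ :- s₂ :* r₁)) refl s₁ s₂ r₁ r₂) (*-zero _ l≡0)) ,
         x-y≡0⇒x≡y (trans (solve 4 (λ s₁ s₂ r₁ r₂ → (s₁ :* s₁ :+ s₂ :* s₂) :* r₂ :- (s₁ :* r₁ :+ s₂ :* r₂) :* s₂ := s₁ :* (s₁ :* r₂ :- s₂ :* r₁)) refl s₁ s₂ r₁ r₂) (*-zero _ l≡0))) ,
        (x-y≡0⇒x≡y (trans (solve 8 (λ s₁ s₂ r₁ r₂ a₁ a₂ E₁ E₂ →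
             let η₁ = E₁ :- (r₁ :* a₁ :- r₂ :* (:- a₂)) ; η₂ = E₂ :- (r₁ :* (:- a₂) :+ r₂ :* a₁) in
             (s₁ :* s₁ :+ s₂ :* s₂) :* E₁ :- (s₁ :* r₁ :+ s₂ :* r₂) :* (s₁ :* a₁ :- s₂ :* (:- a₂))
             := ((:- s₁) :* (:- (s₁ :* η₁ :+ s₂ :* η₂)) :+ s₂ :* (:- (s₁ :* η₂ :- s₂ :* η₁))) :+ (s₁ :* a₂ :- s₂ :* a₁) :* (s₁ :* r₂ :- s₂ :* r₁)) refl s₁ s₂ r₁ r₂ a₁ a₂ E₁ E₂)
           (zero-+ (zero-+ (*-zero _ μ₂≡0) (*-zero _ μ₁≡0)) (*-zero _ l≡0))) ,
         x-y≡0⇒x≡y (trans (solve 8 (λ s₁ s₂ r₁ r₂ a₁ a₂ E₁ E₂ →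
             let η₁ = E₁ :- (r₁ :* a₁ :- r₂ :* (:- a₂)) ; η₂ = E₂ :- (r₁ :* (:- a₂) :+ r₂ :* a₁) in
             (s₁ :* s₁ :+ s₂ :* s₂) :* E₂ :- (s₁ :* r₁ :+ s₂ :* r₂) :* (s₁ :* (:- a₂) :+ s₂ :* a₁)
             := ((:- s₂) :* (:- (s₁ :* η₁ :+ s₂ :* η₂)) :+ (:- s₁) :* (:- (s₁ :* η₂ :- s₂ :* η₁))) :+ (s₁ :* a₁ :+ s₂ :* a₂) :* (s₁ :* r₂ :- s₂ :* r₁)) refl s₁ s₂ r₁ r₂ a₁ a₂ E₁ E₂)
           (zero-+ (zero-+ (*-zero _ μ₂≡0) (*-zero _ μ₁≡0)) (*-zero _ l≡0))))
        where
        s₁ = proj₁ s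
        s₂ = proj₂ s
        r₁ = proj₁ s°
        r₂ = proj₂ s°
        a₁ = proj₁ a
        a₂ = proj₂ a
        E₁ = proj₁ E°
        E₂ = proj₂ E°

  -- Isotropic directions, circles and lines.

  module Conics where

    open FiniteSums
    open 𝔽ₚ
    open Polynomials
    open Reflections
    open import Data.Nat using (_≤_)
    open import Data.Integer as ℤ using (ℤ)
    open import Data.List using (List; _++_; map; cartesianProduct)
    open import Data.List.Membership.Propositional using (_∈_)
    open import Data.List.Membership.Propositional.Properties using (∈-map⁺; ∈-map⁻; ∈-++⁺ˡ; ∈-++⁺ʳ; ∈-cartesianProduct⁺; ∈-allFin)
    open import Data.List.Relation.Unary.Any using (Any)
    open import Data.List.Relation.Unary.Unique.Propositional using (Unique)
    open import Data.List.Relation.Unary.Unique.Propositional.Properties using (allFin⁺; cartesianProduct⁺; map⁺; ++⁺)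
    open import Data.Product using (Σ; _×_; _,_; proj₁; proj₂)
    open import Data.Product.Properties using (≡-dec)
    open import Data.Sum using (_⊎_; inj₁; inj₂)
    open import Data.Empty using (⊥; ⊥-elim)
    open import Relation.Nullary using (¬_; Dec; yes; no)
    open import Relation.Binary.PropositionalEquality

    open Solver
    open ≡-Reasoning

    _≟V_ : (x y : V) → Dec (x ≡ y)
    _≟V_ = ≡-dec _≟_ _≟_

    allV : List V
    allV = cartesianProduct allF allF

    ∈-allF : ∀ x → x ∈ allF
    ∈-allF = ∈-allFin

    ∈-allV : ∀ x → x ∈ allV
    ∈-allV (x , y) = ∈-cartesianProduct⁺ (∈-allF x) (∈-allF y)

    unique-allF : Unique allF
    unique-allF = allFin⁺ p

    unique-allV : Unique allV
    unique-allV = cartesianProduct⁺ unique-allF unique-allF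

    -- A system of isotropic directions: one of the two isotropic lines if -1 is a square, the zero vector otherwise.
    record Isotropy : Set₁ where
      field
        Iso : V → Set
        Iso? : ∀ v → Dec (Iso v)
        iso-zero : Iso (0# , 0#)
        iso-⊝ : ∀ {x y} → Iso x → Iso y → Iso (x ⊝ y)
        iso-null : ∀ {x} → Iso x → norm² x ≡ 0#
        iso-either : ∀ {x y} → norm² x ≡ 0# → norm² y ≡ 0# → norm² (x ⊝ y) ≢ 0# → Iso x ⊎ Iso y

    anisotropic : (∀ v → norm² v ≡ 0# → v ≡ (0# , 0#)) → Isotropy
    anisotropic null = record
      { Iso = _≡ (0# , 0#)
      ; Iso? = λ v → v ≟V (0# , 0#)
      ; iso-zero = refl
      ; iso-⊝ = λ { refl refl → cong₂ _,_ (x-x≡0 0#) (x-x≡0 0#) }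
      ; iso-null = λ { refl → solve 0 (con (ℤ.+ 0) :* con (ℤ.+ 0) :+ con (ℤ.+ 0) :* con (ℤ.+ 0) := con (ℤ.+ 0)) refl }
      ; iso-either = λ nx _ _ → inj₁ (null _ nx) }

    factor : ∀ ι → ι * ι + 1# ≡ 0# → ∀ x → norm² x ≡ (proj₁ x - ι * proj₂ x) * (proj₁ x + ι * proj₂ x)
    factor ι ι² (x₁ , x₂) = begin
      x₁ * x₁ + x₂ * x₂ ≡⟨ solve 3 (λ x y i → x :* x :+ y :* y := (x :- i :* y) :* (x :+ i :* y) :+ y :* y :* (i :* i :+ con (ℤ.+ 1))) refl x₁ x₂ ι ⟩
      (x₁ - ι * x₂) * (x₁ + ι * x₂) + x₂ * x₂ * (ι * ι + 1#) ≡⟨ cong ((x₁ - ι * x₂) * (x₁ + ι * x₂) +_) (*-zero (x₂ * x₂) ι²) ⟩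
      (x₁ - ι * x₂) * (x₁ + ι * x₂) + 0# ≡⟨ +-identityʳ _ ⟩
      (x₁ - ι * x₂) * (x₁ + ι * x₂) ∎

    splitIsotropy : ∀ ι → ι * ι + 1# ≡ 0# → Isotropy
    splitIsotropy ι ι² = record
      { Iso = λ v → proj₁ v - ι * proj₂ v ≡ 0#
      ; Iso? = λ v → (proj₁ v - ι * proj₂ v) ≟ 0#
      ; iso-zero = solve 1 (λ i → con (ℤ.+ 0) :- i :* con (ℤ.+ 0) := con (ℤ.+ 0)) refl ι
      ; iso-⊝ = λ {x} {y} e e′ → trans (solve 5 (λ x₁ x₂ y₁ y₂ i → (x₁ :- y₁) :- i :* (x₂ :- y₂) := (x₁ :- i :* x₂) :- (y₁ :- i :* y₂)) refl (proj₁ x) (proj₂ x) (proj₁ y) (proj₂ y) ι)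
          (trans (cong₂ _-_ e e′) (x-x≡0 0#))
      ; iso-null = λ {x} e → trans (factor ι ι² x) (trans (cong (_* (proj₁ x + ι * proj₂ x)) e) (zeroˡ _))
      ; iso-either = either }
      where
      either : ∀ {x y} → norm² x ≡ 0# → norm² y ≡ 0# → norm² (x ⊝ y) ≢ 0# → proj₁ x - ι * proj₂ x ≡ 0# ⊎ proj₁ y - ι * proj₂ y ≡ 0#
      either {x} {y} nx ny nxy with (proj₁ x - ι * proj₂ x) ≟ 0# | (proj₁ y - ι * proj₂ y) ≟ 0#
      ... | yes e | _ = inj₁ e
      ... | no _ | yes e = inj₂ e
      ... | no x≢ | no y≢ = ⊥-elim (nxy (trans (factor ι ι² (x ⊝ y)) (*-zero _ (begin
          (proj₁ x - proj₁ y) + ι * (proj₂ x - proj₂ y)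
            ≡⟨ solve 5 (λ x₁ x₂ y₁ y₂ i → (x₁ :- y₁) :+ i :* (x₂ :- y₂) := (x₁ :+ i :* x₂) :- (y₁ :+ i :* y₂)) refl (proj₁ x) (proj₂ x) (proj₁ y) (proj₂ y) ι ⟩
          (proj₁ x + ι * proj₂ x) - (proj₁ y + ι * proj₂ y)
            ≡⟨ cong₂ _-_ (*-cancel-0 x≢ (trans (sym (factor ι ι² x)) nx)) (*-cancel-0 y≢ (trans (sym (factor ι ι² y)) ny)) ⟩
          0# - 0# ≡⟨ x-x≡0 0# ⟩
          0# ∎))))

    -- λ |v|² + μ·v + ν = 0
    Curve : Set
    Curve = F × V × F

    _onto_ : Curve → V → F
    (l , (m₁ , m₂) , n) onto v = l * norm² v + (m₁ * proj₁ v + m₂ * proj₂ v) + n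

    On : Curve → V → Set
    On C v = C onto v ≡ 0#

    on? : ∀ C v → Dec (On C v)
    on? C v = (C onto v) ≟ 0#

    4# : F
    4# = fromℤ (ℤ.+ 4)

    -- For λ ≠ 0 this is 4λ² times the squared radius, for λ = 0 the norm of the normal vector.
    -- Requiring it to be non-zero excludes circles of radius zero and isotropic lines.
    disc : Curve → F
    disc (l , m , n) = norm² m - 4# * (l * n)

    circle : V × F → Curve
    circle (m , n) = 1# , m , n

    -- Vertical lines are left out: the pairs of points they contain have equal first coordinates
    -- and are treated separately.
    line : F × F → Curve
    line (k , n) = 0# , (k , 1#) , n

    -- One normalised equation per curve. Without the normalisation, proportional equations would be
    -- different members with all their points in common, and `three-points` would fail.
    curves : List Curve
    curves = map circle (cartesianProduct allV allF) ++ map line (cartesianProduct allF allF)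

    ∈-circle : ∀ m n → circle (m , n) ∈ curves
    ∈-circle m n = ∈-++⁺ˡ (∈-map⁺ circle (∈-cartesianProduct⁺ (∈-allV m) (∈-allF n)))

    ∈-line : ∀ k n → line (k , n) ∈ curves
    ∈-line k n = ∈-++⁺ʳ (map circle (cartesianProduct allV allF)) (∈-map⁺ line (∈-cartesianProduct⁺ (∈-allF k) (∈-allF n)))

    unique-curves : 2 ≤ p → Unique curves
    unique-curves 2≤p = ++⁺ (map⁺ (λ { refl → refl }) (cartesianProduct⁺ unique-allV unique-allF)) (map⁺ (λ { refl → refl }) (cartesianProduct⁺ unique-allF unique-allF))
      (λ { (c∈ , l∈) → disjoint (∈-map⁻ circle c∈) (∈-map⁻ line l∈) })
      where
      disjoint : ∀ {C} → Σ (V × F) (λ q → q ∈ cartesianProduct allV allF × C ≡ circle q) → Σ (F × F) (λ q → q ∈ cartesianProduct allF allF × C ≡ line q) → ⊥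
      disjoint (_ , _ , refl) (_ , _ , e) = 1≢0 2≤p (cong proj₁ e)

    -- The conic λ |v - a|² + μ·(v - a) = 0.
    through : V → F → V → Curve
    through a l m = l , (proj₁ m - 2# * (l * proj₁ a) , proj₂ m - 2# * (l * proj₂ a)) , l * norm² a - (proj₁ m * proj₁ a + proj₂ m * proj₂ a)

    through-onto : ∀ a l m b → through a l m onto b ≡ l * norm² (b ⊝ a) + (proj₁ m * proj₁ (b ⊝ a) + proj₂ m * proj₂ (b ⊝ a))
    through-onto (a₁ , a₂) l (m₁ , m₂) (b₁ , b₂) = solve 7 (λ a₁ a₂ l m₁ m₂ b₁ b₂ →
      l :* (b₁ :* b₁ :+ b₂ :* b₂) :+ ((m₁ :- con (ℤ.+ 2) :* (l :* a₁)) :* b₁ :+ (m₂ :- con (ℤ.+ 2) :* (l :* a₂)) :* b₂) :+ (l :* (a₁ :* a₁ :+ a₂ :* a₂) :- (m₁ :* a₁ :+ m₂ :* a₂))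
      := l :* ((b₁ :- a₁) :* (b₁ :- a₁) :+ (b₂ :- a₂) :* (b₂ :- a₂)) :+ (m₁ :* (b₁ :- a₁) :+ m₂ :* (b₂ :- a₂))) refl a₁ a₂ l m₁ m₂ b₁ b₂

    disc-through : ∀ a l m → disc (through a l m) ≡ norm² m
    disc-through (a₁ , a₂) l (m₁ , m₂) = solve 5 (λ a₁ a₂ l m₁ m₂ →
      let x = m₁ :- con (ℤ.+ 2) :* (l :* a₁) ; y = m₂ :- con (ℤ.+ 2) :* (l :* a₂) in
      (x :* x :+ y :* y) :- con (ℤ.+ 4) :* (l :* (l :* (a₁ :* a₁ :+ a₂ :* a₂) :- (m₁ :* a₁ :+ m₂ :* a₂))) := m₁ :* m₁ :+ m₂ :* m₂) refl a₁ a₂ l m₁ m₂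

    through-self : ∀ a l m → On (through a l m) a
    through-self a@(a₁ , a₂) l (m₁ , m₂) = trans (through-onto a l (m₁ , m₂) a) (solve 5 (λ a₁ a₂ l m₁ m₂ →
      l :* ((a₁ :- a₁) :* (a₁ :- a₁) :+ (a₂ :- a₂) :* (a₂ :- a₂)) :+ (m₁ :* (a₁ :- a₁) :+ m₂ :* (a₂ :- a₂)) := con (ℤ.+ 0)) refl a₁ a₂ l m₁ m₂)

    normalise : F → Curve → Curve
    normalise z (l , (m₁ , m₂) , n) = z * l , (z * m₁ , z * m₂) , z * n

    normalise-onto : ∀ z C v → normalise z C onto v ≡ z * (C onto v)
    normalise-onto z (l , (m₁ , m₂) , n) (v₁ , v₂) = solve 7 (λ z l m₁ m₂ n v₁ v₂ → z :* l :* (v₁ :* v₁ :+ v₂ :* v₂) :+ (z :* m₁ :* v₁ :+ z :* m₂ :* v₂) :+ z :* n := z :* (l :* (v₁ :* v₁ :+ v₂ :* v₂) :+ (m₁ :* v₁ :+ m₂ :* v₂) :+ n)) refl z l m₁ m₂ n v₁ v₂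

    disc-normalise : ∀ z C → disc (normalise z C) ≡ z * z * disc C
    disc-normalise z (l , (m₁ , m₂) , n) = solve 5 (λ z l m₁ m₂ n → (z :* m₁ :* (z :* m₁) :+ z :* m₂ :* (z :* m₂)) :- con (ℤ.+ 4) :* (z :* l :* (z :* n)) := z :* z :* ((m₁ :* m₁ :+ m₂ :* m₂) :- con (ℤ.+ 4) :* (l :* n))) refl z l m₁ m₂ n

    canonical : 2 ≤ p → ∀ C → disc C ≢ 0# → proj₁ C ≢ 0# ⊎ (proj₁ C ≡ 0# × proj₂ (proj₁ (proj₂ C)) ≢ 0#) →
      Σ Curve λ C′ → C′ ∈ curves × disc C′ ≢ 0# × (∀ v → On C v → On C′ v)
    canonical 2≤p C@(l , (m₁ , m₂) , n) d≢0 lead = normalise z C , member lead , (λ e → z≢0 (x*x≡0⇒x≡0 (*-cancel-0 d≢0 (trans (*-comm _ _) (trans (sym (disc-normalise z C)) e))))) ,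
      λ v e → trans (normalise-onto z C v) (*-zero z e)
      where
      unit-of : (l ≢ 0# ⊎ (l ≡ 0# × m₂ ≢ 0#)) → Σ F λ w → w ≢ 0#
      unit-of (inj₁ l≢0) = l , l≢0
      unit-of (inj₂ (_ , m≢0)) = m₂ , m≢0
      z = inv (proj₁ (unit-of lead))
      inverse-z : inv (proj₁ (unit-of lead)) * proj₁ (unit-of lead) ≡ 1#
      inverse-z = trans (*-comm _ _) (*-inv (proj₂ (unit-of lead)))
      z≢0 : z ≢ 0#
      z≢0 e = 1≢0 2≤p (trans (sym inverse-z) (trans (cong (_* proj₁ (unit-of lead)) e) (zeroˡ _)))
      member : (q : l ≢ 0# ⊎ (l ≡ 0# × m₂ ≢ 0#)) → normalise (inv (proj₁ (unit-of q))) C ∈ curves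
      member (inj₁ l≢0) = subst (λ w → (w , (inv l * m₁ , inv l * m₂) , inv l * n) ∈ curves) (sym (trans (*-comm _ _) (*-inv l≢0))) (∈-circle _ _)
      member (inj₂ (refl , m≢0)) = subst₂ (λ w w′ → (w , (inv m₂ * m₁ , w′) , inv m₂ * n) ∈ curves) (sym (zeroʳ (inv m₂))) (sym (trans (*-comm _ _) (*-inv m≢0))) (∈-line _ _)

    circleAround : V → F → Curve
    circleAround q ρ = circle ((- 2# * proj₁ q , - 2# * proj₂ q) , norm² q - ρ)

    circleAround-on : ∀ q ρ v → norm² (v ⊝ q) ≡ ρ → On (circleAround q ρ) v
    circleAround-on (q₁ , q₂) _ (v₁ , v₂) refl = solve 4 (λ q₁ q₂ v₁ v₂ →
      con (ℤ.+ 1) :* (v₁ :* v₁ :+ v₂ :* v₂) :+ ((:- con (ℤ.+ 2)) :* q₁ :* v₁ :+ (:- con (ℤ.+ 2)) :* q₂ :* v₂) :+ ((q₁ :* q₁ :+ q₂ :* q₂) :- ((v₁ :- q₁) :* (v₁ :- q₁) :+ (v₂ :- q₂) :* (v₂ :- q₂))) := con (ℤ.+ 0)) refl q₁ q₂ v₁ v₂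

    disc-circleAround : ∀ q ρ → disc (circleAround q ρ) ≡ 2# * (2# * ρ)
    disc-circleAround (q₁ , q₂) ρ = solve 3 (λ q₁ q₂ r → ((:- con (ℤ.+ 2)) :* q₁ :* ((:- con (ℤ.+ 2)) :* q₁) :+ (:- con (ℤ.+ 2)) :* q₂ :* ((:- con (ℤ.+ 2)) :* q₂)) :- con (ℤ.+ 4) :* (con (ℤ.+ 1) :* ((q₁ :* q₁ :+ q₂ :* q₂) :- r)) := con (ℤ.+ 2) :* (con (ℤ.+ 2) :* r)) refl q₁ q₂ ρ

    isotropic-line : ∀ m h → norm² m ≡ 0# → ¬ (proj₁ m ≡ 0# × proj₂ m ≡ 0#) → proj₁ m * proj₁ h + proj₂ m * proj₂ h ≡ 0# → norm² h ≡ 0#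
    isotropic-line (m₁ , m₂) (h₁ , h₂) nm m≢0 e with m₁ ≟ 0# | m₂ ≟ 0#
    ... | yes z₁ | yes z₂ = ⊥-elim (m≢0 (z₁ , z₂))
    ... | no m₁≢0 | _ = *-cancel-0 (*-nonzero m₁≢0 m₁≢0) (trans
        (solve 4 (λ m₁ m₂ h₁ h₂ → m₁ :* m₁ :* (h₁ :* h₁ :+ h₂ :* h₂) := (m₁ :* h₁ :- m₂ :* h₂) :* (m₁ :* h₁ :+ m₂ :* h₂) :+ h₂ :* h₂ :* (m₁ :* m₁ :+ m₂ :* m₂)) refl m₁ m₂ h₁ h₂)
        (zero-+ (*-zero _ e) (*-zero _ nm)))
    ... | _ | no m₂≢0 = *-cancel-0 (*-nonzero m₂≢0 m₂≢0) (trans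
        (solve 4 (λ m₁ m₂ h₁ h₂ → m₂ :* m₂ :* (h₁ :* h₁ :+ h₂ :* h₂) := (m₂ :* h₂ :- m₁ :* h₁) :* (m₁ :* h₁ :+ m₂ :* h₂) :+ h₁ :* h₁ :* (m₁ :* m₁ :+ m₂ :* m₂)) refl m₁ m₂ h₁ h₂)
        (zero-+ (*-zero _ e) (*-zero _ nm)))

    -- A circle of radius zero through a, λ |h|² + μ·h = 0 with |μ|² = 0: its centre is a - μ / 2λ.
    nullCentre : V → F → V → V
    nullCentre a l m = proj₁ a - inv (2# * l) * proj₁ m , proj₂ a - inv (2# * l) * proj₂ m

    nullCentre-self : ∀ a l m → norm² m ≡ 0# → norm² (a ⊝ nullCentre a l m) ≡ 0#
    nullCentre-self (a₁ , a₂) l (m₁ , m₂) nm = trans (solve 5 (λ a₁ a₂ z m₁ m₂ →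
        (a₁ :- (a₁ :- z :* m₁)) :* (a₁ :- (a₁ :- z :* m₁)) :+ (a₂ :- (a₂ :- z :* m₂)) :* (a₂ :- (a₂ :- z :* m₂)) := z :* z :* (m₁ :* m₁ :+ m₂ :* m₂)) refl a₁ a₂ (inv (2# * l)) m₁ m₂)
      (*-zero _ nm)

    nullCentre-on : ∀ a l m b → 2# * l ≢ 0# → norm² m ≡ 0# → l * norm² (b ⊝ a) + (proj₁ m * proj₁ (b ⊝ a) + proj₂ m * proj₂ (b ⊝ a)) ≡ 0# → norm² (b ⊝ nullCentre a l m) ≡ 0#
    nullCentre-on (a₁ , a₂) l (m₁ , m₂) (b₁ , b₂) 2l≢0 nm e = *-cancel-0 2l≢0 (begin
      2# * l * norm² ((b₁ , b₂) ⊝ nullCentre (a₁ , a₂) l (m₁ , m₂))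
        ≡⟨ solve 8 (λ a₁ a₂ z m₁ m₂ b₁ b₂ l →
             let h₁ = b₁ :- a₁ ; h₂ = b₂ :- a₂ ; x = b₁ :- (a₁ :- z :* m₁) ; y = b₂ :- (a₂ :- z :* m₂) in
             con (ℤ.+ 2) :* l :* (x :* x :+ y :* y)
             := con (ℤ.+ 2) :* (l :* (h₁ :* h₁ :+ h₂ :* h₂) :+ (m₁ :* h₁ :+ m₂ :* h₂)) :+ (con (ℤ.+ 2) :* (m₁ :* h₁ :+ m₂ :* h₂) :* (con (ℤ.+ 2) :* l :* z :- con (ℤ.+ 1))
                :+ con (ℤ.+ 2) :* l :* (z :* z) :* (m₁ :* m₁ :+ m₂ :* m₂))) refl a₁ a₂ (inv (2# * l)) m₁ m₂ b₁ b₂ l ⟩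
      _ ≡⟨ zero-+ (*-zero 2# e) (zero-+ (*-zero _ (trans (cong (_- 1#) (*-inv 2l≢0)) (x-x≡0 1#))) (*-zero _ nm)) ⟩
      0# ∎)

  -- Intersections of circles and lines, and uniqueness of common points.

  module CircleFamilies where

    open FiniteSums
    open 𝔽ₚ
    open Polynomials
    open Reflections
    open Conics
    open import Data.Nat using (_≤_)
    open import Data.Integer as ℤ using (ℤ)
    open import Data.List using (List; map; cartesianProduct)
    open import Data.List.Membership.Propositional using (_∈_)
    open import Data.List.Membership.Propositional.Properties using (∈-map⁻)
    open import Data.List.Relation.Unary.Any using (Any)
    open import Data.List.Relation.Unary.Unique.Propositional using (Unique)
    open import Data.Product using (Σ; _×_; _,_; proj₁; proj₂)
    open import Data.Sum using (_⊎_; inj₁; inj₂)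
    open import Data.Empty using (⊥-elim)
    open import Relation.Nullary using (¬_; Dec; yes; no; _×-dec_)
    open import Relation.Binary.PropositionalEquality

    open Solver
    open ≡-Reasoning

    conic-difference : ∀ C y z → C onto z - C onto y ≡
      proj₁ C * norm² (z ⊝ y) + ((2# * proj₁ C * proj₁ y + proj₁ (proj₁ (proj₂ C))) * proj₁ (z ⊝ y) + (2# * proj₁ C * proj₂ y + proj₂ (proj₁ (proj₂ C))) * proj₂ (z ⊝ y))
    conic-difference (l , (m₁ , m₂) , n) (y₁ , y₂) (z₁ , z₂) = solve 8 (λ l m₁ m₂ n y₁ y₂ z₁ z₂ →
      (l :* (z₁ :* z₁ :+ z₂ :* z₂) :+ (m₁ :* z₁ :+ m₂ :* z₂) :+ n) :- (l :* (y₁ :* y₁ :+ y₂ :* y₂) :+ (m₁ :* y₁ :+ m₂ :* y₂) :+ n)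
      := l :* ((z₁ :- y₁) :* (z₁ :- y₁) :+ (z₂ :- y₂) :* (z₂ :- y₂)) :+ ((con (ℤ.+ 2) :* l :* y₁ :+ m₁) :* (z₁ :- y₁) :+ (con (ℤ.+ 2) :* l :* y₂ :+ m₂) :* (z₂ :- y₂))) refl l m₁ m₂ n y₁ y₂ z₁ z₂

    parallel : ∀ {m₁ m₂ h₁ h₂ g₁ g₂} → ¬ (m₁ ≡ 0# × m₂ ≡ 0#) → m₁ * h₁ + m₂ * h₂ ≡ 0# → m₁ * g₁ + m₂ * g₂ ≡ 0# → h₁ * g₂ - h₂ * g₁ ≡ 0#
    parallel {m₁} {m₂} {h₁} {h₂} {g₁} {g₂} m≢0 e e′ = go (m₁ ≟ 0#) (m₂ ≟ 0#)
      where
      by₁ : m₁ ≢ 0# → h₁ * g₂ - h₂ * g₁ ≡ 0#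
      by₁ m₁≢0 = *-cancel-0 m₁≢0 (trans (solve 6 (λ m₁ m₂ h₁ h₂ g₁ g₂ → m₁ :* (h₁ :* g₂ :- h₂ :* g₁) := g₂ :* (m₁ :* h₁ :+ m₂ :* h₂) :+ (:- h₂) :* (m₁ :* g₁ :+ m₂ :* g₂)) refl m₁ m₂ h₁ h₂ g₁ g₂)
        (zero-+ (*-zero _ e) (*-zero _ e′)))
      by₂ : m₂ ≢ 0# → h₁ * g₂ - h₂ * g₁ ≡ 0#
      by₂ m₂≢0 = *-cancel-0 m₂≢0 (trans (solve 6 (λ m₁ m₂ h₁ h₂ g₁ g₂ → m₂ :* (h₁ :* g₂ :- h₂ :* g₁) := h₁ :* (m₁ :* g₁ :+ m₂ :* g₂) :+ (:- g₁) :* (m₁ :* h₁ :+ m₂ :* h₂)) refl m₁ m₂ h₁ h₂ g₁ g₂)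
        (zero-+ (*-zero _ e′) (*-zero _ e)))
      go : Dec (m₁ ≡ 0#) → Dec (m₂ ≡ 0#) → h₁ * g₂ - h₂ * g₁ ≡ 0#
      go (no m₁≢0) _ = by₁ m₁≢0
      go (yes _) (no m₂≢0) = by₂ m₂≢0
      go (yes z₁) (yes z₂) = ⊥-elim (m≢0 (z₁ , z₂))

    -- Both vectors lie on the circle |v|² = q·v through the origin and on one line through the
    -- origin; a non-isotropic line meets this circle in one further point.
    parallel-equal : ∀ {h₁ h₂ g₁ g₂ q₁ q₂} → h₁ * g₂ - h₂ * g₁ ≡ 0# → h₁ * h₁ + h₂ * h₂ ≢ 0# → g₁ * g₁ + g₂ * g₂ ≢ 0# →
      h₁ * h₁ + h₂ * h₂ ≡ q₁ * h₁ + q₂ * h₂ → g₁ * g₁ + g₂ * g₂ ≡ q₁ * g₁ + q₂ * g₂ → h₁ ≡ g₁ × h₂ ≡ g₂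
    parallel-equal {h₁} {h₂} {g₁} {g₂} {q₁} {q₂} par nh ng eh eg =
      x-y≡0⇒x≡y (*-cancel-0 nh (trans (solve 4 (λ h₁ h₂ g₁ g₂ → (h₁ :* h₁ :+ h₂ :* h₂) :* (h₁ :- g₁) := ((h₁ :* h₁ :+ h₂ :* h₂) :- (h₁ :* g₁ :+ h₂ :* g₂)) :* h₁ :+ h₂ :* (h₁ :* g₂ :- h₂ :* g₁)) refl h₁ h₂ g₁ g₂)
        (zero-+ (trans (cong (_* h₁) dot) (zeroˡ h₁)) (*-zero _ par)))) ,
      x-y≡0⇒x≡y (*-cancel-0 nh (trans (solve 4 (λ h₁ h₂ g₁ g₂ → (h₁ :* h₁ :+ h₂ :* h₂) :* (h₂ :- g₂) := ((h₁ :* h₁ :+ h₂ :* h₂) :- (h₁ :* g₁ :+ h₂ :* g₂)) :* h₂ :+ (:- h₁) :* (h₁ :* g₂ :- h₂ :* g₁)) refl h₁ h₂ g₁ g₂)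
        (zero-+ (trans (cong (_* h₂) dot) (zeroˡ h₂)) (*-zero _ par))))
      where
      n m d : F
      n = h₁ * h₁ + h₂ * h₂
      m = g₁ * g₁ + g₂ * g₂
      d = h₁ * g₁ + h₂ * g₂
      -- With d = h·g: n g = d h, so n (q·g) = d (q·h), i.e. n m = d n; hence d = m, and n m = d² gives n = d.
      nm≡dn : n * (m - d) ≡ 0#
      nm≡dn = begin
        n * (m - d) ≡⟨ solve 3 (λ n m d → n :* (m :- d) := n :* m :- d :* n) refl n m d ⟩
        n * m - d * n ≡⟨ cong₂ (λ x y → n * x - d * y) eg eh ⟩
        n * (q₁ * g₁ + q₂ * g₂) - d * (q₁ * h₁ + q₂ * h₂)
          ≡⟨ solve 6 (λ h₁ h₂ g₁ g₂ q₁ q₂ → (h₁ :* h₁ :+ h₂ :* h₂) :* (q₁ :* g₁ :+ q₂ :* g₂) :- (h₁ :* g₁ :+ h₂ :* g₂) :* (q₁ :* h₁ :+ q₂ :* h₂)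
               := (q₂ :* h₁ :- q₁ :* h₂) :* (h₁ :* g₂ :- h₂ :* g₁)) refl h₁ h₂ g₁ g₂ q₁ q₂ ⟩
        _ ≡⟨ *-zero _ par ⟩
        0# ∎
        where open ≡-Reasoning
      m≡d : m - d ≡ 0#
      m≡d = *-cancel-0 nh nm≡dn
      dot : n - d ≡ 0#
      dot = *-cancel-0 ng (begin
        m * (n - d) ≡⟨ solve 4 (λ h₁ h₂ g₁ g₂ → (g₁ :* g₁ :+ g₂ :* g₂) :* ((h₁ :* h₁ :+ h₂ :* h₂) :- (h₁ :* g₁ :+ h₂ :* g₂))
            := (h₁ :* g₂ :- h₂ :* g₁) :* (h₁ :* g₂ :- h₂ :* g₁) :+ (:- (h₁ :* g₁ :+ h₂ :* g₂)) :* ((g₁ :* g₁ :+ g₂ :* g₂) :- (h₁ :* g₁ :+ h₂ :* g₂))) refl h₁ h₂ g₁ g₂ ⟩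
        _ ≡⟨ zero-+ (*-zero _ par) (*-zero _ m≡d) ⟩
        0# ∎)
        where open ≡-Reasoning

    equidistant-dot : ∀ x y z → norm² (x ⊝ y) ≡ norm² (x ⊝ z) → norm² (z ⊝ y) ≡ 2# * proj₁ (x ⊝ y) * proj₁ (z ⊝ y) + 2# * proj₂ (x ⊝ y) * proj₂ (z ⊝ y)
    equidistant-dot x@(x₁ , x₂) y@(y₁ , y₂) z@(z₁ , z₂) e = x-y≡0⇒x≡y (trans
      (solve 6 (λ x₁ x₂ y₁ y₂ z₁ z₂ → ((z₁ :- y₁) :* (z₁ :- y₁) :+ (z₂ :- y₂) :* (z₂ :- y₂)) :- (con (ℤ.+ 2) :* (x₁ :- y₁) :* (z₁ :- y₁) :+ con (ℤ.+ 2) :* (x₂ :- y₂) :* (z₂ :- y₂))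
        := ((x₁ :- z₁) :* (x₁ :- z₁) :+ (x₂ :- z₂) :* (x₂ :- z₂)) :- ((x₁ :- y₁) :* (x₁ :- y₁) :+ (x₂ :- y₂) :* (x₂ :- y₂))) refl x₁ x₂ y₁ y₂ z₁ z₂)
      (trans (cong (λ w → w - norm² (x ⊝ y)) (sym e)) (x-x≡0 _)))

    ⊝-zero : ∀ {x y : V} → proj₁ (x ⊝ y) ≡ 0# × proj₂ (x ⊝ y) ≡ 0# → x ≡ y
    ⊝-zero (e₁ , e₂) = V-≡ e₁ e₂

    ⊝-injective : ∀ {z z′ y : V} → proj₁ (z ⊝ y) ≡ proj₁ (z′ ⊝ y) × proj₂ (z ⊝ y) ≡ proj₂ (z′ ⊝ y) → z ≡ z′
    ⊝-injective {z} {z′} {y} (e₁ , e₂) = V-≡ (trans (sh (proj₁ z) (proj₁ z′) (proj₁ y)) (trans (cong (λ w → w - (proj₁ z′ - proj₁ y)) e₁) (x-x≡0 _)))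
      (trans (sh (proj₂ z) (proj₂ z′) (proj₂ y)) (trans (cong (λ w → w - (proj₂ z′ - proj₂ y)) e₂) (x-x≡0 _)))
      where
      sh : ∀ x y z → x - y ≡ (x - z) - (y - z)
      sh = solve 3 (λ x y z → x :- y := (x :- z) :- (y :- z)) refl

    Centre : Curve → V → Set
    Centre (l , (m₁ , m₂) , _) (x₁ , x₂) = 2# * l * x₁ + m₁ ≡ 0# × 2# * l * x₂ + m₂ ≡ 0#

    centre? : ∀ C x → Dec (Centre C x)
    centre? (l , (m₁ , m₂) , _) (x₁ , x₂) = ((2# * l * x₁ + m₁) ≟ 0#) ×-dec ((2# * l * x₂ + m₂) ≟ 0#)

    centre-unique : 2# ≢ 0# → ∀ {C x x′} → disc C ≢ 0# → Centre C x → Centre C x′ → x ≡ x′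
    centre-unique 2≢0 {l , (m₁ , m₂) , n} {x₁ , x₂} {x₁′ , x₂′} d≢0 (e₁ , e₂) (e₁′ , e₂′) = go (l ≟ 0#)
      where
      vanish : ∀ {x m} → l ≡ 0# → 2# * l * x + m ≡ 0# → m ≡ 0#
      vanish {x} {m} refl e = trans (solve 2 (λ x m → m := con (ℤ.+ 2) :* con (ℤ.+ 0) :* x :+ m) refl x m) e
      same : ∀ {x x′ m} → l ≢ 0# → 2# * l * x + m ≡ 0# → 2# * l * x′ + m ≡ 0# → x ≡ x′
      same {x} {x′} {m} l≢0 e e′ = x-y≡0⇒x≡y (*-cancel-0 (*-nonzero 2≢0 l≢0) (trans (solve 4 (λ l x x′ m → con (ℤ.+ 2) :* l :* (x :- x′) := (con (ℤ.+ 2) :* l :* x :+ m) :- (con (ℤ.+ 2) :* l :* x′ :+ m)) refl l x x′ m)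
        (trans (cong₂ _-_ e e′) (x-x≡0 0#))))
      go : Dec (l ≡ 0#) → (x₁ , x₂) ≡ (x₁′ , x₂′)
      go (no l≢0) = cong₂ _,_ (same l≢0 e₁ e₁′) (same l≢0 e₂ e₂′)
      go (yes l≡0) = ⊥-elim (d≢0 (trans (cong₂ (λ u w → u - 4# * w) (zero-+ (*-zero m₁ (vanish l≡0 e₁)) (*-zero m₂ (vanish l≡0 e₂))) (trans (cong (_* n) l≡0) (zeroˡ n)))
        (solve 0 (con (ℤ.+ 0) :- con (ℤ.+ 4) :* con (ℤ.+ 0) := con (ℤ.+ 0)) refl)))

    -- The chords z - y and z′ - y belong to `C` and to the circle around x through y. Combining the
    -- two equations makes both orthogonal to 2λx + μ, which is non-zero because x is not the
    -- centre; so they are parallel and `parallel-equal` applies.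
    second-intersection : ∀ {C x y z z′} → ¬ Centre C x → On C y → On C z → On C z′ → norm² (z ⊝ y) ≢ 0# → norm² (z′ ⊝ y) ≢ 0# →
      norm² (x ⊝ y) ≡ norm² (x ⊝ z) → norm² (x ⊝ y) ≡ norm² (x ⊝ z′) → z ≡ z′
    second-intersection {C@(l , (m₁ , m₂) , n)} {x@(x₁ , x₂)} {y@(y₁ , y₂)} {z} {z′} notCentre oy oz oz′ nz nz′ e e′ =
      ⊝-injective {z} {z′} {y} (parallel-equal {q₁ = 2# * proj₁ (x ⊝ y)} {q₂ = 2# * proj₂ (x ⊝ y)} (parallel notCentre (chord oz e) (chord oz′ e′)) nz nz′ (equidistant-dot x y z e) (equidistant-dot x y z′ e′))
      where
      open ≡-Reasoning
      chord : ∀ {z} → On C z → norm² (x ⊝ y) ≡ norm² (x ⊝ z) → (2# * l * x₁ + m₁) * proj₁ (z ⊝ y) + (2# * l * x₂ + m₂) * proj₂ (z ⊝ y) ≡ 0#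
      chord {z} oz e = begin
        (2# * l * x₁ + m₁) * h₁ + (2# * l * x₂ + m₂) * h₂
          ≡⟨ solve 9 (λ l m₁ m₂ x₁ x₂ y₁ y₂ h₁ h₂ → (con (ℤ.+ 2) :* l :* x₁ :+ m₁) :* h₁ :+ (con (ℤ.+ 2) :* l :* x₂ :+ m₂) :* h₂
               := l :* (con (ℤ.+ 2) :* (x₁ :- y₁) :* h₁ :+ con (ℤ.+ 2) :* (x₂ :- y₂) :* h₂) :+ ((con (ℤ.+ 2) :* l :* y₁ :+ m₁) :* h₁ :+ (con (ℤ.+ 2) :* l :* y₂ :+ m₂) :* h₂)) refl l m₁ m₂ x₁ x₂ y₁ y₂ h₁ h₂ ⟩
        l * (2# * (x₁ - y₁) * h₁ + 2# * (x₂ - y₂) * h₂) + rest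
          ≡⟨ cong (λ w → l * w + rest) (sym (equidistant-dot x y z e)) ⟩
        l * norm² (z ⊝ y) + rest
          ≡⟨ sym (conic-difference C y z) ⟩
        C onto z - C onto y
          ≡⟨ trans (cong₂ _-_ oz oy) (x-x≡0 0#) ⟩
        0# ∎
        where
        h₁ = proj₁ (z ⊝ y)
        h₂ = proj₂ (z ⊝ y)
        rest = (2# * l * y₁ + m₁) * h₁ + (2# * l * y₂ + m₂) * h₂

    isotropic-excluded : 2# ≢ 0# → ∀ {x y z} → y ≢ z → norm² (x ⊝ y) ≡ norm² (x ⊝ z) → norm² (x ⊝ y) ≢ 0# → norm² (z ⊝ y) ≢ 0#
    isotropic-excluded 2≢0 {x} {y} {z} y≢z e n≢0 nzy = n≢0 (isotropic-line (z ⊝ y) (x ⊝ y) nzy (λ q → y≢z (sym (⊝-zero q))) (*-cancel-0 2≢0 (begin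
      2# * (proj₁ (z ⊝ y) * proj₁ (x ⊝ y) + proj₂ (z ⊝ y) * proj₂ (x ⊝ y))
        ≡⟨ solve 4 (λ a b c d → con (ℤ.+ 2) :* (a :* b :+ c :* d) := con (ℤ.+ 2) :* b :* a :+ con (ℤ.+ 2) :* d :* c) refl (proj₁ (z ⊝ y)) (proj₁ (x ⊝ y)) (proj₂ (z ⊝ y)) (proj₂ (x ⊝ y)) ⟩
      _ ≡⟨ equidistant-dot x y z e ⟨
      norm² (z ⊝ y) ≡⟨ nzy ⟩
      0# ∎)))

    vertical-unique : ∀ {x y z z′} → y ≢ z → y ≢ z′ → proj₁ z - proj₁ y ≡ 0# → proj₁ z′ - proj₁ y ≡ 0# →
      norm² (x ⊝ y) ≡ norm² (x ⊝ z) → norm² (x ⊝ y) ≡ norm² (x ⊝ z′) → z ≡ z′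
    vertical-unique {x} {y} {z} {z′} y≢z y≢z′ v v′ e e′ = ⊝-injective {z} {z′} {y} (trans v (sym v′) , trans (height-of {z} y≢z v e) (sym (height-of {z′} y≢z′ v′ e′)))
      where
      height-of : ∀ {z} → y ≢ z → proj₁ z - proj₁ y ≡ 0# → norm² (x ⊝ y) ≡ norm² (x ⊝ z) → proj₂ (z ⊝ y) ≡ 2# * proj₂ (x ⊝ y)
      height-of {z} y≢z v e = x-y≡0⇒x≡y (*-cancel-0 (λ q → y≢z (sym (⊝-zero (v , q)))) (begin
        h₂ * (h₂ - 2# * g₂)
          ≡⟨ solve 4 (λ h₁ h₂ g₁ g₂ → h₂ :* (h₂ :- con (ℤ.+ 2) :* g₂) := ((h₁ :* h₁ :+ h₂ :* h₂) :- (con (ℤ.+ 2) :* g₁ :* h₁ :+ con (ℤ.+ 2) :* g₂ :* h₂)) :+ (con (ℤ.+ 2) :* g₁ :- h₁) :* h₁) refl (proj₁ (z ⊝ y)) h₂ (proj₁ (x ⊝ y)) g₂ ⟩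
        _ ≡⟨ zero-+ (trans (cong (λ w → w - (2# * proj₁ (x ⊝ y) * proj₁ (z ⊝ y) + 2# * g₂ * h₂)) (equidistant-dot x y z e)) (x-x≡0 _)) (*-zero _ v) ⟩
        0# ∎))
        where
        h₂ = proj₂ (z ⊝ y)
        g₂ = proj₂ (x ⊝ y)

    -- The parameters (k , h) are those of `slope` and `height`. Horizontal lines are missing; they
    -- are the mirrors of pairs with equal first coordinates, which `Good` excludes.
    OnLine : V → V → Set
    OnLine (k , h) (x₁ , x₂) = x₁ + k * x₂ ≡ h

    onLine? : ∀ ℓ x → Dec (OnLine ℓ x)
    onLine? (k , h) (x₁ , x₂) = (x₁ + k * x₂) ≟ h

    line-unique : ∀ {x x′ ℓ ℓ′} → x ≢ x′ → OnLine ℓ x → OnLine ℓ x′ → OnLine ℓ′ x → OnLine ℓ′ x′ → ℓ ≡ ℓ′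
    line-unique {x₁ , x₂} {x₁′ , x₂′} {k , _} {k′ , _} x≢ refl e refl e′ = cong₂ _,_ k≡ (cong (λ w → x₁ + w * x₂) k≡)
      where
      difference : ∀ {k} → x₁′ + k * x₂′ ≡ x₁ + k * x₂ → (x₁ - x₁′) + k * (x₂ - x₂′) ≡ 0#
      difference {k} e = trans (solve 5 (λ a a′ k b b′ → (a :- a′) :+ k :* (b :- b′) := (a :+ k :* b) :- (a′ :+ k :* b′)) refl x₁ x₁′ k x₂ x₂′) (trans (cong (λ w → (x₁ + k * x₂) - w) e) (x-x≡0 _))
      x₂≢ : x₂ - x₂′ ≢ 0#
      x₂≢ q = x≢ (V-≡ (trans (solve 3 (λ a k b → a := (a :+ k :* b) :- k :* b) refl (x₁ - x₁′) k (x₂ - x₂′)) (trans (cong₂ _-_ (difference e) (*-zero k q)) (x-x≡0 0#))) q)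
      k≡ : k ≡ k′
      k≡ = x-y≡0⇒x≡y (*-cancel-0 x₂≢ (trans (solve 4 (λ d k k′ a → d :* (k :- k′) := (a :+ k :* d) :- (a :+ k′ :* d)) refl (x₂ - x₂′) k k′ (x₁ - x₁′)) (trans (cong₂ _-_ (difference e) (difference e′)) (x-x≡0 0#))))

    shifted : Curve → V → V
    shifted C y = 2# * proj₁ C * proj₁ y + proj₁ (proj₁ (proj₂ C)) , 2# * proj₁ C * proj₂ y + proj₂ (proj₁ (proj₂ C))

    chord-relation : ∀ C {y z} → On C y → On C z → proj₁ C * norm² (z ⊝ y) + (proj₁ (shifted C y) * proj₁ (z ⊝ y) + proj₂ (shifted C y) * proj₂ (z ⊝ y)) ≡ 0#
    chord-relation C {y} {z} oy oz = trans (sym (conic-difference C y z)) (trans (cong₂ _-_ oz oy) (x-x≡0 0#))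

    disc-shifted : ∀ C {y} → On C y → norm² (shifted C y) ≡ disc C
    disc-shifted (l , (m₁ , m₂) , n) {y₁ , y₂} oy = x-y≡0⇒x≡y (trans (solve 6 (λ l m₁ m₂ n y₁ y₂ →
       let a = con (ℤ.+ 2) :* l :* y₁ :+ m₁ ; b = con (ℤ.+ 2) :* l :* y₂ :+ m₂ in
       (a :* a :+ b :* b) :- ((m₁ :* m₁ :+ m₂ :* m₂) :- con (ℤ.+ 4) :* (l :* n)) := con (ℤ.+ 4) :* l :* (l :* (y₁ :* y₁ :+ y₂ :* y₂) :+ (m₁ :* y₁ :+ m₂ :* y₂) :+ n)) refl l m₁ m₂ n y₁ y₂)
      (*-zero _ oy))

    chord-nonisotropic : ∀ C {y z} → disc C ≢ 0# → y ≢ z → On C y → On C z → norm² (z ⊝ y) ≢ 0#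
    chord-nonisotropic C {y} {z} d≢0 y≢z oy oz n≡0 = d≢0 (trans (sym (disc-shifted C oy)) (isotropic-line (z ⊝ y) (shifted C y) n≡0 (λ q → y≢z (sym (⊝-zero q))) (begin
      h₁ * M₁ + h₂ * M₂ ≡⟨ solve 6 (λ h₁ h₂ M₁ M₂ l n → h₁ :* M₁ :+ h₂ :* M₂ := (l :* n :+ (M₁ :* h₁ :+ M₂ :* h₂)) :- l :* n) refl h₁ h₂ M₁ M₂ (proj₁ C) (norm² (z ⊝ y)) ⟩
      _ ≡⟨ cong₂ _-_ (chord-relation C oy oz) (*-zero _ n≡0) ⟩
      0# - 0# ≡⟨ x-x≡0 0# ⟩
      0# ∎)))
      where
      h₁ = proj₁ (z ⊝ y)
      h₂ = proj₂ (z ⊝ y)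
      M₁ = proj₁ (shifted C y)
      M₂ = proj₂ (shifted C y)

    circle-chord : ∀ {M₁ M₂ h₁ h₂} → 1# * (h₁ * h₁ + h₂ * h₂) + (M₁ * h₁ + M₂ * h₂) ≡ 0# → h₁ * h₁ + h₂ * h₂ ≡ - M₁ * h₁ + - M₂ * h₂
    circle-chord {M₁} {M₂} {h₁} {h₂} e = x-y≡0⇒x≡y (trans (solve 4 (λ M₁ M₂ h₁ h₂ → (h₁ :* h₁ :+ h₂ :* h₂) :- ((:- M₁) :* h₁ :+ (:- M₂) :* h₂) := con (ℤ.+ 1) :* (h₁ :* h₁ :+ h₂ :* h₂) :+ (M₁ :* h₁ :+ M₂ :* h₂)) refl M₁ M₂ h₁ h₂) e)

    difference-chord : ∀ {M₁ M₂ M₁′ M₂′ h₁ h₂ n} → n + (M₁ * h₁ + M₂ * h₂) ≡ 0# → n + (M₁′ * h₁ + M₂′ * h₂) ≡ 0# → (M₁ - M₁′) * h₁ + (M₂ - M₂′) * h₂ ≡ 0#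
    difference-chord {M₁} {M₂} {M₁′} {M₂′} {h₁} {h₂} {n} e e′ = trans (solve 7 (λ M₁ M₂ N₁ N₂ h₁ h₂ n → (M₁ :- N₁) :* h₁ :+ (M₂ :- N₂) :* h₂ := (n :+ (M₁ :* h₁ :+ M₂ :* h₂)) :- (n :+ (N₁ :* h₁ :+ N₂ :* h₂))) refl M₁ M₂ M₁′ M₂′ h₁ h₂ n)
      (trans (cong₂ _-_ e e′) (x-x≡0 0#))

    line-chord : ∀ {M₁ M₂ h₁ h₂ n} → 0# * n + (M₁ * h₁ + M₂ * h₂) ≡ 0# → M₁ * h₁ + M₂ * h₂ ≡ 0#
    line-chord {M₁} {M₂} {h₁} {h₂} {n} e = trans (solve 5 (λ M₁ M₂ h₁ h₂ n → M₁ :* h₁ :+ M₂ :* h₂ := con (ℤ.+ 0) :* n :+ (M₁ :* h₁ :+ M₂ :* h₂)) refl M₁ M₂ h₁ h₂ n) e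

    line-proper : 2 ≤ p → ∀ k n y → ¬ (proj₁ (shifted (line (k , n)) y) ≡ 0# × proj₂ (shifted (line (k , n)) y) ≡ 0#)
    line-proper 2≤p k n (y₁ , y₂) (_ , e) = 1≢0 2≤p (trans (solve 1 (λ y → con (ℤ.+ 1) := con (ℤ.+ 2) :* con (ℤ.+ 0) :* y :+ con (ℤ.+ 1)) refl y₂) e)

    curve-shape : ∀ {C} → C ∈ curves → (Σ (V × F) λ q → C ≡ circle q) ⊎ (Σ (F × F) λ q → C ≡ line q)
    curve-shape {C} C∈ = go (∈-++⁻ (map circle (cartesianProduct allV allF)) C∈)
      where
      open import Data.List.Membership.Propositional.Properties using (∈-++⁻)
      go : C ∈ map circle (cartesianProduct allV allF) ⊎ C ∈ map line (cartesianProduct allF allF) → (Σ (V × F) λ q → C ≡ circle q) ⊎ (Σ (F × F) λ q → C ≡ line q)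
      go (inj₁ c∈) = let q , _ , e = ∈-map⁻ circle c∈ in inj₁ (q , e)
      go (inj₂ l∈) = let q , _ , e = ∈-map⁻ line l∈ in inj₂ (q , e)

    infix 7 _∙_
    _∙_ : V → V → F
    M ∙ h = proj₁ M * proj₁ h + proj₂ M * proj₂ h

    two-circles : ∀ (M M′ h g : V) → ¬ (proj₁ M - proj₁ M′ ≡ 0# × proj₂ M - proj₂ M′ ≡ 0#) → norm² h ≢ 0# → norm² g ≢ 0# →
      1# * norm² h + M ∙ h ≡ 0# → 1# * norm² h + M′ ∙ h ≡ 0# → 1# * norm² g + M ∙ g ≡ 0# → 1# * norm² g + M′ ∙ g ≡ 0# →
      proj₁ h ≡ proj₁ g × proj₂ h ≡ proj₂ g
    two-circles (M₁ , M₂) (M₁′ , M₂′) (h₁ , h₂) (g₁ , g₂) proper nh ng eh eh′ eg eg′ = parallel-equal {q₁ = - M₁} {q₂ = - M₂}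
      (parallel proper (difference-chord {M₁} {M₂} {M₁′} {M₂′} {h₁} {h₂} {1# * (h₁ * h₁ + h₂ * h₂)} eh eh′) (difference-chord {M₁} {M₂} {M₁′} {M₂′} {g₁} {g₂} {1# * (g₁ * g₁ + g₂ * g₂)} eg eg′))
      nh ng (circle-chord {M₁} {M₂} eh) (circle-chord {M₁} {M₂} eg)

    circle-and-line : ∀ (M M′ h g : V) → ¬ (proj₁ M′ ≡ 0# × proj₂ M′ ≡ 0#) → norm² h ≢ 0# → norm² g ≢ 0# →
      1# * norm² h + M ∙ h ≡ 0# → 0# * norm² h + M′ ∙ h ≡ 0# → 1# * norm² g + M ∙ g ≡ 0# → 0# * norm² g + M′ ∙ g ≡ 0# →
      proj₁ h ≡ proj₁ g × proj₂ h ≡ proj₂ g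
    circle-and-line (M₁ , M₂) (M₁′ , M₂′) (h₁ , h₂) (g₁ , g₂) proper nh ng eh eh′ eg eg′ = parallel-equal {q₁ = - M₁} {q₂ = - M₂}
      (parallel proper (line-chord {M₁′} {M₂′} {h₁} {h₂} {h₁ * h₁ + h₂ * h₂} eh′) (line-chord {M₁′} {M₂′} {g₁} {g₂} {g₁ * g₁ + g₂ * g₂} eg′))
      nh ng (circle-chord {M₁} {M₂} eh) (circle-chord {M₁} {M₂} eg)

    constant-term : ∀ l m n n′ y → On (l , m , n) y → On (l , m , n′) y → n ≡ n′
    constant-term l m n n′ y e e′ = x-y≡0⇒x≡y (trans (solve 3 (λ w n n′ → n :- n′ := (w :+ n) :- (w :+ n′)) refl (l * norm² y + (proj₁ m * proj₁ y + proj₂ m * proj₂ y)) n n′) (trans (cong₂ _-_ e e′) (x-x≡0 0#)))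

    circles-equal : ∀ m m′ n n′ y → On (circle (m , n)) y → On (circle (m′ , n′)) y →
      proj₁ (shifted (circle (m , n)) y) - proj₁ (shifted (circle (m′ , n′)) y) ≡ 0# × proj₂ (shifted (circle (m , n)) y) - proj₂ (shifted (circle (m′ , n′)) y) ≡ 0# →
      circle (m , n) ≡ circle (m′ , n′)
    circles-equal (m₁ , m₂) (m₁′ , m₂′) n n′ (y₁ , y₂) o o′ (e₁ , e₂) = go (unshift y₁ m₁ m₁′ e₁) (unshift y₂ m₂ m₂′ e₂)
      where
      unshift : ∀ x a b → (2# * 1# * x + a) - (2# * 1# * x + b) ≡ 0# → a ≡ b
      unshift x a b e = x-y≡0⇒x≡y (trans (solve 3 (λ x a b → a :- b := (con (ℤ.+ 2) :* con (ℤ.+ 1) :* x :+ a) :- (con (ℤ.+ 2) :* con (ℤ.+ 1) :* x :+ b)) refl x a b) e)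
      go : m₁ ≡ m₁′ → m₂ ≡ m₂′ → circle ((m₁ , m₂) , n) ≡ circle ((m₁′ , m₂′) , n′)
      go refl refl = cong (λ w → 1# , (m₁ , m₂) , w) (constant-term 1# (m₁ , m₂) n n′ (y₁ , y₂) o o′)

    lines-equal : ∀ k k′ n n′ y h → ¬ (proj₁ h ≡ 0# × proj₂ h ≡ 0#) → On (line (k , n)) y → On (line (k′ , n′)) y →
      0# * norm² h + shifted (line (k , n)) y ∙ h ≡ 0# → 0# * norm² h + shifted (line (k′ , n′)) y ∙ h ≡ 0# → line (k , n) ≡ line (k′ , n′)
    lines-equal k k′ n n′ (y₁ , y₂) (h₁ , h₂) h≢0 o o′ r r′ = go k≡
      where
      simplify : ∀ k → 0# * (h₁ * h₁ + h₂ * h₂) + ((2# * 0# * y₁ + k) * h₁ + (2# * 0# * y₂ + 1#) * h₂) ≡ 0# → h₂ ≡ - (k * h₁)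
      simplify k e = x-y≡0⇒x≡y (trans (solve 5 (λ k h₁ h₂ y₁ y₂ → h₂ :- (:- (k :* h₁)) := con (ℤ.+ 0) :* (h₁ :* h₁ :+ h₂ :* h₂) :+ ((con (ℤ.+ 2) :* con (ℤ.+ 0) :* y₁ :+ k) :* h₁ :+ (con (ℤ.+ 2) :* con (ℤ.+ 0) :* y₂ :+ con (ℤ.+ 1)) :* h₂)) refl k h₁ h₂ y₁ y₂) e)
      s : h₂ ≡ - (k * h₁)
      s = simplify k r
      h₁≢0 : h₁ ≢ 0#
      h₁≢0 e = h≢0 (e , trans s (trans (cong (λ w → - (k * w)) e) (solve 1 (λ k → :- (k :* con (ℤ.+ 0)) := con (ℤ.+ 0)) refl k)))
      k≡ : k ≡ k′
      k≡ = x-y≡0⇒x≡y (*-cancel-0 h₁≢0 (trans (solve 3 (λ h k k′ → h :* (k :- k′) := (:- (k′ :* h)) :- (:- (k :* h))) refl h₁ k k′) (trans (cong₂ _-_ (sym (simplify k′ r′)) (sym s)) (x-x≡0 h₂))))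
      go : k ≡ k′ → line (k , n) ≡ line (k′ , n′)
      go refl = cong (λ w → line (k , w)) (constant-term 0# (k , 1#) n n′ (y₁ , y₂) o o′)

    -- Subtracting the equations of two circles leaves their radical axis, so z and z′ lie on one
    -- line through y and on a circle through y. With a circle and a line the axis is the line
    -- itself, and two different lines cannot share y and z.
    three-points : 2 ≤ p → ∀ {C C′ y z z′} → C ∈ curves → C′ ∈ curves → C ≢ C′ → disc C ≢ 0# → y ≢ z → y ≢ z′ →
      On C y → On C′ y → On C z → On C′ z → On C z′ → On C′ z′ → z ≡ z′
    three-points 2≤p {C} {C′} {y} {z} {z′} C∈ C′∈ C≢ d≢0 y≢z y≢z′ oy oy′ oz oz₂ oz′ oz₂′ = go (curve-shape C∈) (curve-shape C′∈) C≢ oy oy′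
        (chord-relation C oy oz) (chord-relation C′ oy′ oz₂) (chord-relation C oy oz′) (chord-relation C′ oy′ oz₂′)
      where
      nz : norm² (z ⊝ y) ≢ 0#
      nz = chord-nonisotropic C d≢0 y≢z oy oz
      nz′ : norm² (z′ ⊝ y) ≢ 0#
      nz′ = chord-nonisotropic C d≢0 y≢z′ oy oz′
      Chord : Curve → V → Set
      Chord C z = proj₁ C * norm² (z ⊝ y) + shifted C y ∙ (z ⊝ y) ≡ 0#
      go : ∀ {C C′} → (Σ (V × F) λ q → C ≡ circle q) ⊎ (Σ (F × F) λ q → C ≡ line q) → (Σ (V × F) λ q → C′ ≡ circle q) ⊎ (Σ (F × F) λ q → C′ ≡ line q) →
        C ≢ C′ → On C y → On C′ y → Chord C z → Chord C′ z → Chord C z′ → Chord C′ z′ → z ≡ z′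
      go (inj₁ ((m , n) , refl)) (inj₁ ((m′ , n′) , refl)) C≢ o o′ r r₂ r′ r₂′ = ⊝-injective {z} {z′} {y}
        (two-circles (shifted (circle (m , n)) y) (shifted (circle (m′ , n′)) y) (z ⊝ y) (z′ ⊝ y) (λ q → C≢ (circles-equal m m′ n n′ y o o′ q)) nz nz′ r r₂ r′ r₂′)
      go (inj₁ ((m , n) , refl)) (inj₂ ((k , n′) , refl)) _ _ _ r r₂ r′ r₂′ = ⊝-injective {z} {z′} {y}
        (circle-and-line (shifted (circle (m , n)) y) (shifted (line (k , n′)) y) (z ⊝ y) (z′ ⊝ y) (line-proper 2≤p k n′ y) nz nz′ r r₂ r′ r₂′)
      go (inj₂ ((k , n) , refl)) (inj₁ ((m , n′) , refl)) _ _ _ r r₂ r′ r₂′ = ⊝-injective {z} {z′} {y}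
        (circle-and-line (shifted (circle (m , n′)) y) (shifted (line (k , n)) y) (z ⊝ y) (z′ ⊝ y) (line-proper 2≤p k n y) nz nz′ r₂ r r₂′ r′)
      go (inj₂ ((k , n) , refl)) (inj₂ ((k′ , n′) , refl)) C≢ o o′ r r₂ _ _ = ⊥-elim (C≢ (lines-equal k k′ n n′ y (z ⊝ y) (λ q → y≢z (sym (⊝-zero q))) o o′ r r₂))

    null-orthogonal : ∀ {k u} → 2# ≢ 0# → 1# + k * k ≢ 0# → norm² u ≡ 0# → 2# * (proj₁ u + k * proj₂ u) ≡ 0# → u ≡ (0# , 0#)
    null-orthogonal {k} {u₁ , u₂} 2≢0 n≢0 nu e = cong₂ _,_ u₁≡0 u₂≡0
      where
      orthogonal : u₁ + k * u₂ ≡ 0#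
      orthogonal = *-cancel-0 2≢0 e
      u₂≡0 : u₂ ≡ 0#
      u₂≡0 = x*x≡0⇒x≡0 (*-cancel-0 n≢0 (trans (solve 3 (λ k x y → (con (ℤ.+ 1) :+ k :* k) :* (y :* y) := (x :* x :+ y :* y) :+ (k :* y :- x) :* (x :+ k :* y)) refl k u₁ u₂)
        (zero-+ nu (*-zero _ orthogonal))))
      u₁≡0 : u₁ ≡ 0#
      u₁≡0 = trans (solve 3 (λ k x y → x := (x :+ k :* y) :+ (:- k) :* y) refl k u₁ u₂) (zero-+ orthogonal (*-zero _ u₂≡0))

    no-shift : ∀ {k ω z} → ω ≡ 0# → (1# + k * k) * ω + z ≡ 0# → z ≡ 0#
    no-shift {k} {_} {z} refl e = trans (solve 2 (λ k z → z := (con (ℤ.+ 1) :+ k :* k) :* con (ℤ.+ 0) :+ z) refl k z) e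

    moved-apart : ∀ {k ω} {u v : V} → 1# + k * k ≢ 0# → ω ≢ 0# → v ≡ (proj₁ u + ω , proj₂ u + k * ω) → norm² (u ⊝ v) ≢ 0#
    moved-apart {k} {ω} {u₁ , u₂} n≢0 ω≢0 refl e = *-nonzero (*-nonzero ω≢0 ω≢0) n≢0 (trans
      (solve 4 (λ k w x y → w :* w :* (con (ℤ.+ 1) :+ k :* k) := (x :- (x :+ w)) :* (x :- (x :+ w)) :+ (y :- (y :+ k :* w)) :* (y :- (y :+ k :* w))) refl k ω u₁ u₂) e)

  -- Incidences inside a block of frames of equal length.

  module BisectorBlocks where

    open FiniteSums
    open Pruning
    open 𝔽ₚ
    open Polynomials
    open Reguli
    open Interpolation
    open Reflections
    open Conics
    open import Data.Nat as ℕ using (ℕ; zero; suc; z≤n; s≤s; _≤_; _<_)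
    import Data.Nat.Properties as ℕₚ
    open import Data.Fin using (Fin; zero; suc)
    open import Data.Integer as ℤ using (ℤ)
    open import Data.Vec as Vec using ([]; _∷_)
    open import Data.List using (List; []; _∷_; length; filter)
    open import Data.List.Membership.Propositional using (_∈_)
    open import Data.List.Membership.Propositional.Properties using (∈-filter⁺)
    open import Data.List.Relation.Unary.Any as Any using (Any; any?; here; there)
    open import Data.List.Relation.Unary.Unique.Propositional using (Unique)
    open import Data.Product using (Σ; _×_; _,_; proj₁; proj₂)
    open import Data.Product.Properties using (≡-dec)
    open import Data.Sum using (_⊎_; inj₁; inj₂)
    open import Data.Empty using (⊥; ⊥-elim)
    open import Relation.Nullary using (¬_; Dec; yes; no; ¬?; _×-dec_)
    open import Relation.Binary.PropositionalEquality

    open Solver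
    open ≡-Reasoning

    Frame : Set
    Frame = V × V

    _≟Fr_ : (i j : Frame) → Dec (i ≡ j)
    _≟Fr_ = ≡-dec _≟V_ _≟V_

    ⊝-cancel : ∀ x y q → (x ⊝ q) ⊝ (y ⊝ q) ≡ x ⊝ y
    ⊝-cancel (x₁ , x₂) (y₁ , y₂) (q₁ , q₂) = cong₂ _,_ (e x₁ y₁ q₁) (e x₂ y₂ q₂)
      where e = solve 3 (λ x y q → (x :- q) :- (y :- q) := x :- y) refl

    norm²-⊝-sym : ∀ x y → norm² (x ⊝ y) ≡ norm² (y ⊝ x)
    norm²-⊝-sym (x₁ , x₂) (y₁ , y₂) = solve 4 (λ x₁ x₂ y₁ y₂ → (x₁ :- y₁) :* (x₁ :- y₁) :+ (x₂ :- y₂) :* (x₂ :- y₂) := (y₁ :- x₁) :* (y₁ :- x₁) :+ (y₂ :- x₂) :* (y₂ :- x₂)) refl x₁ x₂ y₁ y₂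

    few-roots : 9 < p → (g : Fin 8 → F) → ¬ (∀ k → g k ≡ 0#) → ∑ allF (λ θ → 𝟙 (horner 8 g θ ≟ 0#)) ≤ 8
    few-roots 9<p g g≢0 = ℕₚ.≮⇒≥ (λ many → g≢0 (horner≡0⇒coefficients≡0 8 g 9<p
      (λ t → trans (sym (eval-horner₁ 8 g t)) (rootCount⇒Zero (horner₁ 8 g) (ℕₚ.≤-<-trans (deg-horner₁ 8 g) (ℕₚ.<-≤-trans many count≤)) t))))
      where
      count≤ : ∑ allF (λ θ → 𝟙 (horner 8 g θ ≟ 0#)) ≤ rootCount (horner₁ 8 g)
      count≤ = ∑-mono allF (λ {θ} _ → 𝟙-mono (horner 8 g θ ≟ 0#) (eval (horner₁ 8 g) θ ≟ 0#) (trans (eval-horner₁ 8 g θ)))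

    module Setup (2<p : 2 < p) (I : Isotropy) (Y : List V) (κ : ℕ)
      (thin : ∀ v → ∑ Y (λ y → 𝟙 (Isotropy.Iso? I (y ⊝ v))) < κ) where

      open Isotropy I

      2≤p : 2 ≤ p
      2≤p = ℕₚ.<⇒≤ 2<p

      2≢0′ : 2# ≢ 0#
      2≢0′ = 2≢0 2<p

      Rich : Curve → Set
      Rich C = disc C ≢ 0# × κ ≤ ∑ Y (λ y → 𝟙 (on? C y))

      rich? : ∀ C → Dec (Rich C)
      rich? C = ¬? (disc C ≟ 0#) ×-dec (κ ℕ.≤? ∑ Y (λ y → 𝟙 (on? C y)))

      richCurves : List Curve
      richCurves = filter rich? curves

      CoRich : V → V → Set
      CoRich y z = Any (λ C → On C y × On C z) richCurves

      coRich? : ∀ y z → Dec (CoRich y z)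
      coRich? y z = any? (λ C → on? C y ×-dec on? C z) richCurves

      -- The three conditions give the bisector a slope, make it non-isotropic, and discard pairs
      -- lying on a common rich curve; the triangles lost by the first and the last are counted
      -- elsewhere.
      Good : V → V → Set
      Good y z = (proj₁ z - proj₁ y) ≢ 0# × norm² (z ⊝ y) ≢ 0# × ¬ CoRich y z

      good? : ∀ y z → Dec (Good y z)
      good? y z = ¬? ((proj₁ z - proj₁ y) ≟ 0#) ×-dec ¬? (norm² (z ⊝ y) ≟ 0#) ×-dec ¬? (coRich? y z)

      record Edge (i j : Frame) : Set where
        constructor edge
        field
          good₁ : Good (proj₁ i) (proj₁ j)
          good₂ : Good (proj₂ i) (proj₂ j)
          slopes : slope (proj₁ i) (proj₁ j) ≡ slope (proj₂ i) (proj₂ j)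
          heights : height (proj₁ i) (proj₁ j) ≡ height (proj₂ i) (proj₂ j)
      open Edge

      edge? : ∀ i j → Dec (Edge i j)
      edge? (a , c) (b , d) with good? a b ×-dec good? c d ×-dec (slope a b ≟ slope c d) ×-dec (height a b ≟ height c d)
      ... | yes (g , g′ , e , e′) = yes (edge g g′ e e′)
      ... | no ¬e = no λ { (edge g g′ e e′) → ¬e (g , g′ , e , e′) }

      reflected₁ : ∀ {i j} → Edge i j → Reflected (slope (proj₁ i) (proj₁ j)) (height (proj₁ i) (proj₁ j)) (proj₁ i) (proj₁ j)
      reflected₁ {a , _} {b , _} r = bisector-reflected 2≢0′ a b (proj₁ (good₁ r)) (proj₁ (proj₂ (good₁ r)))

      reflected₂ : ∀ {i j} → Edge i j → Reflected (slope (proj₁ i) (proj₁ j)) (height (proj₁ i) (proj₁ j)) (proj₂ i) (proj₂ j)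
      reflected₂ {a , c} {b , d} r = subst₂ (λ k h → Reflected k h c d) (sym (slopes r)) (sym (heights r))
        (bisector-reflected 2≢0′ c d (proj₁ (good₂ r)) (proj₁ (proj₂ (good₂ r))))

      edge-flip : ∀ {a b c d} → Edge (a , c) (b , d) → Edge (c , a) (d , b)
      edge-flip (edge g g′ e e′) = edge g′ g (sym e) (sym e′)

      key₁-injective : ∀ {i j j′} → Edge i j → Edge i j′ → proj₁ j ≡ proj₁ j′ → j ≡ j′
      key₁-injective {a , c} {b , d} {b′ , d′} r r′ refl = cong (b ,_) (reflected-unique (reflected₂ r) (reflected₂ r′))

      key₂-injective : ∀ {i j j′} → Edge i j → Edge i j′ → proj₂ j ≡ proj₂ j′ → j ≡ j′
      key₂-injective {a , c} {b , d} {b′ , d′} r r′ refl = cong (_, d) (cong proj₂ (key₁-injective (edge-flip r) (edge-flip r′) refl))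

      -- The neighbours of `i` that satisfy `Cond` are few: one of the endpoints, the `key`,
      -- determines such a neighbour and lies in a set containing fewer than κ points of `Y`. Which
      -- endpoint serves as key depends on the shape of the conic.
      record Trap (i : Frame) (Cond : Frame → Set) : Set₁ where
        field
          key : Frame → V
          key-injective : ∀ {j j′} → Edge i j → Edge i j′ → key j ≡ key j′ → j ≡ j′
          key-∈ : ∀ {j} → proj₁ j ∈ Y → proj₂ j ∈ Y → key j ∈ Y
          Pred : V → Set
          pred? : ∀ v → Dec (Pred v)
          few : ∑ Y (λ y → 𝟙 (pred? y)) < κ
          caught : ∀ {j} → Edge i j → Cond j → Pred (key j)

      trap₁ : ∀ {i Cond} (P : V → Set) (P? : ∀ v → Dec (P v)) → ∑ Y (λ y → 𝟙 (P? y)) < κ → (∀ {j} → Edge i j → Cond j → P (proj₁ j)) → Trap i Cond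
      trap₁ P P? few caught = record { key = proj₁ ; key-injective = key₁-injective ; key-∈ = λ p q → p ; Pred = P ; pred? = P? ; few = few ; caught = caught }

      trap₂ : ∀ {i Cond} (P : V → Set) (P? : ∀ v → Dec (P v)) → ∑ Y (λ y → 𝟙 (P? y)) < κ → (∀ {j} → Edge i j → Cond j → P (proj₂ j)) → Trap i Cond
      trap₂ P P? few caught = record { key = proj₂ ; key-injective = key₂-injective ; key-∈ = λ p q → q ; Pred = P ; pred? = P? ; few = few ; caught = caught }

      noTrap : ∀ {i Cond} → (∀ {j} → Edge i j → Cond j → ⊥) → Trap i Cond
      noTrap none = trap₁ (λ _ → ⊥) (λ _ → no (λ ())) (ℕₚ.≤-<-trans (ℕₚ.≤-trans (ℕₚ.≤-reflexive (∑-zero Y)) z≤n) (thin (0# , 0#))) none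

      -- If `C` is rich, a neighbour on it would share a rich curve with `a`, which `Good` forbids,
      -- so there is none. If `C` is poor, it has fewer than κ points of `Y`.
      curveTrap₁ : ∀ {a c Cond} C → C ∈ curves → disc C ≢ 0# → On C a → (∀ {j} → Edge (a , c) j → Cond j → On C (proj₁ j)) → Trap (a , c) Cond
      curveTrap₁ C C∈ d≢0 Ca on with κ ℕ.≤? ∑ Y (λ y → 𝟙 (on? C y))
      ... | yes rich = noTrap (λ r q → proj₂ (proj₂ (good₁ r)) (Any.map (λ { refl → Ca , on r q }) (∈-filter⁺ rich? C∈ (d≢0 , rich))))
      ... | no poor = trap₁ (On C) (on? C) (ℕₚ.≰⇒> poor) on

      curveTrap₂ : ∀ {a c Cond} C → C ∈ curves → disc C ≢ 0# → On C c → (∀ {j} → Edge (a , c) j → Cond j → On C (proj₂ j)) → Trap (a , c) Cond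
      curveTrap₂ C C∈ d≢0 Cc on with κ ℕ.≤? ∑ Y (λ y → 𝟙 (on? C y))
      ... | yes rich = noTrap (λ r q → proj₂ (proj₂ (good₂ r)) (Any.map (λ { refl → Cc , on r q }) (∈-filter⁺ rich? C∈ (d≢0 , rich))))
      ... | no poor = trap₂ (On C) (on? C) (ℕₚ.≰⇒> poor) on

      OnConic : V → F → V → Frame → Set
      OnConic a l m j = l * norm² (proj₁ j ⊝ a) + (proj₁ m * proj₁ (proj₁ j ⊝ a) + proj₂ m * proj₂ (proj₁ j ⊝ a)) ≡ 0#

      module _ (a c : V) (ac≢0 : norm² (c ⊝ a) ≢ 0#) (l : F) (m : V) where

        linear-part : ∀ {j} → l ≡ 0# → OnConic a l m j → proj₁ m * proj₁ (proj₁ j ⊝ a) + proj₂ m * proj₂ (proj₁ j ⊝ a) ≡ 0#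
        linear-part {j} l≡0 q = begin
          w                        ≡⟨ solve 2 (λ w n → w := con (ℤ.+ 0) :* n :+ w) refl w (norm² (proj₁ j ⊝ a)) ⟩
          0# * norm² (proj₁ j ⊝ a) + w  ≡⟨ cong (λ z → z * norm² (proj₁ j ⊝ a) + w) l≡0 ⟨
          l * norm² (proj₁ j ⊝ a) + w   ≡⟨ q ⟩
          0#                       ∎
          where w = proj₁ m * proj₁ (proj₁ j ⊝ a) + proj₂ m * proj₂ (proj₁ j ⊝ a)

        vertical : ∀ {j} → l ≡ 0# → proj₁ m ≢ 0# → proj₂ m ≡ 0# → Edge (a , c) j → OnConic a l m j → ⊥
        vertical {j} l≡0 m₁≢0 m₂≡0 r q = proj₁ (good₁ r) (*-cancel-0 m₁≢0 (begin
          w                                   ≡⟨ solve 2 (λ w n → w := w :+ con (ℤ.+ 0) :* n) refl w (proj₂ (proj₁ j ⊝ a)) ⟩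
          w + 0# * proj₂ (proj₁ j ⊝ a)        ≡⟨ cong (λ z → w + z * proj₂ (proj₁ j ⊝ a)) m₂≡0 ⟨
          w + proj₂ m * proj₂ (proj₁ j ⊝ a)   ≡⟨ linear-part {j} l≡0 q ⟩
          0#                                  ∎))
          where w = proj₁ m * proj₁ (proj₁ j ⊝ a)

        conicTrap : norm² m ≢ 0# → proj₁ (through a l m) ≢ 0# ⊎ (proj₁ (through a l m) ≡ 0# × proj₂ (proj₁ (proj₂ (through a l m))) ≢ 0#) → Trap (a , c) (OnConic a l m)
        conicTrap nm≢0 lead = conclude (canonical 2≤p (through a l m) (λ e → nm≢0 (trans (sym (disc-through a l m)) e)) lead)
          where
          conclude : (Σ Curve λ C′ → C′ ∈ curves × disc C′ ≢ 0# × (∀ v → On (through a l m) v → On C′ v)) → Trap (a , c) (OnConic a l m)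
          conclude (C , C∈ , d , on) = curveTrap₁ C C∈ d (on a (through-self a l m)) (λ {j} _ q → on (proj₁ j) (trans (through-onto a l m (proj₁ j)) q))

        regularTrap : norm² m ≢ 0# → Dec (l ≡ 0#) → Dec (proj₂ m ≡ 0#) → Trap (a , c) (OnConic a l m)
        regularTrap nm≢0 (yes l≡0) (yes m₂≡0) = noTrap (λ {j} → vertical {j} l≡0 (λ e → nm≢0 (zero-+ (*-zero _ e) (*-zero _ m₂≡0))) m₂≡0)
        regularTrap nm≢0 (no l≢0) _ = conicTrap nm≢0 (inj₁ l≢0)
        regularTrap nm≢0 (yes l≡0) (no m₂≢0) = conicTrap nm≢0 (inj₂ (l≡0 , λ e → m₂≢0 (trans
          (solve 2 (λ x y → x := x :- con (ℤ.+ 2) :* (con (ℤ.+ 0) :* y)) refl (proj₂ m) (proj₂ a))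
          (trans (cong (λ z → proj₂ m - 2# * (z * proj₂ a)) (sym l≡0)) e))))

        -- The conic is a circle of radius zero around `q`. Then `q` is equidistant from a and b, so
        -- it lies on the mirror, and d is as far from `q` as c. This moves the constraint to the
        -- second endpoint and to a circle that may have non-zero radius.
        module Singular (nm≡0 : norm² m ≡ 0#) (l≢0 : l ≢ 0#) where
          q : V
          q = nullCentre a l m

          self : norm² (a ⊝ q) ≡ 0#
          self = nullCentre-self a l m nm≡0

          first : ∀ {j} → OnConic a l m j → norm² (proj₁ j ⊝ q) ≡ 0#
          first {j} o = nullCentre-on a l m (proj₁ j) (*-nonzero 2≢0′ l≢0) nm≡0 o

          second : ∀ {j} → Edge (a , c) j → OnConic a l m j → norm² (proj₂ j ⊝ q) ≡ norm² (c ⊝ q)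
          second {j} r o = mirror-equidistant (reflected₂ r) q (mirror-point 2≢0′ (reflected₁ r) q (trans (first {j} o) (sym self)))

          differ : ∀ {x y} → norm² (y ⊝ x) ≢ 0# → norm² ((x ⊝ q) ⊝ (y ⊝ q)) ≢ 0#
          differ {x} {y} xy≢0 e = xy≢0 (trans (norm²-⊝-sym y x) (trans (cong norm² (sym (⊝-cancel x y q))) e))

          clash : ∀ {x y} → norm² (y ⊝ x) ≢ 0# → Iso (x ⊝ q) → Iso (y ⊝ q) → ⊥
          clash {x} {y} xy≢0 ix iy = differ {x} {y} xy≢0 (iso-null (iso-⊝ ix iy))

          pick₂ : ∀ {x y} → norm² (y ⊝ x) ≢ 0# → Iso (x ⊝ q) ⊎ Iso (y ⊝ q) → ¬ Iso (x ⊝ q) → Iso (y ⊝ q)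
          pick₂ xy≢0 (inj₁ ix) ¬ix = ⊥-elim (¬ix ix)
          pick₂ xy≢0 (inj₂ iy) ¬ix = iy

          -- Now a, b, c and d are all at distance zero from `q`. Since c - a is not isotropic, a
          -- and c are on different isotropic lines through `q`, and so are c and d, and a and b. If
          -- a is on the distinguished line then so is d, otherwise c and b are; either way thinness
          -- of `Y` applies.
          isoTrap : norm² (c ⊝ q) ≡ 0# → Iso (a ⊝ q) ⊎ Iso (c ⊝ q) → Trap (a , c) (OnConic a l m)
          isoTrap cq≡0 (inj₁ ia) = trap₂ (λ v → Iso (v ⊝ a)) (λ v → Iso? (v ⊝ a)) (thin a) caught
            where
            caught : ∀ {j} → Edge (a , c) j → OnConic a l m j → Iso (proj₂ j ⊝ a)
            caught {j} r o = subst Iso (⊝-cancel (proj₂ j) a q) (iso-⊝ (pick₂ cd≢0 (iso-either cq≡0 (trans (second r o) cq≡0) (differ {c} {proj₂ j} cd≢0)) (clash {a} {c} ac≢0 ia)) ia)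
              where cd≢0 = proj₁ (proj₂ (good₂ r))
          isoTrap cq≡0 (inj₂ ic) = trap₁ (λ v → Iso (v ⊝ c)) (λ v → Iso? (v ⊝ c)) (thin c) caught
            where
            caught : ∀ {j} → Edge (a , c) j → OnConic a l m j → Iso (proj₁ j ⊝ c)
            caught {j} r o = subst Iso (⊝-cancel (proj₁ j) c q) (iso-⊝ (pick₂ ab≢0 (iso-either self (first {j} o) (differ {a} {proj₁ j} ab≢0)) (λ ia → clash {a} {c} ac≢0 ia ic)) ic)
              where ab≢0 = proj₁ (proj₂ (good₁ r))

          singularTrap : Dec (norm² (c ⊝ q) ≡ 0#) → Trap (a , c) (OnConic a l m)
          singularTrap (no cq≢0) = curveTrap₂ (circleAround q (norm² (c ⊝ q))) (∈-circle _ _)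
            (λ e → *-nonzero 2≢0′ (*-nonzero 2≢0′ cq≢0) (trans (sym (disc-circleAround q (norm² (c ⊝ q)))) e))
            (circleAround-on q _ c refl) (λ {j} r o → circleAround-on q _ (proj₂ j) (second r o))
          singularTrap (yes cq≡0) = isoTrap cq≡0 (iso-either self cq≡0 (differ {a} {c} ac≢0))

        -- Three cases for λ|h|² + μ·h = 0: if μ is not isotropic this is a proper circle or line;
        -- if μ is isotropic and λ ≠ 0 it is a circle of radius zero; if λ = 0 as well, b - a is
        -- isotropic, contrary to `Good`.
        trap : ¬ (l ≡ 0# × proj₁ m ≡ 0# × proj₂ m ≡ 0#) → Trap (a , c) (OnConic a l m)
        trap proper = decide (norm² m ≟ 0#) (l ≟ 0#)
          where
          decide : Dec (norm² m ≡ 0#) → Dec (l ≡ 0#) → Trap (a , c) (OnConic a l m)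
          decide (no nm≢0) l? = regularTrap nm≢0 l? (proj₂ m ≟ 0#)
          decide (yes nm≡0) (no l≢0) = Singular.singularTrap nm≡0 l≢0 (norm² (c ⊝ Singular.q nm≡0 l≢0) ≟ 0#)
          decide (yes nm≡0) (yes l≡0) = noTrap (λ {j} r q → proj₁ (proj₂ (good₁ r))
              (isotropic-line m (proj₁ j ⊝ a) nm≡0 (λ { (z₁ , z₂) → proper (l≡0 , z₁ , z₂) }) (linear-part {j} l≡0 q)))

      prod : (V → F) → List V → Poly₁
      prod ξ [] = Con 1#
      prod ξ (y ∷ ys) = T- (ξ y) ⊠ prod ξ ys

      deg-prod : ∀ ξ ys → deg (prod ξ ys) ≡ length ys
      deg-prod ξ [] = refl
      deg-prod ξ (y ∷ ys) = cong suc (deg-prod ξ ys)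

      prod-root : ∀ ξ {y ys} → y ∈ ys → eval (prod ξ ys) (ξ y) ≡ 0#
      prod-root ξ {y} {_ ∷ ys} (here refl) = trans (cong (_* eval (prod ξ ys) (ξ y)) (x-x≡0 (ξ y))) (zeroˡ _)
      prod-root ξ {ys = y′ ∷ ys} (there y∈) = *-zero _ (prod-root ξ y∈)

      prod≢0 : ∀ ξ ys → length ys < p → ¬ Zero (prod ξ ys)
      prod≢0 ξ [] _ z = 1≢0 2≤p (z 0#)
      prod≢0 ξ (y ∷ ys) l<p z = prod≢0 ξ ys (ℕₚ.<-trans (ℕₚ.n<1+n _) l<p)
        (Zero-⊠ (T- (ξ y)) (prod ξ ys) (shift≢0 2≤p (ξ y)) (ℕₚ.≤-<-trans (ℕₚ.≤-reflexive (cong suc (deg-prod ξ ys))) l<p) z)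

      module Parameter (e : V) (ne≢0 : norm² e ≢ 0#) where

        angle : (e′ : V) → norm² e′ ≢ 0# → V → V
        angle e′ n≢0 u = go (norm² u ≟ norm² e′)
          where
          go : Dec (norm² u ≡ norm² e′) → V
          go (yes q) = proj₁ (halfAngle e′ u 2≢0′ q n≢0)
          -- A default for vectors of another length; all frames of a block have the length of `e`.
          go (no _) = 0# , 0#

        angle-half : ∀ e′ n≢0 u → norm² u ≡ norm² e′ → Half e′ u (angle e′ n≢0 u)
        angle-half e′ n≢0 u eq with norm² u ≟ norm² e′
        ... | yes q = proj₂ (halfAngle e′ u 2≢0′ q n≢0)
        ... | no ¬q = ⊥-elim (¬q eq)

        norm-bar : norm² (bar e) ≡ norm² e
        norm-bar = solve 2 (λ x y → x :* x :+ (:- y) :* (:- y) := x :* x :+ y :* y) refl (proj₁ e) (proj₂ e)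

        nē≢0 : norm² (bar e) ≢ 0#
        nē≢0 q = ne≢0 (trans (sym norm-bar) q)

        -- The half angles stay opaque from here on; they are known only through `s-half` and
        -- `t-half`.
        abstract
          s t : Frame → V
          s (a , c) = angle e ne≢0 (c ⊝ a)
          t (b , d) = angle (bar e) nē≢0 (d ⊝ b)

          s-half : ∀ {a c} → norm² (c ⊝ a) ≡ norm² e → Half e (c ⊝ a) (s (a , c))
          s-half {a} {c} eq = angle-half e ne≢0 (c ⊝ a) eq

          t-half : ∀ {b d} → norm² (d ⊝ b) ≡ norm² e → Half (bar e) (d ⊝ b) (t (b , d))
          t-half {b} {d} eq = angle-half (bar e) nē≢0 (d ⊝ b) (trans eq (sym norm-bar))

        E g : Frame → V
        E i = s i · bar (proj₁ i)
        g j = t j · bar (proj₁ j)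

        -- The frame i becomes the point (P : Q : s₁ : s₂) and the frame j the plane (-t₁ : t₂ : C : D), in
        -- projective coordinates sheared by θ so that the pairing is unchanged.
        module Coordinates (θ : F) where
          θ² θ³ θ⁴ : F
          θ² = θ * θ
          θ³ = θ * θ²
          θ⁴ = θ * θ³

          P Q C D′ : Frame → F
          P i = proj₁ (E i) - θ⁴ * proj₁ (s i) - θ * proj₂ (s i)
          Q i = proj₂ (E i) - θ² * proj₁ (s i) - θ³ * proj₂ (s i)
          C j = proj₁ (g j) - θ⁴ * proj₁ (t j) + θ² * proj₂ (t j)
          D′ j = - proj₂ (g j) - θ * proj₁ (t j) + θ³ * proj₂ (t j)

        open Coordinates

        Sheared : Frame → Frame → Set
        Sheared i j = proj₁ (t j · (s i · bar (proj₁ j ⊝ proj₁ i))) ≡ 0#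

        pairing : ∀ θ i j → Sheared i j → - proj₁ (t j) * P θ i + proj₂ (t j) * Q θ i + C θ j * proj₁ (s i) + D′ θ j * proj₂ (s i) ≡ 0#
        pairing θ i@((a₁ , a₂) , c) j@((b₁ , b₂) , d) inc = trans
          (solve 9 (λ θ s₁ s₂ t₁ t₂ a₁ a₂ b₁ b₂ →
             let θ² = θ :* θ ; θ³ = θ :* θ² ; θ⁴ = θ :* θ³
                 E₁ = s₁ :* a₁ :- s₂ :* (:- a₂) ; E₂ = s₁ :* (:- a₂) :+ s₂ :* a₁ ; g₁ = t₁ :* b₁ :- t₂ :* (:- b₂) ; g₂ = t₁ :* (:- b₂) :+ t₂ :* b₁
                 h₁ = b₁ :- a₁ ; h₂ = :- (b₂ :- a₂) in
             (:- t₁) :* (E₁ :- θ⁴ :* s₁ :- θ :* s₂) :+ t₂ :* (E₂ :- θ² :* s₁ :- θ³ :* s₂) :+ (g₁ :- θ⁴ :* t₁ :+ θ² :* t₂) :* s₁ :+ ((:- g₂) :- θ :* t₁ :+ θ³ :* t₂) :* s₂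
             := t₁ :* (s₁ :* h₁ :- s₂ :* h₂) :- t₂ :* (s₁ :* h₂ :+ s₂ :* h₁)) refl θ (proj₁ (s i)) (proj₂ (s i)) (proj₁ (t j)) (proj₂ (t j)) a₁ a₂ b₁ b₂)
          inc

        Merged₁ Merged₂ : F → Frame → Frame → Set
        Merged₁ θ j j′ = C θ j * D′ θ j′ - C θ j′ * D′ θ j ≡ 0#
        Merged₂ θ i i′ = P θ i * Q θ i′ - P θ i′ * Q θ i ≡ 0#

        merged₁? : ∀ θ j j′ → Dec (Merged₁ θ j j′)
        merged₁? θ j j′ = (C θ j * D′ θ j′ - C θ j′ * D′ θ j) ≟ 0#

        merged₂? : ∀ θ i i′ → Dec (Merged₂ θ i i′)
        merged₂? θ i i′ = (P θ i * Q θ i′ - P θ i′ * Q θ i) ≟ 0#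

        same-frame : ∀ {a c a′ c′ : V} → a ≡ a′ × c ⊝ a ≡ c′ ⊝ a′ → (a , c) ≡ (a′ , c′)
        same-frame {a} {c} {_} {c′} (refl , eq) = cong (a ,_) (V-≡ (trans (e₁ (proj₁ c) (proj₁ c′) (proj₁ a)) (trans (cong (λ z → z - (proj₁ c′ - proj₁ a)) (cong proj₁ eq)) (x-x≡0 _)))
          (trans (e₁ (proj₂ c) (proj₂ c′) (proj₂ a)) (trans (cong (λ z → z - (proj₂ c′ - proj₂ a)) (cong proj₂ eq)) (x-x≡0 _))))
          where
          e₁ : ∀ x y z → x - y ≡ (x - z) - (y - z)
          e₁ = solve 3 (λ x y z → x :- y := (x :- z) :- (y :- z)) refl

        neg⇒zero : ∀ {x} → - x ≡ 0# → x ≡ 0#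
        neg⇒zero {x} e = trans (solve 1 (λ x → x := :- (:- x)) refl x) (trans (cong -_ e) (solve 0 (:- con (ℤ.+ 0) := con (ℤ.+ 0)) refl))

        +-zero⁻ : ∀ {x y} → x + y ≡ 0# → y ≡ 0# → x ≡ 0#
        +-zero⁻ {x} {y} e e′ = trans (sym (+-identityʳ x)) (trans (cong (x +_) (sym e′)) e)

        -- The coefficients of the powers of θ are, up to sign, the 2 × 2 minors of the two coordinate vectors.
        module Minors (E₁ E₂ s₁ s₂ E₁′ E₂′ s₁′ s₂′ : F) where
          m m₁₁ m₁₂ m₂₁ m₂₂ m₀ : F
          m = s₁ * s₂′ - s₂ * s₁′
          m₁₁ = E₁ * s₁′ - s₁ * E₁′
          m₁₂ = E₁ * s₂′ - s₂ * E₁′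
          m₂₁ = E₂ * s₁′ - s₁ * E₂′
          m₂₂ = E₂ * s₂′ - s₂ * E₂′
          m₀ = E₁ * E₂′ - E₂ * E₁′

          coefficients₁ coefficients₂ : Vec.Vec F 8
          coefficients₁ = - m₀ ∷ - m₁₁ ∷ m₂₂ ∷ (m₁₂ + m) ∷ - m₂₁ ∷ 0# ∷ 0# ∷ - m ∷ []
          coefficients₂ = m₀ ∷ m₂₂ ∷ - m₁₁ ∷ - (m₁₂ + m) ∷ m₂₁ ∷ 0# ∷ 0# ∷ m ∷ []

        -- If the polynomial in θ were zero, the coefficient of θ⁷ would give m = 0, and then that
        -- of θ³, which is m₁₂ + m, would give m₁₂ = 0. The remaining minors needed by
        -- `frame-injective` sit alone in their powers, and the two frames would coincide.
        few-merged₁ : 9 < p → ∀ {b d b′ d′} → norm² (d ⊝ b) ≡ norm² e → norm² (d′ ⊝ b′) ≡ norm² e → (b , d) ≢ (b′ , d′) →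
          ∑ allF (λ θ → 𝟙 (merged₁? θ (b , d) (b′ , d′))) ≤ 8
        few-merged₁ 9<p {b} {d} {b′} {d′} n n′ j≢ = ℕₚ.≤-trans
          (∑-mono allF (λ {θ} _ → 𝟙-mono (merged₁? θ j j′) (horner 8 (Vec.lookup coefficients₁) θ ≟ 0#) (trans (expand θ))))
          (few-roots 9<p (Vec.lookup coefficients₁) (λ z → let m≡0 = neg⇒zero (z (suc (suc (suc (suc (suc (suc (suc zero)))))))) in
            j≢ (same-frame (frame-injective b b′ (t-half n) (t-half n′) m≡0
              (neg⇒zero (z (suc zero))) (+-zero⁻ (z (suc (suc (suc zero)))) m≡0) (neg⇒zero (z (suc (suc (suc (suc zero)))))) (z (suc (suc zero)))))))
          where
          j = b , d
          j′ = b′ , d′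
          open Minors (proj₁ (g j)) (proj₂ (g j)) (proj₁ (t j)) (proj₂ (t j)) (proj₁ (g j′)) (proj₂ (g j′)) (proj₁ (t j′)) (proj₂ (t j′))
          expand : ∀ θ → horner 8 (Vec.lookup coefficients₁) θ ≡ C θ j * D′ θ j′ - C θ j′ * D′ θ j
          expand θ = solve 9 (λ θ g₁ g₂ t₁ t₂ h₁ h₂ r₁ r₂ →
            let θ² = θ :* θ ; θ³ = θ :* θ² ; θ⁴ = θ :* θ³ ; o = con (ℤ.+ 0)
                m = t₁ :* r₂ :- t₂ :* r₁ ; m₁₁ = g₁ :* r₁ :- t₁ :* h₁ ; m₁₂ = g₁ :* r₂ :- t₂ :* h₁ ; m₂₁ = g₂ :* r₁ :- t₁ :* h₂ ; m₂₂ = g₂ :* r₂ :- t₂ :* h₂ ; m₀ = g₁ :* h₂ :- g₂ :* h₁ in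
            (:- m₀) :+ θ :* ((:- m₁₁) :+ θ :* (m₂₂ :+ θ :* ((m₁₂ :+ m) :+ θ :* ((:- m₂₁) :+ θ :* (o :+ θ :* (o :+ θ :* ((:- m) :+ θ :* o)))))))
            := (g₁ :- θ⁴ :* t₁ :+ θ² :* t₂) :* ((:- h₂) :- θ :* r₁ :+ θ³ :* r₂) :- (h₁ :- θ⁴ :* r₁ :+ θ² :* r₂) :* ((:- g₂) :- θ :* t₁ :+ θ³ :* t₂)) refl
            θ (proj₁ (g j)) (proj₂ (g j)) (proj₁ (t j)) (proj₂ (t j)) (proj₁ (g j′)) (proj₂ (g j′)) (proj₁ (t j′)) (proj₂ (t j′))

        few-merged₂ : 9 < p → ∀ {a c a′ c′} → norm² (c ⊝ a) ≡ norm² e → norm² (c′ ⊝ a′) ≡ norm² e → (a , c) ≢ (a′ , c′) →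
          ∑ allF (λ θ → 𝟙 (merged₂? θ (a , c) (a′ , c′))) ≤ 8
        few-merged₂ 9<p {a} {c} {a′} {c′} n n′ i≢ = ℕₚ.≤-trans
          (∑-mono allF (λ {θ} _ → 𝟙-mono (merged₂? θ i i′) (horner 8 (Vec.lookup coefficients₂) θ ≟ 0#) (trans (expand θ))))
          (few-roots 9<p (Vec.lookup coefficients₂) (λ z → let m≡0 = z (suc (suc (suc (suc (suc (suc (suc zero))))))) in
            i≢ (same-frame (frame-injective a a′ (s-half n) (s-half n′) m≡0
              (neg⇒zero (z (suc (suc zero)))) (+-zero⁻ (neg⇒zero (z (suc (suc (suc zero))))) m≡0) (z (suc (suc (suc (suc zero))))) (z (suc zero))))))
          where
          i = a , c
          i′ = a′ , c′
          open Minors (proj₁ (E i)) (proj₂ (E i)) (proj₁ (s i)) (proj₂ (s i)) (proj₁ (E i′)) (proj₂ (E i′)) (proj₁ (s i′)) (proj₂ (s i′))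
          expand : ∀ θ → horner 8 (Vec.lookup coefficients₂) θ ≡ P θ i * Q θ i′ - P θ i′ * Q θ i
          expand θ = solve 9 (λ θ g₁ g₂ t₁ t₂ h₁ h₂ r₁ r₂ →
            let θ² = θ :* θ ; θ³ = θ :* θ² ; θ⁴ = θ :* θ³ ; o = con (ℤ.+ 0)
                m = t₁ :* r₂ :- t₂ :* r₁ ; m₁₁ = g₁ :* r₁ :- t₁ :* h₁ ; m₁₂ = g₁ :* r₂ :- t₂ :* h₁ ; m₂₁ = g₂ :* r₁ :- t₁ :* h₂ ; m₂₂ = g₂ :* r₂ :- t₂ :* h₂ ; m₀ = g₁ :* h₂ :- g₂ :* h₁ in
            m₀ :+ θ :* (m₂₂ :+ θ :* ((:- m₁₁) :+ θ :* ((:- (m₁₂ :+ m)) :+ θ :* (m₂₁ :+ θ :* (o :+ θ :* (o :+ θ :* (m :+ θ :* o)))))))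
            := (g₁ :- θ⁴ :* t₁ :- θ :* t₂) :* (h₂ :- θ² :* r₁ :- θ³ :* r₂) :- (h₁ :- θ⁴ :* r₁ :- θ :* r₂) :* (g₂ :- θ² :* t₁ :- θ³ :* t₂)) refl
            θ (proj₁ (E i)) (proj₂ (E i)) (proj₁ (s i)) (proj₂ (s i)) (proj₁ (E i′)) (proj₂ (E i′)) (proj₁ (s i′)) (proj₂ (s i′))

        unit≢0 : ∀ (x : V) → norm² x ≢ 0# → ¬ (proj₁ x ≡ 0# × proj₂ x ≡ 0#)
        unit≢0 x n≢0 (z₁ , z₂) = n≢0 (zero-+ (*-zero _ z₁) (*-zero _ z₂))

        few-P≡0 : 9 < p → ∀ {a c} → norm² (c ⊝ a) ≡ norm² e → ∑ allF (λ θ → 𝟙 (P θ (a , c) ≟ 0#)) ≤ 8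
        few-P≡0 9<p {a} {c} n = ℕₚ.≤-trans
          (∑-mono allF (λ {θ} _ → 𝟙-mono (P θ i ≟ 0#) (horner 8 (Vec.lookup coefficients) θ ≟ 0#) (trans (expand θ))))
          (few-roots 9<p (Vec.lookup coefficients) (λ z → unit≢0 (s i) (Half.unit (s-half n)) (neg⇒zero (z (suc (suc (suc (suc zero))))) , neg⇒zero (z (suc zero)))))
          where
          i = a , c
          coefficients : Vec.Vec F 8
          coefficients = proj₁ (E i) ∷ - proj₂ (s i) ∷ 0# ∷ 0# ∷ - proj₁ (s i) ∷ 0# ∷ 0# ∷ 0# ∷ []
          expand : ∀ θ → horner 8 (Vec.lookup coefficients) θ ≡ P θ i
          expand θ = solve 4 (λ θ E s₁ s₂ → let o = con (ℤ.+ 0) in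
            E :+ θ :* ((:- s₂) :+ θ :* (o :+ θ :* (o :+ θ :* ((:- s₁) :+ θ :* (o :+ θ :* (o :+ θ :* (o :+ θ :* o)))))))
            := E :- θ :* (θ :* (θ :* θ)) :* s₁ :- θ :* s₂) refl θ (proj₁ (E i)) (proj₁ (s i)) (proj₂ (s i))

        few-D≡0 : 9 < p → ∀ {b d} → norm² (d ⊝ b) ≡ norm² e → ∑ allF (λ θ → 𝟙 (D′ θ (b , d) ≟ 0#)) ≤ 8
        few-D≡0 9<p {b} {d} n = ℕₚ.≤-trans
          (∑-mono allF (λ {θ} _ → 𝟙-mono (D′ θ j ≟ 0#) (horner 8 (Vec.lookup coefficients) θ ≟ 0#) (trans (expand θ))))
          (few-roots 9<p (Vec.lookup coefficients) (λ z → unit≢0 (t j) (Half.unit (t-half n)) (neg⇒zero (z (suc zero)) , z (suc (suc (suc zero))))))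
          where
          j = b , d
          coefficients : Vec.Vec F 8
          coefficients = - proj₂ (g j) ∷ - proj₁ (t j) ∷ 0# ∷ proj₂ (t j) ∷ 0# ∷ 0# ∷ 0# ∷ 0# ∷ []
          expand : ∀ θ → horner 8 (Vec.lookup coefficients) θ ≡ D′ θ j
          expand θ = solve 4 (λ θ g t₁ t₂ → let o = con (ℤ.+ 0) in
            (:- g) :+ θ :* ((:- t₁) :+ θ :* (o :+ θ :* (t₂ :+ θ :* (o :+ θ :* (o :+ θ :* (o :+ θ :* (o :+ θ :* o)))))))
            := (:- g) :- θ :* t₁ :+ θ :* (θ :* θ) :* t₂) refl θ (proj₂ (g j)) (proj₁ (t j)) (proj₂ (t j))

        sheared : ∀ {i j} → norm² (proj₂ i ⊝ proj₁ i) ≡ norm² e → norm² (proj₂ j ⊝ proj₁ j) ≡ norm² e → Edge i j → Sheared i j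
        sheared {a , c} {b , d} n n′ r = frames-incident {e} 2≢0′ n ne≢0 (s-half n) (t-half n′) (reflected₁ r) (reflected₂ r)

        -- A linear relation between the coordinates of the planes j is a second point common to them.
        module SecondPoint (θ : F) (i : Frame) (c₁ c₂ : F) where
          s° E° : V
          s° = c₁ , c₂
          E° = c₁ * θ⁴ θ + c₂ * θ , 1# + c₁ * θ² θ + c₂ * θ³ θ

          open Pencil (proj₁ i) (s i) s° E° public

          onSecond : ∀ j → c₁ * C θ j + c₂ * D′ θ j + proj₂ (t j) ≡ 0# → proj₁ (t j · (s° · bar (proj₁ j) ⊝ E°)) ≡ 0#
          onSecond j@((b₁ , b₂) , d) rel = trans
            (solve 7 (λ θ c₁ c₂ t₁ t₂ b₁ b₂ →
              let θ² = θ :* θ ; θ³ = θ :* θ² ; θ⁴ = θ :* θ³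
                  g₁ = t₁ :* b₁ :- t₂ :* (:- b₂) ; g₂ = t₁ :* (:- b₂) :+ t₂ :* b₁
                  x = (c₁ :* b₁ :- c₂ :* (:- b₂)) :- (c₁ :* θ⁴ :+ c₂ :* θ) ; y = (c₁ :* (:- b₂) :+ c₂ :* b₁) :- (con (ℤ.+ 1) :+ c₁ :* θ² :+ c₂ :* θ³) in
              t₁ :* x :- t₂ :* y := c₁ :* (g₁ :- θ⁴ :* t₁ :+ θ² :* t₂) :+ c₂ :* ((:- g₂) :- θ :* t₁ :+ θ³ :* t₂) :+ t₂) refl θ c₁ c₂ (proj₁ (t j)) (proj₂ (t j)) b₁ b₂)
            rel

          proper : norm² (proj₂ i ⊝ proj₁ i) ≡ norm² e → P θ i ≢ 0# → ¬ (lam ≡ 0# × proj₁ μ ≡ 0# × proj₂ μ ≡ 0#)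
          proper n P≢0 (l≡0 , μ₁≡0 , μ₂≡0) = 1≢0 2≤p (begin
            1#  ≡⟨ solve 2 (λ x y → con (ℤ.+ 1) := con (ℤ.+ 1) :+ con (ℤ.+ 0) :* x :+ con (ℤ.+ 0) :* y) refl (θ² θ) (θ³ θ) ⟩
            1# + 0# * θ² θ + 0# * θ³ θ ≡⟨ cong₂ (λ x y → 1# + x * θ² θ + y * θ³ θ) (sym c₁≡0) (sym c₂≡0) ⟩
            proj₂ E° ≡⟨ *-cancel-0 ns≢0 (trans (proj₂ (proj₂ multiple)) (trans (cong (_* proj₂ (E i)) ρ≡0) (zeroˡ _))) ⟩
            0# ∎)
            where
            ns≢0 : norm² (s i) ≢ 0#
            ns≢0 = Half.unit (s-half n)
            multiple = degenerate l≡0 μ₁≡0 μ₂≡0 ns≢0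
            ρ : F
            ρ = proj₁ (s i) * c₁ + proj₂ (s i) * c₂
            ρ≡0 : ρ ≡ 0#
            ρ≡0 = *-cancel-0 P≢0 (begin
              P θ i * ρ
                ≡⟨ solve 6 (λ E h s₁ s₂ θ r → (E :- h :* s₁ :- θ :* s₂) :* r := r :* E :- h :* (r :* s₁) :- θ :* (r :* s₂)) refl (proj₁ (E i)) (θ⁴ θ) (proj₁ (s i)) (proj₂ (s i)) θ ρ ⟩
              ρ * proj₁ (E i) - θ⁴ θ * (ρ * proj₁ (s i)) - θ * (ρ * proj₂ (s i))
                ≡⟨ cong₂ _-_ (cong₂ (λ x y → x - θ⁴ θ * y) (sym (proj₁ (proj₂ multiple))) (sym (proj₁ (proj₁ multiple)))) (cong (θ *_) (sym (proj₂ (proj₁ multiple)))) ⟩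
              norm² (s i) * (c₁ * θ⁴ θ + c₂ * θ) - θ⁴ θ * (norm² (s i) * c₁) - θ * (norm² (s i) * c₂)
                ≡⟨ solve 5 (λ n a b h θ → n :* (a :* h :+ b :* θ) :- h :* (n :* a) :- θ :* (n :* b) := con (ℤ.+ 0)) refl (norm² (s i)) c₁ c₂ (θ⁴ θ) θ ⟩
              0# ∎)
            c₁≡0 : c₁ ≡ 0#
            c₁≡0 = *-cancel-0 ns≢0 (trans (proj₁ (proj₁ multiple)) (trans (cong (_* proj₁ (s i)) ρ≡0) (zeroˡ _)))
            c₂≡0 : c₂ ≡ 0#
            c₂≡0 = *-cancel-0 ns≢0 (trans (proj₂ (proj₁ multiple)) (trans (cong (_* proj₂ (s i)) ρ≡0) (zeroˡ _)))

      module Count (s₀ d M N : ℕ) (3s≤d : s₀ ℕ.+ (s₀ ℕ.+ (s₀ ℕ.+ 0)) ≤ d) (few-lines : N ℕ.* suc d < s₀ ℕ.* (s₀ ℕ.* s₀))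
        (4d≤M : d ℕ.+ d ℕ.+ (d ℕ.+ d) ≤ M) (d+κ≤M : d ℕ.+ κ ≤ M) (M<p : M ℕ.+ 3 < p) (M*8256≤p : suc M ℕ.* 8256 ≤ p) (9<p : 9 < p)
        (r : F) (r≢0 : r ≢ 0#) (as bs : List Frame) (uas : Unique as) (ubs : Unique bs)
        (as-norm : ∀ {i} → i ∈ as → norm² (proj₂ i ⊝ proj₁ i) ≡ r) (bs-norm : ∀ {j} → j ∈ bs → norm² (proj₂ j ⊝ proj₁ j) ≡ r)
        (bs-Y : ∀ {j} → j ∈ bs → proj₁ j ∈ Y × proj₂ j ∈ Y) (as≤N : length as ≤ N) (bs≤N : length bs ≤ N) where

        edgeCount : ℕ
        edgeCount = ∑ as (λ i → ∑ bs (λ j → 𝟙 (edge? i j)))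

        -- The chord of one frame of the block serves as the reference vector `e` of norm r; any
        -- frame would do, as all have the same non-zero norm.
        module Contradiction (i₀ : Frame) (i₀∈ : i₀ ∈ as) (many : N ℕ.* suc M ℕ.* 8 < edgeCount) where

          e : V
          e = proj₂ i₀ ⊝ proj₁ i₀

          ne≢0 : norm² e ≢ 0#
          ne≢0 q = r≢0 (trans (sym (as-norm i₀∈)) q)

          as-e : ∀ {i} → i ∈ as → norm² (proj₂ i ⊝ proj₁ i) ≡ norm² e
          as-e i∈ = trans (as-norm i∈) (sym (as-norm i₀∈))

          bs-e : ∀ {j} → j ∈ bs → norm² (proj₂ j ⊝ proj₁ j) ≡ norm² e
          bs-e j∈ = trans (bs-norm j∈) (sym (as-norm i₀∈))

          open Parameter e ne≢0
          open Coordinates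

          Singular₁ Singular₂ : F → Frame → Set
          Singular₁ θ i = P θ i ≡ 0#
          Singular₂ θ j = D′ θ j ≡ 0#

          singular₁? : ∀ θ i → Dec (Singular₁ θ i)
          singular₁? θ i = P θ i ≟ 0#

          singular₂? : ∀ θ j → Dec (Singular₂ θ j)
          singular₂? θ j = D′ θ j ≟ 0#

          few₁ : ∀ {j j′} → j ∈ bs → j′ ∈ bs → j ≢ j′ → ∑ allF (λ θ → 𝟙 (merged₁? θ j j′)) ≤ 8
          few₁ j∈ j′∈ = few-merged₁ 9<p (bs-e j∈) (bs-e j′∈)

          few₂ : ∀ {i i′} → i ∈ as → i′ ∈ as → i ≢ i′ → ∑ allF (λ θ → 𝟙 (merged₂? θ i i′)) ≤ 8
          few₂ i∈ i′∈ = few-merged₂ 9<p (as-e i∈) (as-e i′∈)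

          few-singular₁ : ∀ {i} → i ∈ as → ∑ allF (λ θ → 𝟙 (singular₁? θ i)) ≤ 8
          few-singular₁ i∈ = few-P≡0 9<p (as-e i∈)

          few-singular₂ : ∀ {j} → j ∈ bs → ∑ allF (λ θ → 𝟙 (singular₂? θ j)) ≤ 8
          few-singular₂ j∈ = few-D≡0 9<p (bs-e j∈)

          1≤F : 1 ≤ length allF
          1≤F = ℕₚ.≤-trans (ℕₚ.<⇒≤ 2≤p) (ℕₚ.≤-reflexive (sym length-allF))

          M*8256≤F : suc M ℕ.* 8256 ≤ length allF
          M*8256≤F = ℕₚ.≤-trans M*8256≤p (ℕₚ.≤-reflexive (sym length-allF))

          module Sel = Selection allF Edge edge? as bs uas ubs _≟Fr_ _≟Fr_ Merged₁ merged₁? few₁ Merged₂ merged₂? few₂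
            Singular₁ singular₁? few-singular₁ Singular₂ singular₂? few-singular₂ (suc M) N (s≤s z≤n) as≤N bs≤N 1≤F M*8256≤F

          module Selected (o : Sel.Outcome) where
            open Sel.Outcome o renaming (parameter to θ; regular₁ to P≢0; regular₂ to D≢0)

            in-as : ∀ {i} → i ∈ as′ → i ∈ as
            in-as = _⊑_.member as′⊑

            in-bs : ∀ {j} → j ∈ bs′ → j ∈ bs
            in-bs = _⊑_.member bs′⊑

            -- Dividing `pairing` by `P` and `D′`, which are non-zero on the surviving frames, turns
            -- the incidence of point and plane into α x + β = γ z + δ′, the crossing of a line in Z
            -- = z with a line in X = x.
            x z α β γ δ′ : Frame → F
            x j = C θ j * inv (D′ θ j)
            γ j = - proj₂ (t j) * inv (D′ θ j)
            δ′ j = proj₁ (t j) * inv (D′ θ j)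
            z i = Q θ i * inv (P θ i)
            α i = proj₁ (s i) * inv (P θ i)
            β i = proj₂ (s i) * inv (P θ i)

            same-ratio : ∀ {c c′ y y′} → y ≢ 0# → y′ ≢ 0# → c * inv y ≡ c′ * inv y′ → c * y′ - c′ * y ≡ 0#
            same-ratio {c} {c′} {y} {y′} y≢0 y′≢0 q = begin
              c * y′ - c′ * y
                ≡⟨ cong₂ (λ u w → u * y′ - w * y) (sym (*-inv-cancel c y≢0)) (sym (*-inv-cancel c′ y′≢0)) ⟩
              c * inv y * y * y′ - c′ * inv y′ * y′ * y
                ≡⟨ cong (λ w → w * y * y′ - c′ * inv y′ * y′ * y) q ⟩
              c′ * inv y′ * y * y′ - c′ * inv y′ * y′ * y
                ≡⟨ solve 3 (λ w y y′ → w :* y :* y′ :- w :* y′ :* y := con (ℤ.+ 0)) refl (c′ * inv y′) y y′ ⟩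
              0# ∎

            merge₁ : ∀ {j j′} → j ∈ bs′ → j′ ∈ bs′ → x j ≡ x j′ → Merged₁ θ j j′
            merge₁ j∈ j′∈ = same-ratio (D≢0 j∈) (D≢0 j′∈)

            merge₂ : ∀ {i i′} → i ∈ as′ → i′ ∈ as′ → z i ≡ z i′ → Merged₂ θ i i′
            merge₂ {i} {i′} i∈ i′∈ q = trans (solve 4 (λ P Q P′ Q′ → P :* Q′ :- P′ :* Q := Q′ :* P :- Q :* P′) refl (P θ i) (Q θ i) (P θ i′) (Q θ i′))
              (same-ratio (P≢0 i′∈) (P≢0 i∈) (sym q))

            -- The selection was made with K = M + 1, so vanishing at all neighbours means more
            -- roots than the degree allows.
            rich₁ : ∀ {i} → i ∈ as′ → ∀ g → deg g ≤ M → (∀ {j} → j ∈ bs′ → Edge i j → eval g (x j) ≡ 0#) → Zero g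
            rich₁ {i} i∈ g dg vanish = rootCount⇒Zero g (ℕₚ.<-≤-trans (s≤s dg)
              (manyLabels₁ i∈ allF unique-allF (λ l → ∈-allF l) _≟_ x merge₁ (λ l → eval g l ≟ 0#) vanish))

            rich₂ : ∀ {j} → j ∈ bs′ → ∀ g → deg g ≤ M → (∀ {i} → i ∈ as′ → Edge i j → eval g (z i) ≡ 0#) → Zero g
            rich₂ {j} j∈ g dg vanish = rootCount⇒Zero g (ℕₚ.<-≤-trans (s≤s dg)
              (manyLabels₂ j∈ allF unique-allF (λ l → ∈-allF l) _≟_ z merge₂ (λ l → eval g l ≟ 0#) vanish))

            divide : ∀ {p′ q c d′ s₁ s₂ t₁ t₂ ip id} → p′ * ip ≡ 1# → d′ * id ≡ 1# → - t₁ * p′ + t₂ * q + c * s₁ + d′ * s₂ ≡ 0# →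
              s₁ * ip * (c * id) + s₂ * ip ≡ - t₂ * id * (q * ip) + t₁ * id
            divide {p′} {q} {c} {d′} {s₁} {s₂} {t₁} {t₂} {ip} {id} pe de rel = x-y≡0⇒x≡y (begin
              s₁ * ip * (c * id) + s₂ * ip - (- t₂ * id * (q * ip) + t₁ * id)
                ≡⟨ solve 10 (λ p q c d s₁ s₂ t₁ t₂ ip id → s₁ :* ip :* (c :* id) :+ s₂ :* ip :- ((:- t₂) :* id :* (q :* ip) :+ t₁ :* id)
                     := (ip :* id) :* ((:- t₁) :* p :+ t₂ :* q :+ c :* s₁ :+ d :* s₂) :+ (s₂ :* ip :* (con (ℤ.+ 1) :- d :* id) :+ (:- (t₁ :* id)) :* (con (ℤ.+ 1) :- p :* ip))) refl
                     p′ q c d′ s₁ s₂ t₁ t₂ ip id ⟩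
              _ ≡⟨ zero-+ (*-zero _ rel) (zero-+ (*-zero _ (trans (cong (λ w → 1# - w) de) (x-x≡0 1#))) (*-zero _ (trans (cong (λ w → 1# - w) pe) (x-x≡0 1#)))) ⟩
              0# ∎)

            sheared′ : ∀ {i j} → i ∈ as′ → j ∈ bs′ → Edge i j → Sheared i j
            sheared′ i∈ j∈ = sheared (as-e (in-as i∈)) (bs-e (in-bs j∈))

            incident : ∀ {i j} → i ∈ as′ → j ∈ bs′ → Edge i j → α i * x j + β i ≡ γ j * z i + δ′ j
            incident {i} {j} i∈ j∈ ij = divide (*-inv (P≢0 i∈)) (*-inv (D≢0 j∈)) (pairing θ i j (sheared′ i∈ j∈ ij))

            module Surf = Surface Edge as′ bs′ z α β x γ δ′ incident d M 4d≤M M<p rich₁ rich₂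

            someEdge : Σ Frame λ j → j ∈ bs′
            someEdge = let i , i∈ , pos = ∑-positive as′ nonempty ; j , j∈ , _ = ∑-positive bs′ pos in j , j∈

            as′≤N : length as′ ≤ N
            as′≤N = ℕₚ.≤-trans (ℕₚ.≤-trans (ℕₚ.≤-reflexive (count as′)) (_⊑_.∑-≤ as′⊑ (λ _ → 1))) (ℕₚ.≤-trans (ℕₚ.≤-reflexive (sym (count as))) as≤N)
              where
              count : ∀ (xs : List Frame) → length xs ≡ ∑ xs (λ _ → 1)
              count xs = sym (trans (∑-const xs 1) (ℕₚ.*-identityʳ _))

            linear : ∀ i v → deg (Surf.L₁ i v) ≤ 1
            linear i = deg-line₁ (z i) (α i) (β i)

            sd<p : suc d < p
            sd<p = ℕₚ.≤-<-trans (ℕₚ.≤-trans (s≤s Surf.d≤M) (ℕₚ.≤-trans (ℕₚ.≤-reflexive (ℕₚ.+-comm 1 M)) (ℕₚ.+-monoʳ-≤ M (s≤s z≤n)))) M<p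

            few′ : length as′ ℕ.* suc d < s₀ ℕ.* (s₀ ℕ.* s₀)
            few′ = ℕₚ.≤-<-trans (ℕₚ.*-monoˡ-≤ (suc d) as′≤N) few-lines

            clear : ∀ {c₁ c₂ t₂ c d′ id} → d′ * id ≡ 1# → - t₂ * id ≡ c₁ * (c * id) + c₂ → c₁ * c + c₂ * d′ + t₂ ≡ 0#
            clear {c₁} {c₂} {t₂} {c} {d′} {id} de q = begin
              c₁ * c + c₂ * d′ + t₂
                ≡⟨ solve 6 (λ c₁ c₂ t c d id → c₁ :* c :+ c₂ :* d :+ t := d :* ((c₁ :* (c :* id) :+ c₂) :- (:- t) :* id) :+ (c₁ :* c :+ t) :* (con (ℤ.+ 1) :- d :* id)) refl c₁ c₂ t₂ c d′ id ⟩
              _ ≡⟨ zero-+ (*-zero d′ (trans (cong (λ w → (c₁ * (c * id) + c₂) - w) q) (x-x≡0 _))) (*-zero _ (trans (cong (λ w → 1# - w) de) (x-x≡0 1#))) ⟩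
              0# ∎

            -- The regulus contradicts richness. A neighbour of `i` has its label either at a root
            -- of φ or on the regulus; in the latter case it satisfies a conic and its key falls
            -- into the trap. So φ times a product of fewer than κ linear factors vanishes at all
            -- labels; its degree is at most d + κ ≤ M, hence it is zero, although neither factor
            -- is.
            module Kill (a c : V) (i∈ : (a , c) ∈ as′) (c₁ c₂ : F) (φ : Poly₁) (dφ : deg φ ≤ d) (t₀ : F) (φ≢0 : eval φ t₀ ≢ 0#)
              (ruled : ∀ {j} → j ∈ bs′ → Edge (a , c) j → eval φ (x j) ≡ 0# ⊎ γ j ≡ c₁ * x j + c₂) where

              i : Frame
              i = a , c

              open SecondPoint θ i c₁ c₂

              onConic : ∀ {j} → j ∈ bs′ → Edge i j → γ j ≡ c₁ * x j + c₂ → OnConic a lam μ j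
              onConic {j} j∈ ij q = conic (proj₁ j) (t j) (Half.unit (t-half (bs-e (in-bs j∈)))) (sheared′ i∈ j∈ ij) (onSecond j (clear (*-inv (D≢0 j∈)) q))

              ac≢0 : norm² (c ⊝ a) ≢ 0#
              ac≢0 q = r≢0 (trans (sym (as-norm (in-as i∈))) q)

              open Trap (trap a c ac≢0 lam μ (proper (as-e (in-as i∈)) (P≢0 i∈)))

              Neighbour : V → Frame → Set
              Neighbour v j = Edge i j × key j ≡ v

              neighbour? : ∀ v → Dec (Any (Neighbour v) bs′)
              neighbour? v = any? (λ j → edge? i j ×-dec (key j ≟V v)) bs′

              label : ∀ {v} → Dec (Any (Neighbour v) bs′) → F
              label (yes found) = x (proj₁ (Any.satisfied found))
              -- The default is harmless: it only adds the root zero to the product below.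
              label (no _) = 0#

              ξ : V → F
              ξ v = label (neighbour? v)

              ξ-key : ∀ {j} → j ∈ bs′ → Edge i j → ξ (key j) ≡ x j
              ξ-key {j} j∈ ij = go (neighbour? (key j))
                where
                go : (q : Dec (Any (Neighbour (key j)) bs′)) → label q ≡ x j
                go (yes found) = cong x (key-injective (proj₁ (proj₂ (Any.satisfied found))) ij (proj₂ (proj₂ (Any.satisfied found))))
                go (no none) = ⊥-elim (none (Any.map (λ { refl → ij , refl }) j∈))

              ys : List V
              ys = filter pred? Y

              ys<κ : length ys < κ
              ys<κ = ℕₚ.≤-<-trans (ℕₚ.≤-reflexive (length-filter-∑ pred? Y)) few

              degree : deg (φ ⊠ prod ξ ys) ≤ M
              degree = ℕₚ.≤-trans (ℕₚ.+-mono-≤ dφ (ℕₚ.≤-trans (ℕₚ.≤-reflexive (deg-prod ξ ys)) (ℕₚ.<⇒≤ ys<κ))) d+κ≤M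

              M<p′ : M < p
              M<p′ = ℕₚ.≤-<-trans (ℕₚ.m≤m+n M 3) M<p

              vanish : ∀ {j} → j ∈ bs′ → Edge i j → eval (φ ⊠ prod ξ ys) (x j) ≡ 0#
              vanish {j} j∈ ij = go (ruled j∈ ij)
                where
                go : eval φ (x j) ≡ 0# ⊎ γ j ≡ c₁ * x j + c₂ → eval φ (x j) * eval (prod ξ ys) (x j) ≡ 0#
                go (inj₁ q) = trans (cong (_* eval (prod ξ ys) (x j)) q) (zeroˡ _)
                go (inj₂ q) = *-zero _ (trans (cong (eval (prod ξ ys)) (sym (ξ-key j∈ ij)))
                  (prod-root ξ (∈-filter⁺ pred? (key-∈ (proj₁ (bs-Y (in-bs j∈))) (proj₂ (bs-Y (in-bs j∈)))) (caught ij (onConic j∈ ij q)))))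

              killed : ⊥
              killed = prod≢0 ξ ys (ℕₚ.<-trans (ℕₚ.<-≤-trans ys<κ (ℕₚ.≤-trans (ℕₚ.m≤n+m κ d) d+κ≤M)) M<p′)
                (Zero-⊠ φ (prod ξ ys) φ≢0 (ℕₚ.≤-<-trans degree M<p′) (rich₁ i∈ (φ ⊠ prod ξ ys) degree vanish))

            contradiction′ : ⊥
            contradiction′ = go (interpolation s₀ as′ Surf.L₁ linear d 3s≤d sd<p few′)
              where
              finish : Σ Frame (λ i → i ∈ as′ × Σ F λ c → Σ F λ c′ → Σ Poly₁ λ φ → deg φ ≤ d × (Σ F λ t → eval φ t ≢ 0#) ×
                (∀ {j} → j ∈ bs′ → Edge i j → eval φ (x j) ≡ 0# ⊎ γ j ≡ c * x j + c′)) → ⊥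
              finish ((a , c) , i∈ , c₁ , c₂ , φ , dφ , (t₀ , φ≢0) , ruled) = Kill.killed a c i∈ c₁ c₂ φ dφ t₀ φ≢0 ruled
              go : (Σ Poly₃ λ f → deg₃ f ≤ d × (∀ {i} → i ∈ as′ → Zero (sub f (Surf.L₁ i))) × Σ (Var → F) λ ρ → eval₃ f ρ ≢ 0#) → ⊥
              go (f , df , on , ρ , f≢0) = finish (Surf.regulus f df on f≢0 (proj₂ someEdge))

          contradiction : ⊥
          contradiction = Selected.contradiction′ (Sel.outcome many)

        fewEdges : edgeCount ≤ N ℕ.* suc M ℕ.* 8
        fewEdges = ℕₚ.≮⇒≥ (λ many → let i₀ , i₀∈ , _ = ∑-positive as (ℕₚ.≤-<-trans z≤n many) in Contradiction.contradiction i₀ i₀∈ many)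

  -- Counting isosceles triangles by rich curves, bisectors and bisector energy.

  module IsoscelesTriangles where

    open FiniteSums
    open 𝔽ₚ using (F; 0#; 1#; _-_)
    open Polynomials using (_≟_; allF; length-allF)
    open Reflections
    open Conics
    open CircleFamilies
    open BisectorBlocks
    open import Data.Nat hiding (_≟_)
    open import Data.Nat.Properties hiding (_≟_)
    open import Data.Nat.Tactic.RingSolver using (solve-∀)
    open import Data.List using (List; _∷_; length; filter; cartesianProduct)
    open import Data.List.Membership.Propositional using (_∈_)
    open import Data.List.Membership.Propositional.Properties using (∈-filter⁻; ∈-cartesianProduct⁻)
    open import Data.List.Relation.Unary.Any using (Any; here; there)
    open import Data.List.Relation.Unary.Unique.Propositional using (Unique)
    open import Data.List.Relation.Unary.Unique.Propositional.Properties using (cartesianProduct⁺; filter⁺)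
    open import Data.Product using (Σ; _×_; _,_; proj₁; proj₂)
    open import Data.Product.Properties using (≡-dec)
    open import Data.Sum using (_⊎_; inj₁; inj₂)
    open import Relation.Nullary using (Dec; yes; no; ¬?; _×-dec_)
    open import Relation.Binary.PropositionalEquality

    _≟C_ : (C C′ : Curve) → Dec (C ≡ C′)
    _≟C_ = ≡-dec _≟_ (≡-dec _≟V_ _≟_)

    Equidistant : V → V → V → Set
    Equidistant x y z = norm² (x ⊝ y) ≡ norm² (x ⊝ z)

    equidistant? : ∀ x y z → Dec (Equidistant x y z)
    equidistant? x y z = norm² (x ⊝ y) ≟ norm² (x ⊝ z)

    module Counts (2<p : 2 < p) (I : Isotropy) (Y : List V) (uY : Unique Y) (κ : ℕ)
      (thin : ∀ v → ∑ Y (λ y → 𝟙 (Isotropy.Iso? I (y ⊝ v))) < κ) (many : 4 * length Y ≤ κ * κ) where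

      open Isotropy I
      open Setup 2<p I Y κ thin

      n : ℕ
      n = length Y

      1≤κ : 1 ≤ κ
      1≤κ = ≤-<-trans z≤n (thin (0# , 0#))

      onCount : Curve → ℕ
      onCount C = ∑ Y (λ y → 𝟙 (on? C y))

      S : ℕ
      S = ∑ richCurves onCount

      unique-rich : Unique richCurves
      unique-rich = filter⁺ rich? (unique-curves 2≤p)

      rich-curve : ∀ {C} → C ∈ richCurves → C ∈ curves × Rich C
      rich-curve = ∈-filter⁻ rich? {xs = curves}

      κ*curves≤S : κ * length richCurves ≤ S
      κ*curves≤S = ≤-trans (≤-reflexive (trans (*-comm κ _) (sym (∑-const richCurves κ)))) (∑-mono richCurves (λ C∈ → proj₂ (proj₂ (rich-curve C∈))))

      throughCount : V → ℕ
      throughCount y = ∑ richCurves (λ C → 𝟙 (on? C y))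

      pairs≤ : ∑ Y (λ y → throughCount y * throughCount y) ≤ S + length richCurves * (length richCurves * 2)
      pairs≤ = begin
        ∑ Y (λ y → throughCount y * throughCount y)
          ≡⟨ ∑-cong Y (λ y → ∑-product richCurves richCurves _ _) ⟩
        ∑ Y (λ y → ∑ richCurves (λ C → ∑ richCurves (λ C′ → 𝟙 (on? C y) * 𝟙 (on? C′ y))))
          ≡⟨ trans (∑-swap Y richCurves _) (∑-cong richCurves (λ C → ∑-swap Y richCurves _)) ⟩
        ∑ richCurves (λ C → ∑ richCurves (λ C′ → ∑ Y (λ y → 𝟙 (on? C y) * 𝟙 (on? C′ y))))
          ≤⟨ ∑-mono richCurves (λ {C} C∈ → ∑-mono richCurves (λ {C′} C′∈ → common C∈ C′∈ (C ≟C C′))) ⟩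
        ∑ richCurves (λ C → ∑ richCurves (λ C′ → 𝟙 (C ≟C C′) * onCount C + 2))
          ≡⟨ ∑-cong richCurves (λ C → ∑-+ richCurves _ _) ⟩
        ∑ richCurves (λ C → ∑ richCurves (λ C′ → 𝟙 (C ≟C C′) * onCount C) + ∑ richCurves (λ _ → 2))
          ≤⟨ ∑-mono richCurves (λ {C} _ → +-mono-≤ (∑-atMostOne (C ≟C_) unique-rich (λ _ _ e e′ → trans (sym e) e′) (λ _ → onCount C) (onCount C) (λ _ _ → ≤-refl))
               (≤-reflexive (∑-const richCurves 2))) ⟩
        ∑ richCurves (λ C → onCount C + length richCurves * 2)
          ≡⟨ trans (∑-+ richCurves _ _) (cong (S +_) (∑-const richCurves _)) ⟩
        S + length richCurves * (length richCurves * 2) ∎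
        where
        open ≤-Reasoning
        common : ∀ {C C′} → C ∈ richCurves → C′ ∈ richCurves → (d : Dec (C ≡ C′)) → ∑ Y (λ y → 𝟙 (on? C y) * 𝟙 (on? C′ y)) ≤ 𝟙 d * onCount C + 2
        common {C} _ _ (yes refl) = ≤-trans (≤-reflexive (trans (∑-cong Y (λ y → 𝟙-idem (on? C y))) (sym (*-identityˡ _)))) (m≤m+n _ 2)
        common {C} {C′} C∈ C′∈ (no C≢) = ≤-trans (≤-reflexive (∑-cong Y (λ y → sym (𝟙-× (on? C y) (on? C′ y)))))
          (count≤2 (λ y → on? C y ×-dec on? C′ y) uY (λ { (oy , oy′) (oz , oz′) (ow , ow′) y≢z y≢w →
            three-points 2≤p (proj₁ (rich-curve C∈)) (proj₁ (rich-curve C′∈)) C≢ (proj₁ (proj₂ (rich-curve C∈))) y≢z y≢w oy oy′ oz oz′ ow ow′ }))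

      -- Cauchy-Schwarz with at most two common points for two curves gives S² ≤ n (S + 2M²) for M
      -- rich curves. As κM ≤ S and 4n ≤ κ², the term 2nM² is at most S²/2, which is absorbed on the
      -- left.
      S≤2n : S ≤ 2 * n
      S≤2n = conclude S refl
        where
        open ≤-Reasoning
        M = length richCurves
        square : S * S ≤ n * (S + M * (M * 2))
        square = begin
          S * S                               ≡⟨ cong₂ _*_ S≡ S≡ ⟩
          ∑ Y throughCount * ∑ Y throughCount ≤⟨ ∑² Y throughCount ⟩
          n * ∑ Y (λ y → throughCount y * throughCount y) ≤⟨ *-monoʳ-≤ n pairs≤ ⟩
          n * (S + M * (M * 2))               ∎
          where
          S≡ : S ≡ ∑ Y throughCount
          S≡ = ∑-swap richCurves Y (λ C y → 𝟙 (on? C y))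
        cancel : κ * κ * (S * S) ≤ κ * κ * (2 * n * S)
        cancel = +-cancelʳ-≤ (κ * κ * (S * S)) _ _ (begin
          κ * κ * (S * S) + κ * κ * (S * S)                       ≤⟨ +-mono-≤ (*-monoʳ-≤ (κ * κ) square) (*-monoʳ-≤ (κ * κ) square) ⟩
          κ * κ * (n * (S + M * (M * 2))) + κ * κ * (n * (S + M * (M * 2))) ≡⟨ e₁ κ n S M ⟩
          κ * κ * (2 * n * S) + 4 * n * (κ * M * (κ * M))         ≤⟨ +-monoʳ-≤ (κ * κ * (2 * n * S)) (*-mono-≤ many (*-mono-≤ κ*curves≤S κ*curves≤S)) ⟩
          κ * κ * (2 * n * S) + κ * κ * (S * S)                   ∎)
          where
          e₁ : ∀ κ n S M → κ * κ * (n * (S + M * (M * 2))) + κ * κ * (n * (S + M * (M * 2))) ≡ κ * κ * (2 * n * S) + 4 * n * (κ * M * (κ * M))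
          e₁ = solve-∀
        instance
          κ≢0 : NonZero κ
          κ≢0 = >-nonZero 1≤κ
        conclude : ∀ s → S ≡ s → S ≤ 2 * n
        conclude zero eq = ≤-trans (≤-reflexive eq) z≤n
        conclude (suc s) eq = *-cancelʳ-≤ S (2 * n) S {{subst NonZero (sym eq) _}} (*-cancelˡ-≤ (κ * κ) {{m*n≢0 κ κ}} cancel)

      module Triples (X : List V) (uX : Unique X) where
        nX : ℕ
        nX = length X

        ∑³ : (V → V → V → ℕ) → ℕ
        ∑³ f = ∑ X (λ x → ∑ Y (λ y → ∑ Y (λ z → f x y z)))

        ∑³-+ : ∀ f g → ∑³ (λ x y z → f x y z + g x y z) ≡ ∑³ f + ∑³ g
        ∑³-+ f g = trans (∑-cong X (λ x → trans (∑-cong Y (λ y → ∑-+ Y _ _)) (∑-+ Y _ _))) (∑-+ X _ _)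

        ∑³-mono : ∀ {f g} → (∀ x y z → f x y z ≤ g x y z) → ∑³ f ≤ ∑³ g
        ∑³-mono h = ∑-mono X (λ _ → ∑-mono Y (λ _ → ∑-mono Y (λ _ → h _ _ _)))

        ∑³-≤ : ∀ {f} → (∀ x y → ∑ Y (f x y) ≤ 1) → ∑³ f ≤ nX * n
        ∑³-≤ h = ∑-≤const X n (λ {x} _ → ≤-trans (∑-≤const Y 1 (λ {y} _ → h x y)) (≤-reflexive (*-identityʳ n)))

        triple? : ∀ x y z → Dec (Equidistant x y z × norm² (x ⊝ y) ≢ 0#)
        triple? x y z = equidistant? x y z ×-dec ¬? (norm² (x ⊝ y) ≟ 0#)

        Isosceles : ℕ
        Isosceles = ∑³ (λ x y z → 𝟙 (triple? x y z))

        goodTriple? : ∀ x y z → Dec (Good y z × Equidistant x y z)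
        goodTriple? x y z = good? y z ×-dec equidistant? x y z

        GoodTriples : ℕ
        GoodTriples = ∑³ (λ x y z → 𝟙 (goodTriple? x y z))

        Vertical : V → V → V → Set
        Vertical x y z = y ≢ z × (proj₁ z - proj₁ y) ≡ 0# × Equidistant x y z

        vertical? : ∀ x y z → Dec (Vertical x y z)
        vertical? x y z = ¬? (y ≟V z) ×-dec ((proj₁ z - proj₁ y) ≟ 0#) ×-dec equidistant? x y z

        RichTriple : Curve → V → V → V → Set
        RichTriple C x y z = On C z × norm² (z ⊝ y) ≢ 0# × Equidistant x y z

        richTriple? : ∀ C x y z → Dec (RichTriple C x y z)
        richTriple? C x y z = on? C z ×-dec ¬? (norm² (z ⊝ y) ≟ 0#) ×-dec equidistant? x y z

        richTerm : V → V → V → ℕ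
        richTerm x y z = ∑ richCurves (λ C → 𝟙 (on? C y) * 𝟙 (richTriple? C x y z))

        1≤any : ∀ {Cs : List Curve} {P : Curve → Set} {f : Curve → ℕ} → Any P Cs → (∀ {C} → P C → 1 ≤ f C) → 1 ≤ ∑ Cs f
        1≤any (here q) h = ≤-trans (h q) (m≤m+n _ _)
        1≤any {C ∷ Cs} {f = f} (there q) h = ≤-trans (1≤any q h) (m≤n+m _ (f C))

        -- The classes are y = z, pairs with equal first coordinates, pairs on a common rich curve,
        -- and good pairs. Isotropic pairs do not form a class: for y ≠ z at equal non-zero distance
        -- from x, z - y is never isotropic.
        split : ∀ x y z → 𝟙 (triple? x y z) ≤ (𝟙 (y ≟V z) + 𝟙 (vertical? x y z)) + (richTerm x y z + 𝟙 (goodTriple? x y z))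
        split x y z = 𝟙-≤ (triple? x y z) (λ { (e , ne) → go e ne (y ≟V z) ((proj₁ z - proj₁ y) ≟ 0#) (coRich? y z) })
          where
          v g : ℕ
          v = 𝟙 (vertical? x y z)
          g = 𝟙 (goodTriple? x y z)
          go : Equidistant x y z → norm² (x ⊝ y) ≢ 0# → (d : Dec (y ≡ z)) → Dec ((proj₁ z - proj₁ y) ≡ 0#) → Dec (CoRich y z) → 1 ≤ (𝟙 d + v) + (richTerm x y z + g)
          go e ne (yes _) _ _ = s≤s z≤n
          go e ne (no y≢z) (yes q) _ = ≤-trans (≤-reflexive (sym (𝟙-yes (vertical? x y z) (y≢z , q , e)))) (m≤m+n v _)
          go e ne (no y≢z) (no q) (yes r) = ≤-trans (1≤any r (λ {C} (oy , oz) → ≤-reflexive (sym (trans (𝟙-*-yes (on? C y) _ oy)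
            (𝟙-yes (richTriple? C x y z) (oz , isotropic-excluded 2≢0′ {x} {y} {z} y≢z e ne , e)))))) (≤-trans (m≤m+n (richTerm x y z) g) (m≤n+m _ v))
          go e ne (no y≢z) (no q) (no r) = ≤-trans (≤-reflexive (sym (𝟙-yes (goodTriple? x y z) ((q , isotropic-excluded 2≢0′ {x} {y} {z} y≢z e ne , r) , e))))
            (≤-trans (m≤n+m g (richTerm x y z)) (m≤n+m _ v))

        -- For y on `C`, an apex other than the centre determines z on `C`, which accounts for one z
        -- per apex; the centre, of which there is at most one, may see all of `Y`.
        curveTriples : ∀ {C} → C ∈ richCurves → ∑³ (λ x y z → 𝟙 (on? C y) * 𝟙 (richTriple? C x y z)) ≤ onCount C * (nX + n)
        curveTriples {C} C∈ = begin
          ∑ X (λ x → ∑ Y (λ y → ∑ Y (λ z → 𝟙 (on? C y) * 𝟙 (richTriple? C x y z))))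
            ≡⟨ ∑-swap X Y _ ⟩
          ∑ Y (λ y → ∑ X (λ x → ∑ Y (λ z → 𝟙 (on? C y) * 𝟙 (richTriple? C x y z))))
            ≡⟨ ∑-cong Y (λ y → trans (∑-cong X (λ x → ∑-*ˡ Y (𝟙 (on? C y)) _)) (∑-*ˡ X (𝟙 (on? C y)) _)) ⟩
          ∑ Y (λ y → 𝟙 (on? C y) * ∑ X (λ x → ∑ Y (λ z → 𝟙 (richTriple? C x y z))))
            ≤⟨ ∑-mono Y (λ {y} _ → fixed y (on? C y)) ⟩
          ∑ Y (λ y → 𝟙 (on? C y) * (nX + n))
            ≡⟨ ∑-*ʳ Y (nX + n) _ ⟩
          onCount C * (nX + n) ∎
          where
          open ≤-Reasoning
          disc≢0 : disc C ≢ 0#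
          disc≢0 = proj₁ (proj₂ (rich-curve C∈))
          perX : ∀ x y → On C y → (d : Dec (Centre C x)) → ∑ Y (λ z → 𝟙 (richTriple? C x y z)) ≤ 1 + 𝟙 d * n
          perX x y oy (yes _) = ≤-trans (∑-≤const Y 1 (λ {z} _ → 𝟙≤1 (richTriple? C x y z))) (≤-trans (≤-reflexive (*-comm n 1)) (n≤1+n _))
          perX x y oy (no ¬c) = ≤-trans (count≤1 (richTriple? C x y) uY (λ { {z} {z′} _ _ (oz , nz , e) (oz′ , nz′ , e′) →
            second-intersection {C} {x} {y} {z} {z′} ¬c oy oz oz′ nz nz′ e e′ })) (m≤m+n 1 _)
          fixed : ∀ y → (d : Dec (On C y)) → 𝟙 d * ∑ X (λ x → ∑ Y (λ z → 𝟙 (richTriple? C x y z))) ≤ 𝟙 d * (nX + n)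
          fixed y (no _) = z≤n
          fixed y (yes oy) = *-monoʳ-≤ 1 (begin
            ∑ X (λ x → ∑ Y (λ z → 𝟙 (richTriple? C x y z)))   ≤⟨ ∑-mono X (λ {x} _ → perX x y oy (centre? C x)) ⟩
            ∑ X (λ x → 1 + 𝟙 (centre? C x) * n)               ≡⟨ ∑-+ X _ _ ⟩
            ∑ X (λ _ → 1) + ∑ X (λ x → 𝟙 (centre? C x) * n)
              ≤⟨ +-mono-≤ (≤-reflexive (trans (∑-const X 1) (*-identityʳ nX)))
                   (∑-atMostOne (centre? C) uX (λ { {x} {x′} _ _ c c′ → centre-unique 2≢0′ {C} {x} {x′} disc≢0 c c′ }) (λ _ → n) n (λ _ _ → ≤-refl)) ⟩
            nX + n ∎)

        richTriples≤ : ∑³ richTerm ≤ 2 * n * (nX + n)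
        richTriples≤ = begin
          ∑³ richTerm
            ≡⟨ trans (∑-cong X (λ x → trans (∑-cong Y (λ y → ∑-swap Y richCurves _)) (∑-swap Y richCurves _))) (∑-swap X richCurves _) ⟩
          ∑ richCurves (λ C → ∑³ (λ x y z → 𝟙 (on? C y) * 𝟙 (richTriple? C x y z)))
            ≤⟨ ∑-mono richCurves curveTriples ⟩
          ∑ richCurves (λ C → onCount C * (nX + n))
            ≡⟨ ∑-*ʳ richCurves (nX + n) onCount ⟩
          S * (nX + n)
            ≤⟨ *-monoˡ-≤ (nX + n) S≤2n ⟩
          2 * n * (nX + n) ∎
          where open ≤-Reasoning

        isosceles≤ : Isosceles ≤ (nX * n + nX * n) + (2 * n * (nX + n) + GoodTriples)
        isosceles≤ = begin
          Isosceles ≤⟨ ∑³-mono split ⟩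
          ∑³ (λ x y z → (𝟙 (y ≟V z) + 𝟙 (vertical? x y z)) + (richTerm x y z + 𝟙 (goodTriple? x y z)))
            ≡⟨ trans (∑³-+ _ _) (cong₂ _+_ (∑³-+ _ _) (∑³-+ _ _)) ⟩
          (∑³ (λ x y z → 𝟙 (y ≟V z)) + ∑³ (λ x y z → 𝟙 (vertical? x y z))) + (∑³ richTerm + GoodTriples)
            ≤⟨ +-mono-≤ (+-mono-≤ (∑³-≤ {λ x y z → 𝟙 (y ≟V z)} (λ x y → count≤1 (y ≟V_) uY (λ _ _ e e′ → trans (sym e) e′)))
                 (∑³-≤ {λ x y z → 𝟙 (vertical? x y z)} (λ x y → count≤1 (vertical? x y) uY (λ { {z} {z′} _ _ (y≢z , v , e) (y≢z′ , v′ , e′) → vertical-unique {x} {y} {z} {z′} y≢z y≢z′ v v′ e e′ }))))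
                 (+-monoˡ-≤ GoodTriples richTriples≤) ⟩
          (nX * n + nX * n) + (2 * n * (nX + n) + GoodTriples) ∎
          where open ≤-Reasoning

        lineCount : V → ℕ
        lineCount ℓ = ∑ X (λ x → 𝟙 (onLine? ℓ x))

        ∑-lineCount : ∑ allV lineCount ≡ p * nX
        ∑-lineCount = trans (∑-swap allV X _) (trans (∑-cong X perPoint) (trans (∑-const X p) (*-comm nX p)))
          where
          perPoint : ∀ x → ∑ allV (λ ℓ → 𝟙 (onLine? ℓ x)) ≡ p
          perPoint x = trans (∑-× allF allF _) (trans (∑-cong allF (λ k → ≤-antisym
            (count≤1 (λ h → onLine? (k , h) x) unique-allF (λ _ _ e e′ → trans (sym e) e′)) (1≤count (λ h → onLine? (k , h) x) (∈-allF _) refl)))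
            (trans (∑-const allF 1) (trans (*-identityʳ _) length-allF)))

        -- Ordered pairs of points on a common line: a point lies on p lines of this family, two
        -- different points on at most one.
        ∑-lineCount² : ∑ allV (λ ℓ → lineCount ℓ * lineCount ℓ) ≤ nX * p + nX * nX
        ∑-lineCount² = begin
          ∑ allV (λ ℓ → lineCount ℓ * lineCount ℓ)
            ≡⟨ ∑-cong allV (λ ℓ → ∑-product X X _ _) ⟩
          ∑ allV (λ ℓ → ∑ X (λ x → ∑ X (λ x′ → 𝟙 (onLine? ℓ x) * 𝟙 (onLine? ℓ x′))))
            ≡⟨ trans (∑-swap allV X _) (∑-cong X (λ x → ∑-swap allV X _)) ⟩
          ∑ X (λ x → ∑ X (λ x′ → ∑ allV (λ ℓ → 𝟙 (onLine? ℓ x) * 𝟙 (onLine? ℓ x′))))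
            ≤⟨ ∑-mono X (λ {x} _ → ∑-mono X (λ {x′} _ → pair x x′ (x ≟V x′))) ⟩
          ∑ X (λ x → ∑ X (λ x′ → 𝟙 (x ≟V x′) * p + 1))
            ≡⟨ ∑-cong X (λ x → ∑-+ X _ _) ⟩
          ∑ X (λ x → ∑ X (λ x′ → 𝟙 (x ≟V x′) * p) + ∑ X (λ _ → 1))
            ≤⟨ ∑-mono X (λ {x} _ → +-mono-≤ (∑-atMostOne (x ≟V_) uX (λ _ _ e e′ → trans (sym e) e′) (λ _ → p) p (λ _ _ → ≤-refl)) (≤-reflexive (trans (∑-const X 1) (*-identityʳ nX)))) ⟩
          ∑ X (λ _ → p + nX)
            ≡⟨ trans (∑-const X (p + nX)) (*-distribˡ-+ nX p nX) ⟩
          nX * p + nX * nX ∎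
          where
          open ≤-Reasoning
          linesThrough : ∀ x → ∑ allV (λ ℓ → 𝟙 (onLine? ℓ x)) ≤ p
          linesThrough x = ≤-trans (≤-reflexive (∑-× allF allF _)) (≤-trans (∑-≤const allF 1 (λ {k} _ →
            count≤1 (λ h → onLine? (k , h) x) unique-allF (λ _ _ e e′ → trans (sym e) e′))) (≤-reflexive (trans (*-identityʳ _) length-allF)))
          pair : ∀ x x′ → (d : Dec (x ≡ x′)) → ∑ allV (λ ℓ → 𝟙 (onLine? ℓ x) * 𝟙 (onLine? ℓ x′)) ≤ 𝟙 d * p + 1
          pair x _ (yes refl) = ≤-trans (≤-reflexive (∑-cong allV (λ ℓ → 𝟙-idem (onLine? ℓ x)))) (≤-trans (linesThrough x) (≤-trans (≤-reflexive (sym (*-identityˡ p))) (m≤m+n _ 1)))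
          pair x x′ (no x≢) = ≤-trans (≤-reflexive (∑-cong allV (λ ℓ → sym (𝟙-× (onLine? ℓ x) (onLine? ℓ x′)))))
            (count≤1 (λ ℓ → onLine? ℓ x ×-dec onLine? ℓ x′) unique-allV (λ { {ℓ} {ℓ′} _ _ (o , o′) (q , q′) → line-unique {x} {x′} {ℓ} {ℓ′} x≢ o o′ q q′ }))

      Bisects : V → V → V → Set
      Bisects ℓ y z = Good y z × slope y z ≡ proj₁ ℓ × height y z ≡ proj₂ ℓ

      bisects? : ∀ ℓ y z → Dec (Bisects ℓ y z)
      bisects? ℓ y z = good? y z ×-dec (slope y z ≟ proj₁ ℓ) ×-dec (height y z ≟ proj₂ ℓ)

      bisectorCount : V → ℕ
      bisectorCount ℓ = ∑ Y (λ y → ∑ Y (λ z → 𝟙 (bisects? ℓ y z)))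

      BisectorEnergy : ℕ
      BisectorEnergy = ∑ allV (λ ℓ → bisectorCount ℓ * bisectorCount ℓ)

      same-line : ∀ {ℓ ℓ′ y z} → Bisects ℓ y z → Bisects ℓ′ y z → ℓ ≡ ℓ′
      same-line (_ , e₁ , e₂) (_ , e₁′ , e₂′) = cong₂ _,_ (trans (sym e₁) e₁′) (trans (sym e₂) e₂′)

      ∑-bisectorCount : ∑ allV bisectorCount ≤ n * n
      ∑-bisectorCount = ≤-trans (≤-reflexive (trans (∑-swap allV Y _) (∑-cong Y (λ y → ∑-swap allV Y _))))
        (∑-≤const Y n (λ {y} _ → ≤-trans (∑-≤const Y 1 (λ {z} _ → count≤1 (λ ℓ → bisects? ℓ y z) unique-allV (λ _ _ → same-line {y = y} {z}))) (≤-reflexive (*-identityʳ n))))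

      2*≤ : ∀ a c → 2 * (a * c) ≤ a * a + c * c
      2*≤ a c = *-cancelˡ-≤ 2 (+-cancelʳ-≤ (2 * (2 * (a * c))) _ _ (≤-trans (≤-reflexive (e₁ a c)) (≤-trans (+-mono-≤ (4uv≤ a c) (4uv≤ a c)) (≤-reflexive (e₂ a c)))))
        where
        e₁ : ∀ a c → 2 * (2 * (a * c)) + 2 * (2 * (a * c)) ≡ 4 * (a * c) + 4 * (a * c)
        e₁ = solve-∀
        e₂ : ∀ a c → (a + c) * (a + c) + (a + c) * (a + c) ≡ 2 * (a * a + c * c) + 2 * (2 * (a * c))
        e₂ = solve-∀

      module Incidences (X : List V) (uX : Unique X) where
        open Triples X uX

        goodTriples≤ : GoodTriples ≤ ∑ allV (λ ℓ → lineCount ℓ * bisectorCount ℓ)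
        goodTriples≤ = begin
          GoodTriples
            ≤⟨ ∑³-mono incidence ⟩
          ∑³ (λ x y z → ∑ allV (λ ℓ → 𝟙 (onLine? ℓ x) * 𝟙 (bisects? ℓ y z)))
            ≡⟨ ∑-cong X (λ x → trans (∑-cong Y (λ y → sym (∑-swap allV Y _))) (sym (∑-swap allV Y _))) ⟩
          ∑ X (λ x → ∑ allV (λ ℓ → ∑ Y (λ y → ∑ Y (λ z → 𝟙 (onLine? ℓ x) * 𝟙 (bisects? ℓ y z)))))
            ≡⟨ sym (∑-swap allV X _) ⟩
          ∑ allV (λ ℓ → ∑ X (λ x → ∑ Y (λ y → ∑ Y (λ z → 𝟙 (onLine? ℓ x) * 𝟙 (bisects? ℓ y z)))))
            ≡⟨ ∑-cong allV (λ ℓ → ∑-cong X (λ x → trans (∑-cong Y (λ y → ∑-*ˡ Y (𝟙 (onLine? ℓ x)) _)) (∑-*ˡ Y (𝟙 (onLine? ℓ x)) _))) ⟩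
          ∑ allV (λ ℓ → ∑ X (λ x → 𝟙 (onLine? ℓ x) * bisectorCount ℓ))
            ≡⟨ ∑-cong allV (λ ℓ → ∑-*ʳ X (bisectorCount ℓ) _) ⟩
          ∑ allV (λ ℓ → lineCount ℓ * bisectorCount ℓ) ∎
          where
          open ≤-Reasoning
          incidence : ∀ x y z → 𝟙 (goodTriple? x y z) ≤ ∑ allV (λ ℓ → 𝟙 (onLine? ℓ x) * 𝟙 (bisects? ℓ y z))
          incidence x y z = 𝟙-≤ (goodTriple? x y z) (λ { (g , e) →
            let ℓ = slope y z , height y z
                on = mirror-point 2≢0′ (bisector-reflected 2≢0′ y z (proj₁ g) (proj₁ (proj₂ g))) x (trans (norm²-⊝-sym z x) (trans (sym e) (norm²-⊝-sym x y)))
            in ≤-trans (≤-reflexive (sym (cong₂ _*_ (𝟙-yes (onLine? ℓ x) on) (𝟙-yes (bisects? ℓ y z) (g , refl , refl)))))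
                 (term≤∑ (λ ℓ → 𝟙 (onLine? ℓ x) * 𝟙 (bisects? ℓ y z)) (∈-allV ℓ)) })

        -- Sum (Λ (p lineCount - nX) - p bisectorCount)² ≥ 0 over all lines.
        variance : ∀ Λ → 2 * Λ * p * GoodTriples ≤ Λ * Λ * (p * p) * nX + 2 * Λ * nX * (n * n) + p * BisectorEnergy
        variance Λ = *-cancelʳ-≤ _ _ p {{>-nonZero (<-trans (s≤s z≤n) 2<p)}} (+-cancelʳ-≤ (2 * (Λ * Λ * (p * p) * (nX * nX))) _ _ (begin
          2 * Λ * p * GoodTriples * p + 2 * (Λ * Λ * (p * p) * (nX * nX))
            ≤⟨ +-monoˡ-≤ _ (*-monoˡ-≤ p (*-monoʳ-≤ (2 * Λ * p) goodTriples≤)) ⟩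
          2 * Λ * p * B * p + 2 * (Λ * Λ * (p * p) * (nX * nX))
            ≡⟨ e₁ Λ p nX B ⟩
          2 * (Λ * p * (Λ * nX)) * (p * nX) + 2 * (Λ * p * p) * B
            ≡⟨ cong (λ w → 2 * (Λ * p * (Λ * nX)) * w + 2 * (Λ * p * p) * B) (sym ∑-lineCount) ⟩
          2 * (Λ * p * (Λ * nX)) * ∑ allV lineCount + 2 * (Λ * p * p) * B
            ≡⟨ cong₂ _+_ (sym (∑-*ˡ allV (2 * (Λ * p * (Λ * nX))) lineCount)) (sym (∑-*ˡ allV (2 * (Λ * p * p)) (λ ℓ → lineCount ℓ * bisectorCount ℓ))) ⟩
          ∑ allV (λ ℓ → 2 * (Λ * p * (Λ * nX)) * lineCount ℓ) + ∑ allV (λ ℓ → 2 * (Λ * p * p) * (lineCount ℓ * bisectorCount ℓ))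
            ≡⟨ sym (∑-+ allV _ _) ⟩
          ∑ allV (λ ℓ → 2 * (Λ * p * (Λ * nX)) * lineCount ℓ + 2 * (Λ * p * p) * (lineCount ℓ * bisectorCount ℓ))
            -- The square enters as 2ac ≤ a² + c², with a = Λ p `lineCount` and c = Λ nX + p
            -- `bisectorCount`, which avoids subtraction. The sum of `lineCount` is known exactly,
            -- so its contribution cancels on both sides.
            ≤⟨ ∑-mono allV (λ {ℓ} _ → ≤-trans (≤-reflexive (e₂ Λ p nX (lineCount ℓ) (bisectorCount ℓ))) (≤-trans (2*≤ (Λ * p * lineCount ℓ) (Λ * nX + p * bisectorCount ℓ))
                 (≤-reflexive (e₃ Λ p nX (lineCount ℓ) (bisectorCount ℓ))))) ⟩
          ∑ allV (λ ℓ → Λ * p * (Λ * p) * (lineCount ℓ * lineCount ℓ) + (Λ * nX * (Λ * nX) + (2 * (Λ * nX * p) * bisectorCount ℓ + p * p * (bisectorCount ℓ * bisectorCount ℓ))))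
            ≡⟨ trans (∑-+ allV _ _) (cong₂ _+_ (∑-*ˡ allV (Λ * p * (Λ * p)) _) (trans (∑-+ allV _ _) (cong₂ _+_ (∑-const allV _)
                 (trans (∑-+ allV _ _) (cong₂ _+_ (∑-*ˡ allV (2 * (Λ * nX * p)) bisectorCount) (∑-*ˡ allV (p * p) _)))))) ⟩
          Λ * p * (Λ * p) * ∑ allV (λ ℓ → lineCount ℓ * lineCount ℓ) + (length allV * (Λ * nX * (Λ * nX)) + (2 * (Λ * nX * p) * ∑ allV bisectorCount + p * p * BisectorEnergy))
            ≤⟨ +-mono-≤ (*-monoʳ-≤ (Λ * p * (Λ * p)) ∑-lineCount²) (+-mono-≤ (≤-reflexive (cong (_* (Λ * nX * (Λ * nX))) length-allV))
                 (+-monoˡ-≤ (p * p * BisectorEnergy) (*-monoʳ-≤ (2 * (Λ * nX * p)) ∑-bisectorCount))) ⟩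
          Λ * p * (Λ * p) * (nX * p + nX * nX) + (p * p * (Λ * nX * (Λ * nX)) + (2 * (Λ * nX * p) * (n * n) + p * p * BisectorEnergy))
            ≡⟨ e₄ Λ p nX n BisectorEnergy ⟩
          (Λ * Λ * (p * p) * nX + 2 * Λ * nX * (n * n) + p * BisectorEnergy) * p + 2 * (Λ * Λ * (p * p) * (nX * nX)) ∎))
          where
          open ≤-Reasoning
          B = ∑ allV (λ ℓ → lineCount ℓ * bisectorCount ℓ)
          length-allV : length allV ≡ p * p
          length-allV = trans (length-cartesianProduct allF allF) (cong₂ _*_ length-allF length-allF)
          e₁ : ∀ Λ p x B → 2 * Λ * p * B * p + 2 * (Λ * Λ * (p * p) * (x * x)) ≡ 2 * (Λ * p * (Λ * x)) * (p * x) + 2 * (Λ * p * p) * B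
          e₁ = solve-∀
          e₂ : ∀ Λ p x l b → 2 * (Λ * p * (Λ * x)) * l + 2 * (Λ * p * p) * (l * b) ≡ 2 * (Λ * p * l * (Λ * x + p * b))
          e₂ = solve-∀
          e₃ : ∀ Λ p x l b → Λ * p * l * (Λ * p * l) + (Λ * x + p * b) * (Λ * x + p * b) ≡ Λ * p * (Λ * p) * (l * l) + (Λ * x * (Λ * x) + (2 * (Λ * x * p) * b + p * p * (b * b)))
          e₃ = solve-∀
          e₄ : ∀ Λ p x n Q → Λ * p * (Λ * p) * (x * p + x * x) + (p * p * (Λ * x * (Λ * x)) + (2 * (Λ * x * p) * (n * n) + p * p * Q))
            ≡ (Λ * Λ * (p * p) * x + 2 * Λ * x * (n * n) + p * Q) * p + 2 * (Λ * Λ * (p * p) * (x * x))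
          e₄ = solve-∀

      chord : Frame → V
      chord i = proj₂ i ⊝ proj₁ i

      frames : List Frame
      frames = cartesianProduct Y Y

      edge-norm : ∀ {i j} → Edge i j → norm² (chord j) ≡ norm² (chord i)
      edge-norm r = norm-reflected (reflected₁ r) (reflected₂ r)

      energy≤edges : BisectorEnergy ≤ ∑ frames (λ i → ∑ frames (λ j → 𝟙 (edge? i j)))
      energy≤edges = begin
        ∑ allV (λ ℓ → bisectorCount ℓ * bisectorCount ℓ)
          ≡⟨ ∑-cong allV (λ ℓ → trans (∑-product Y Y _ _) (∑-cong Y (λ a → ∑-cong Y (λ c → ∑-product Y Y _ _)))) ⟩
        ∑ allV (λ ℓ → ∑ Y (λ a → ∑ Y (λ c → ∑ Y (λ b → ∑ Y (λ d → 𝟙 (bisects? ℓ a b) * 𝟙 (bisects? ℓ c d))))))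
          ≡⟨ trans (∑-swap allV Y _) (∑-cong Y (λ a → trans (∑-swap allV Y _) (∑-cong Y (λ c → trans (∑-swap allV Y _) (∑-cong Y (λ b → ∑-swap allV Y _)))))) ⟩
        ∑ Y (λ a → ∑ Y (λ c → ∑ Y (λ b → ∑ Y (λ d → ∑ allV (λ ℓ → 𝟙 (bisects? ℓ a b) * 𝟙 (bisects? ℓ c d))))))
          ≤⟨ ∑-mono Y (λ {a} _ → ∑-mono Y (λ {c} _ → ∑-mono Y (λ {b} _ → ∑-mono Y (λ {d} _ → common a b c d)))) ⟩
        ∑ Y (λ a → ∑ Y (λ c → ∑ Y (λ b → ∑ Y (λ d → 𝟙 (edge? (a , c) (b , d))))))
          ≡⟨ trans (∑-× Y Y _) (∑-cong Y (λ a → ∑-cong Y (λ c → ∑-× Y Y _))) ⟨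
        ∑ frames (λ i → ∑ frames (λ j → 𝟙 (edge? i j))) ∎
        where
        open ≤-Reasoning
        common : ∀ a b c d → ∑ allV (λ ℓ → 𝟙 (bisects? ℓ a b) * 𝟙 (bisects? ℓ c d)) ≤ 𝟙 (edge? (a , c) (b , d))
        common a b c d = begin
          ∑ allV (λ ℓ → 𝟙 (bisects? ℓ a b) * 𝟙 (bisects? ℓ c d))
            ≤⟨ ∑-mono allV (λ {ℓ} _ → both (bisects? ℓ a b) (bisects? ℓ c d)) ⟩
          ∑ allV (λ ℓ → 𝟙 (bisects? ℓ a b) * 𝟙 (edge? (a , c) (b , d)))
            ≤⟨ ∑-atMostOne (λ ℓ → bisects? ℓ a b) unique-allV (λ _ _ → same-line {y = a} {b}) (λ _ → 𝟙 (edge? (a , c) (b , d))) _ (λ _ _ → ≤-refl) ⟩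
          𝟙 (edge? (a , c) (b , d)) ∎
          where
          both : ∀ {ℓ} (u : Dec (Bisects ℓ a b)) (w : Dec (Bisects ℓ c d)) → 𝟙 u * 𝟙 w ≤ 𝟙 u * 𝟙 (edge? (a , c) (b , d))
          both (no _) _ = z≤n
          both (yes _) (no _) = z≤n
          both (yes (g , e₁ , e₂)) (yes (g′ , e₁′ , e₂′)) = ≤-reflexive (cong (1 *_) (sym (𝟙-yes (edge? (a , c) (b , d)) (edge g g′ (trans e₁ (sym e₁′)) (trans e₂ (sym e₂′))))))

      -- The mirror is not isotropic. It either fixes an isotropic chord, which is then orthogonal
      -- to the normal and hence zero, or moves it to a chord that is also isotropic but in the
      -- other direction; one of the two directions is the distinguished one.
      null-edge : ∀ {i j} → Edge i j → norm² (chord i) ≡ 0# → Iso (chord i) ⊎ Iso (chord j)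
      null-edge {i} {j} r nz = null-mirror-iso (mirror-linear (reflected₁ r) (reflected₂ r))
        where
        null-mirror-iso : (Σ F λ ω → (chord j ≡ (proj₁ (chord i) 𝔽ₚ.+ ω , proj₂ (chord i) 𝔽ₚ.+ slope (proj₁ i) (proj₁ j) 𝔽ₚ.* ω)) ×
            (1# 𝔽ₚ.+ slope (proj₁ i) (proj₁ j) 𝔽ₚ.* slope (proj₁ i) (proj₁ j)) 𝔽ₚ.* ω 𝔽ₚ.+ 2# 𝔽ₚ.* (proj₁ (chord i) 𝔽ₚ.+ slope (proj₁ i) (proj₁ j) 𝔽ₚ.* proj₂ (chord i)) ≡ 0#) → Iso (chord i) ⊎ Iso (chord j)
        null-mirror-iso (ω , v≡ , rel) = go (ω ≟ 0#)
          where
          go : Dec (ω ≡ 0#) → Iso (chord i) ⊎ Iso (chord j)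
          go (yes ω≡0) = inj₁ (subst Iso (sym (null-orthogonal 2≢0′ (Reflected.nonisotropic (reflected₁ r)) nz (no-shift ω≡0 rel))) iso-zero)
          go (no ω≢0) = iso-either nz (trans (edge-norm r) nz) (moved-apart (Reflected.nonisotropic (reflected₁ r)) ω≢0 v≡)

      nullEdges : ℕ
      nullEdges = ∑ frames (λ i → ∑ frames (λ j → 𝟙 (norm² (chord i) ≟ 0#) * 𝟙 (edge? i j)))

      thinCount : ∀ a → ∑ Y (λ c → 𝟙 (Iso? (c ⊝ a))) ≤ κ
      thinCount a = <⇒≤ (thin a)

      -- There are at most nκ frames whose chord lies in the distinguished direction, and a frame
      -- adjacent to a given one is determined by its first point, for which there are n choices.
      -- The factor 2 covers both ends of the edge.
      nullEdges≤ : nullEdges ≤ 2 * (n * n * κ)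
      nullEdges≤ = begin
        nullEdges
          ≤⟨ ∑-mono frames (λ {i} _ → ∑-mono frames (λ {j} _ → either {i} {j} (norm² (chord i) ≟ 0#) (edge? i j))) ⟩
        ∑ frames (λ i → ∑ frames (λ j → 𝟙 (Iso? (chord i)) * 𝟙 (edge? i j) + 𝟙 (Iso? (chord j)) * 𝟙 (edge? i j)))
          ≡⟨ trans (∑-cong frames (λ i → ∑-+ frames _ _)) (∑-+ frames _ _) ⟩
        ∑ frames (λ i → ∑ frames (λ j → 𝟙 (Iso? (chord i)) * 𝟙 (edge? i j))) + ∑ frames (λ i → ∑ frames (λ j → 𝟙 (Iso? (chord j)) * 𝟙 (edge? i j)))
          ≤⟨ +-mono-≤ first second ⟩
        n * n * κ + n * n * κ
          ≡⟨ double (n * n * κ) ⟩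
        2 * (n * n * κ) ∎
        where
        open ≤-Reasoning
        double : ∀ x → x + x ≡ 2 * x
        double = solve-∀
        either : ∀ {i j} (u : Dec (norm² (chord i) ≡ 0#)) (w : Dec (Edge i j)) → 𝟙 u * 𝟙 w ≤ 𝟙 (Iso? (chord i)) * 𝟙 w + 𝟙 (Iso? (chord j)) * 𝟙 w
        either (no _) _ = z≤n
        either (yes _) (no _) = z≤n
        either {i} {j} (yes nz) (yes r) = case (null-edge r nz)
          where
          case : Iso (chord i) ⊎ Iso (chord j) → 1 ≤ 𝟙 (Iso? (chord i)) * 1 + 𝟙 (Iso? (chord j)) * 1
          case (inj₁ q) = ≤-trans (≤-reflexive (sym (cong (_* 1) (𝟙-yes (Iso? (chord i)) q)))) (m≤m+n _ _)
          case (inj₂ q) = ≤-trans (≤-reflexive (sym (cong (_* 1) (𝟙-yes (Iso? (chord j)) q)))) (m≤n+m _ (𝟙 (Iso? (chord i)) * 1))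
        perPair : ∀ a → ∑ Y (λ c → 𝟙 (Iso? (c ⊝ a)) * n) ≤ κ * n
        perPair a = ≤-trans (≤-reflexive (∑-*ʳ Y n _)) (*-monoˡ-≤ n (thinCount a))
        total : n * (κ * n) ≡ n * n * κ
        total = e n κ
          where
          e : ∀ n κ → n * (κ * n) ≡ n * n * κ
          e = solve-∀
        first : ∑ frames (λ i → ∑ frames (λ j → 𝟙 (Iso? (chord i)) * 𝟙 (edge? i j))) ≤ n * n * κ
        first = begin
          ∑ frames (λ i → ∑ frames (λ j → 𝟙 (Iso? (chord i)) * 𝟙 (edge? i j)))
            ≡⟨ ∑-cong frames (λ i → ∑-*ˡ frames (𝟙 (Iso? (chord i))) _) ⟩
          ∑ frames (λ i → 𝟙 (Iso? (chord i)) * ∑ frames (λ j → 𝟙 (edge? i j)))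
            ≤⟨ ∑-mono frames (λ {i} _ → *-monoʳ-≤ (𝟙 (Iso? (chord i))) (≤-trans (≤-reflexive (∑-× Y Y _)) (≤-trans (∑-≤const Y 1 (λ {b} _ →
                 count≤1 (λ d → edge? i (b , d)) uY (λ _ _ r r′ → cong proj₂ (key₁-injective r r′ refl)))) (≤-reflexive (*-identityʳ n))))) ⟩
          ∑ frames (λ i → 𝟙 (Iso? (chord i)) * n)
            ≡⟨ ∑-× Y Y _ ⟩
          ∑ Y (λ a → ∑ Y (λ c → 𝟙 (Iso? (c ⊝ a)) * n))
            ≤⟨ ∑-≤const Y (κ * n) (λ {a} _ → perPair a) ⟩
          n * (κ * n) ≡⟨ total ⟩
          n * n * κ ∎
        second : ∑ frames (λ i → ∑ frames (λ j → 𝟙 (Iso? (chord j)) * 𝟙 (edge? i j))) ≤ n * n * κ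
        second = begin
          ∑ frames (λ i → ∑ frames (λ j → 𝟙 (Iso? (chord j)) * 𝟙 (edge? i j)))
            ≡⟨ trans (∑-swap frames frames _) (∑-cong frames (λ j → ∑-*ˡ frames (𝟙 (Iso? (chord j))) _)) ⟩
          ∑ frames (λ j → 𝟙 (Iso? (chord j)) * ∑ frames (λ i → 𝟙 (edge? i j)))
            ≤⟨ ∑-mono frames (λ {j} _ → *-monoʳ-≤ (𝟙 (Iso? (chord j))) (≤-trans (≤-reflexive (∑-× Y Y _)) (≤-trans (∑-≤const Y 1 (λ {a} _ →
                 count≤1 (λ c → edge? (a , c) j) uY (λ _ _ r r′ → reflected-unique (reflected-sym (reflected₂ r)) (reflected-sym (reflected₂ r′))))) (≤-reflexive (*-identityʳ n))))) ⟩
          ∑ frames (λ j → 𝟙 (Iso? (chord j)) * n)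
            ≡⟨ ∑-× Y Y _ ⟩
          ∑ Y (λ b → ∑ Y (λ d → 𝟙 (Iso? (d ⊝ b)) * n))
            ≤⟨ ∑-≤const Y (κ * n) (λ {b} _ → perPair b) ⟩
          n * (κ * n) ≡⟨ total ⟩
          n * n * κ ∎

      ofLength : F → List Frame
      ofLength r = filter (λ i → norm² (chord i) ≟ r) frames

      unique-ofLength : ∀ r → Unique (ofLength r)
      unique-ofLength r = filter⁺ (λ i → norm² (chord i) ≟ r) (cartesianProduct⁺ uY uY)

      ofLength-norm : ∀ {r i} → i ∈ ofLength r → norm² (chord i) ≡ r
      ofLength-norm {r} i∈ = proj₂ (∈-filter⁻ (λ i → norm² (chord i) ≟ r) {xs = frames} i∈)

      ofLength-Y : ∀ {r i} → i ∈ ofLength r → proj₁ i ∈ Y × proj₂ i ∈ Y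
      ofLength-Y {r} i∈ = ∈-cartesianProduct⁻ Y Y (proj₁ (∈-filter⁻ (λ i → norm² (chord i) ≟ r) {xs = frames} i∈))

      edgesOfLength : F → ℕ
      edgesOfLength r = ∑ (ofLength r) (λ i → ∑ (ofLength r) (λ j → 𝟙 (edge? i j)))

      edges-split : ∑ frames (λ i → ∑ frames (λ j → 𝟙 (edge? i j))) ≤ nullEdges + ∑ allF (λ r → 𝟙 (¬? (r ≟ 0#)) * edgesOfLength r)
      edges-split = begin
        ∑ frames (λ i → ∑ frames (λ j → 𝟙 (edge? i j)))
          ≤⟨ ∑-mono frames (λ {i} _ → ∑-mono frames (λ {j} _ → pointwise i j)) ⟩
        ∑ frames (λ i → ∑ frames (λ j → 𝟙 (norm² (chord i) ≟ 0#) * 𝟙 (edge? i j) + ∑ allF (λ r → 𝟙 (¬? (r ≟ 0#)) * (𝟙 (norm² (chord i) ≟ r) * (𝟙 (norm² (chord j) ≟ r) * 𝟙 (edge? i j))))))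
          ≡⟨ trans (∑-cong frames (λ i → ∑-+ frames _ _)) (∑-+ frames _ _) ⟩
        nullEdges + ∑ frames (λ i → ∑ frames (λ j → ∑ allF (λ r → 𝟙 (¬? (r ≟ 0#)) * (𝟙 (norm² (chord i) ≟ r) * (𝟙 (norm² (chord j) ≟ r) * 𝟙 (edge? i j))))))
          ≡⟨ cong (nullEdges +_) (trans (∑-cong frames (λ i → ∑-swap frames allF _)) (∑-swap frames allF _)) ⟩
        nullEdges + ∑ allF (λ r → ∑ frames (λ i → ∑ frames (λ j → 𝟙 (¬? (r ≟ 0#)) * (𝟙 (norm² (chord i) ≟ r) * (𝟙 (norm² (chord j) ≟ r) * 𝟙 (edge? i j))))))
          ≡⟨ cong (nullEdges +_) (∑-cong allF collect) ⟩
        nullEdges + ∑ allF (λ r → 𝟙 (¬? (r ≟ 0#)) * edgesOfLength r) ∎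
        where
        open ≤-Reasoning
        pointwise : ∀ i j → 𝟙 (edge? i j) ≤ 𝟙 (norm² (chord i) ≟ 0#) * 𝟙 (edge? i j) + ∑ allF (λ r → 𝟙 (¬? (r ≟ 0#)) * (𝟙 (norm² (chord i) ≟ r) * (𝟙 (norm² (chord j) ≟ r) * 𝟙 (edge? i j))))
        pointwise i j = go (edge? i j) (norm² (chord i) ≟ 0#)
          where
          go : (w : Dec (Edge i j)) (u : Dec (norm² (chord i) ≡ 0#)) → 𝟙 w ≤ 𝟙 u * 𝟙 w + ∑ allF (λ r → 𝟙 (¬? (r ≟ 0#)) * (𝟙 (norm² (chord i) ≟ r) * (𝟙 (norm² (chord j) ≟ r) * 𝟙 w)))
          go (no _) _ = z≤n
          go (yes r) (yes _) = s≤s z≤n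
          go (yes r) (no q) = ≤-trans (≤-reflexive (sym (cong₂ _*_ (𝟙-yes (¬? (norm² (chord i) ≟ 0#)) q)
              (cong₂ _*_ (𝟙-yes (norm² (chord i) ≟ norm² (chord i)) refl) (cong (_* 1) (𝟙-yes (norm² (chord j) ≟ norm² (chord i)) (edge-norm r)))))))
            (term≤∑ (λ s → 𝟙 (¬? (s ≟ 0#)) * (𝟙 (norm² (chord i) ≟ s) * (𝟙 (norm² (chord j) ≟ s) * 1))) (∈-allF (norm² (chord i))))
        collect : ∀ r → ∑ frames (λ i → ∑ frames (λ j → 𝟙 (¬? (r ≟ 0#)) * (𝟙 (norm² (chord i) ≟ r) * (𝟙 (norm² (chord j) ≟ r) * 𝟙 (edge? i j))))) ≡ 𝟙 (¬? (r ≟ 0#)) * edgesOfLength r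
        collect r = trans (∑-cong frames (λ i → ∑-*ˡ frames (𝟙 (¬? (r ≟ 0#))) _)) (trans (∑-*ˡ frames (𝟙 (¬? (r ≟ 0#))) _) (cong (𝟙 (¬? (r ≟ 0#)) *_)
          (trans (∑-cong frames (λ i → trans (∑-*ˡ frames (𝟙 (norm² (chord i) ≟ r)) _) (cong (𝟙 (norm² (chord i) ≟ r) *_) (sym (∑-filter (λ j → norm² (chord j) ≟ r) frames _)))))
            (sym (∑-filter (λ i → norm² (chord i) ≟ r) frames _)))))

      module YY = Triples Y uY

      -- The frames of length r, sorted by their first point a, are counted by Cauchy-Schwarz over
      -- a. Summed over r ≠ 0, pairs of frames with common first point are isosceles triples with
      -- apex a; here the energy bound falls back on T.
      squares≤ : ∑ allF (λ r → 𝟙 (¬? (r ≟ 0#)) * (length (ofLength r) * length (ofLength r))) ≤ n * YY.Isosceles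
      squares≤ = begin
        ∑ allF (λ r → 𝟙 (¬? (r ≟ 0#)) * (length (ofLength r) * length (ofLength r)))
          ≤⟨ ∑-mono allF (λ {r} _ → *-monoʳ-≤ (𝟙 (¬? (r ≟ 0#))) (square r)) ⟩
        ∑ allF (λ r → 𝟙 (¬? (r ≟ 0#)) * (n * ∑ Y (λ a → ∑ Y (λ c → ∑ Y (λ c′ → 𝟙 (norm² (c ⊝ a) ≟ r) * 𝟙 (norm² (c′ ⊝ a) ≟ r))))))
          ≡⟨ ∑-cong allF (λ r → trans (rotate (𝟙 (¬? (r ≟ 0#))) n _) (cong (n *_) (trans (sym (∑-*ˡ Y (𝟙 (¬? (r ≟ 0#))) _)) (∑-cong Y (λ a → trans (sym (∑-*ˡ Y (𝟙 (¬? (r ≟ 0#))) _)) (∑-cong Y (λ c → sym (∑-*ˡ Y (𝟙 (¬? (r ≟ 0#))) _)))))))) ⟩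
        ∑ allF (λ r → n * ∑ Y (λ a → ∑ Y (λ c → ∑ Y (λ c′ → 𝟙 (¬? (r ≟ 0#)) * (𝟙 (norm² (c ⊝ a) ≟ r) * 𝟙 (norm² (c′ ⊝ a) ≟ r))))))
          ≡⟨ ∑-*ˡ allF n _ ⟩
        n * ∑ allF (λ r → ∑ Y (λ a → ∑ Y (λ c → ∑ Y (λ c′ → 𝟙 (¬? (r ≟ 0#)) * (𝟙 (norm² (c ⊝ a) ≟ r) * 𝟙 (norm² (c′ ⊝ a) ≟ r))))))
          ≡⟨ cong (n *_) (trans (∑-swap allF Y _) (∑-cong Y (λ a → trans (∑-swap allF Y _) (∑-cong Y (λ c → ∑-swap allF Y _))))) ⟩
        n * ∑ Y (λ a → ∑ Y (λ c → ∑ Y (λ c′ → ∑ allF (λ r → 𝟙 (¬? (r ≟ 0#)) * (𝟙 (norm² (c ⊝ a) ≟ r) * 𝟙 (norm² (c′ ⊝ a) ≟ r))))))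
          ≤⟨ *-monoʳ-≤ n (∑-mono Y (λ {a} _ → ∑-mono Y (λ {c} _ → ∑-mono Y (λ {c′} _ → triple a c c′)))) ⟩
        n * YY.Isosceles ∎
        where
        open ≤-Reasoning
        rotate : ∀ a b c → a * (b * c) ≡ b * (a * c)
        rotate = solve-∀
        square : ∀ r → length (ofLength r) * length (ofLength r) ≤ n * ∑ Y (λ a → ∑ Y (λ c → ∑ Y (λ c′ → 𝟙 (norm² (c ⊝ a) ≟ r) * 𝟙 (norm² (c′ ⊝ a) ≟ r))))
        square r = ≤-trans (≤-reflexive (cong₂ _*_ count count)) (≤-trans (∑² Y (λ a → ∑ Y (λ c → 𝟙 (norm² (c ⊝ a) ≟ r)))) (≤-reflexive (cong (n *_) (∑-cong Y (λ a → ∑-product Y Y _ _)))))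
          where
          count : length (ofLength r) ≡ ∑ Y (λ a → ∑ Y (λ c → 𝟙 (norm² (c ⊝ a) ≟ r)))
          count = trans (length-filter-∑ (λ i → norm² (chord i) ≟ r) frames) (∑-× Y Y _)
        triple : ∀ a c c′ → ∑ allF (λ r → 𝟙 (¬? (r ≟ 0#)) * (𝟙 (norm² (c ⊝ a) ≟ r) * 𝟙 (norm² (c′ ⊝ a) ≟ r))) ≤ 𝟙 (YY.triple? a c c′)
        triple a c c′ = begin
          ∑ allF (λ r → 𝟙 (¬? (r ≟ 0#)) * (𝟙 (norm² (c ⊝ a) ≟ r) * 𝟙 (norm² (c′ ⊝ a) ≟ r)))
            ≤⟨ ∑-mono allF (λ {r} _ → go (r ≟ 0#) (norm² (c ⊝ a) ≟ r) (norm² (c′ ⊝ a) ≟ r)) ⟩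
          ∑ allF (λ r → 𝟙 (norm² (c ⊝ a) ≟ r) * 𝟙 (YY.triple? a c c′))
            ≤⟨ ∑-atMostOne (norm² (c ⊝ a) ≟_) unique-allF (λ _ _ e e′ → trans (sym e) e′) (λ _ → 𝟙 (YY.triple? a c c′)) _ (λ _ _ → ≤-refl) ⟩
          𝟙 (YY.triple? a c c′) ∎
          where
          go : ∀ {r} (d : Dec (r ≡ 0#)) (u : Dec (norm² (c ⊝ a) ≡ r)) (w : Dec (norm² (c′ ⊝ a) ≡ r)) → 𝟙 (¬? d) * (𝟙 u * 𝟙 w) ≤ 𝟙 u * 𝟙 (YY.triple? a c c′)
          go (yes _) _ _ = z≤n
          go (no _) (no _) _ = z≤n
          go (no _) (yes _) (no _) = z≤n
          go (no r≢0) (yes e) (yes e′) = ≤-reflexive (cong (1 *_) (sym (𝟙-yes (YY.triple? a c c′)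
            (trans (norm²-⊝-sym a c) (trans e (trans (sym e′) (norm²-⊝-sym c′ a))) , λ q → r≢0 (trans (sym e) (trans (norm²-⊝-sym c a) q))))))

      module Energy (N W : ℕ) (1≤N : 1 ≤ N)
        (block : ∀ r → r ≢ 0# → ∀ as bs → Unique as → Unique bs → (∀ {i} → i ∈ as → i ∈ ofLength r) → (∀ {j} → j ∈ bs → j ∈ ofLength r) →
          length as ≤ N → length bs ≤ N → ∑ as (λ i → ∑ bs (λ j → 𝟙 (edge? i j))) ≤ W) where

        -- Cutting both copies of the frames into blocks gives ((L + N)/N)² block pairs with at most
        -- `W` edges each, and (L + N)² ≤ 2L² + 2N².
        edgesOfLength≤ : ∀ r → r ≢ 0# → edgesOfLength r * N * N ≤ 2 * W * (length (ofLength r) * length (ofLength r)) + 2 * W * (N * N)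
        edgesOfLength≤ r r≢0 = begin
          edgesOfLength r * N * N
            ≡⟨ cong (_* N) (sym (∑-*ʳ Sr N _)) ⟩
          ∑ Sr (λ i → ∑ Sr (λ j → 𝟙 (edge? i j)) * N) * N
            ≤⟨ ∑-blocks N 1≤N (λ i → ∑ Sr (λ j → 𝟙 (edge? i j)) * N) ((L + N) * W) outer (unique-ofLength r) ⟩
          (L + N) * ((L + N) * W)
            ≡⟨ e₁ L N W ⟩
          (L + N) * (L + N) * W
            ≤⟨ *-monoˡ-≤ W (≤-trans (≤-reflexive (e₂ L N)) (+-monoʳ-≤ (L * L + N * N) (2*≤ L N))) ⟩
          (L * L + N * N + (L * L + N * N)) * W
            ≡⟨ e₃ L N W ⟩
          2 * W * (L * L) + 2 * W * (N * N) ∎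
          where
          open ≤-Reasoning
          Sr = ofLength r
          L = length Sr
          e₁ : ∀ L N W → (L + N) * ((L + N) * W) ≡ (L + N) * (L + N) * W
          e₁ = solve-∀
          e₂ : ∀ L N → (L + N) * (L + N) ≡ (L * L + N * N) + 2 * (L * N)
          e₂ = solve-∀
          e₃ : ∀ L N W → (L * L + N * N + (L * L + N * N)) * W ≡ 2 * W * (L * L) + 2 * W * (N * N)
          e₃ = solve-∀
          outer : ∀ as → Unique as → (∀ {i} → i ∈ as → i ∈ Sr) → length as ≤ N → ∑ as (λ i → ∑ Sr (λ j → 𝟙 (edge? i j)) * N) ≤ (L + N) * W
          outer as uas as⊆ as≤ = begin
            ∑ as (λ i → ∑ Sr (λ j → 𝟙 (edge? i j)) * N)
              ≡⟨ trans (∑-*ʳ as N _) (cong (_* N) (∑-swap as Sr _)) ⟩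
            ∑ Sr (λ j → ∑ as (λ i → 𝟙 (edge? i j))) * N
              ≤⟨ ∑-blocks N 1≤N (λ j → ∑ as (λ i → 𝟙 (edge? i j))) W (λ bs ubs bs⊆ bs≤ →
                   ≤-trans (≤-reflexive (∑-swap bs as _)) (block r r≢0 as bs uas ubs as⊆ bs⊆ as≤ bs≤)) (unique-ofLength r) ⟩
            (L + N) * W ∎

        energy : BisectorEnergy * N * N ≤ 2 * (n * n * κ) * (N * N) + 2 * W * (n * YY.Isosceles + p * (N * N))
        energy = begin
          BisectorEnergy * N * N
            ≤⟨ *-monoˡ-≤ N (*-monoˡ-≤ N (≤-trans energy≤edges (≤-trans edges-split (+-monoˡ-≤ _ nullEdges≤)))) ⟩
          (2 * (n * n * κ) + ∑ allF (λ r → 𝟙 (¬? (r ≟ 0#)) * edgesOfLength r)) * N * N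
            ≡⟨ e₁ (2 * (n * n * κ)) (∑ allF (λ r → 𝟙 (¬? (r ≟ 0#)) * edgesOfLength r)) N ⟩
          2 * (n * n * κ) * (N * N) + ∑ allF (λ r → 𝟙 (¬? (r ≟ 0#)) * edgesOfLength r) * (N * N)
            ≡⟨ cong (2 * (n * n * κ) * (N * N) +_) (sym (∑-*ʳ allF (N * N) _)) ⟩
          2 * (n * n * κ) * (N * N) + ∑ allF (λ r → 𝟙 (¬? (r ≟ 0#)) * edgesOfLength r * (N * N))
            ≤⟨ +-monoʳ-≤ (2 * (n * n * κ) * (N * N)) (∑-mono allF (λ {r} _ → term r (r ≟ 0#))) ⟩
          2 * (n * n * κ) * (N * N) + ∑ allF (λ r → 2 * W * (𝟙 (¬? (r ≟ 0#)) * (length (ofLength r) * length (ofLength r))) + 2 * W * (N * N))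
            ≡⟨ cong (2 * (n * n * κ) * (N * N) +_) (trans (∑-+ allF _ _) (cong₂ _+_ (∑-*ˡ allF (2 * W) _) (trans (∑-const allF _) (cong (_* (2 * W * (N * N))) length-allF)))) ⟩
          2 * (n * n * κ) * (N * N) + (2 * W * ∑ allF (λ r → 𝟙 (¬? (r ≟ 0#)) * (length (ofLength r) * length (ofLength r))) + p * (2 * W * (N * N)))
            ≤⟨ +-monoʳ-≤ (2 * (n * n * κ) * (N * N)) (+-monoˡ-≤ _ (*-monoʳ-≤ (2 * W) squares≤)) ⟩
          2 * (n * n * κ) * (N * N) + (2 * W * (n * YY.Isosceles) + p * (2 * W * (N * N)))
            ≡⟨ cong (2 * (n * n * κ) * (N * N) +_) (e₂ W (n * YY.Isosceles) p (N * N)) ⟩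
          2 * (n * n * κ) * (N * N) + 2 * W * (n * YY.Isosceles + p * (N * N)) ∎
          where
          open ≤-Reasoning
          e₁ : ∀ a b N → (a + b) * N * N ≡ a * (N * N) + b * (N * N)
          e₁ = solve-∀
          e₂ : ∀ W a p m → 2 * W * a + p * (2 * W * m) ≡ 2 * W * (a + p * m)
          e₂ = solve-∀
          term : ∀ r (d : Dec (r ≡ 0#)) → 𝟙 (¬? d) * edgesOfLength r * (N * N) ≤ 2 * W * (𝟙 (¬? d) * (length (ofLength r) * length (ofLength r))) + 2 * W * (N * N)
          term r (yes _) = z≤n
          term r (no r≢0) = ≤-trans (≤-reflexive (e₃ (edgesOfLength r) N)) (≤-trans (edgesOfLength≤ r r≢0) (≤-reflexive (cong (λ w → 2 * W * w + 2 * W * (N * N)) (sym (*-identityˡ _)))))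
            where
            e₃ : ∀ a N → 1 * a * (N * N) ≡ a * N * N
            e₃ = solve-∀

  -- Halving a set to remove isotropic concentration, and distances from isosceles counts.

  module ThinSubsets where

    open FiniteSums
    open 𝔽ₚ
    open Polynomials
    open Reflections
    open Conics
    open import Data.Nat as ℕ using (ℕ; zero; suc; z≤n; s≤s; _≤_; _<_)
    import Data.Nat.Properties as ℕₚ
    open import Data.Nat.Tactic.RingSolver using (solve-∀)
    import Data.Fin.Properties as Finₚ
    open import Data.Integer as ℤ using (ℤ)
    open import Data.List using (List; []; _∷_; length; filter; take; cartesianProduct)
    open import Data.List.Properties using (length-take)
    open import Data.List.Membership.Propositional using (_∈_)
    open import Data.List.Membership.Propositional.Properties using (∈-filter⁺; ∈-filter⁻)
    open import Data.List.Relation.Unary.Any as Any using (Any; any?; here; there)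
    open import Data.List.Relation.Unary.Unique.Propositional using (Unique)
    open import Data.List.Relation.Unary.Unique.Propositional.Properties using (filter⁺; take⁺)
    open import Data.Product using (Σ; _×_; _,_; proj₁; proj₂)
    open import Data.Empty using (⊥-elim)
    open import Function using (_∘_)
    open import Relation.Nullary using (Dec; yes; no; ¬?; _×-dec_)
    open import Relation.Binary.PropositionalEquality

    open Solver

    ∈-take : ∀ {A : Set} n (xs : List A) {y} → y ∈ take n xs → y ∈ xs
    ∈-take (suc n) (x ∷ xs) (here e) = here e
    ∈-take (suc n) (x ∷ xs) (there y∈) = there (∈-take n xs y∈)

    ∑-take : ∀ {A : Set} n (xs : List A) f → ∑ (take n xs) f ≤ ∑ xs f
    ∑-take zero xs f = z≤n
    ∑-take (suc n) [] f = z≤n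
    ∑-take (suc n) (x ∷ xs) f = ℕₚ.+-monoʳ-≤ (f x) (∑-take n xs f)

    record Thin (Y₀ : List V) (n κ : ℕ) : Set₁ where
      field
        Y : List V
        unique : Unique Y
        length-Y : length Y ≡ n
        subset : ∀ {y} → y ∈ Y → y ∈ Y₀
        isotropy : Isotropy
        thin : ∀ v → ∑ Y (λ y → 𝟙 (Isotropy.Iso? isotropy (y ⊝ v))) < κ

    module _ (2<p : 2 < p) (Y₀ : List V) (u₀ : Unique Y₀) (n κ : ℕ) (length-Y₀ : length Y₀ ≡ 2 ℕ.* n) (large : 2 ℕ.* n < κ ℕ.* κ) (1<κ : 1 < κ) where

      private
        iso-shift : ∀ (I : Isotropy) {x y} v → Isotropy.Iso I (x ⊝ v) → Isotropy.Iso I (y ⊝ v) → Isotropy.Iso I (x ⊝ y)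
        iso-shift I {x} {y} v ix iy = subst (Isotropy.Iso I) (cancel x y v) (Isotropy.iso-⊝ I ix iy)
          where
          cancel : ∀ x y v → (x ⊝ v) ⊝ (y ⊝ v) ≡ x ⊝ y
          cancel (x₁ , x₂) (y₁ , y₂) (v₁ , v₂) = cong₂ _,_ (e x₁ y₁ v₁) (e x₂ y₂ v₂)
            where e = solve 3 (λ x y q → (x :- q) :- (y :- q) := x :- y) refl

        truncate : ∀ Y₁ (I : Isotropy) → Unique Y₁ → (∀ {y} → y ∈ Y₁ → y ∈ Y₀) → n ≤ length Y₁ → (∀ v → ∑ Y₁ (λ y → 𝟙 (Isotropy.Iso? I (y ⊝ v))) < κ) → Thin Y₀ n κ
        truncate Y₁ I u₁ sub n≤ thin = record
          { Y = take n Y₁ ; unique = take⁺ n u₁ ; length-Y = trans (length-take n Y₁) (ℕₚ.m≤n⇒m⊓n≡m n≤)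
          ; subset = sub ∘ ∈-take n Y₁ ; isotropy = I ; thin = λ v → ℕₚ.≤-<-trans (∑-take n Y₁ _) (thin v) }

        anisotropic-thin : (∀ ι → ι * ι + 1# ≢ 0#) → Thin Y₀ n κ
        anisotropic-thin none = truncate Y₀ (anisotropic null) u₀ (λ y∈ → y∈) (ℕₚ.≤-trans (ℕₚ.m≤m+n n _) (ℕₚ.≤-reflexive (sym length-Y₀)))
          (λ v → ℕₚ.≤-<-trans (count≤1 (λ y → (y ⊝ v) ≟V (0# , 0#)) u₀ (λ _ _ e e′ → trans (equal e) (sym (equal e′)))) 1<κ)
          where
          equal : ∀ {y v : V} → y ⊝ v ≡ (0# , 0#) → y ≡ v
          equal e = V-≡ (cong proj₁ e) (cong proj₂ e)
          null : ∀ v → norm² v ≡ 0# → v ≡ (0# , 0#)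
          null (v₁ , v₂) e = go (v₂ ≟ 0#)
            where
            go : Dec (v₂ ≡ 0#) → (v₁ , v₂) ≡ (0# , 0#)
            go (no v₂≢0) = ⊥-elim (none (v₁ * inv v₂) (*-cancel-0 (*-nonzero v₂≢0 v₂≢0) (trans
              (solve 3 (λ x y z → y :* y :* (x :* z :* (x :* z) :+ con (ℤ.+ 1)) := (x :* z :* y) :* (x :* z :* y) :+ y :* y) refl v₁ v₂ (inv v₂))
              (trans (cong (λ w → w * w + v₂ * v₂) (*-inv-cancel v₁ v₂≢0)) e))))
            go (yes refl) = cong (_, 0#) (x*x≡0⇒x≡0 (trans (solve 1 (λ x → x :* x := x :* x :+ con (ℤ.+ 0) :* con (ℤ.+ 0)) refl v₁) e))

        module Split (ι : F) (ι² : ι * ι + 1# ≡ 0#) where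
          ι²′ : - ι * - ι + 1# ≡ 0#
          ι²′ = trans (solve 1 (λ i → (:- i) :* (:- i) :+ con (ℤ.+ 1) := i :* i :+ con (ℤ.+ 1)) refl ι) ι²

          ι≢0 : ι ≢ 0#
          ι≢0 e = 1≢0 (ℕₚ.<⇒≤ 2<p) (trans (solve 1 (λ i → con (ℤ.+ 1) := (i :* i :+ con (ℤ.+ 1)) :- i :* i) refl ι) (trans (cong₂ _-_ ι² (*-zero ι e)) (x-x≡0 0#)))

          I₊ I₋ : Isotropy
          I₊ = splitIsotropy ι ι²
          I₋ = splitIsotropy (- ι) ι²′

          open Isotropy I₊ using () renaming (Iso to Iso₊; Iso? to Iso₊?)
          open Isotropy I₋ using () renaming (Iso to Iso₋; Iso? to Iso₋?)

          both : ∀ {x y : V} → Iso₊ (x ⊝ y) → Iso₋ (x ⊝ y) → x ≡ y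
          both {x} {y} e e′ = V-≡ d₁≡0 d₂≡0
            where
            d₁ = proj₁ x - proj₁ y
            d₂ = proj₂ x - proj₂ y
            d₂≡0 : d₂ ≡ 0#
            d₂≡0 = *-cancel-0 (*-nonzero (2≢0 2<p) ι≢0) (trans (solve 3 (λ a b i → con (ℤ.+ 2) :* i :* b := (a :- (:- i) :* b) :- (a :- i :* b)) refl d₁ d₂ ι) (trans (cong₂ _-_ e′ e) (x-x≡0 0#)))
            d₁≡0 : d₁ ≡ 0#
            d₁≡0 = trans (solve 3 (λ a b i → a := (a :- i :* b) :+ i :* b) refl d₁ d₂ ι) (zero-+ e (*-zero ι d₂≡0))

          lineCount₊ : V → ℕ
          lineCount₊ y = ∑ Y₀ (λ y′ → 𝟙 (Iso₊? (y′ ⊝ y)))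

          rich? : ∀ y → Dec (κ ≤ lineCount₊ y)
          rich? y = κ ℕ.≤? lineCount₊ y

          Rich Poor : List V
          Rich = filter rich? Y₀
          Poor = filter (¬? ∘ rich?) Y₀

          rich+poor : length Rich ℕ.+ length Poor ≡ 2 ℕ.* n
          rich+poor = trans (cong₂ ℕ._+_ (length-filter-∑ rich? Y₀) (length-filter-∑ (¬? ∘ rich?) Y₀)) (trans (sym (∑-+ Y₀ _ _))
            (trans (∑-cong Y₀ (λ y → one (rich? y))) (trans (sym (length-∑ Y₀)) length-Y₀)))
            where
            one : ∀ {P : Set} (d : Dec P) → 𝟙 d ℕ.+ 𝟙 (¬? d) ≡ 1
            one (yes _) = refl
            one (no _) = refl

          -- Here v is arbitrary, while poverty is known only for members of `Y₀`. If the line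
          -- through v contains a poor point y₀ at all, it is also the line through y₀.
          poor-thin : ∀ v → ∑ Poor (λ y → 𝟙 (Iso₊? (y ⊝ v))) < κ
          poor-thin v = go (∑ Poor (λ y → 𝟙 (Iso₊? (y ⊝ v)))) refl
            where
            go : ∀ c → ∑ Poor (λ y → 𝟙 (Iso₊? (y ⊝ v))) ≡ c → ∑ Poor (λ y → 𝟙 (Iso₊? (y ⊝ v))) < κ
            go zero e = ℕₚ.≤-<-trans (ℕₚ.≤-reflexive e) (ℕₚ.<-trans (s≤s z≤n) 1<κ)
            go (suc c) e = found (∑-positive Poor (ℕₚ.≤-trans (s≤s z≤n) (ℕₚ.≤-reflexive (sym e))))
              where
              found : Σ V (λ y → y ∈ Poor × 0 < 𝟙 (Iso₊? (y ⊝ v))) → ∑ Poor (λ y → 𝟙 (Iso₊? (y ⊝ v))) < κ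
              found (y₀ , y₀∈ , pos) = ℕₚ.≤-<-trans (ℕₚ.≤-trans (ℕₚ.≤-reflexive (∑-filter (¬? ∘ rich?) Y₀ _)) (∑-mono Y₀ (λ {y} _ →
                  𝟙-*-≤ (¬? (rich? y)) {𝟙 (Iso₊? (y ⊝ v))} (λ _ → 𝟙-mono (Iso₊? (y ⊝ v)) (Iso₊? (y ⊝ y₀)) (λ q → iso-shift I₊ v q (𝟙-positive (Iso₊? (y₀ ⊝ v)) pos))))))
                (ℕₚ.≰⇒> (proj₂ (∈-filter⁻ (¬? ∘ rich?) {xs = Y₀} y₀∈)))

          -- Each rich point on the second isotropic line through v carries κ points on its own line
          -- of the first direction. A line of each direction meet in one point only, so these sets
          -- are disjoint: the number of rich points on the line times κ is at most 2n < κ².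
          rich-thin : ∀ v → ∑ Rich (λ y → 𝟙 (Iso₋? (y ⊝ v))) < κ
          rich-thin v = ℕₚ.*-cancelʳ-< κ _ _ (ℕₚ.≤-<-trans bound large)
            where
            open ℕₚ.≤-Reasoning
            bound : ∑ Rich (λ y → 𝟙 (Iso₋? (y ⊝ v))) ℕ.* κ ≤ 2 ℕ.* n
            bound = begin
              ∑ Rich (λ y → 𝟙 (Iso₋? (y ⊝ v))) ℕ.* κ
                ≡⟨ ∑-*ʳ Rich κ _ ⟨
              ∑ Rich (λ y → 𝟙 (Iso₋? (y ⊝ v)) ℕ.* κ)
                ≤⟨ ∑-mono Rich (λ {y} y∈ → ℕₚ.*-monoʳ-≤ (𝟙 (Iso₋? (y ⊝ v))) (proj₂ (∈-filter⁻ rich? {xs = Y₀} y∈))) ⟩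
              ∑ Rich (λ y → 𝟙 (Iso₋? (y ⊝ v)) ℕ.* ∑ Y₀ (λ y′ → 𝟙 (Iso₊? (y′ ⊝ y))))
                ≡⟨ trans (∑-cong Rich (λ y → sym (∑-*ˡ Y₀ (𝟙 (Iso₋? (y ⊝ v))) _))) (∑-swap Rich Y₀ _) ⟩
              ∑ Y₀ (λ y′ → ∑ Rich (λ y → 𝟙 (Iso₋? (y ⊝ v)) ℕ.* 𝟙 (Iso₊? (y′ ⊝ y))))
                ≤⟨ ∑-≤const Y₀ 1 (λ {y′} _ → ℕₚ.≤-trans (ℕₚ.≤-reflexive (∑-cong Rich (λ y → sym (𝟙-× (Iso₋? (y ⊝ v)) (Iso₊? (y′ ⊝ y))))))
                     (count≤1 (λ y → Iso₋? (y ⊝ v) ×-dec Iso₊? (y′ ⊝ y)) (filter⁺ rich? u₀) (λ { {y} {z} _ _ (e₋ , e₊) (f₋ , f₊) → same {y} {z} {y′} e₋ e₊ f₋ f₊ }))) ⟩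
              length Y₀ ℕ.* 1
                ≡⟨ trans (ℕₚ.*-identityʳ _) length-Y₀ ⟩
              2 ℕ.* n ∎
              where
              same : ∀ {y z y′} → Iso₋ (y ⊝ v) → Iso₊ (y′ ⊝ y) → Iso₋ (z ⊝ v) → Iso₊ (y′ ⊝ z) → y ≡ z
              same {y} {z} {y′} e₋ e₊ f₋ f₊ = both (iso-shift I₊ y′ (neg {y′} {y} e₊) (neg {y′} {z} f₊)) (iso-shift I₋ v e₋ f₋)
                where
                neg : ∀ {x y} → Iso₊ (x ⊝ y) → Iso₊ (y ⊝ x)
                neg {x} {y} q = trans (solve 5 (λ a b c d i → (b :- a) :- i :* (d :- c) := :- ((a :- b) :- i :* (c :- d))) refl (proj₁ x) (proj₁ y) (proj₂ x) (proj₂ y) ι)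
                  (trans (cong -_ q) (solve 0 (:- con (ℤ.+ 0) := con (ℤ.+ 0)) refl))

          split-thin : Thin Y₀ n κ
          split-thin = go (n ℕ.≤? length Rich)
            where
            go : Dec (n ≤ length Rich) → Thin Y₀ n κ
            go (yes r) = truncate Rich I₋ (filter⁺ rich? u₀) (λ y∈ → proj₁ (∈-filter⁻ rich? {xs = Y₀} y∈)) r rich-thin
            go (no ¬r) = truncate Poor I₊ (filter⁺ (¬? ∘ rich?) u₀) (λ y∈ → proj₁ (∈-filter⁻ (¬? ∘ rich?) {xs = Y₀} y∈))
              (ℕₚ.+-cancelˡ-≤ n _ _ (ℕₚ.≤-trans (ℕₚ.≤-reflexive (trans (cong (n ℕ.+_) (sym (ℕₚ.+-identityʳ n))) (sym rich+poor))) (ℕₚ.+-monoˡ-≤ (length Poor) (ℕₚ.<⇒≤ (ℕₚ.≰⇒> ¬r)))))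
              poor-thin

      thinSubset : Thin Y₀ n κ
      thinSubset = go (Finₚ.any? (λ ι → (ι * ι + 1#) ≟ 0#))
        where
        go : Dec (Σ F λ ι → ι * ι + 1# ≡ 0#) → Thin Y₀ n κ
        go (yes (ι , ι²)) = Split.split-thin ι ι²
        go (no none) = anisotropic-thin (λ ι e → none (ι , e))

    nullDistances≤ : ∀ x (ys : List V) → Unique ys → ∑ ys (λ y → 𝟙 (norm² (x ⊝ y) ≟ 0#)) ≤ p ℕ.* 2
    nullDistances≤ x ys u = ℕₚ.≤-trans (∑-subset _≟V_ u (λ _ → ∈-allV _) _) (ℕₚ.≤-trans (ℕₚ.≤-reflexive (∑-× allF allF _)) (ℕₚ.≤-trans (∑-≤const allF 2 (λ {y₁} _ →
      count≤2 (λ y₂ → norm² (x ⊝ (y₁ , y₂)) ≟ 0#) unique-allF (λ {a} {b} {c} ea eb ec a≢b a≢c → trans (mirror y₁ ea eb a≢b) (sym (mirror y₁ ea ec a≢c)))))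
      (ℕₚ.≤-reflexive (cong (ℕ._* 2) length-allF))))
      where
      mirror : ∀ y₁ {a b} → norm² (x ⊝ (y₁ , a)) ≡ 0# → norm² (x ⊝ (y₁ , b)) ≡ 0# → a ≢ b → b ≡ 2# * proj₂ x - a
      mirror y₁ {a} {b} ea eb a≢b = x-y≡0⇒x≡y (*-cancel-0 (x≢y⇒x-y≢0 a≢b) (trans
        (solve 4 (λ x₁ x₂ a b → (a :- b) :* (b :- (con (ℤ.+ 2) :* x₂ :- a)) := (x₁ :+ (x₂ :- a) :* (x₂ :- a)) :- (x₁ :+ (x₂ :- b) :* (x₂ :- b))) refl ((proj₁ x - y₁) * (proj₁ x - y₁)) (proj₂ x) a b)
        (trans (cong₂ _-_ ea eb) (x-x≡0 0#))))

    Distance : List V → List V → F → Set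
    Distance X Y r = Any (λ x → Any (λ y → norm² (x ⊝ y) ≡ r) Y) X

    distance? : ∀ X Y r → Dec (Distance X Y r)
    distance? X Y r = any? (λ x → any? (λ y → norm² (x ⊝ y) ≟ r) Y) X

    distances : List V → List V → List F
    distances X Y = filter (distance? X Y) allF

    -- Cauchy–Schwarz over pairs (x , r): each distance r ≠ 0 is attained from x by h x r points of Y.
    module Distances (X Y : List V) (uY : Unique Y) (T : ℕ)
      (isosceles≤ : ∑ X (λ x → ∑ Y (λ y → ∑ Y (λ z → 𝟙 ((norm² (x ⊝ y) ≟ norm² (x ⊝ z)) ×-dec ¬? (norm² (x ⊝ y) ≟ 0#))))) ≤ T)
      (4p≤n : 4 ℕ.* p ≤ length Y) where

      private
        R = distances X Y
        nX = length X
        n = length Y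

      h : V → F → ℕ
      h x r = ∑ Y (λ y → 𝟙 ((norm² (x ⊝ y) ≟ r) ×-dec ¬? (norm² (x ⊝ y) ≟ 0#)))

      total : ℕ
      total = ∑ X (λ x → ∑ Y (λ y → 𝟙 (¬? (norm² (x ⊝ y) ≟ 0#))))

      total≤ : total ≤ ∑ X (λ x → ∑ R (h x))
      total≤ = ∑-mono X (λ {x} x∈ → ℕₚ.≤-trans (∑-mono Y (λ {y} y∈ → 𝟙-≤ (¬? (norm² (x ⊝ y) ≟ 0#)) (λ q →
          ℕₚ.≤-trans (ℕₚ.≤-reflexive (sym (𝟙-yes ((norm² (x ⊝ y) ≟ norm² (x ⊝ y)) ×-dec ¬? (norm² (x ⊝ y) ≟ 0#)) (refl , q))))
            (term≤∑ (λ r → 𝟙 ((norm² (x ⊝ y) ≟ r) ×-dec ¬? (norm² (x ⊝ y) ≟ 0#))) (∈-filter⁺ (distance? X Y) (∈-allF _) (Any.map (λ { refl → Any.map (λ { refl → refl }) y∈ }) x∈))))))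
        (ℕₚ.≤-reflexive (∑-swap Y R _)))

      -- A point has at most 2p points at distance zero, so n ≥ 4p leaves at least half of all pairs
      -- at non-zero distance.
      nX*n≤ : nX ℕ.* n ≤ 2 ℕ.* total
      nX*n≤ = ℕₚ.+-cancelʳ-≤ (nX ℕ.* n) _ _ (begin
        nX ℕ.* n ℕ.+ nX ℕ.* n                      ≤⟨ ℕₚ.+-mono-≤ all all ⟩
        (total ℕ.+ nX ℕ.* (p ℕ.* 2)) ℕ.+ (total ℕ.+ nX ℕ.* (p ℕ.* 2)) ≡⟨ e total nX p ⟩
        2 ℕ.* total ℕ.+ nX ℕ.* (4 ℕ.* p)           ≤⟨ ℕₚ.+-monoʳ-≤ (2 ℕ.* total) (ℕₚ.*-monoʳ-≤ nX 4p≤n) ⟩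
        2 ℕ.* total ℕ.+ nX ℕ.* n                   ∎)
        where
        open ℕₚ.≤-Reasoning
        e : ∀ t x p → (t ℕ.+ x ℕ.* (p ℕ.* 2)) ℕ.+ (t ℕ.+ x ℕ.* (p ℕ.* 2)) ≡ 2 ℕ.* t ℕ.+ x ℕ.* (4 ℕ.* p)
        e = solve-∀
        one : ∀ {P : Set} (d : Dec P) → 1 ≡ 𝟙 (¬? d) ℕ.+ 𝟙 d
        one (yes _) = refl
        one (no _) = refl
        all : nX ℕ.* n ≤ total ℕ.+ nX ℕ.* (p ℕ.* 2)
        all = begin
          nX ℕ.* n ≡⟨ trans (cong (nX ℕ.*_) (length-∑ Y)) (sym (∑-const X _)) ⟩
          ∑ X (λ x → ∑ Y (λ y → 1))
            ≡⟨ ∑-cong X (λ x → trans (∑-cong Y (λ y → one (norm² (x ⊝ y) ≟ 0#))) (∑-+ Y _ _)) ⟩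
          ∑ X (λ x → ∑ Y (λ y → 𝟙 (¬? (norm² (x ⊝ y) ≟ 0#))) ℕ.+ ∑ Y (λ y → 𝟙 (norm² (x ⊝ y) ≟ 0#)))
            ≡⟨ ∑-+ X _ _ ⟩
          total ℕ.+ ∑ X (λ x → ∑ Y (λ y → 𝟙 (norm² (x ⊝ y) ≟ 0#)))
            ≤⟨ ℕₚ.+-monoʳ-≤ total (∑-≤const X (p ℕ.* 2) (λ {x} _ → nullDistances≤ x Y uY)) ⟩
          total ℕ.+ nX ℕ.* (p ℕ.* 2) ∎

      squares : ∑ X (λ x → ∑ R (λ r → h x r ℕ.* h x r)) ≤ T
      squares = ℕₚ.≤-trans (∑-mono X (λ {x} _ → begin
        ∑ R (λ r → h x r ℕ.* h x r)
          ≡⟨ trans (∑-cong R (λ r → ∑-product Y Y _ _)) (trans (∑-swap R Y _) (∑-cong Y (λ y → ∑-swap R Y _))) ⟩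
        ∑ Y (λ y → ∑ Y (λ z → ∑ R (λ r → 𝟙 ((norm² (x ⊝ y) ≟ r) ×-dec ¬? (norm² (x ⊝ y) ≟ 0#)) ℕ.* 𝟙 ((norm² (x ⊝ z) ≟ r) ×-dec ¬? (norm² (x ⊝ z) ≟ 0#)))))
          ≤⟨ ∑-mono Y (λ {y} _ → ∑-mono Y (λ {z} _ → pair x y z)) ⟩
        ∑ Y (λ y → ∑ Y (λ z → 𝟙 ((norm² (x ⊝ y) ≟ norm² (x ⊝ z)) ×-dec ¬? (norm² (x ⊝ y) ≟ 0#)))) ∎)) isosceles≤
        where
        open ℕₚ.≤-Reasoning
        pair : ∀ x y z → ∑ R (λ r → 𝟙 ((norm² (x ⊝ y) ≟ r) ×-dec ¬? (norm² (x ⊝ y) ≟ 0#)) ℕ.* 𝟙 ((norm² (x ⊝ z) ≟ r) ×-dec ¬? (norm² (x ⊝ z) ≟ 0#)))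
          ≤ 𝟙 ((norm² (x ⊝ y) ≟ norm² (x ⊝ z)) ×-dec ¬? (norm² (x ⊝ y) ≟ 0#))
        pair x y z = ℕₚ.≤-trans (∑-mono R (λ {r} _ → go ((norm² (x ⊝ y) ≟ r) ×-dec ¬? (norm² (x ⊝ y) ≟ 0#)) ((norm² (x ⊝ z) ≟ r) ×-dec ¬? (norm² (x ⊝ z) ≟ 0#))))
          (∑-atMostOne (λ r → (norm² (x ⊝ y) ≟ r) ×-dec ¬? (norm² (x ⊝ y) ≟ 0#)) (filter⁺ (distance? X Y) unique-allF) (λ _ _ q q′ → trans (sym (proj₁ q)) (proj₁ q′))
            (λ _ → 𝟙 ((norm² (x ⊝ y) ≟ norm² (x ⊝ z)) ×-dec ¬? (norm² (x ⊝ y) ≟ 0#))) _ (λ _ _ → ℕₚ.≤-refl))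
          where
          go : ∀ {r} (u : Dec (norm² (x ⊝ y) ≡ r × norm² (x ⊝ y) ≢ 0#)) (w : Dec (norm² (x ⊝ z) ≡ r × norm² (x ⊝ z) ≢ 0#)) → 𝟙 u ℕ.* 𝟙 w ≤
            𝟙 u ℕ.* 𝟙 ((norm² (x ⊝ y) ≟ norm² (x ⊝ z)) ×-dec ¬? (norm² (x ⊝ y) ≟ 0#))
          go (no _) _ = z≤n
          go (yes _) (no _) = z≤n
          go (yes (e , q)) (yes (e′ , _)) = ℕₚ.≤-reflexive (cong (1 ℕ.*_) (sym (𝟙-yes ((norm² (x ⊝ y) ≟ norm² (x ⊝ z)) ×-dec ¬? (norm² (x ⊝ y) ≟ 0#)) (trans e (sym e′) , q))))

      manyDistances : nX ℕ.* n ℕ.* (nX ℕ.* n) ≤ 4 ℕ.* (nX ℕ.* length R ℕ.* T)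
      manyDistances = begin
        nX ℕ.* n ℕ.* (nX ℕ.* n)                    ≤⟨ ℕₚ.*-mono-≤ nX*n≤ nX*n≤ ⟩
        2 ℕ.* total ℕ.* (2 ℕ.* total)              ≡⟨ e total ⟩
        4 ℕ.* (total ℕ.* total)                    ≤⟨ ℕₚ.*-monoʳ-≤ 4 (ℕₚ.≤-trans (ℕₚ.*-mono-≤ total≤′ total≤′) (∑² (cartesianProduct X R) (λ { (x , r) → h x r }))) ⟩
        4 ℕ.* (length (cartesianProduct X R) ℕ.* ∑ (cartesianProduct X R) (λ { (x , r) → h x r ℕ.* h x r }))
          ≡⟨ cong (4 ℕ.*_) (cong₂ ℕ._*_ (length-cartesianProduct X R) (∑-× X R _)) ⟩
        4 ℕ.* (nX ℕ.* length R ℕ.* ∑ X (λ x → ∑ R (λ r → h x r ℕ.* h x r)))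
          ≤⟨ ℕₚ.*-monoʳ-≤ 4 (ℕₚ.*-monoʳ-≤ (nX ℕ.* length R) squares) ⟩
        4 ℕ.* (nX ℕ.* length R ℕ.* T) ∎
        where
        open ℕₚ.≤-Reasoning
        e : ∀ t → 2 ℕ.* t ℕ.* (2 ℕ.* t) ≡ 4 ℕ.* (t ℕ.* t)
        e = solve-∀
        total≤′ : total ≤ ∑ (cartesianProduct X R) (λ { (x , r) → h x r })
        total≤′ = ℕₚ.≤-trans total≤ (ℕₚ.≤-reflexive (sym (∑-× X R _)))

  -- A positive proportion of distances between two planar sets.

  module PlanarDistances where

    open FiniteSums
    open 𝔽ₚ using (0#)
    open Reflections using (V)
    open BisectorBlocks
    open IsoscelesTriangles
    open ThinSubsets
    open import Data.Nat
    open import Data.Nat.Properties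
    open import Data.List using (List; length; take)
    open import Data.List.Properties using (length-take)
    open import Data.List.Relation.Binary.Subset.Propositional.Properties using (Any-resp-⊆)
    open import Data.List.Membership.Propositional using (_∈_)
    open import Data.List.Relation.Unary.Any as Any using (Any)
    open import Data.List.Relation.Unary.Unique.Propositional using (Unique)
    open import Data.List.Relation.Unary.Unique.Propositional.Properties using (take⁺)
    open import Relation.Binary.PropositionalEquality
    open Polynomials using (allF)

    distances-mono : ∀ X {Y Z} → (∀ {y} → y ∈ Y → y ∈ Z) → length (distances X Y) ≤ length (distances X Z)
    distances-mono X {Y} {Z} Y⊆Z = ≤-trans (≤-reflexive (length-filter-∑ (distance? X Y) allF)) (≤-trans
      (∑-mono allF (λ {r} _ → 𝟙-mono (distance? X Y r) (distance? X Z r) (Any.map (Any-resp-⊆ Y⊆Z))))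
      (≤-reflexive (sym (length-filter-∑ (distance? X Z) allF))))

    module _ (m : ℕ) (p≤m⁴ : p ≤ m * (m * (m * m))) (m⁴≤16p : m * (m * (m * m)) ≤ 16 * p) (1≤p : 1 ≤ p) (large : 4227072 ≤ m) where

      module A = Arithmetic.Parameters p m p≤m⁴ m⁴≤16p 1≤p large

      2<p : 2 < p
      2<p = ≤-trans (s≤s (s≤s (s≤s z≤n))) A.9<p

      module _ (X Y₀ : List V) (uX : Unique X) (u₀ : Unique Y₀) (X≥ : A.n ≤ length X) (Y₀≡ : length Y₀ ≡ 2 * A.n) where

        -- The triangle count is used twice: with apexes in `Y` it closes the loop that bounds the
        -- energy of `Y`, and with apexes in `X` it turns this energy into distances. `X` therefore
        -- needs neither thinning nor an exact size.
        module FromThin (t : Thin Y₀ A.n A.κ) where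
          open Thin t

          Y≡n : length Y ≡ A.n
          Y≡n = length-Y

          many : 4 * length Y ≤ A.κ * A.κ
          many = ≤-trans (≤-reflexive (cong (4 *_) Y≡n)) A.4n≤κ²

          module C = Counts 2<p isotropy Y unique A.κ thin many
          module S = Setup 2<p isotropy Y A.κ thin

          block : ∀ r → r ≢ 0# → ∀ as bs → Unique as → Unique bs → (∀ {i} → i ∈ as → i ∈ C.ofLength r) → (∀ {j} → j ∈ bs → j ∈ C.ofLength r) →
            length as ≤ A.N → length bs ≤ A.N → ∑ as (λ i → ∑ bs (λ j → 𝟙 (S.edge? i j))) ≤ A.W
          block r r≢0 as bs uas ubs as⊆ bs⊆ as≤ bs≤ = S.Count.fewEdges A.s A.d A.M A.N ≤-refl A.few-lines A.4d≤M A.d+κ≤M A.M+3<p A.M*8256≤p A.9<p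
            r r≢0 as bs uas ubs (λ i∈ → C.ofLength-norm (as⊆ i∈)) (λ j∈ → C.ofLength-norm (bs⊆ j∈)) (λ j∈ → C.ofLength-Y (bs⊆ j∈)) as≤ bs≤

          module En = C.Energy A.N A.W A.1≤N block
          module TY = C.Triples Y unique
          module IY = C.Incidences Y unique
          module TX = C.Triples X uX
          module IX = C.Incidences X uX

          isoscelesʸ : TY.Isosceles ≤ (A.n * A.n + A.n * A.n) + (2 * A.n * (A.n + A.n) + TY.GoodTriples)
          isoscelesʸ = subst (λ n → TY.Isosceles ≤ (n * n + n * n) + (2 * n * (n + n) + TY.GoodTriples)) Y≡n TY.isosceles≤

          varianceʸ : 2 * A.Λ * p * TY.GoodTriples ≤ A.Λ * A.Λ * (p * p) * A.n + 2 * A.Λ * A.n * (A.n * A.n) + p * C.BisectorEnergy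
          varianceʸ = subst (λ n → 2 * A.Λ * p * TY.GoodTriples ≤ A.Λ * A.Λ * (p * p) * n + 2 * A.Λ * n * (n * n) + p * C.BisectorEnergy) Y≡n (IY.variance A.Λ)

          energy : C.BisectorEnergy * A.N * A.N ≤ 2 * (A.n * A.n * A.κ) * (A.N * A.N) + 2 * A.W * (A.n * TY.Isosceles + p * (A.N * A.N))
          energy = subst (λ n → C.BisectorEnergy * A.N * A.N ≤ 2 * (n * n * A.κ) * (A.N * A.N) + 2 * A.W * (n * TY.Isosceles + p * (A.N * A.N))) Y≡n En.energy

          module B = Arithmetic.Bootstrap p A.n TY.Isosceles TY.GoodTriples C.BisectorEnergy A.N A.κ A.W A.Λ A.1≤Λ A.1≤N
            isoscelesʸ varianceʸ energy A.n²≡ A.12p≤n A.2Wn≤ A.2κp≤ A.2Wp²≤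

          4p≤ : 4 * p ≤ length Y
          4p≤ = ≤-trans (*-monoˡ-≤ p (m≤m+n 4 8)) (≤-trans A.12p≤n (≤-reflexive (sym Y≡n)))

          module Δ = Distances X Y unique TX.Isosceles ≤-refl 4p≤

          isoscelesˣ : TX.Isosceles ≤ (length X * A.n + length X * A.n) + (2 * A.n * (length X + A.n) + TX.GoodTriples)
          isoscelesˣ = subst (λ n → TX.Isosceles ≤ (length X * n + length X * n) + (2 * n * (length X + n) + TX.GoodTriples)) Y≡n TX.isosceles≤

          varianceˣ : 2 * A.Λ * p * TX.GoodTriples ≤ A.Λ * A.Λ * (p * p) * length X + 2 * A.Λ * length X * (A.n * A.n) + p * C.BisectorEnergy
          varianceˣ = subst (λ n → 2 * A.Λ * p * TX.GoodTriples ≤ A.Λ * A.Λ * (p * p) * length X + 2 * A.Λ * length X * (n * n) + p * C.BisectorEnergy) Y≡n (IX.variance A.Λ)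

          manyDistances : length X * A.n * (length X * A.n) ≤ 4 * (length X * length (distances X Y) * TX.Isosceles)
          manyDistances = subst (λ n → length X * n * (length X * n) ≤ 4 * (length X * length (distances X Y) * TX.Isosceles)) Y≡n Δ.manyDistances

          module P = B.Pinned (length X) TX.Isosceles TX.GoodTriples (length (distances X Y)) X≥ A.1≤n isoscelesˣ varianceˣ manyDistances

        exact : p ≤ 24 * length (distances X Y₀)
        exact = ≤-trans (FromThin.P.p≤24R t) (*-monoʳ-≤ 24 (distances-mono X (Thin.subset t)))
          where
          t : Thin Y₀ A.n A.κ
          t = thinSubset 2<p Y₀ u₀ A.n A.κ Y₀≡ A.2n<κ² A.1<κ

      -- `Y` is cut to exactly 2n points, so that its thin half has exactly n and n² = Λp² holds
      -- with equality.
      planar : ∀ X Y → Unique X → Unique Y → A.n ≤ length X → 2 * A.n ≤ length Y → p ≤ 24 * length (distances X Y)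
      planar X Y uX uY X≥ Y≥ = ≤-trans (exact X (take (2 * A.n) Y) uX (take⁺ (2 * A.n) uY) X≥ (trans (length-take (2 * A.n) Y) (m≤n⇒m⊓n≡m Y≥)))
        (*-monoʳ-≤ 24 (distances-mono X (∈-take (2 * A.n) Y)))

  -- Fibres of a subset of the product.

  module Fibres where

    open FiniteSums
    open 𝔽ₚ using (F)
    open Polynomials using (allF; length-allF)
    open Reflections using (V; norm²; _⊝_)
    open Conics
    open ThinSubsets using (distance?; distances)
    open import Data.Nat
    open import Data.Nat.Properties
    open import Data.Nat.Tactic.RingSolver using (solve-∀)
    open import Data.List using (List; length; filter; cartesianProduct)
    open import Data.List.Membership.Propositional using (_∈_; find)
    import Data.List.Membership.DecPropositional as DecMembership
    open import Data.List.Membership.Propositional.Properties using (∈-filter⁻; ∈-cartesianProduct⁺)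
    open import Data.List.Relation.Unary.Any using (Any)
    open import Data.List.Relation.Unary.Unique.Propositional using (Unique)
    open import Data.List.Relation.Unary.Unique.Propositional.Properties using (filter⁺)
    open import Data.Product using (Σ; _×_; _,_; proj₂)
    open import Data.Product.Properties using (≡-dec)
    open import Relation.Nullary using (Dec; yes; no)
    open import Relation.Binary.PropositionalEquality

    open DecMembership (≡-dec _≟V_ _≟V_) using (_∈?_)

    allE : List (V × V)
    allE = cartesianProduct allV allV

    length-allV : length allV ≡ p * p
    length-allV = trans (length-cartesianProduct allF allF) (cong₂ _*_ length-allF length-allF)

    ∈-allE : ∀ e → e ∈ allE
    ∈-allE (v , w) = ∈-cartesianProduct⁺ (∈-allV v) (∈-allV w)

    length≤p⁴ : ∀ {E} → Unique E → length E ≤ p * p * (p * p)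
    length≤p⁴ {E} u = begin
      length E               ≡⟨ length-∑ E ⟩
      ∑ E (λ _ → 1)          ≤⟨ ∑-subset (≡-dec _≟V_ _≟V_) u (λ _ → ∈-allE _) (λ _ → 1) ⟩
      ∑ allE (λ _ → 1)       ≡⟨ length-∑ allE ⟨
      length allE            ≡⟨ length-cartesianProduct allV allV ⟩
      length allV * length allV ≡⟨ cong₂ _*_ length-allV length-allV ⟩
      p * p * (p * p)        ∎
      where open ≤-Reasoning

    module _ (E : List (V × V)) (unique-E : Unique E) (n : ℕ) (1≤p : 1 ≤ p) (large : 2 * (p * p) * n ≤ length E) where

      fibre : V → List V
      fibre v = filter (λ w → (v , w) ∈? E) allV

      fibre-∈ : ∀ {v w} → w ∈ fibre v → (v , w) ∈ E
      fibre-∈ {v} w∈ = proj₂ (∈-filter⁻ (λ w → (v , w) ∈? E) {xs = allV} w∈)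

      rich? : ∀ v → Dec (n ≤ length (fibre v))
      rich? v = n ≤? length (fibre v)

      base : List V
      base = filter rich? allV

      length-fibre≤ : ∀ v → length (fibre v) ≤ 𝟙 (rich? v) * (p * p) + n
      length-fibre≤ v = go (rich? v)
        where
        go : (d : Dec (n ≤ length (fibre v))) → length (fibre v) ≤ 𝟙 d * (p * p) + n
        go (yes _) = ≤-trans (≤-reflexive (length-filter-∑ (λ w → (v , w) ∈? E) allV))
          (≤-trans (∑-≤const allV 1 (λ _ → 𝟙≤1 (_ ∈? E))) (≤-trans (≤-reflexive (trans (*-comm (length allV) 1) (cong (1 *_) length-allV))) (m≤m+n _ n)))
        go (no ¬rich) = <⇒≤ (≰⇒> ¬rich)

      rich : ∀ {v} → v ∈ base → n ≤ length (fibre v)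
      rich v∈ = proj₂ (∈-filter⁻ rich? {xs = allV} v∈)

      -- Fibres below the threshold n contribute at most p²n, which is half of what |E| is known to
      -- exceed or equal; the other half is spread over rich fibres of at most p² elements each.
      base≥ : n ≤ length base
      base≥ = *-cancelʳ-≤ n (length base) (p * p) {{m*n≢0 p p {{>-nonZero 1≤p}} {{>-nonZero 1≤p}}}} (+-cancelʳ-≤ (n * (p * p)) _ _ (begin
        n * (p * p) + n * (p * p)                     ≡⟨ e n (p * p) ⟩
        2 * (p * p) * n                               ≤⟨ large ⟩
        length E                                      ≡⟨ length-∑ E ⟩
        ∑ E (λ _ → 1)                                 ≤⟨ ∑-mono E (λ {e} e∈ → ≤-reflexive (sym (𝟙-yes (e ∈? E) e∈))) ⟩
        ∑ E (λ e → 𝟙 (e ∈? E))                        ≤⟨ ∑-subset (≡-dec _≟V_ _≟V_) unique-E (λ _ → ∈-allE _) _ ⟩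
        ∑ allE (λ e → 𝟙 (e ∈? E))                     ≡⟨ ∑-× allV allV _ ⟩
        ∑ allV (λ v → ∑ allV (λ w → 𝟙 ((v , w) ∈? E)))
          ≡⟨ ∑-cong allV (λ v → sym (length-filter-∑ (λ w → (v , w) ∈? E) allV)) ⟩
        ∑ allV (λ v → length (fibre v))               ≤⟨ ∑-mono allV (λ {v} _ → length-fibre≤ v) ⟩
        ∑ allV (λ v → 𝟙 (rich? v) * (p * p) + n)      ≡⟨ ∑-+ allV _ _ ⟩
        ∑ allV (λ v → 𝟙 (rich? v) * (p * p)) + ∑ allV (λ _ → n)
          ≡⟨ cong₂ _+_ (trans (∑-*ʳ allV (p * p) _) (cong (_* (p * p)) (sym (length-filter-∑ rich? allV)))) (trans (∑-const allV n) (trans (cong (_* n) length-allV) (*-comm (p * p) n))) ⟩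
        length base * (p * p) + n * (p * p)           ∎))
        where
        open ≤-Reasoning
        e : ∀ n q → n * q + n * q ≡ 2 * q * n
        e = solve-∀

      module _ (planar : ∀ X Y → Unique X → Unique Y → n ≤ length X → n ≤ length Y → p ≤ 24 * length (distances X Y))
        {Attained : F × F → Set} (attained? : ∀ rs → Dec (Attained rs))
        (attained : ∀ {x x′ y y′} → (x , x′) ∈ E → (y , y′) ∈ E → Attained (norm² (x ⊝ y) , norm² (x′ ⊝ y′))) where

        manyOver : ∀ {r} → Any (λ x → Any (λ y → norm² (x ⊝ y) ≡ r) base) base → p ≤ 24 * ∑ allF (λ s → 𝟙 (attained? (r , s)))
        manyOver {r} found = go (find found)
          where
          over : ∀ {v v′} → norm² (v ⊝ v′) ≡ r → ∀ s → Any (λ w → Any (λ w′ → norm² (w ⊝ w′) ≡ s) (fibre v′)) (fibre v) → Attained (r , s)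
          over {v} {v′} refl s q with find q
          ... | w , w∈ , q′ with find q′
          ... | w′ , w′∈ , refl = attained (fibre-∈ w∈) (fibre-∈ w′∈)
          go : (Σ V λ v → v ∈ base × Any (λ v′ → norm² (v ⊝ v′) ≡ r) base) → p ≤ 24 * ∑ allF (λ s → 𝟙 (attained? (r , s)))
          go (v , v∈ , q) with find q
          ... | v′ , v′∈ , eq = ≤-trans (planar (fibre v) (fibre v′) (filter⁺ _ unique-allV) (filter⁺ _ unique-allV) (rich v∈) (rich v′∈))
            (*-monoʳ-≤ 24 (≤-trans (≤-reflexive (length-filter-∑ (distance? (fibre v) (fibre v′)) allF))
              (∑-mono allF (λ {s} _ → 𝟙-mono (distance? (fibre v) (fibre v′) s) (attained? (r , s)) (over eq s)))))

        -- One factor 24 comes from the distances between points of `base`, the other from two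
        -- fibres over a pair realising such a distance; 576 = 24².
        manyPairs : p * p ≤ 576 * length (filter attained? (cartesianProduct allF allF))
        manyPairs = begin
          p * p                                                   ≤⟨ *-monoˡ-≤ p (planar base base (filter⁺ rich? unique-allV) (filter⁺ rich? unique-allV) base≥ base≥) ⟩
          24 * length (distances base base) * p                   ≡⟨ cong (λ l → 24 * l * p) (length-filter-∑ (distance? base base) allF) ⟩
          24 * ∑ allF (λ r → 𝟙 (distance? base base r)) * p       ≡⟨ trans (*-assoc 24 (∑ allF first) p) (cong (24 *_) (sym (∑-*ʳ allF p first))) ⟩
          24 * ∑ allF (λ r → 𝟙 (distance? base base r) * p)       ≤⟨ *-monoʳ-≤ 24 (∑-mono allF (λ {r} _ → 𝟙-*-≤ (distance? base base r) manyOver)) ⟩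
          24 * ∑ allF (λ r → 24 * ∑ allF (λ s → 𝟙 (attained? (r , s))))
            ≡⟨ trans (cong (24 *_) (∑-*ˡ allF 24 second)) (sym (*-assoc 24 24 (∑ allF second))) ⟩
          576 * ∑ allF (λ r → ∑ allF (λ s → 𝟙 (attained? (r , s)))) ≡⟨ cong (576 *_) (∑-× allF allF (λ rs → 𝟙 (attained? rs))) ⟨
          576 * ∑ (cartesianProduct allF allF) (λ rs → 𝟙 (attained? rs)) ≡⟨ cong (576 *_) (length-filter-∑ attained? (cartesianProduct allF allF)) ⟨
          576 * length (filter attained? (cartesianProduct allF allF)) ∎
          where
          open ≤-Reasoning
          first second : F → ℕ
          first r = 𝟙 (distance? base base r)
          second r = ∑ allF (λ s → 𝟙 (attained? (r , s)))

-- Transfer to the given distance sets.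

module ProductDistances where

  open import Data.Nat
  open import Data.Nat.Properties
  open import Data.Nat.Primality using (Prime; prime⇒nonZero)
  open import Data.Fin using (toℕ)
  open import Data.List using (List; length)
  open import Data.List.Membership.Propositional using (_∈_)
  import Data.List.Membership.DecPropositional as DecMembership
  open import Data.List.Membership.Propositional.Properties using (∈-map⁺; ∈-cartesianProduct⁺)
  open import Data.List.Relation.Unary.Unique.Propositional using (Unique)
  open import Data.Product using (Σ; _×_; _,_)
  open import Relation.Binary.PropositionalEquality

  -- The numerical constant is a variable with a lower bound, so that its powers stay symbolic.
  module _ (a : ℕ) (4227072≤a : 4227072 ≤ a) (p : ℕ) (pr : Prime p) where
    open Construction p pr
    open Defs.Field p {{prime⇒nonZero pr}} using (Pt; Pair; dist; decFF; Δ-list; ∣Δ₂₂∣)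
    open DecMembership decFF using (_∈?_)
    open FieldTheory primeField using (_-_)
    open Geometry.Reflections primeField using (norm²; _⊝_)

    -ₚ≡- : ∀ x y → x -ₚ y ≡ x - y
    -ₚ≡- x y = trans (sym (reduce-+ (toℕ x) (p ∸ toℕ y))) (cong (_+ₚ neg y) (reduce-toℕ x))

    dist≡norm² : ∀ (x y : Pt) → dist x y ≡ norm² (x ⊝ y)
    dist≡norm² (x₁ , x₂) (y₁ , y₂) = cong₂ _+ₚ_ (cong₂ _*ₚ_ (-ₚ≡- x₁ y₁) (-ₚ≡- x₁ y₁)) (cong₂ _*ₚ_ (-ₚ≡- x₂ y₂) (-ₚ≡- x₂ y₂))

    ∈-Δ : ∀ {E : List Pair} {x x′ y y′} → (x , x′) ∈ E → (y , y′) ∈ E → (norm² (x ⊝ y) , norm² (x′ ⊝ y′)) ∈ Δ-list E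
    ∈-Δ {E} {x} {x′} {y} {y′} e∈ e′∈ = subst₂ (λ r s → (r , s) ∈ Δ-list E) (dist≡norm² x y) (dist≡norm² x′ y′) (∈-map⁺ _ (∈-cartesianProduct⁺ e∈ e′∈))

    -- Fourth powers express |E| ≥ C p^{13/4} in natural numbers, with C = a³ + 1. No lower bound on
    -- p is assumed; it follows from this inequality together with |E| ≤ p⁴.
    productDistances : (E : List Pair) → Unique E → suc (a * (a * a)) ^ 4 * p ^ 13 ≤ length E ^ 4 → p ^ 2 ≤ 576 * ∣Δ₂₂∣ E
    productDistances E u E-large = go (Scales.quarticRoot p 1≤p)
      where
      1≤p : 1 ≤ p
      1≤p = >-nonZero⁻¹ p
      go : (Σ ℕ λ m → p ≤ m * (m * (m * m)) × m * (m * (m * m)) ≤ 16 * p) → p ^ 2 ≤ 576 * ∣Δ₂₂∣ E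
      go (m , p≤m⁴ , m⁴≤16p) = ≤-trans (≤-reflexive (cong (p *_) (*-identityʳ p)))
        -- A single threshold serves both arguments of `planar`: twice 512 p m, because the second
        -- set is halved on the way.
        (F.manyPairs E u (2 * (512 * p * m)) 1≤p S.fibres-large
          (λ X Y uX uY X≥ Y≥ → Geometry.PlanarDistances.planar primeField m p≤m⁴ m⁴≤16p 1≤p (≤-trans 4227072≤a S.root-large) X Y uX uY (≤-trans (m≤m+n _ _) X≥) Y≥)
          (_∈? Δ-list E) ∈-Δ)
        where
        module F = Geometry.Fibres primeField
        4096≤a³ : 4096 ≤ a * (a * a)
        4096≤a³ = ≤-trans (≤-trans (m≤m+n 4096 4222976) 4227072≤a) (≤-trans (≤-reflexive (sym (*-identityʳ a))) (*-monoʳ-≤ a (*-mono-≤ 1≤a 1≤a)))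
          where
          1≤a : 1 ≤ a
          1≤a = ≤-trans (m≤m+n 1 4227071) 4227072≤a
        module S = Scales.Sizes a p (length E) 4096≤a³ 1≤p (F.length≤p⁴ u) E-large m p≤m⁴ m⁴≤16p

open import Defs
open import Data.Nat using (ℕ; _*_; _^_; _≤_; _>_; NonZero)
open import Data.Nat.Primality using (Prime; prime⇒nonZero)
open import Data.Product using (Σ; _×_)
open import Data.List using (List; length)
open import Data.List.Relation.Unary.Unique.Propositional using (Unique)
open import Data.Nat using (suc; s≤s; z≤n)
open import Data.Nat.Properties using (≤-refl)
open import Data.Product using (_,_)

theorem4 : Σ ℕ λ C → Σ ℕ λ d → d > 0 ×
    ((p : ℕ) → (pr : Prime p) → (E : List (Field.Pair p {{prime⇒nonZero pr}})) → Unique E →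
    C ^ 4 * p ^ 13 ≤ length E ^ 4 →
    p ^ 2 ≤ d * Field.∣Δ₂₂∣ p {{prime⇒nonZero pr}} E)
theorem4 = suc (4227072 * (4227072 * 4227072)) , 576 , s≤s z≤n , ProductDistances.productDistances 4227072 ≤-refl
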